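{- Let $b\le c$ be non-negative integers. Let $(G,k)$ be an instance of the Directed $k$-Walk $[b,c]$-Covering Problem ($k[b,c]$-DWCP) and suppose we are given a vertex ordering $\nu=(v_1,v_2,\dots,v_n)$ of $G$ with cutwidth at most $p$. Then $(G,k)$ can be solved in time $O^*((c2^k)^p4^k)$.
   Context: Digraphs have no loops and no parallel arcs; a digraph is connected if its underlying undirected graph is connected; a weighted digraph $G=(V,A)$ has a non-negative integer weight $\omega(a)$ on each arc $a\in A$. Directed $k$-Walk $[b,c]$-Covering Problem ($k[b,c]$-DWCP): the input is a connected weighted digraph $G=(V,A)$ and a positive integer $k$; the task is to find a minimum total weight set of $k$ non-empty closed directed walks in which every arc of $G$ appears between $b$ and $c$ times (counted in total over all $k$ walks, with multiplicity), or to report that none exists. The total weight of the walks is the sum of the weights of all arcs traversed, counted with multiplicity. For a digraph $G$ and a vertex ordering $\nu=(v_1,\dots,v_n)$ of $V(G)$, the cutwidth of $\nu$ is the maximum, over all $i\in\{1,\dots,n\}$, of the number of arcs (in either direction) between $\{v_1,\dots,v_i\}$ and $\{v_{i+1},\dots,v_n\}$. The notation $O^*(\cdot)$ suppresses factors polynomial in the input size. -}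

module Defs where

open import Data.Fin using (Fin; toℕ; _≤_; _<_)
open import Data.Fin.Permutation using (Permutation′; _⟨$⟩ʳ_; _⟨$⟩ˡ_)
open import Data.Fin.Properties using (_≟_; _≤?_; _<?_)
open import Data.List using (List; []; _∷_; allFin; concat; filter; foldr; length; map; tabulate)
open import Data.List.Extrema.Nat using (max)
open import Data.Maybe using (Maybe; just; nothing)
open import Data.Nat as ℕ using (ℕ; suc; _+_; _*_; _^_)
open import Data.Nat.Binary as ℕᵇ using (ℕᵇ; 2[1+_]; 1+[2_])
open import Data.Nat.ListAction using (sum)
open import Data.Product using (Σ-syntax; ∃-syntax; _×_)
open import Data.Sum using (_⊎_)
open import Data.Vec as Vec using (Vec)
open import Data.Vec.Relation.Unary.All using (All)
open import Relation.Binary.Construct.Closure.Equivalence using (EqClosure)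
open import Relation.Binary.PropositionalEquality using (_≡_; _≢_)
open import Relation.Nullary using (¬_)
open import Relation.Nullary.Decidable using (_×-dec_; _⊎-dec_)
open import Relation.Unary using (Decidable)

record WeightedDigraph : Set where
  field
    n m : ℕ

  Vertex : Set
  Vertex = Fin n

  Arc : Set
  Arc = Fin m

  field
    tail head   : Arc → Vertex
    noLoop      : ∀ a → tail a ≢ head a
    noParallel  : ∀ {a a′} → tail a ≡ tail a′ → head a ≡ head a′ → a ≡ a′
    ω           : Arc → ℕ

open WeightedDigraph

Connected : WeightedDigraph → Set
Connected G = ∀ u v → EqClosure (λ x y → ∃[ a ] tail G a ≡ x × head G a ≡ y) u v

-- ν ⟨$⟩ʳ i is the i-th vertex of the ordering, ν ⟨$⟩ˡ u the position of u.
Ordering : WeightedDigraph → Set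
Ordering G = Permutation′ (n G)

module _ (G : WeightedDigraph) (ν : Ordering G) where

  -- a joins the vertices at positions ≤ i to those at positions > i
  Crosses : Fin (n G) → Arc G → Set
  Crosses i a = (s ≤ i × i < t) ⊎ (t ≤ i × i < s)
    where
    s = ν ⟨$⟩ˡ tail G a
    t = ν ⟨$⟩ˡ head G a

  crosses? : ∀ i → Decidable (Crosses i)
  crosses? i a = ((s ≤? i) ×-dec (i <? t)) ⊎-dec ((t ≤? i) ×-dec (i <? s))
    where
    s = ν ⟨$⟩ˡ tail G a
    t = ν ⟨$⟩ˡ head G a

  cutSize : Fin (n G) → ℕ
  cutSize i = length (filter (crosses? i) (allFin (m G)))

  cutwidth : ℕ
  cutwidth = max 0 (tabulate cutSize)

module _ (G : WeightedDigraph) where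

  data IsWalk : Vertex G → List (Arc G) → Vertex G → Set where
    []  : ∀ {u} → IsWalk u [] u
    _∷_ : ∀ {u v a as} → tail G a ≡ u → IsWalk (head G a) as v → IsWalk u (a ∷ as) v

  IsNonEmptyClosedWalk : List (Arc G) → Set
  IsNonEmptyClosedWalk as = as ≢ [] × ∃[ u ] IsWalk u as u

  Walks : ℕ → Set
  Walks k = Vec (List (Arc G)) k

  traversed : ∀ {k} → Walks k → List (Arc G)
  traversed ws = concat (Vec.toList ws)

  occurrences : ∀ {k} → Arc G → Walks k → ℕ
  occurrences a ws = length (filter (a ≟_) (traversed ws))

  weight : ∀ {k} → Walks k → ℕ
  weight ws = sum (map (ω G) (traversed ws))

  IsCovering : (b c : ℕ) {k : ℕ} → Walks k → Set
  IsCovering b c ws =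
    All IsNonEmptyClosedWalk ws × (∀ a → b ℕ.≤ occurrences a ws × occurrences a ws ℕ.≤ c)

  IsSolution : (b c k : ℕ) → Maybe (Walks k) → Set
  IsSolution b c k (just ws) =
    IsCovering b c ws × (∀ (ws′ : Walks k) → IsCovering b c ws′ → weight ws ℕ.≤ weight ws′)
  IsSolution b c k nothing   = ∀ (ws : Walks k) → ¬ IsCovering b c ws

------------------------------------------------------------------------
-- Model of computation: a first-order functional language with general
-- recursion over binary trees (N. D. Jones, "Computability and Complexity
-- from a Programming Perspective").  Values are immutable and shared, there
-- is no equality test on trees and no primitive arithmetic, so each
-- evaluation rule is a bounded number of pointer operations on a RAM.
-- Conversely, RAM memory can be kept in a balanced tree, at the cost of a
-- factor polynomial in the lengths of addresses and words.

infixr 5 _∙_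

data Tree : Set where
  leaf : Tree
  _∙_  : Tree → Tree → Tree

size : Tree → ℕ
size leaf    = 1
size (l ∙ r) = suc (size l + size r)

-- Expressions over f unary procedures and v variables (de Bruijn indices)
data Exp (f v : ℕ) : Set where
  var   : Fin v → Exp f v
  leaf  : Exp f v
  _∙_   : Exp f v → Exp f v → Exp f v
  let′  : Exp f v → Exp f (1 + v) → Exp f v
  case  : Exp f v → Exp f v → Exp f (2 + v) → Exp f v
  call  : Fin f → Exp f v → Exp f v

record Program : Set where
  field
    {procs} : ℕ
    body    : Vec (Exp procs 1) procs
    main    : Exp procs 1

open Program

-- P , ρ ⊢ e ⇓ w [ t ]: in environment ρ, e evaluates to w in t steps.
-- Evaluation is deterministic, so t is the running time.
infix 3 _,_⊢_⇓_[_]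

data _,_⊢_⇓_[_] (P : Program) {v : ℕ} (ρ : Vec Tree v) : Exp (procs P) v → Tree → ℕ → Set where
  var       : ∀ {x} → P , ρ ⊢ var x ⇓ Vec.lookup ρ x [ 1 ]
  leaf      : P , ρ ⊢ leaf ⇓ leaf [ 1 ]
  _∙_       : ∀ {e₁ e₂ w₁ w₂ t₁ t₂} →
              P , ρ ⊢ e₁ ⇓ w₁ [ t₁ ] →
              P , ρ ⊢ e₂ ⇓ w₂ [ t₂ ] →
              P , ρ ⊢ e₁ ∙ e₂ ⇓ w₁ ∙ w₂ [ 1 + t₁ + t₂ ]
  let′      : ∀ {e₁ e₂ w₁ w₂ t₁ t₂} →
              P , ρ ⊢ e₁ ⇓ w₁ [ t₁ ] →
              P , w₁ Vec.∷ ρ ⊢ e₂ ⇓ w₂ [ t₂ ] →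
              P , ρ ⊢ let′ e₁ e₂ ⇓ w₂ [ 1 + t₁ + t₂ ]
  case-leaf : ∀ {e e₀ e₁ w s t} →
              P , ρ ⊢ e ⇓ leaf [ s ] →
              P , ρ ⊢ e₀ ⇓ w [ t ] →
              P , ρ ⊢ case e e₀ e₁ ⇓ w [ 1 + s + t ]
  case-node : ∀ {e e₀ e₁ l r w s t} →
              P , ρ ⊢ e ⇓ l ∙ r [ s ] →
              P , l Vec.∷ r Vec.∷ ρ ⊢ e₁ ⇓ w [ t ] →
              P , ρ ⊢ case e e₀ e₁ ⇓ w [ 1 + s + t ]
  call      : ∀ {g e u w s t} →
              P , ρ ⊢ e ⇓ u [ s ] →
              P , u Vec.∷ Vec.[] ⊢ Vec.lookup (body P) g ⇓ w [ t ] →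
              P , ρ ⊢ call g e ⇓ w [ 1 + s + t ]

_On_Outputs_Within_ : Program → Tree → (Tree → Set) → ℕ → Set
P On input Outputs Correct Within bound =
  ∃[ output ] ∃[ t ]
    (P , input Vec.∷ Vec.[] ⊢ main P ⇓ output [ t ]) × Correct output × t ℕ.≤ bound

-- A concrete member of O*(f): C and d are the coefficient and degree of the
-- suppressed polynomial.  The summand 1 only matters where f vanishes; no
-- algorithm takes time 0.
O* : (C d : ℕ) → (inputSize f : ℕ) → ℕ
O* C d inputSize f = C * inputSize ^ d * (1 + f)

------------------------------------------------------------------------
-- Encodings.  Numbers are in binary, least significant digit first.

encℕᵇ : ℕᵇ → Tree
encℕᵇ ℕᵇ.zero  = leaf
encℕᵇ 2[1+ x ] = leaf ∙ encℕᵇ x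
encℕᵇ 1+[2 x ] = (leaf ∙ leaf) ∙ encℕᵇ x

encℕ : ℕ → Tree
encℕ x = encℕᵇ (ℕᵇ.fromℕ x)

encFin : ∀ {x} → Fin x → Tree
encFin i = encℕ (toℕ i)

encList : {A : Set} → (A → Tree) → List A → Tree
encList enc = foldr (λ x t → enc x ∙ t) leaf

module _ (G : WeightedDigraph) where

  encArc : Arc G → Tree
  encArc a = encFin (tail G a) ∙ encFin (head G a)

  encDigraph : Tree
  encDigraph = encℕ (n G) ∙ encList (λ a → encArc a ∙ encℕ (ω G a)) (allFin (m G))

  encOrdering : Ordering G → Tree
  encOrdering ν = encList encFin (tabulate (ν ⟨$⟩ʳ_))

  encInput : (b c k : ℕ) → Ordering G → Tree
  encInput b c k ν = encℕ b ∙ encℕ c ∙ encDigraph ∙ encℕ k ∙ encOrdering ν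

  encAnswer : ∀ {k} → Maybe (Walks G k) → Tree
  encAnswer nothing   = leaf
  encAnswer (just ws) = leaf ∙ encList (encList encArc) (Vec.toList ws)

  EncodesSolution : (b c k : ℕ) → Tree → Set
  EncodesSolution b c k output =
    Σ[ answer ∈ Maybe (Walks G k) ] output ≡ encAnswer answer × IsSolution G b c k answer

-- Label every pair of an arc a and a walk j by y(a,j), where y(a,0) ≤ c and
-- y(a,j) ≤ 1 for j > 0.  Every covering gives a labelling whose rows y(·,j) are
-- nonzero circulations and whose sums over j lie between b and c: take a closed
-- walk without repeated arcs out of each walk j > 0 and give all other arcs to
-- walk 0.  Conversely, follow a closed trail in every row and insert the arcs left
-- over into these trails by Hierholzer's algorithm.  If b ≥ 1, this uses up all
-- arcs because G is connected; if b = 0, the arcs that remain may be dropped.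
--
-- A row is a circulation iff it is balanced across every cut of the ordering.
-- Hence a dynamic program over the cuts needs to remember only which rows are
-- nonzero and the labels of the arcs crossing the current cut: these are 2^k
-- flags times at most ((c + 1) 2^(k-1))^p ≤ (c 2^k)^p labels.  Partial labellings
-- of minimal weight are kept in a trie with these data as key.  As k is given in
-- binary, a factor polynomial in k need not be polynomial in the input size; such
-- factors are absorbed by the second 2^k of 4^k.

module Submission where

open import Data.Bool using (Bool; true; false; if_then_else_; _∧_; _∨_; not; T) renaming (_≟_ to _≟ᵇ_)
open import Data.Bool.ListAction using (any; all; and)
open import Data.Bool.Properties using (∧-assoc)
open import Data.Empty using (⊥; ⊥-elim)
open import Data.Fin as Fin using (Fin; zero; suc; toℕ; _↑ˡ_; _↑ʳ_; splitAt)
open import Data.Fin.Permutation using (_⟨$⟩ʳ_; _⟨$⟩ˡ_; inverseˡ; inverseʳ)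
open import Data.Fin.Properties using (splitAt-↑ˡ; splitAt-↑ʳ; toℕ<n; toℕ-injective; toℕ-fromℕ<) renaming (<-cmp to Fin-<-cmp)
open import Data.List as List using (List; []; _∷_; _++_; length; initLast; _∷ʳ′_)
open import Data.List.Extrema.Nat using (xs≤max)
open import Data.List.Membership.Propositional using (_∈_; _∉_; find; lose)
open import Data.List.Membership.Propositional.Properties using (∈-∃++; ∈-tabulate⁺; ∈-tabulate⁻; ∈-filter⁺; ∈-length; ∈-concat⁻′; ∈-concat⁺′; ∈-cartesianProduct⁺; ∈-allFin; ∈-upTo⁺; ∈-map⁺; ∈-++⁻; ∈-map⁻; ∈-concatMap⁺; ∈-concatMap⁻)
open import Data.List.Properties using (++-assoc; ++-identityʳ; concatMap-cong; filter-accept; length-++; length-map; length-tabulate; length-upTo; map-++; map-cong; map-tabulate; map-∘; ∷-injectiveʳ; ∷-injectiveˡ; ≡-dec)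
open import Data.List.Relation.Unary.All as All using (All; []; _∷_)
import Data.List.Relation.Unary.All.Properties as All++
open import Data.List.Relation.Unary.Any as Any using (Any; here; there)
open import Data.List.Relation.Unary.Unique.Propositional using (Unique; []; _∷_)
open import Data.List.Relation.Unary.Unique.Propositional.Properties using (map⁺; tabulate⁺; cartesianProduct⁺; allFin⁺; upTo⁺)
open import Data.Maybe using (Maybe; just; nothing)
open import Data.Maybe.Properties using (just-injective)
open import Data.Maybe.Relation.Unary.All as All? using (just; nothing) renaming (All to All?)
open import Data.Nat using (ℕ; zero; suc; _+_; _*_; _^_; _≤_; _<_; z≤n; s≤s; _≤ᵇ_; _<ᵇ_; _≡ᵇ_; >-nonZero; NonZero; ⌊_/2⌋; ⌈_/2⌉)
open import Data.Nat.Binary as ℕᵇ using (ℕᵇ; 2[1+_]; 1+[2_])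
open import Data.Nat.Binary.Properties using (fromℕ-toℕ; toℕ-fromℕ)
open import Data.Nat.ListAction using (sum; product)
open import Data.Nat.ListAction.Properties using (sum-++; product-++)
open import Data.Nat.Properties using (*-assoc; *-comm; *-distribˡ-+; *-identityʳ; *-identityˡ; *-mono-≤; *-monoʳ-≤; *-monoˡ-≤; *-suc; *-zeroʳ; +-assoc; +-cancelʳ-≡; +-cancelˡ-≡; +-comm; +-identityʳ; +-mono-≤; +-monoʳ-≤; +-monoˡ-≤; +-suc; <-irrefl; <-≤-trans; ^-distribˡ-+-*; ^-identityʳ; ^-monoʳ-<; ^-monoʳ-≤; ^-monoˡ-≤; _<?_; _≤?_; m<m+n; m^n>0; m≤m*n; m≤m+n; m≤n+m; m≤n⇒m≤1+n; n<1⇒n≡0; n≢0⇒n>0; n≤0⇒n≡0; n≤1+n; n≮n; suc-injective; ≡ᵇ⇒≡; ≤-antisym; ≤-pred; ≤-refl; ≤-reflexive; ≤-trans; ≤ᵇ⇒≤; ≤⇒≤ᵇ; ≮⇒≥; ≰⇒>; ≰⇒≥; ⌊n/2⌋+⌈n/2⌉≡n; ⌊n/2⌋≤⌈n/2⌉; module ≤-Reasoning) renaming (_≟_ to _≟ℕ_)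
open import Data.Nat.Tactic.RingSolver using (solve-∀)
open import Data.Product using (Σ-syntax; ∃-syntax; _×_; _,_; proj₁; proj₂)
open import Data.Product.Properties using () renaming (≡-dec to ≡-dec×)
open import Data.Sum using (_⊎_; inj₁; inj₂; [_,_]′)
open import Data.Unit using (⊤; tt)
open import Data.Vec as Vec using (Vec; []; _∷_)
open import Data.Vec.Properties using (lookup∘tabulate; toList∘fromList; toList-cast)
import Data.Vec.Relation.Unary.All as VAll
open VAll using ([]; _∷_)
open import Defs
open import Function using (_∘_; id)
open import Relation.Binary.Construct.Closure.Equivalence using (EqClosure)
open import Relation.Binary.Construct.Closure.ReflexiveTransitive using (ε; _◅_)
open import Relation.Binary.Construct.Closure.Symmetric using (fwd; bwd)
open import Relation.Binary.Definitions using (DecidableEquality; tri<; tri≈; tri>)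
open import Relation.Binary.PropositionalEquality using (_≡_; _≢_; refl; sym; trans; cong; cong₂; subst; subst₂; module ≡-Reasoning)
open import Relation.Nullary using (Dec; yes; no; ¬_)

-- The theorem concerns the running time of a concrete program, and the main obstacle is to bound
-- the time of many nested procedures without calculating by hand. So every piece of program is an
-- `Fn`, which carries its code, the function computed, its exact time and an abstract
-- interpretation that propagates bounds `M ^ a * B ^ b * F ^ c`. The degree of the polynomial is
-- nowhere written down: the type checker evaluates the bound of the whole program, and
-- `main-linear` checks by `refl` that `B` and `F` occur at most to the first power. Only the
-- lengths of enumerated lists (ranges, flags, labellings of a cut) escape this mechanism and are
-- bounded by hand.
--
-- The step from (c + 1) 2^(k-1) to c 2^k needs c ≥ 1. Moreover c is given in binary, so that even
-- writing down c copies of an arc takes time beyond any polynomial; this is affordable because c is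
-- at most (c 2^k)^p as soon as an arc forces p ≥ 1. Hence c = 0 and digraphs without arcs are
-- answered separately.

-- Compilation

-- An intermediate language with local recursive procedures of any arity:
-- Fix B es calls the procedure with body B on es, and Self es inside B is a
-- recursive call.  The first index is the arity of the enclosing procedure.
data Code : Maybe ℕ → ℕ → Set where
  Var  : ∀ {s v} → Fin v → Code s v
  Leaf : ∀ {s v} → Code s v
  Node : ∀ {s v} → Code s v → Code s v → Code s v
  Let  : ∀ {s v} → Code s v → Code s (1 + v) → Code s v
  Case : ∀ {s v} → Code s v → Code s v → Code s (2 + v) → Code s v
  Fix  : ∀ {s v n} → Code (just n) n → Vec (Code s v) n → Code s v
  Self : ∀ {v n} → Vec (Code (just n) v) n → Code (just n) v

Proc : Maybe ℕ → Set
Proc nothing  = ⊤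
Proc (just n) = Code (just n) n

mutual
  -- The times are exactly those of the compiled expressions. In a call, `n * 2` pays for taking the
  -- packed arguments apart, one `case` and one `var` for each; the empty argument list costs 1
  -- because it is compiled to `leaf`.
  data Eval : ∀ {s v} → Proc s → Vec Tree v → Code s v → Tree → ℕ → Set where
    Var       : ∀ {s v} {π : Proc s} {ρ : Vec Tree v} {x} →
                Eval π ρ (Var x) (Vec.lookup ρ x) 1
    Leaf      : ∀ {s v} {π : Proc s} {ρ : Vec Tree v} → Eval π ρ Leaf leaf 1
    Node      : ∀ {s v} {π : Proc s} {ρ : Vec Tree v} {c d w x t u} →
                Eval π ρ c w t → Eval π ρ d x u → Eval π ρ (Node c d) (w ∙ x) (1 + t + u)
    Let       : ∀ {s v} {π : Proc s} {ρ : Vec Tree v} {c d w x t u} →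
                Eval π ρ c w t → Eval π (w ∷ ρ) d x u → Eval π ρ (Let c d) x (1 + t + u)
    Case-leaf : ∀ {s v} {π : Proc s} {ρ : Vec Tree v} {c d e x t u} →
                Eval π ρ c leaf t → Eval π ρ d x u → Eval π ρ (Case c d e) x (1 + t + u)
    Case-node : ∀ {s v} {π : Proc s} {ρ : Vec Tree v} {c d e l r x t u} →
                Eval π ρ c (l ∙ r) t → Eval π (l ∷ r ∷ ρ) e x u →
                Eval π ρ (Case c d e) x (1 + t + u)
    Fix       : ∀ {s v n} {π : Proc s} {ρ : Vec Tree v} {B} {es : Vec (Code s v) n} {us w t u} →
                Evals π ρ es us t → Eval {s = just n} B us B w u → Eval π ρ (Fix B es) w (1 + t + (n * 2 + u))
    Self      : ∀ {v n} {B : Code (just n) n} {ρ : Vec Tree v} {es us w t u} →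
                Evals {s = just n} B ρ es us t → Eval {s = just n} B us B w u →
                Eval {s = just n} B ρ (Self es) w (1 + t + (n * 2 + u))

  data Evals : ∀ {s v n} → Proc s → Vec Tree v → Vec (Code s v) n → Vec Tree n → ℕ → Set where
    []  : ∀ {s v} {π : Proc s} {ρ : Vec Tree v} → Evals π ρ [] [] 1
    _∷_ : ∀ {s v n} {π : Proc s} {ρ : Vec Tree v} {c} {cs : Vec (Code s v) n} {w ws t u} →
          Eval π ρ c w t → Evals π ρ cs ws u → Evals π ρ (c ∷ cs) (w ∷ ws) (1 + t + u)

mutual
  -- Each occurrence of `Fix` becomes a procedure of its own in the target program, while `Self`
  -- reuses the procedure of the enclosing `Fix`.
  fixes : ∀ {s v} → Code s v → ℕ
  fixes (Var x)      = 0
  fixes Leaf         = 0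
  fixes (Node c d)   = fixes c + fixes d
  fixes (Let c d)    = fixes c + fixes d
  fixes (Case c d e) = fixes c + (fixes d + fixes e)
  fixes (Fix B cs)   = suc (fixes B + fixess cs)
  fixes (Self cs)    = fixess cs

  fixess : ∀ {s v n} → Vec (Code s v) n → ℕ
  fixess []       = 0
  fixess (c ∷ cs) = fixes c + fixess cs

-- Target procedures are unary, so arguments travel as a tuple. Taking it apart binds two variables
-- per component, the component and the rest of the tuple. The accumulating form agrees by
-- computation with the nesting of `case` in `unpack`.
width : ℕ → ℕ → ℕ
width zero    w = w
width (suc n) w = width n (2 + w)

old : ∀ n {w} → Fin w → Fin (width n w)
old zero    i = i
old (suc n) i = old n (suc (suc i))

slot : ∀ n {w} → Fin n → Fin (width n w)
slot (suc n) zero    = old n zero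
slot (suc n) (suc i) = slot n i

packed : ∀ {n} → Vec Tree n → Tree
packed []       = leaf
packed (u ∷ us) = u ∙ packed us

unpacked : ∀ {n w} → Vec Tree n → Vec Tree w → Vec Tree (width n w)
unpacked []       ρ = ρ
unpacked (u ∷ us) ρ = unpacked us (u ∷ packed us ∷ ρ)

lookup-old : ∀ {n w} (us : Vec Tree n) (ρ : Vec Tree w) i →
             Vec.lookup (unpacked us ρ) (old n i) ≡ Vec.lookup ρ i
lookup-old []       ρ i = refl
lookup-old (u ∷ us) ρ i = lookup-old us _ (suc (suc i))

lookup-slot : ∀ {n w} (us : Vec Tree n) (ρ : Vec Tree w) i →
              Vec.lookup (unpacked us ρ) (slot n i) ≡ Vec.lookup us i
lookup-slot (u ∷ us) ρ zero    = lookup-old us _ zero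
lookup-slot (u ∷ us) ρ (suc i) = lookup-slot us _ i

lift : ∀ {v w} → (Fin v → Fin w) → Fin (suc v) → Fin (suc w)
lift ξ zero    = zero
lift ξ (suc i) = suc (ξ i)

-- On a packed tuple of length `n` the `leaf` branch is never reached. The variable `suc zero` is
-- the rest of the tuple, which `case` binds second.
unpack : ∀ {f} n {w} → Fin w → Exp f (width n w) → Exp f w
unpack zero    i e = e
unpack (suc n) i e = case (var i) leaf (unpack n (suc zero) e)

Slot : ℕ → Maybe ℕ → Set
Slot F nothing  = ⊤
Slot F (just n) = Fin F

module _ {F : ℕ} where

  mutual
    -- `ξ` renames the variables, which are no longer consecutive after unpacking; `σ` is the
    -- procedure that `Self` calls; `ι` places the procedures made from `c` among those of the whole
    -- program.
    compile : ∀ {s v w} (c : Code s v) → (Fin v → Fin w) → Slot F s → (Fin (fixes c) → Fin F) → Exp F w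
    compile (Var x)      ξ σ ι = var (ξ x)
    compile Leaf         ξ σ ι = leaf
    compile (Node c d)   ξ σ ι = compile c ξ σ (ι ∘ (_↑ˡ _)) ∙ compile d ξ σ (ι ∘ (_ ↑ʳ_))
    compile (Let c d)    ξ σ ι = let′ (compile c ξ σ (ι ∘ (_↑ˡ _))) (compile d (lift ξ) σ (ι ∘ (_ ↑ʳ_)))
    compile (Case c d e) ξ σ ι =
      case (compile c ξ σ (ι ∘ (_↑ˡ _)))
           (compile d ξ σ (ι ∘ (fixes c ↑ʳ_) ∘ (_↑ˡ _)))
           (compile e (lift (lift ξ)) σ (ι ∘ (fixes c ↑ʳ_) ∘ (fixes d ↑ʳ_)))
    compile (Fix B cs)   ξ σ ι = call (ι zero) (compiles cs ξ σ (ι ∘ suc ∘ (fixes B ↑ʳ_)))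
    compile (Self cs)    ξ σ ι = call σ (compiles cs ξ σ ι)

    compiles : ∀ {s v w n} (cs : Vec (Code s v) n) → (Fin v → Fin w) → Slot F s →
               (Fin (fixess cs) → Fin F) → Exp F w
    compiles []       ξ σ ι = leaf
    compiles (c ∷ cs) ξ σ ι = compile c ξ σ (ι ∘ (_↑ˡ _)) ∙ compiles cs ξ σ (ι ∘ (_ ↑ʳ_))

  mutual
    procedures : ∀ {s v} (c : Code s v) → (Fin (fixes c) → Fin F) → Fin (fixes c) → Exp F 1
    procedures (Node c d)   ι i = [ procedures c (ι ∘ (_↑ˡ _)) , procedures d (ι ∘ (_ ↑ʳ_)) ]′ (splitAt (fixes c) i)
    procedures (Let c d)    ι i = [ procedures c (ι ∘ (_↑ˡ _)) , procedures d (ι ∘ (_ ↑ʳ_)) ]′ (splitAt (fixes c) i)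
    procedures (Case c d e) ι i =
      [ procedures c (ι ∘ (_↑ˡ _))
      , [ procedures d (ι ∘ (fixes c ↑ʳ_) ∘ (_↑ˡ _)) , procedures e (ι ∘ (fixes c ↑ʳ_) ∘ (fixes d ↑ʳ_)) ]′ ∘ splitAt (fixes d)
      ]′ (splitAt (fixes c) i)
    procedures (Fix {n = n} B cs) ι zero = unpack n zero (compile {s = just n} B (slot n) (ι zero) (ι ∘ suc ∘ (_↑ˡ _)))
    procedures (Fix B cs)   ι (suc i) =
      [ procedures B (ι ∘ suc ∘ (_↑ˡ _)) , proceduress cs (ι ∘ suc ∘ (fixes B ↑ʳ_)) ]′ (splitAt (fixes B) i)
    procedures (Self cs)    ι i = proceduress cs ι i

    proceduress : ∀ {s v n} (cs : Vec (Code s v) n) → (Fin (fixess cs) → Fin F) → Fin (fixess cs) → Exp F 1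
    proceduress (c ∷ cs) ι i =
      [ procedures c (ι ∘ (_↑ˡ _)) , proceduress cs (ι ∘ (_ ↑ʳ_)) ]′ (splitAt (fixes c) i)

module Simulation (P : Program) where
  open Program P

  Linked : ∀ {m} → (Fin m → Fin procs) → (Fin m → Exp procs 1) → Set
  Linked ι f = ∀ i → Vec.lookup body (ι i) ≡ f i

  linkedˡ : ∀ {m n} {ι : Fin (m + n) → Fin procs} {f g} →
            Linked ι (λ i → [ f , g ]′ (splitAt m i)) → Linked (ι ∘ (_↑ˡ n)) f
  linkedˡ {m} {n} L i = trans (L (i ↑ˡ n)) (cong [ _ , _ ]′ (splitAt-↑ˡ m i n))

  linkedʳ : ∀ {m n} {ι : Fin (m + n) → Fin procs} {f g} →
            Linked ι (λ i → [ f , g ]′ (splitAt m i)) → Linked (ι ∘ (m ↑ʳ_)) g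
  linkedʳ {m} {n} L i = trans (L (m ↑ʳ i)) (cong [ _ , _ ]′ (splitAt-↑ʳ m n i))

  -- What makes `Self` work: procedure `σ` is the compiled body of the enclosing `Fix`, and the
  -- procedures made from that body are in place as well, so that a recursive call can be simulated
  -- in the same way again.
  Implements : ∀ s → Slot procs s → Proc s → Set
  Implements nothing  σ π = ⊤
  Implements (just n) σ B = Σ[ ι ∈ (Fin (fixes B) → Fin procs) ]
    Vec.lookup body σ ≡ unpack n zero (compile {s = just n} B (slot n) σ ι) × Linked ι (procedures B ι)

  eval-var : ∀ {w} {ρ : Vec Tree w} i {x} → Vec.lookup ρ i ≡ x → P , ρ ⊢ var i ⇓ x [ 1 ]
  eval-var i refl = var

  eval-unpack : ∀ {n w} (us : Vec Tree n) {ρ : Vec Tree w} {i e x t} → Vec.lookup ρ i ≡ packed us →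
                P , unpacked us ρ ⊢ e ⇓ x [ t ] → P , ρ ⊢ unpack n i e ⇓ x [ n * 2 + t ]
  eval-unpack []       _  D = D
  eval-unpack (u ∷ us) {i = i} eq D = case-node (eval-var i eq) (eval-unpack us refl D)

  lookup-lift : ∀ {v w x} {ρ : Vec Tree v} {ρ′ : Vec Tree w} {ξ : Fin v → Fin w} →
               (∀ i → Vec.lookup ρ′ (ξ i) ≡ Vec.lookup ρ i) →
               ∀ i → Vec.lookup (x ∷ ρ′) (lift ξ i) ≡ Vec.lookup (x ∷ ρ) i
  lookup-lift eq zero    = refl
  lookup-lift eq (suc i) = eq i

  mutual
    -- By induction on the evaluation, since a recursive call does not lead to smaller code. Times
    -- are preserved exactly, so that all later estimates can be made on `Code`.
    simulate : ∀ {s v w x t} {π : Proc s} {ρ : Vec Tree v} {c : Code s v} → Eval π ρ c x t →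
               ∀ {ρ′ : Vec Tree w} {ξ σ} {ι : Fin (fixes c) → Fin procs} →
               (∀ i → Vec.lookup ρ′ (ξ i) ≡ Vec.lookup ρ i) →
               Linked ι (procedures c ι) → Implements s σ π → P , ρ′ ⊢ compile c ξ σ ι ⇓ x [ t ]
    simulate (Var {x = x})   eq L I = eval-var _ (eq x)
    simulate Leaf            eq L I = leaf
    simulate (Node D E)      eq L I = simulate D eq (linkedˡ L) I ∙ simulate E eq (linkedʳ L) I
    simulate (Let D E)       eq L I = let′ (simulate D eq (linkedˡ L) I) (simulate E (lookup-lift eq) (linkedʳ L) I)
    simulate (Case-leaf {c = c} D E) eq L I =
      case-leaf (simulate D eq (linkedˡ {fixes c} L) I) (simulate E eq (linkedˡ (linkedʳ {fixes c} L)) I)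
    simulate (Case-node {c = c} {d} D E) eq L I =
      case-node (simulate D eq (linkedˡ {fixes c} L) I)
                (simulate E (lookup-lift (lookup-lift eq)) (linkedʳ {fixes d} (linkedʳ {fixes c} L)) I)
    simulate (Fix {B = B} {us = us} D E) eq L I =
      call (simulates D eq (linkedʳ {fixes B} (L ∘ suc)) I)
           (subst (λ e → P , _ ⊢ e ⇓ _ [ _ ]) (sym (L zero))
             (eval-unpack us refl (simulate {s = just _} {c = B} E (lookup-slot us _) LB (_ , L zero , LB))))
      where LB = linkedˡ {fixes B} (L ∘ suc)
    simulate (Self {us = us} D E) eq L I@(_ , body≡ , LB) =
      call (simulates {s = just _} D eq L I)
           (subst (λ e → P , _ ⊢ e ⇓ _ [ _ ]) (sym body≡)
             (eval-unpack us refl (simulate {s = just _} E (lookup-slot us _) LB I)))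

    simulates : ∀ {s v w n us t} {π : Proc s} {ρ : Vec Tree v} {cs : Vec (Code s v) n} → Evals π ρ cs us t →
                ∀ {ρ′ : Vec Tree w} {ξ σ} {ι : Fin (fixess cs) → Fin procs} →
                (∀ i → Vec.lookup ρ′ (ξ i) ≡ Vec.lookup ρ i) →
                Linked ι (proceduress cs ι) → Implements s σ π → P , ρ′ ⊢ compiles cs ξ σ ι ⇓ packed us [ t ]
    simulates []       eq L I = leaf
    simulates (D ∷ Ds) eq L I = simulate D eq (linkedˡ L) I ∙ simulates Ds eq (linkedʳ L) I

program : Code nothing 1 → Program
program c = record { body = Vec.tabulate (procedures c id) ; main = compile c id tt id }

program-eval : ∀ (c : Code nothing 1) {u w t} → Eval tt (u ∷ []) c w t →
               program c , u ∷ [] ⊢ Program.main (program c) ⇓ w [ t ]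
program-eval c D = Simulation.simulate (program c) {c = c} D (λ _ → refl) (lookup∘tabulate (procedures c id)) tt

-- Scales and bounds

-- Bounds on running times and list lengths.  The bound (a , b , c) stands for
-- M ^ a * B ^ b * F ^ c, where in the end M is polynomial in the input size
-- and k, while B = (c * 2 ^ k) ^ p and F = 2 ^ k; nothing stands for ∞.
record Scale : Set where
  field
    M B F : ℕ
    2≤M   : 2 ≤ M
    1≤B   : 1 ≤ B
    1≤F   : 1 ≤ F

Ord : Set
Ord = ℕ × ℕ × ℕ

Ext : Set
Ext = Maybe Ord

pattern fin a b c = just (a , b , c)

-- A Boolean test evaluates quickly on numerals, which matters because the exponents of the final
-- bound are found by evaluation.
max : ℕ → ℕ → ℕ
max a b = if a ≤ᵇ b then b else a

m≤max : ∀ a b → a ≤ max a b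
m≤max a b with a ≤ᵇ b in eq
... | true  = ≤ᵇ⇒≤ a b (subst T (sym eq) tt)
... | false = ≤-refl

n≤max : ∀ a b → b ≤ max a b
n≤max a b with a ≤ᵇ b in eq
... | true  = ≤-refl
... | false = ≰⇒≥ λ a≤b → subst T eq (≤⇒≤ᵇ a≤b)

join : Ext → Ext → Ext
join (fin a b c) (fin a′ b′ c′) = fin (max a a′) (max b b′) (max c c′)
join _ _ = nothing

infixr 6 _⊕_
infixr 7 _⊗ᵉ_

-- accounts for 1 + t + u, the shape of all composite running times
_⊕_ : Ext → Ext → Ext
fin a b c ⊕ fin a′ b′ c′ = fin (2 + max a a′) (max b b′) (max c c′)
_         ⊕ _            = nothing

_⊗ᵉ_ : Ext → Ext → Ext
fin a b c ⊗ᵉ fin a′ b′ c′ = fin (a + a′) (b + b′) (c + c′)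
_         ⊗ᵉ _            = nothing

⌜_⌝ : ℕ → Ext
⌜ n ⌝ = fin n 0 0

_⊑_ : Ext → Ext → Bool
_           ⊑ nothing          = true
nothing     ⊑ just _           = false
fin a b c ⊑ fin a′ b′ c′ = (a ≤ᵇ a′) ∧ (b ≤ᵇ b′) ∧ (c ≤ᵇ c′)

-- The target `B * 4 ^ k` affords one factor `B` and one factor `F`, which is `2 ^ k`; the other
-- `2 ^ k` is reserved for the powers of `k` hidden in `M`.
linear : Ext → Bool
linear (fin _ b c) = (b ≤ᵇ 1) ∧ (c ≤ᵇ 1)
linear nothing     = false

exponent : Ext → ℕ
exponent (fin a _ _) = a
exponent nothing     = 0

n≤2^n : ∀ n → n ≤ 2 ^ n
n≤2^n zero    = z≤n
n≤2^n (suc n) = ≤-trans (+-mono-≤ (m^n>0 2 n) (n≤2^n n)) (≤-reflexive (cong (2 ^ n +_) (sym (+-identityʳ _))))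

∧-true : ∀ {a b} → a ∧ b ≡ true → a ≡ true × b ≡ true
∧-true {true} {true} _ = refl , refl

≤ᵇ-true : ∀ a b → (a ≤ᵇ b) ≡ true → a ≤ b
≤ᵇ-true a b eq = ≤ᵇ⇒≤ a b (subst T (sym eq) tt)

module Bound (S : Scale) where
  open Scale S

  val : Ord → ℕ
  val (a , b , c) = M ^ a * (B ^ b * F ^ c)

  infix 4 _≼_
  data _≼_ (t : ℕ) : Ext → Set where
    ≤∞ : t ≼ nothing
    ≤v : ∀ {o} → t ≤ val o → t ≼ just o

  private
    instance
      nzM = >-nonZero (≤-trans (s≤s z≤n) 2≤M)
      nzB = >-nonZero 1≤B
      nzF = >-nonZero 1≤F

  val-mono : ∀ a a′ b b′ c c′ → a ≤ a′ → b ≤ b′ → c ≤ c′ → val (a , b , c) ≤ val (a′ , b′ , c′)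
  val-mono _ _ _ _ _ _ a≤ b≤ c≤ = *-mono-≤ (^-monoʳ-≤ M a≤) (*-mono-≤ (^-monoʳ-≤ B b≤) (^-monoʳ-≤ F c≤))

  1≤val : ∀ o → 1 ≤ val o
  1≤val (a , b , c) = val-mono 0 a 0 b 0 c z≤n z≤n z≤n

  ≼-mono : ∀ {t u e} → t ≤ u → u ≼ e → t ≼ e
  ≼-mono t≤u (≤v u≤) = ≤v (≤-trans t≤u u≤)
  ≼-mono _   ≤∞      = ≤∞

  ≼-⊑ : ∀ {t e f} → e ⊑ f ≡ true → t ≼ e → t ≼ f
  ≼-⊑ {f = nothing} eq _ = ≤∞
  ≼-⊑ {e = fin a b c} {fin a′ b′ c′} eq (≤v t≤) =
    let p , q = ∧-true {a ≤ᵇ a′} eq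
        q , r = ∧-true {b ≤ᵇ b′} q
    in ≤v (≤-trans t≤ (val-mono a a′ b b′ c c′ (≤ᵇ-true a a′ p) (≤ᵇ-true b b′ q) (≤ᵇ-true c c′ r)))

  ≼-joinˡ : ∀ {t e} f → t ≼ e → t ≼ join e f
  ≼-joinˡ {e = fin a b c} (fin a′ b′ c′) (≤v t≤) =
    ≤v (≤-trans t≤ (val-mono _ _ _ _ _ _ (m≤max a a′) (m≤max b b′) (m≤max c c′)))
  ≼-joinˡ {e = just _}  nothing  _ = ≤∞
  ≼-joinˡ {e = nothing} (just _) _ = ≤∞
  ≼-joinˡ {e = nothing} nothing  _ = ≤∞

  ≼-joinʳ : ∀ {t f} e → t ≼ f → t ≼ join e f
  ≼-joinʳ {f = fin a′ b′ c′} (fin a b c) (≤v t≤) =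
    ≤v (≤-trans t≤ (val-mono _ _ _ _ _ _ (n≤max a a′) (n≤max b b′) (n≤max c c′)))
  ≼-joinʳ {f = nothing} (just _) _ = ≤∞
  ≼-joinʳ {f = just _}  nothing  _ = ≤∞
  ≼-joinʳ {f = nothing} nothing  _ = ≤∞

  -- With `v` the value of the joined bound, 1 + t + u ≤ 4 v ≤ M^2 v because 2 ≤ M. This is the
  -- origin of the 2 in the exponent of `⊕`.
  ≼-⊕ : ∀ {t u e f} → t ≼ e → u ≼ f → suc (t + u) ≼ e ⊕ f
  ≼-⊕ {t} {u} {fin a b c} {fin a′ b′ c′} p q with ≼-joinˡ (fin a′ b′ c′) p | ≼-joinʳ (fin a b c) q
  ... | ≤v t≤ | ≤v u≤ = ≤v (begin
    1 + (t + u)       ≤⟨ +-mono-≤ (1≤val m) (+-mono-≤ t≤ u≤) ⟩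
    v + (v + v)       ≤⟨ m≤m+n _ v ⟩
    (v + (v + v)) + v ≡⟨ lemma v ⟩
    2 * (2 * v)       ≤⟨ *-mono-≤ 2≤M (*-monoˡ-≤ v 2≤M) ⟩
    M * (M * v)       ≡⟨ cong (M *_) (sym (*-assoc M (M ^ max a a′) _)) ⟩
    M * (M * M ^ max a a′ * _) ≡⟨ sym (*-assoc M (M * M ^ max a a′) _) ⟩
    val (2 + max a a′ , max b b′ , max c c′) ∎)
    where
    open ≤-Reasoning
    m = max a a′ , max b b′ , max c c′
    v = val m
    lemma : ∀ v → (v + (v + v)) + v ≡ 2 * (2 * v)
    lemma = solve-∀
  ≼-⊕ {e = just _}  {nothing} _ _ = ≤∞
  ≼-⊕ {e = nothing} {just _}  _ _ = ≤∞
  ≼-⊕ {e = nothing} {nothing} _ _ = ≤∞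

  ≼-+ : ∀ {t u e f} → t ≼ e → u ≼ f → t + u ≼ e ⊕ f
  ≼-+ p q = ≼-mono (n≤1+n _) (≼-⊕ p q)

  ≼-* : ∀ {t u e f} → t ≼ e → u ≼ f → t * u ≼ e ⊗ᵉ f
  ≼-* {t} {u} {fin a b c} {fin a′ b′ c′} (≤v t≤) (≤v u≤) = ≤v (begin
    t * u                                     ≤⟨ *-mono-≤ t≤ u≤ ⟩
    val (a , b , c) * val (a′ , b′ , c′)      ≡⟨ lemma (M ^ a) (B ^ b) (F ^ c) (M ^ a′) (B ^ b′) (F ^ c′) ⟩
    (M ^ a * M ^ a′) * ((B ^ b * B ^ b′) * (F ^ c * F ^ c′))
      ≡⟨ cong₂ _*_ (sym (^-distribˡ-+-* M a a′)) (cong₂ _*_ (sym (^-distribˡ-+-* B b b′)) (sym (^-distribˡ-+-* F c c′))) ⟩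
    val (a + a′ , b + b′ , c + c′) ∎)
    where
    open ≤-Reasoning
    lemma : ∀ x y z x′ y′ z′ → (x * (y * z)) * (x′ * (y′ * z′)) ≡ (x * x′) * ((y * y′) * (z * z′))
    lemma = solve-∀
  ≼-* {e = just _}  {nothing} _ _ = ≤∞
  ≼-* {e = nothing} {just _}  _ _ = ≤∞
  ≼-* {e = nothing} {nothing} _ _ = ≤∞

  -- n ≤ 2^n ≤ M^n: constants are paid for by powers of `M`, so that bounds need no coefficients.
  ≼-const : ∀ n → n ≼ ⌜ n ⌝
  ≼-const n = ≤v (begin
    n           ≤⟨ n≤2^n n ⟩
    2 ^ n       ≤⟨ ^-monoˡ-≤ n 2≤M ⟩
    M ^ n       ≡⟨ sym (*-identityʳ _) ⟩
    M ^ n * 1   ∎)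
    where open ≤-Reasoning

  ≼-val : ∀ o → val o ≼ just o
  ≼-val o = ≤v ≤-refl

  ≼-power : ∀ a → M ^ a ≼ fin a 0 0
  ≼-power a = ≤v (≤-reflexive (sym (*-identityʳ (M ^ a))))

  ≼-linear : ∀ {t} e → linear e ≡ true → t ≼ e → t ≤ val (exponent e , 1 , 1)
  ≼-linear (fin a b c) eq (≤v t≤) =
    let p , q = ∧-true {b ≤ᵇ 1} eq
    in ≤-trans t≤ (val-mono a a b 1 c 1 ≤-refl (≤ᵇ-true b 1 p) (≤ᵇ-true c 1 q))

  val-linear : ∀ a → val (a , 1 , 1) ≡ M ^ a * (B * F)
  val-linear a = cong (M ^ a *_) (cong₂ _*_ (^-identityʳ B) (^-identityʳ F))

-- Types of data, their encodings and bounds for their values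

infixr 7 _⊗_

data Ty : Set where
  nat bool   : Ty
  _⊗_        : Ty → Ty → Ty
  list maybe : Ty → Ty
  trie       : Ty → Ty

data Trie (A : Set) : Set where
  empty : Trie A
  node  : Maybe A → Trie A → Trie A → Trie A

⟦_⟧ : Ty → Set
⟦ nat ⟧     = ℕ
⟦ bool ⟧    = Bool
⟦ A ⊗ B ⟧   = ⟦ A ⟧ × ⟦ B ⟧
⟦ list A ⟧  = List ⟦ A ⟧
⟦ maybe A ⟧ = Maybe ⟦ A ⟧
⟦ trie A ⟧  = Trie ⟦ A ⟧

encMaybe : {A : Set} → (A → Tree) → Maybe A → Tree
encMaybe e nothing  = leaf
encMaybe e (just x) = leaf ∙ e x

encTrie : {A : Set} → (A → Tree) → Trie A → Tree
encTrie e empty        = leaf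
encTrie e (node v l r) = encMaybe e v ∙ encTrie e l ∙ encTrie e r

enc : ∀ A → ⟦ A ⟧ → Tree
enc nat       = encℕ
enc bool      = λ b → if b then leaf ∙ leaf else leaf
enc (A ⊗ B)   = λ x → enc A (proj₁ x) ∙ enc B (proj₂ x)
enc (list A)  = encList (enc A)
enc (maybe A) = encMaybe (enc A)
enc (trie A)  = encTrie (enc A)

-- Least significant first; true is the digit 1 and false the digit 2.
digitsᵇ : ℕᵇ → List Bool
digitsᵇ ℕᵇ.zero  = []
digitsᵇ 2[1+ x ] = false ∷ digitsᵇ x
digitsᵇ 1+[2 x ] = true ∷ digitsᵇ x

undigitsᵇ : List Bool → ℕᵇ
undigitsᵇ []           = ℕᵇ.zero
undigitsᵇ (false ∷ ds) = 2[1+ undigitsᵇ ds ]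
undigitsᵇ (true ∷ ds)  = 1+[2 undigitsᵇ ds ]

digits : ℕ → List Bool
digits x = digitsᵇ (ℕᵇ.fromℕ x)

undigits : List Bool → ℕ
undigits ds = ℕᵇ.toℕ (undigitsᵇ ds)

bits : ℕ → ℕ
bits x = length (digits x)

enc-digitsᵇ : ∀ x → enc (list bool) (digitsᵇ x) ≡ encℕᵇ x
enc-digitsᵇ ℕᵇ.zero  = refl
enc-digitsᵇ 2[1+ x ] = cong (leaf ∙_) (enc-digitsᵇ x)
enc-digitsᵇ 1+[2 x ] = cong ((leaf ∙ leaf) ∙_) (enc-digitsᵇ x)

digits-undigitsᵇ : ∀ ds → digitsᵇ (undigitsᵇ ds) ≡ ds
digits-undigitsᵇ []           = refl
digits-undigitsᵇ (false ∷ ds) = cong (false ∷_) (digits-undigitsᵇ ds)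
digits-undigitsᵇ (true ∷ ds)  = cong (true ∷_) (digits-undigitsᵇ ds)

undigits-digitsᵇ : ∀ x → undigitsᵇ (digitsᵇ x) ≡ x
undigits-digitsᵇ ℕᵇ.zero  = refl
undigits-digitsᵇ 2[1+ x ] = cong 2[1+_] (undigits-digitsᵇ x)
undigits-digitsᵇ 1+[2 x ] = cong 1+[2_] (undigits-digitsᵇ x)

digits-undigits : ∀ ds → digits (undigits ds) ≡ ds
digits-undigits ds = trans (cong digitsᵇ (fromℕ-toℕ (undigitsᵇ ds))) (digits-undigitsᵇ ds)

undigits-digits : ∀ x → undigits (digits x) ≡ x
undigits-digits x = trans (cong ℕᵇ.toℕ (undigits-digitsᵇ (ℕᵇ.fromℕ x))) (toℕ-fromℕ x)

-- A number is bounded through its count of digits, not through its value. A list has a bound for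
-- its length and a common one for its entries. For a trie only the stored values are bounded, as
-- the time of an access depends on the key.
Bd : Ty → Set
Bd nat       = Ext
Bd bool      = ⊤
Bd (A ⊗ B)   = Bd A × Bd B
Bd (list A)  = Ext × Bd A
Bd (maybe A) = Bd A
Bd (trie A)  = Bd A

⊤ᵇ : ∀ A → Bd A
⊤ᵇ nat       = nothing
⊤ᵇ bool      = tt
⊤ᵇ (A ⊗ B)   = ⊤ᵇ A , ⊤ᵇ B
⊤ᵇ (list A)  = nothing , ⊤ᵇ A
⊤ᵇ (maybe A) = ⊤ᵇ A
⊤ᵇ (trie A)  = ⊤ᵇ A

⊥ᵇ : ∀ A → Bd A
⊥ᵇ nat       = fin 0 0 0
⊥ᵇ bool      = tt
⊥ᵇ (A ⊗ B)   = ⊥ᵇ A , ⊥ᵇ B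
⊥ᵇ (list A)  = fin 0 0 0 , ⊥ᵇ A
⊥ᵇ (maybe A) = ⊥ᵇ A
⊥ᵇ (trie A)  = ⊥ᵇ A

joinᵇ : ∀ A → Bd A → Bd A → Bd A
joinᵇ nat       e f = join e f
joinᵇ bool      _ _ = tt
joinᵇ (A ⊗ B)   β γ = joinᵇ A (proj₁ β) (proj₁ γ) , joinᵇ B (proj₂ β) (proj₂ γ)
joinᵇ (list A)  β γ = join (proj₁ β) (proj₁ γ) , joinᵇ A (proj₂ β) (proj₂ γ)
joinᵇ (maybe A) β γ = joinᵇ A β γ
joinᵇ (trie A)  β γ = joinᵇ A β γ

-- A component that the next approximation `γ` exceeds is given up as infinite, so that no iteration
-- to a fixed point is needed.
widen : ∀ A → Bd A → Bd A → Bd A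
widen nat       e f = if f ⊑ e then e else nothing
widen bool      _ _ = tt
widen (A ⊗ B)   β γ = widen A (proj₁ β) (proj₁ γ) , widen B (proj₂ β) (proj₂ γ)
widen (list A)  β γ = (if proj₁ γ ⊑ proj₁ β then proj₁ β else nothing) , widen A (proj₂ β) (proj₂ γ)
widen (maybe A) β γ = widen A β γ
widen (trie A)  β γ = widen A β γ

⊑ᵇ : ∀ A → Bd A → Bd A → Bool
⊑ᵇ nat       e f = e ⊑ f
⊑ᵇ bool      _ _ = true
⊑ᵇ (A ⊗ B)   β γ = ⊑ᵇ A (proj₁ β) (proj₁ γ) ∧ ⊑ᵇ B (proj₂ β) (proj₂ γ)
⊑ᵇ (list A)  β γ = (proj₁ β ⊑ proj₁ γ) ∧ ⊑ᵇ A (proj₂ β) (proj₂ γ)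
⊑ᵇ (maybe A) β γ = ⊑ᵇ A β γ
⊑ᵇ (trie A)  β γ = ⊑ᵇ A β γ

data AllT {A : Set} (P : A → Set) : Trie A → Set where
  empty : AllT P empty
  node  : ∀ {v l r} → All? P v → AllT P l → AllT P r → AllT P (node v l r)

mapM : ∀ {A : Set} {P Q : A → Set} → (∀ x → P x → Q x) → ∀ {v} → All? P v → All? Q v
mapM f = All?.map (λ {x} → f x)

mapT : ∀ {A : Set} {P Q : A → Set} → (∀ x → P x → Q x) → ∀ {v} → AllT P v → AllT Q v
mapT f empty        = empty
mapT f (node v l r) = node (mapM f v) (mapT f l) (mapT f r)

mapL : ∀ {A : Set} {P Q : A → Set} → (∀ x → P x → Q x) → ∀ {xs} → All P xs → All Q xs
mapL f = All.map (λ {x} → f x)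

module _ (S : Scale) where
  open Bound S

  Fit : ∀ A → Bd A → ⟦ A ⟧ → Set
  Fit nat       e x = bits x ≼ e
  Fit bool      _ _ = ⊤
  Fit (A ⊗ B)   β x = Fit A (proj₁ β) (proj₁ x) × Fit B (proj₂ β) (proj₂ x)
  Fit (list A)  β x = length x ≼ proj₁ β × All (Fit A (proj₂ β)) x
  Fit (maybe A) β x = All? (Fit A β) x
  Fit (trie A)  β x = AllT (Fit A β) x

  mutual
    fit-⊤ : ∀ A x → Fit A (⊤ᵇ A) x
    fit-⊤ nat       x       = ≤∞
    fit-⊤ bool      x       = tt
    fit-⊤ (A ⊗ B)   (x , y) = fit-⊤ A x , fit-⊤ B y
    fit-⊤ (list A)  xs      = ≤∞ , fit-⊤s A xs
    fit-⊤ (maybe A) v       = fit-⊤m A v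
    fit-⊤ (trie A)  v       = fit-⊤t A v

    fit-⊤s : ∀ A xs → All (Fit A (⊤ᵇ A)) xs
    fit-⊤s A []       = []
    fit-⊤s A (x ∷ xs) = fit-⊤ A x ∷ fit-⊤s A xs

    fit-⊤m : ∀ A v → All? (Fit A (⊤ᵇ A)) v
    fit-⊤m A nothing  = nothing
    fit-⊤m A (just x) = just (fit-⊤ A x)

    fit-⊤t : ∀ A v → AllT (Fit A (⊤ᵇ A)) v
    fit-⊤t A empty        = empty
    fit-⊤t A (node v l r) = node (fit-⊤m A v) (fit-⊤t A l) (fit-⊤t A r)

  fit-⊑ : ∀ A β γ → ⊑ᵇ A β γ ≡ true → ∀ x → Fit A β x → Fit A γ x
  fit-⊑ nat       β γ eq x p = ≼-⊑ eq p
  fit-⊑ bool      β γ eq x p = tt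
  fit-⊑ (A ⊗ B)   β γ eq (x , y) (p , q) =
    let eq₁ , eq₂ = ∧-true eq in fit-⊑ A _ _ eq₁ x p , fit-⊑ B _ _ eq₂ y q
  fit-⊑ (list A)  β γ eq xs (p , q) =
    let eq₁ , eq₂ = ∧-true {proj₁ β ⊑ proj₁ γ} eq in ≼-⊑ eq₁ p , mapL (fit-⊑ A _ _ eq₂) q
  fit-⊑ (maybe A) β γ eq x p = mapM (fit-⊑ A β γ eq) p
  fit-⊑ (trie A)  β γ eq x p = mapT (fit-⊑ A β γ eq) p

  fit-joinˡ : ∀ A β γ x → Fit A β x → Fit A (joinᵇ A β γ) x
  fit-joinˡ nat       β γ x p = ≼-joinˡ γ p
  fit-joinˡ bool      β γ x p = tt
  fit-joinˡ (A ⊗ B)   β γ (x , y) (p , q) = fit-joinˡ A _ _ x p , fit-joinˡ B _ _ y q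
  fit-joinˡ (list A)  β γ xs (p , q) = ≼-joinˡ (proj₁ γ) p , mapL (fit-joinˡ A _ _) q
  fit-joinˡ (maybe A) β γ x p = mapM (fit-joinˡ A β γ) p
  fit-joinˡ (trie A)  β γ x p = mapT (fit-joinˡ A β γ) p

  fit-joinʳ : ∀ A β γ x → Fit A γ x → Fit A (joinᵇ A β γ) x
  fit-joinʳ nat       β γ x p = ≼-joinʳ β p
  fit-joinʳ bool      β γ x p = tt
  fit-joinʳ (A ⊗ B)   β γ (x , y) (p , q) = fit-joinʳ A _ _ x p , fit-joinʳ B _ _ y q
  fit-joinʳ (list A)  β γ xs (p , q) = ≼-joinʳ (proj₁ β) p , mapL (fit-joinʳ A _ _) q
  fit-joinʳ (maybe A) β γ x p = mapM (fit-joinʳ A β γ) p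
  fit-joinʳ (trie A)  β γ x p = mapT (fit-joinʳ A β γ) p

-- Typed programs

Ctx : Set
Ctx = List Ty

Tuple : (Ty → Set) → Ctx → Set
Tuple F []      = ⊤
Tuple F (A ∷ Γ) = F A × Tuple F Γ

Env BEnv : Ctx → Set
Env  = Tuple ⟦_⟧
BEnv = Tuple Bd

encEnv : ∀ Γ → Env Γ → Vec Tree (length Γ)
encEnv []      _       = []
encEnv (A ∷ Γ) (x , ρ) = enc A x ∷ encEnv Γ ρ

FitEnv : Scale → ∀ Γ → BEnv Γ → Env Γ → Set
FitEnv S []      _       _       = ⊤
FitEnv S (A ∷ Γ) (β , γ) (x , ρ) = Fit S A β x × FitEnv S Γ γ ρ

open Bound using (_≼_) public
module ≼ {S} = Bound S hiding (_≼_)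
open ≼

-- abs is an abstract interpretation of fun and time: it turns bounds for the
-- arguments into bounds for the result and the running time.
record Fn (Γ : Ctx) (A : Ty) : Set where
  no-eta-equality
  field
    code  : ∀ {s} → Code s (length Γ)
    fun   : Env Γ → ⟦ A ⟧
    time  : Env Γ → ℕ
    run   : ∀ {s} (π : Proc s) ρ → Eval {s} π (encEnv Γ ρ) code (enc A (fun ρ)) (time ρ)
    abs   : BEnv Γ → Bd A × Ext
    sound : ∀ S γ ρ → FitEnv S Γ γ ρ → Fit S A (proj₁ (abs γ)) (fun ρ) × _≼_ S (time ρ) (proj₂ (abs γ))

open Fn public

-- The abs fields are composed with the following functions so that Agda's
-- evaluator shares the results for the components.
infixr 6 _⊕ᵇ_
_⊕ᵇ_ : {A : Set} → Ext → A × Ext → A × Ext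
o ⊕ᵇ p = proj₁ p , o ⊕ proj₂ p

module _ {A B : Set} where
  bindᵇ : B × Ext → (B → A × Ext) → A × Ext
  bindᵇ p k = proj₂ p ⊕ᵇ k (proj₁ p)

  pairᵇ : A × Ext → B × Ext → (A × B) × Ext
  pairᵇ p q = (proj₁ p , proj₁ q) , proj₂ p ⊕ proj₂ q

  firstᵇ : (A → B) → A × Ext → B × Ext
  firstᵇ f p = f (proj₁ p) , proj₂ p

consᵇ : ∀ A → Bd A × Ext → Bd (list A) × Ext → Bd (list A) × Ext
consᵇ A p q = (⌜ 0 ⌝ ⊕ proj₁ (proj₁ q) , joinᵇ A (proj₁ p) (proj₂ (proj₁ q))) , proj₂ p ⊕ proj₂ q

nodeᵇ : ∀ A → (p q r : Bd A × Ext) → Bd A × Ext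
nodeᵇ A p q r = joinᵇ A (proj₁ p) (joinᵇ A (proj₁ q) (proj₁ r)) , proj₂ p ⊕ proj₂ q ⊕ proj₂ r

choiceᵇ : ∀ A {B : Set} → B × Ext → (B → Bd A × Ext) → Bd A × Ext → Bd A × Ext
choiceᵇ A p k r = either (k (proj₁ p))
  where
  either : Bd A × Ext → Bd A × Ext
  either q = joinᵇ A (proj₁ q) (proj₁ r) , proj₂ p ⊕ join (proj₂ q) (proj₂ r)

thinᵇ : ∀ {A : Set} → ℕ → A × Ext → A × Ext
thinᵇ n p = ⌜ n * 2 + 1 ⌝ ⊕ᵇ ⌜ n * 2 ⌝ ⊕ᵇ p

infix 4 _∋_
data _∋_ : Ctx → Ty → Set where
  Z : ∀ {A Γ} → A ∷ Γ ∋ A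
  N : ∀ {A B Γ} → Γ ∋ A → B ∷ Γ ∋ A

position : ∀ {Γ A} → Γ ∋ A → Fin (length Γ)
position Z     = zero
position (N x) = suc (position x)

get : ∀ {F Γ A} → Γ ∋ A → Tuple F Γ → F A
get Z     (x , _) = x
get (N i) (_ , ρ) = get i ρ

lookup-position : ∀ {Γ A} (x : Γ ∋ A) ρ → Vec.lookup (encEnv Γ ρ) (position x) ≡ enc A (get x ρ)
lookup-position Z     ρ       = refl
lookup-position (N x) (_ , ρ) = lookup-position x ρ

fit-get : ∀ {S Γ A} (x : Γ ∋ A) γ ρ → FitEnv S Γ γ ρ → Fit S A (get x γ) (get x ρ)
fit-get Z     γ       ρ       (p , _) = p
fit-get (N x) (_ , γ) (_ , ρ) (_ , p) = fit-get x γ ρ p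

eval-Var : ∀ {s v} {π : Proc s} {ρ : Vec Tree v} x {w} → Vec.lookup ρ x ≡ w → Eval {s} π ρ (Var x) w 1
eval-Var x refl = Var

varF : ∀ {Γ A} → Γ ∋ A → Fn Γ A
varF x .code        = Var (position x)
varF x .fun         = get x
varF x .time _      = 1
varF x .run π ρ     = eval-Var _ (lookup-position x ρ)
varF x .abs γ       = get x γ , ⌜ 1 ⌝
varF x .sound S γ ρ p = fit-get x γ ρ p , ≼-const 1

v0 : ∀ {A Γ} → Fn (A ∷ Γ) A
v0 = varF Z
v1 : ∀ {A B Γ} → Fn (A ∷ B ∷ Γ) B
v1 = varF (N Z)
v2 : ∀ {A B C Γ} → Fn (A ∷ B ∷ C ∷ Γ) C
v2 = varF (N (N Z))
v3 : ∀ {A B C D Γ} → Fn (A ∷ B ∷ C ∷ D ∷ Γ) D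
v3 = varF (N (N (N Z)))
v4 : ∀ {A B C D E Γ} → Fn (A ∷ B ∷ C ∷ D ∷ E ∷ Γ) E
v4 = varF (N (N (N (N Z))))
v5 : ∀ {A B C D E F Γ} → Fn (A ∷ B ∷ C ∷ D ∷ E ∷ F ∷ Γ) F
v5 = varF (N (N (N (N (N Z)))))
v6 : ∀ {A B C D E F G Γ} → Fn (A ∷ B ∷ C ∷ D ∷ E ∷ F ∷ G ∷ Γ) G
v6 = varF (N (N (N (N (N (N Z))))))
v7 : ∀ {A B C D E F G H Γ} → Fn (A ∷ B ∷ C ∷ D ∷ E ∷ F ∷ G ∷ H ∷ Γ) H
v7 = varF (N (N (N (N (N (N (N Z)))))))

quoted : ∀ {s v} → Tree → Code s v
quoted leaf    = Leaf
quoted (l ∙ r) = Node (quoted l) (quoted r)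

eval-quoted : ∀ {s v} {π : Proc s} {ρ : Vec Tree v} w → Eval {s} π ρ (quoted w) w (size w)
eval-quoted leaf    = Leaf
eval-quoted (l ∙ r) = Node (eval-quoted l) (eval-quoted r)

natF : ∀ {Γ} → ℕ → Fn Γ nat
natF x .code          = quoted (encℕ x)
natF x .fun _         = x
natF x .time _        = size (encℕ x)
natF x .run π ρ       = eval-quoted (encℕ x)
natF x .abs _         = ⌜ bits x ⌝ , ⌜ size (encℕ x) ⌝
natF x .sound S _ _ _ = ≼-const _ , ≼-const _

boolF : ∀ {Γ} → Bool → Fn Γ bool
boolF b .code          = quoted (enc bool b)
boolF b .fun _         = b
boolF b .time _        = size (enc bool b)
boolF b .run π ρ       = eval-quoted (enc bool b)
boolF b .abs _         = tt , ⌜ size (enc bool b) ⌝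
boolF b .sound S _ _ _ = tt , ≼-const _

nilF : ∀ {Γ A} → Fn Γ (list A)
nilF .code              = Leaf
nilF .fun _             = []
nilF .time _            = 1
nilF .run π ρ           = Leaf
nilF {A = A} .abs _     = (⌜ 0 ⌝ , ⊥ᵇ A) , ⌜ 1 ⌝
nilF .sound S _ _ _     = (≼-const 0 , []) , ≼-const 1

nothingF : ∀ {Γ A} → Fn Γ (maybe A)
nothingF .code          = Leaf
nothingF .fun _         = nothing
nothingF .time _        = 1
nothingF .run π ρ       = Leaf
nothingF {A = A} .abs _ = ⊥ᵇ A , ⌜ 1 ⌝
nothingF .sound S _ _ _ = nothing , ≼-const 1

emptyF : ∀ {Γ A} → Fn Γ (trie A)
emptyF .code            = Leaf
emptyF .fun _           = empty
emptyF .time _          = 1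
emptyF .run π ρ         = Leaf
emptyF {A = A} .abs _   = ⊥ᵇ A , ⌜ 1 ⌝
emptyF .sound S _ _ _   = empty , ≼-const 1

justF : ∀ {Γ A} → Fn Γ A → Fn Γ (maybe A)
justF f .code    = Node Leaf (f .code)
justF f .fun ρ   = just (f .fun ρ)
justF f .time ρ  = 2 + f .time ρ
justF f .run π ρ = Node Leaf (f .run π ρ)
justF f .abs γ   = ⌜ 1 ⌝ ⊕ᵇ f .abs γ
justF f .sound S γ ρ p = let fit , t = f .sound S γ ρ p in just fit , ≼-⊕ (≼-const 1) t

infixr 5 _,ᶠ_ _∷ᶠ_

_,ᶠ_ : ∀ {Γ A B} → Fn Γ A → Fn Γ B → Fn Γ (A ⊗ B)
(f ,ᶠ g) .code    = Node (f .code) (g .code)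
(f ,ᶠ g) .fun ρ   = f .fun ρ , g .fun ρ
(f ,ᶠ g) .time ρ  = 1 + f .time ρ + g .time ρ
(f ,ᶠ g) .run π ρ = Node (f .run π ρ) (g .run π ρ)
(f ,ᶠ g) .abs γ   = pairᵇ (f .abs γ) (g .abs γ)
(f ,ᶠ g) .sound S γ ρ p = let x , t = f .sound S γ ρ p ; y , u = g .sound S γ ρ p in (x , y) , ≼-⊕ t u

_∷ᶠ_ : ∀ {Γ A} → Fn Γ A → Fn Γ (list A) → Fn Γ (list A)
(f ∷ᶠ g) .code    = Node (f .code) (g .code)
(f ∷ᶠ g) .fun ρ   = f .fun ρ ∷ g .fun ρ
(f ∷ᶠ g) .time ρ  = 1 + f .time ρ + g .time ρ
(f ∷ᶠ g) .run π ρ = Node (f .run π ρ) (g .run π ρ)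
_∷ᶠ_ {A = A} f g .abs γ = consᵇ A (f .abs γ) (g .abs γ)
_∷ᶠ_ {A = A} f g .sound S γ ρ p =
  let x , t = f .sound S γ ρ p ; (n , xs) , u = g .sound S γ ρ p
  in (≼-⊕ (≼-const 0) n , fit-joinˡ S A _ _ _ x ∷ mapL (fit-joinʳ S A _ _) xs) , ≼-⊕ t u

nodeF : ∀ {Γ A} → Fn Γ (maybe A) → Fn Γ (trie A) → Fn Γ (trie A) → Fn Γ (trie A)
nodeF f g h .code    = Node (f .code) (Node (g .code) (h .code))
nodeF f g h .fun ρ   = node (f .fun ρ) (g .fun ρ) (h .fun ρ)
nodeF f g h .time ρ  = 1 + f .time ρ + (1 + g .time ρ + h .time ρ)
nodeF f g h .run π ρ = Node (f .run π ρ) (Node (g .run π ρ) (h .run π ρ))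
nodeF {A = A} f g h .abs γ = nodeᵇ A (f .abs γ) (g .abs γ) (h .abs γ)
nodeF {A = A} f g h .sound S γ ρ p =
  let x , t = f .sound S γ ρ p ; y , u = g .sound S γ ρ p ; z , v = h .sound S γ ρ p
  in node (mapM (fit-joinˡ S A _ _) x)
          (mapT (λ w q → fit-joinʳ S A _ _ w (fit-joinˡ S A _ _ w q)) y)
          (mapT (λ w q → fit-joinʳ S A _ _ w (fit-joinʳ S A _ _ w q)) z) ,
     ≼-⊕ t (≼-⊕ u v)

letF : ∀ {Γ A B} → Fn Γ A → Fn (A ∷ Γ) B → Fn Γ B
letF f g .code    = Let (f .code) (g .code)
letF f g .fun ρ   = g .fun (f .fun ρ , ρ)
letF f g .time ρ  = 1 + f .time ρ + g .time (f .fun ρ , ρ)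
letF f g .run π ρ = Let (f .run π ρ) (g .run π _)
letF f g .abs γ   = bindᵇ (f .abs γ) (λ β → g .abs (β , γ))
letF f g .sound S γ ρ p =
  let x , t = f .sound S γ ρ p ; y , u = g .sound S _ _ (x , p) in y , ≼-⊕ t u

splitF : ∀ {Γ A B C} → Fn Γ (A ⊗ B) → Fn (A ∷ B ∷ Γ) C → Fn Γ C
splitF f g .code    = Case (f .code) Leaf (g .code)
splitF f g .fun ρ   = g .fun (proj₁ (f .fun ρ) , proj₂ (f .fun ρ) , ρ)
splitF f g .time ρ  = 1 + f .time ρ + g .time (proj₁ (f .fun ρ) , proj₂ (f .fun ρ) , ρ)
splitF f g .run π ρ = Case-node (f .run π ρ) (g .run π _)
splitF f g .abs γ   = bindᵇ (f .abs γ) (λ β → g .abs (proj₁ β , proj₂ β , γ))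
splitF f g .sound S γ ρ p =
  let (x , y) , t = f .sound S γ ρ p ; z , u = g .sound S _ _ (x , y , p) in z , ≼-⊕ t u

drop : ∀ F Δ Θ {Γ} → Tuple F (Δ ++ Θ ++ Γ) → Tuple F (Δ ++ Γ)
drop F (A ∷ Δ) Θ       (x , ρ) = x , drop F Δ Θ ρ
drop F []      (A ∷ Θ) (_ , ρ) = drop F [] Θ ρ
drop F []      []      ρ       = ρ

thinning : ∀ Δ Θ {Γ : Ctx} → Fin (length (Δ ++ Γ)) → Fin (length (Δ ++ Θ ++ Γ))
thinning (A ∷ Δ) Θ       zero    = zero
thinning (A ∷ Δ) Θ       (suc i) = suc (thinning Δ Θ i)
thinning []      (A ∷ Θ) i       = suc (thinning [] Θ i)
thinning []      []      i       = i

lookup-thinning : ∀ Δ Θ {Γ} ρ i → Vec.lookup (encEnv (Δ ++ Θ ++ Γ) ρ) (thinning Δ Θ i) ≡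
                  Vec.lookup (encEnv (Δ ++ Γ) (drop ⟦_⟧ Δ Θ ρ)) i
lookup-thinning (A ∷ Δ) Θ       (x , ρ) zero    = refl
lookup-thinning (A ∷ Δ) Θ       (x , ρ) (suc i) = lookup-thinning Δ Θ ρ i
lookup-thinning []      (A ∷ Θ) (x , ρ) i       = lookup-thinning [] Θ ρ i
lookup-thinning []      []      ρ       i       = refl

fit-drop : ∀ S Δ Θ {Γ} γ ρ → FitEnv S (Δ ++ Θ ++ Γ) γ ρ → FitEnv S (Δ ++ Γ) (drop Bd Δ Θ γ) (drop ⟦_⟧ Δ Θ ρ)
fit-drop S (A ∷ Δ) Θ       (_ , γ) (_ , ρ) (x , p) = x , fit-drop S Δ Θ γ ρ p
fit-drop S []      (A ∷ Θ) (_ , γ) (_ , ρ) (x , p) = fit-drop S [] Θ γ ρ p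
fit-drop S []      []      γ       ρ       p       = p

eval-vars : ∀ {s n v} {π : Proc s} {ρ : Vec Tree v} (f : Fin n → Fin v) us →
            (∀ i → Vec.lookup ρ (f i) ≡ Vec.lookup us i) →
            Evals {s} π ρ (Vec.tabulate (Var ∘ f)) us (n * 2 + 1)
eval-vars f []       eq = []
eval-vars f (u ∷ us) eq = eval-Var (f zero) (eq zero) ∷ eval-vars (f ∘ suc) us (eq ∘ suc)

-- Weakening without renaming any code: `f` becomes a procedure that is called with the variables it
-- may see. The extra time is a constant.
thinF : ∀ Δ Θ {Γ A} → Fn (Δ ++ Γ) A → Fn (Δ ++ Θ ++ Γ) A
thinF Δ Θ {Γ} f .code      = Fix (f .code) (Vec.tabulate (Var ∘ thinning Δ Θ {Γ}))
thinF Δ Θ f .fun ρ         = f .fun (drop ⟦_⟧ Δ Θ ρ)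
thinF Δ Θ {Γ} f .time ρ    = let n = length (Δ ++ Γ) in 1 + (n * 2 + 1) + (n * 2 + f .time (drop ⟦_⟧ Δ Θ ρ))
thinF Δ Θ f .run π ρ       = Fix (eval-vars _ _ (lookup-thinning Δ Θ ρ)) (f .run _ _)
thinF Δ Θ {Γ} f .abs γ     = thinᵇ (length (Δ ++ Γ)) (f .abs (drop Bd Δ Θ γ))
thinF Δ Θ f .sound S γ ρ p =
  let x , t = f .sound S _ _ (fit-drop S Δ Θ γ ρ p) in x , ≼-⊕ (≼-const _) (≼-+ (≼-const _) t)

module _ {Γ A} (b : Fn Γ bool) (f g : Fn Γ A) where
  private
    -- `true` is encoded as `leaf ∙ leaf`, so `Case` binds two more variables there, both of them
    -- encodings of `false`.
    f′ = thinF [] (bool ∷ bool ∷ []) f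
    run′ : ∀ {s} (π : Proc s) ρ c {t} → Eval {s} π (encEnv Γ ρ) (b .code) (enc bool c) t →
           Eval {s} π (encEnv Γ ρ) (Case (b .code) (g .code) (f′ .code)) (enc _ (if c then f .fun ρ else g .fun ρ))
                (1 + t + (if c then f′ .time (false , false , ρ) else g .time ρ))
    run′ π ρ true  D = Case-node D (f′ .run π (false , false , ρ))
    run′ π ρ false D = Case-leaf D (g .run π ρ)
    sound′ : ∀ {A} S c {x y β γ t u e f} → Fit S A β x → _≼_ S t e → Fit S A γ y → _≼_ S u f →
             Fit S A (joinᵇ A β γ) (if c then x else y) × _≼_ S (if c then t else u) (join e f)
    sound′ {A} S true  x t y u = fit-joinˡ S A _ _ _ x , ≼-joinˡ _ t
    sound′ {A} S false x t y u = fit-joinʳ S A _ _ _ y , ≼-joinʳ _ u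

  ifF : Fn Γ A
  ifF .code = Case (b .code) (g .code) (f′ .code)
  ifF .fun ρ = if b .fun ρ then f .fun ρ else g .fun ρ
  ifF .time ρ = 1 + b .time ρ + (if b .fun ρ then f′ .time (false , false , ρ) else g .time ρ)
  ifF .run π ρ = run′ π ρ (b .fun ρ) (b .run π ρ)
  ifF .abs γ = choiceᵇ A (b .abs γ) (λ _ → f′ .abs (tt , tt , γ)) (g .abs γ)
  ifF .sound S γ ρ p =
    let x , t = f′ .sound S (tt , tt , γ) (false , false , ρ) (tt , tt , p)
        y , u = g .sound S γ ρ p
        z , w = sound′ {A} S (b .fun ρ) x t y u
    in z , ≼-⊕ (proj₂ (b .sound S γ ρ p)) w

elimL : {A C : Set} → List A → C → (A → List A → C) → C
elimL []       c f = c
elimL (x ∷ xs) c f = f x xs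

elimM : {A C : Set} → Maybe A → C → (A → C) → C
elimM nothing  c f = c
elimM (just x) c f = f x

elimT : {A C : Set} → Trie A → C → (Maybe A → Trie A → Trie A → C) → C
elimT empty        c f = c
elimT (node v l r) c f = f v l r

module _ {Γ A C} (f : Fn Γ (list A)) (g : Fn Γ C) (h : Fn (A ∷ list A ∷ Γ) C) where
  private
    run′ : ∀ {s} (π : Proc s) ρ xs {t} → Eval {s} π (encEnv Γ ρ) (f .code) (enc (list A) xs) t →
           Eval {s} π (encEnv Γ ρ) (Case (f .code) (g .code) (h .code))
                (enc C (elimL xs (g .fun ρ) (λ x xs → h .fun (x , xs , ρ))))
                (1 + t + elimL xs (g .time ρ) (λ x xs → h .time (x , xs , ρ)))
    run′ π ρ []       D = Case-leaf D (g .run π ρ)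
    run′ π ρ (x ∷ xs) D = Case-node D (h .run π (x , xs , ρ))
    sound′ : ∀ S γ ρ → FitEnv S Γ γ ρ → ∀ xs {β} → Fit S (list A) β xs → let γ′ = proj₂ β , β , γ in
             Fit S C (joinᵇ C (proj₁ (h .abs γ′)) (proj₁ (g .abs γ)))
                     (elimL xs (g .fun ρ) (λ x xs → h .fun (x , xs , ρ)))
             × _≼_ S (elimL xs (g .time ρ) (λ x xs → h .time (x , xs , ρ)))
                     (join (proj₂ (h .abs γ′)) (proj₂ (g .abs γ)))
    sound′ S γ ρ p []       q = let x , t = g .sound S γ ρ p in fit-joinʳ S C _ _ _ x , ≼-joinʳ _ t
    sound′ S γ ρ p (x ∷ xs) (n , q ∷ qs) =
      let x , t = h .sound S _ _ (q , (≼-mono (n≤1+n _) n , qs) , p) in fit-joinˡ S C _ _ _ x , ≼-joinˡ _ t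

  caseL : Fn Γ C
  caseL .code = Case (f .code) (g .code) (h .code)
  caseL .fun ρ = elimL (f .fun ρ) (g .fun ρ) (λ x xs → h .fun (x , xs , ρ))
  caseL .time ρ = 1 + f .time ρ + elimL (f .fun ρ) (g .time ρ) (λ x xs → h .time (x , xs , ρ))
  caseL .run π ρ = run′ π ρ (f .fun ρ) (f .run π ρ)
  caseL .abs γ = choiceᵇ C (f .abs γ) (λ β → h .abs (proj₂ β , β , γ)) (g .abs γ)
  caseL .sound S γ ρ p =
    let x , t = f .sound S γ ρ p
        y , u = sound′ S γ ρ p (f .fun ρ) x
    in y , ≼-⊕ t u

-- The variable of type bool is the tag of just.
module _ {Γ A C} (f : Fn Γ (maybe A)) (g : Fn Γ C) (h : Fn (bool ∷ A ∷ Γ) C) where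
  private
    run′ : ∀ {s} (π : Proc s) ρ x {t} → Eval {s} π (encEnv Γ ρ) (f .code) (enc (maybe A) x) t →
           Eval {s} π (encEnv Γ ρ) (Case (f .code) (g .code) (h .code))
                (enc C (elimM x (g .fun ρ) (λ x → h .fun (false , x , ρ))))
                (1 + t + elimM x (g .time ρ) (λ x → h .time (false , x , ρ)))
    run′ π ρ nothing  D = Case-leaf D (g .run π ρ)
    run′ π ρ (just x) D = Case-node D (h .run π (false , x , ρ))
    sound′ : ∀ S γ ρ → FitEnv S Γ γ ρ → ∀ {x β} → Fit S (maybe A) β x → let γ′ = tt , β , γ in
             Fit S C (joinᵇ C (proj₁ (h .abs γ′)) (proj₁ (g .abs γ)))
                     (elimM x (g .fun ρ) (λ x → h .fun (false , x , ρ)))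
             × _≼_ S (elimM x (g .time ρ) (λ x → h .time (false , x , ρ)))
                     (join (proj₂ (h .abs γ′)) (proj₂ (g .abs γ)))
    sound′ S γ ρ p nothing = let x , t = g .sound S γ ρ p in fit-joinʳ S C _ _ _ x , ≼-joinʳ _ t
    sound′ S γ ρ p (just q) =
      let x , t = h .sound S _ _ (tt , q , p) in fit-joinˡ S C _ _ _ x , ≼-joinˡ _ t

  caseM : Fn Γ C
  caseM .code = Case (f .code) (g .code) (h .code)
  caseM .fun ρ = elimM (f .fun ρ) (g .fun ρ) (λ x → h .fun (false , x , ρ))
  caseM .time ρ = 1 + f .time ρ + elimM (f .fun ρ) (g .time ρ) (λ x → h .time (false , x , ρ))
  caseM .run π ρ = run′ π ρ (f .fun ρ) (f .run π ρ)
  caseM .abs γ = choiceᵇ C (f .abs γ) (λ β → h .abs (tt , β , γ)) (g .abs γ)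
  caseM .sound S γ ρ p =
    let x , t = f .sound S γ ρ p
        y , u = sound′ S γ ρ p x
    in y , ≼-⊕ t u

module _ {Γ A C} (f : Fn Γ (trie A)) (g : Fn Γ C) (h : Fn (maybe A ∷ (trie A ⊗ trie A) ∷ Γ) C) where
  private
    run′ : ∀ {s} (π : Proc s) ρ x {t} → Eval {s} π (encEnv Γ ρ) (f .code) (enc (trie A) x) t →
           Eval {s} π (encEnv Γ ρ) (Case (f .code) (g .code) (h .code))
                (enc C (elimT x (g .fun ρ) (λ v l r → h .fun (v , (l , r) , ρ))))
                (1 + t + elimT x (g .time ρ) (λ v l r → h .time (v , (l , r) , ρ)))
    run′ π ρ empty        D = Case-leaf D (g .run π ρ)
    run′ π ρ (node v l r) D = Case-node D (h .run π (v , (l , r) , ρ))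
    sound′ : ∀ S γ ρ → FitEnv S Γ γ ρ → ∀ {x β} → Fit S (trie A) β x → let γ′ = β , (β , β) , γ in
             Fit S C (joinᵇ C (proj₁ (h .abs γ′)) (proj₁ (g .abs γ)))
                     (elimT x (g .fun ρ) (λ v l r → h .fun (v , (l , r) , ρ)))
             × _≼_ S (elimT x (g .time ρ) (λ v l r → h .time (v , (l , r) , ρ)))
                     (join (proj₂ (h .abs γ′)) (proj₂ (g .abs γ)))
    sound′ S γ ρ p empty = let x , t = g .sound S γ ρ p in fit-joinʳ S C _ _ _ x , ≼-joinʳ _ t
    sound′ S γ ρ p (node v l r) =
      let x , t = h .sound S _ _ (v , (l , r) , p) in fit-joinˡ S C _ _ _ x , ≼-joinˡ _ t

  caseT : Fn Γ C
  caseT .code = Case (f .code) (g .code) (h .code)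
  caseT .fun ρ = elimT (f .fun ρ) (g .fun ρ) (λ v l r → h .fun (v , (l , r) , ρ))
  caseT .time ρ = 1 + f .time ρ + elimT (f .fun ρ) (g .time ρ) (λ v l r → h .time (v , (l , r) , ρ))
  caseT .run π ρ = run′ π ρ (f .fun ρ) (f .run π ρ)
  caseT .abs γ = choiceᵇ C (f .abs γ) (λ β → h .abs (β , (β , β) , γ)) (g .abs γ)
  caseT .sound S γ ρ p =
    let x , t = f .sound S γ ρ p
        y , u = sound′ S γ ρ p x
    in y , ≼-⊕ t u

-- A number and the list of its digits are the same tree, by `enc-digitsᵇ`, so the conversion costs
-- nothing.
digitsF : ∀ {Γ} → Fn Γ nat → Fn Γ (list bool)
digitsF f .code    = f .code
digitsF f .fun ρ   = digits (f .fun ρ)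
digitsF f .time    = f .time
digitsF {Γ} f .run {s} π ρ =
  subst (λ w → Eval {s} π (encEnv Γ ρ) (f .code) w (f .time ρ)) (sym (enc-digitsᵇ (ℕᵇ.fromℕ (f .fun ρ)))) (f .run π ρ)
digitsF f .abs γ   = firstᵇ (_, tt) (f .abs γ)
digitsF f .sound S γ ρ p = let x , t = f .sound S γ ρ p in (x , fit-⊤s S bool _) , t

-- The notation with digits 1 and 2 is bijective: every list of digits denotes a number without any
-- normalisation, hence this conversion is free as well.
undigitsF : ∀ {Γ} → Fn Γ (list bool) → Fn Γ nat
undigitsF f .code    = f .code
undigitsF f .fun ρ   = undigits (f .fun ρ)
undigitsF f .time    = f .time
undigitsF {Γ} f .run {s} π ρ =
  subst (λ w → Eval {s} π (encEnv Γ ρ) (f .code) w (f .time ρ))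
        (trans (cong (enc (list bool)) (sym (digits-undigits (f .fun ρ)))) (enc-digitsᵇ (ℕᵇ.fromℕ (undigits (f .fun ρ)))))
        (f .run π ρ)
undigitsF f .abs γ   = firstᵇ proj₁ (f .abs γ)
undigitsF f .sound S γ ρ p =
  let (x , _) , t = f .sound S γ ρ p
  in subst (λ l → _≼_ S l _) (sym (cong length (digits-undigits (f .fun ρ)))) x , t

data Args (Γ : Ctx) : Ctx → Set where
  []  : Args Γ []
  _∷_ : ∀ {A Δ} → Fn Γ A → Args Γ Δ → Args Γ (A ∷ Δ)

module _ {Γ : Ctx} where

  argsCode : ∀ {s Δ} → Args Γ Δ → Vec (Code s (length Γ)) (length Δ)
  argsCode []       = []
  argsCode (f ∷ fs) = f .code ∷ argsCode fs

  argsFun : ∀ {Δ} → Args Γ Δ → Env Γ → Env Δ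
  argsFun []       ρ = tt
  argsFun (f ∷ fs) ρ = f .fun ρ , argsFun fs ρ

  argsTime : ∀ {Δ} → Args Γ Δ → Env Γ → ℕ
  argsTime []       ρ = 1
  argsTime (f ∷ fs) ρ = 1 + f .time ρ + argsTime fs ρ

  argsRun : ∀ {s Δ} (fs : Args Γ Δ) (π : Proc s) ρ →
            Evals {s} π (encEnv Γ ρ) (argsCode fs) (encEnv Δ (argsFun fs ρ)) (argsTime fs ρ)
  argsRun []       π ρ = []
  argsRun (f ∷ fs) π ρ = f .run π ρ ∷ argsRun fs π ρ

  argsAbs : ∀ {Δ} → Args Γ Δ → BEnv Γ → BEnv Δ × Ext
  argsAbs []       γ = tt , ⌜ 1 ⌝
  argsAbs (f ∷ fs) γ = pairᵇ (f .abs γ) (argsAbs fs γ)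

  argsSound : ∀ {Δ} (fs : Args Γ Δ) S γ ρ → FitEnv S Γ γ ρ →
              FitEnv S Δ (proj₁ (argsAbs fs γ)) (argsFun fs ρ) × _≼_ S (argsTime fs ρ) (proj₂ (argsAbs fs γ))
  argsSound []       S γ ρ p = tt , ≼-const 1
  argsSound (f ∷ fs) S γ ρ p =
    let x , t = f .sound S γ ρ p ; y , u = argsSound fs S γ ρ p in (x , y) , ≼-⊕ t u

callF : ∀ {Γ Δ A} → Fn Δ A → Args Γ Δ → Fn Γ A
callF f fs .code    = Fix (f .code) (argsCode fs)
callF f fs .fun ρ   = f .fun (argsFun fs ρ)
callF {Δ = Δ} f fs .time ρ  = 1 + argsTime fs ρ + (length Δ * 2 + f .time (argsFun fs ρ))
callF f fs .run π ρ = Fix (argsRun fs π ρ) (f .run _ _)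
callF {Δ = Δ} f fs .abs γ = bindᵇ (argsAbs fs γ) (λ δ → ⌜ length Δ * 2 ⌝ ⊕ᵇ f .abs δ)
callF f fs .sound S γ ρ p =
  let x , t = argsSound fs S γ ρ p ; y , u = f .sound S _ _ x in y , ≼-⊕ t (≼-+ (≼-const _) u)

-- Replaces the function read off from the code by its specification, so that later proofs meet only
-- the latter.
withFun : ∀ {Γ A} (f : Fn Γ A) (g : Env Γ → ⟦ A ⟧) → (∀ ρ → f .fun ρ ≡ g ρ) → Fn Γ A
withFun f g eq .code          = f .code
withFun f g eq .fun           = g
withFun f g eq .time          = f .time
withFun {Γ} {A} f g eq .run {s} π ρ = subst (λ x → Eval {s} π (encEnv Γ ρ) (f .code) (enc A x) _) (eq ρ) (f .run π ρ)
withFun f g eq .abs           = f .abs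
withFun {A = A} f g eq .sound S γ ρ p =
  let x , t = f .sound S γ ρ p in subst (Fit S A _) (eq ρ) x , t

withAbs : ∀ {Γ A} (f : Fn Γ A) (abs : BEnv Γ → Bd A × Ext) →
          (∀ S γ ρ → FitEnv S Γ γ ρ → Fit S A (proj₁ (abs γ)) (f .fun ρ) × _≼_ S (f .time ρ) (proj₂ (abs γ))) →
          Fn Γ A
withAbs f a q .code  = f .code
withAbs f a q .fun   = f .fun
withAbs f a q .time  = f .time
withAbs f a q .run   = f .run
withAbs f a q .abs   = a
withAbs f a q .sound = q

-- Time of a recursion over a list of length at most `l`: the factor `⌜ 0 ⌝ ⊕ l` bounds one more
-- than the length, as `⊕` accounts for a successor, and the other factor is the cost of one round
-- including the `overhead` of the recursive call.
recShape : ℕ → (xs l p base pre post : Ext) → Ext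
recShape n xs l p base pre post =
  (xs ⊕ p ⊕ ⌜ n * 2 + 1 ⌝) ⊕ ⌜ (2 + n) * 2 ⌝ ⊕
  (⌜ 0 ⌝ ⊕ l) ⊗ᵉ (⌜ 12 + (n * 2 + n * 2) ⌝ ⊕ base ⊕ pre ⊕ post)

-- Structural recursion on a list with a parameter:
--   rec []       p = base p
--   rec (x ∷ xs) p = post (rec xs (pre x p)) x p
module Rec {Γ A P R} (base : Fn (list A ∷ P ∷ Γ) R) (pre : Fn (A ∷ list A ∷ list A ∷ P ∷ Γ) P)
           (post : Fn (R ∷ A ∷ list A ∷ list A ∷ P ∷ Γ) R) where

  n : ℕ
  n = length Γ

  body : Code (just (2 + n)) (2 + n)
  body = Case (Var zero) (base .code)
           (Let (Self (Var (suc zero) ∷ pre .code ∷ Vec.tabulate (λ i → Var (suc (suc (suc (suc i))))))) (post .code))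

  rec : Env Γ → List ⟦ A ⟧ → ⟦ P ⟧ → ⟦ R ⟧
  rec ρ []       p = base .fun ([] , p , ρ)
  rec ρ (x ∷ xs) p = post .fun (rec ρ xs (pre .fun (x , xs , x ∷ xs , p , ρ)) , x , xs , x ∷ xs , p , ρ)

  loop : Env Γ → List ⟦ A ⟧ → ⟦ P ⟧ → ℕ
  loop ρ []       p = 1 + 1 + base .time ([] , p , ρ)
  loop ρ (x ∷ xs) p =
    let ρ′ = x , xs , x ∷ xs , p , ρ ; p′ = pre .fun ρ′
    in 1 + 1 + (1 + (1 + (1 + 1 + (1 + pre .time ρ′ + (n * 2 + 1))) + ((2 + n) * 2 + loop ρ xs p′))
                  + post .time (rec ρ xs p′ , ρ′))

  run-loop : ∀ ρ xs p → Eval {just (2 + n)} body (enc (list A) xs ∷ enc P p ∷ encEnv Γ ρ) body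
                             (enc R (rec ρ xs p)) (loop ρ xs p)
  run-loop ρ []       p = Case-leaf Var (base .run {just _} body ([] , p , ρ))
  run-loop ρ (x ∷ xs) p =
    let ρ′ = x , xs , x ∷ xs , p , ρ
    in Case-node Var (Let (Self (Var ∷ pre .run {just _} body ρ′ ∷ eval-vars {just _} _ (encEnv Γ ρ) (λ _ → refl))
                                (run-loop ρ xs (pre .fun ρ′)))
                          (post .run {just _} body (_ , ρ′)))

  overhead : ℕ
  overhead = 12 + (n * 2 + n * 2)

  -- There is one round per entry and one for the end of the list. The bounds `b`, `c`, `d` are
  -- plain numbers and `J` is any predicate that survives the descent; so times can be inserted here
  -- that depend on more than bounds for the arguments.
  loop-≤ : ∀ ρ xs p (J : List ⟦ A ⟧ → ⟦ P ⟧ → Set) {b c d} →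
           (∀ {p} → J [] p → base .time ([] , p , ρ) ≤ b) →
           (∀ {x xs p} → J (x ∷ xs) p → let ρ′ = x , xs , x ∷ xs , p , ρ in
              J xs (pre .fun ρ′) × pre .time ρ′ ≤ c × post .time (rec ρ xs (pre .fun ρ′) , ρ′) ≤ d) →
           J xs p → loop ρ xs p ≤ suc (length xs) * (overhead + (b + (c + d)))
  loop-≤ ρ []       p J {b} {c} {d} nil cons j = begin
    2 + base .time ([] , p , ρ)    ≤⟨ +-mono-≤ (m≤m+n 2 (10 + (n * 2 + n * 2))) (≤-trans (nil j) (m≤m+n b (c + d))) ⟩
    overhead + (b + (c + d))       ≡⟨ sym (+-identityʳ _) ⟩
    overhead + (b + (c + d)) + 0   ∎
    where open ≤-Reasoning
  loop-≤ ρ (x ∷ xs) p J {b} {c} {d} nil cons j = let j′ , c≤ , d≤ = cons j in begin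
    loop ρ (x ∷ xs) p                        ≡⟨ lemma n (pre .time ρ′) (loop ρ xs p′) (post .time (rec ρ xs p′ , ρ′)) ⟩
    overhead + (0 + (pre .time ρ′ + post .time (rec ρ xs p′ , ρ′))) + loop ρ xs p′
      ≤⟨ +-mono-≤ (+-monoʳ-≤ overhead (+-mono-≤ (z≤n {b}) (+-mono-≤ c≤ d≤))) (loop-≤ ρ xs p′ J nil cons j′) ⟩
    overhead + (b + (c + d)) + suc (length xs) * (overhead + (b + (c + d))) ∎
    where
    open ≤-Reasoning
    ρ′ = x , xs , x ∷ xs , p , ρ
    p′ = pre .fun ρ′
    lemma : ∀ n c r d → 1 + 1 + (1 + (1 + (1 + 1 + (1 + c + (n * 2 + 1))) + ((2 + n) * 2 + r)) + d)
                        ≡ 12 + (n * 2 + n * 2) + (0 + (c + d)) + r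
    lemma = solve-∀

  module _ (xs : Fn Γ (list A)) (p : Fn Γ P) where

    recF : Fn Γ R
    recF .code          = Fix body (xs .code ∷ p .code ∷ Vec.tabulate Var)
    recF .fun ρ         = rec ρ (xs .fun ρ) (p .fun ρ)
    recF .time ρ        = 1 + (1 + xs .time ρ + (1 + p .time ρ + (n * 2 + 1))) + ((2 + n) * 2 + loop ρ (xs .fun ρ) (p .fun ρ))
    recF .run π ρ       = Fix (xs .run π ρ ∷ p .run π ρ ∷ eval-vars _ _ (λ _ → refl)) (run-loop ρ (xs .fun ρ) (p .fun ρ))
    -- The code alone yields no bound for a recursion. Each instance obtains one from an invariant
    -- by `recSound` and installs it with `withAbs`.
    recF .abs γ         = ⊤ᵇ R , nothing
    recF .sound S γ ρ _ = fit-⊤ S R _ , ≤∞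

    recExt : BEnv Γ → Bd P → Bd R → Ext
    recExt γ βP βR =
      let βs = proj₁ (xs .abs γ)
      in recShape n (proj₂ (xs .abs γ)) (proj₁ βs) (proj₂ (p .abs γ)) (proj₂ (base .abs (βs , βP , γ)))
           (proj₂ (pre .abs (proj₂ βs , βs , βs , βP , γ))) (proj₂ (post .abs (βR , proj₂ βs , βs , βs , βP , γ)))

    module _ (S : Scale) (γ : BEnv Γ) (ρ : Env Γ) (fits : FitEnv S Γ γ ρ) where

      βs : Bd (list A)
      βs = proj₁ (xs .abs γ)

      -- `J` travels down with the parameter and `Q` comes back up with the result; each has to
      -- imply the claimed bound for the value it describes.
      record Invariant (βP : Bd P) (βR : Bd R) : Set₁ where
        field
          J     : List ⟦ A ⟧ → ⟦ P ⟧ → Set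
          Q     : List ⟦ A ⟧ → ⟦ P ⟧ → ⟦ R ⟧ → Set
          J⇒fit : ∀ {xs p} → Fit S (list A) βs xs → J xs p → Fit S P βP p
          Q⇒fit : ∀ {xs p r} → Fit S (list A) βs xs → J xs p → Q xs p r → Fit S R βR r
          step  : ∀ {x xs p} → Fit S (list A) βs (x ∷ xs) → J (x ∷ xs) p → J xs (pre .fun (x , xs , x ∷ xs , p , ρ))
          nil   : ∀ {p} → J [] p → Q [] p (base .fun ([] , p , ρ))
          cons  : ∀ {x xs p r} → Fit S (list A) βs (x ∷ xs) → J (x ∷ xs) p →
                  Q xs (pre .fun (x , xs , x ∷ xs , p , ρ)) r →
                  Q (x ∷ xs) p (post .fun (r , x , xs , x ∷ xs , p , ρ))

      module _ {βP βR} (I : Invariant βP βR) where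
        open Invariant I

        fit-tail : ∀ {x xs} → Fit S (list A) βs (x ∷ xs) → Fit S (list A) βs xs
        fit-tail (m , _ ∷ qs) = ≼-mono (n≤1+n _) m , qs

        rec-Q : ∀ xs p → Fit S (list A) βs xs → J xs p → Q xs p (rec ρ xs p)
        rec-Q []       p f j = nil j
        rec-Q (x ∷ xs) p f j = cons f j (rec-Q xs _ (fit-tail f) (step f j))

        private
          eb = proj₂ (base .abs (βs , βP , γ))
          ep = proj₂ (pre .abs (proj₂ βs , βs , βs , βP , γ))
          eq = proj₂ (post .abs (βR , proj₂ βs , βs , βs , βP , γ))

          J′ : List ⟦ A ⟧ → ⟦ P ⟧ → Set
          J′ xs p = Fit S (list A) βs xs × J xs p

          nil-time : ∀ {p} → J′ [] p → _≼_ S (base .time ([] , p , ρ)) eb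
          nil-time (f , j) = proj₂ (base .sound S _ _ (f , J⇒fit f j , fits))

          cons-time : ∀ {x xs p} → J′ (x ∷ xs) p → let ρ′ = x , xs , x ∷ xs , p , ρ in
                      J′ xs (pre .fun ρ′) × _≼_ S (pre .time ρ′) ep ×
                      _≼_ S (post .time (rec ρ xs (pre .fun ρ′) , ρ′)) eq
          cons-time (f@(_ , q ∷ qs) , j) =
            let f′ = fit-tail f
                fρ = q , f′ , f , J⇒fit f j , fits
            in (f′ , step f j) , proj₂ (pre .sound S _ _ fρ) ,
               proj₂ (post .sound S _ _ (Q⇒fit f′ (step f j) (rec-Q _ _ f′ (step f j)) , fρ))

          un≤ : ∀ {t o} → _≼_ S t (just o) → t ≤ Bound.val S o
          un≤ (≤v t≤) = t≤

          val≼ : ∀ o → _≼_ S (Bound.val S o) (just o)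
          val≼ o = ≤v ≤-refl

          ≼∞ : ∀ {t} e → _≼_ S t (e ⊗ᵉ nothing)
          ≼∞ (just _) = ≤∞
          ≼∞ nothing  = ≤∞

        loop-≼ : ∀ eb ep eq xs p → (∀ {p} → J′ [] p → _≼_ S (base .time ([] , p , ρ)) eb) →
                 (∀ {x xs p} → J′ (x ∷ xs) p → let ρ′ = x , xs , x ∷ xs , p , ρ in
                  J′ xs (pre .fun ρ′) × _≼_ S (pre .time ρ′) ep ×
                  _≼_ S (post .time (rec ρ xs (pre .fun ρ′) , ρ′)) eq) →
                 J′ xs p → _≼_ S (loop ρ xs p) ((⌜ 0 ⌝ ⊕ proj₁ βs) ⊗ᵉ (⌜ overhead ⌝ ⊕ eb ⊕ ep ⊕ eq))
        loop-≼ nothing  ep       eq       xs p nt ct j = ≼∞ (⌜ 0 ⌝ ⊕ proj₁ βs)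
        loop-≼ (just _) nothing  eq       xs p nt ct j = ≼∞ (⌜ 0 ⌝ ⊕ proj₁ βs)
        loop-≼ (just _) (just _) nothing  xs p nt ct j = ≼∞ (⌜ 0 ⌝ ⊕ proj₁ βs)
        loop-≼ (just b) (just c) (just d) xs p nt ct j =
          ≼-mono (loop-≤ ρ xs p J′ (λ j → un≤ (nt j)) (λ j → let a , b , c = ct j in a , un≤ b , un≤ c) j)
            (≼-* (≼-⊕ (≼-const 0) (proj₁ (proj₁ j)))
                 (≼-+ (≼-const overhead) (≼-+ (val≼ b) (≼-+ (val≼ c) (val≼ d)))))

        recSound : J (xs .fun ρ) (p .fun ρ) →
                   Q (xs .fun ρ) (p .fun ρ) (recF .fun ρ) × _≼_ S (recF .time ρ) (recExt γ βP βR)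
        recSound j =
          let f , t = xs .sound S γ ρ fits ; _ , u = p .sound S γ ρ fits
          in rec-Q _ _ f j , ≼-⊕ (≼-⊕ t (≼-⊕ u (≼-const _))) (≼-+ (≼-const _) (loop-≼ eb ep eq _ _ nil-time cons-time (f , j)))

open Rec using (recF; recExt; recSound; Invariant) public

-- List combinators with their bounds

mapTails : {A B : Set} → (A → List A → B) → List A → List B
mapTails f []       = []
mapTails f (x ∷ xs) = f x xs ∷ mapTails f xs

mapTails-map : ∀ {A B : Set} (f : A → B) xs → mapTails (λ x _ → f x) xs ≡ List.map f xs
mapTails-map f []       = refl
mapTails-map f (x ∷ xs) = cong (f x ∷_) (mapTails-map f xs)

mapAcc : {A B P : Set} → (A → P → B × P) → P → List A → List B
mapAcc f p []       = []
mapAcc f p (x ∷ xs) = proj₁ (f x p) ∷ mapAcc f (proj₂ (f x p)) xs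

module _ {S : Scale} where
  fit-tail : ∀ {A β x xs} → Fit S (list A) β (x ∷ xs) → Fit S (list A) β xs
  fit-tail (m , _ ∷ qs) = ≼-mono (n≤1+n _) m , qs

module _ {Γ A B} (f : Fn (A ∷ list A ∷ Γ) B) (xs : Fn Γ (list A)) where
  private
    f′ : Fn (list B ∷ A ∷ list A ∷ list A ∷ bool ∷ Γ) B
    f′ = thinF [] (list B ∷ []) (thinF (A ∷ list A ∷ []) (list A ∷ bool ∷ []) f)
    base : Fn (list A ∷ bool ∷ Γ) (list B)
    base = nilF
    pre : Fn (A ∷ list A ∷ list A ∷ bool ∷ Γ) bool
    pre = v3
    post = f′ ∷ᶠ v0
    raw : Fn Γ (list B)
    raw = recF base pre post xs (boolF false)
    module _ (γ : BEnv Γ) where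
      βs = proj₁ (xs .abs γ)
      βB = proj₁ (f .abs (proj₂ βs , βs , γ))
    eq : ∀ ρ ys p → Rec.rec base pre post ρ ys p ≡ mapTails (λ y ys → f .fun (y , ys , ρ)) ys
    eq ρ []       p = refl
    eq ρ (y ∷ ys) p = cong (_ ∷_) (eq ρ ys p)

    abs′ : BEnv Γ → Bd (list A) × Ext → Bd (list B) × Ext
    abs′ γ x = h (f .abs (proj₂ (proj₁ x) , proj₁ x , γ))
      where
      n = length Γ
      h : Bd B × Ext → Bd (list B) × Ext
      h r = (proj₁ (proj₁ x) , proj₁ r) ,
            recShape n (proj₂ x) (proj₁ (proj₁ x)) ⌜ 1 ⌝ ⌜ 1 ⌝ ⌜ 1 ⌝ (proj₂ (thinᵇ (4 + n) (thinᵇ (2 + n) r)) ⊕ ⌜ 1 ⌝)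

  private
    mapTails° : Fn Γ (list B)
    mapTails° = withFun (withAbs raw
      (λ γ → abs′ γ (xs .abs γ))
      (λ S γ ρ fits →
        let (len , all) , t = recSound base pre post xs (boolF false) S γ ρ fits record
              { J     = λ _ _ → ⊤
              ; Q     = λ ys _ r → length r ≤ length ys × All (Fit S B (βB γ)) r
              ; J⇒fit = λ _ _ → tt
              ; Q⇒fit = λ (m , _) _ (l , qs) → ≼-mono l m , qs
              ; step  = λ _ _ → tt
              ; nil   = λ _ → z≤n , []
              ; cons  = λ { f@(_ , q ∷ _) _ (l , qs) → s≤s l , proj₁ (mapTailsF-sound S γ ρ fits q (fit-tail f)) ∷ qs }
              } tt
        in (≼-mono len (proj₁ (proj₁ (xs .sound S γ ρ fits))) , all) , t))
      (λ ρ → mapTails (λ y ys → f .fun (y , ys , ρ)) (xs .fun ρ))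
      (λ ρ → eq ρ (xs .fun ρ) false)
      where
      mapTailsF-sound : ∀ S γ ρ → FitEnv S Γ γ ρ → ∀ {y ys} → Fit S A (proj₂ (βs γ)) y → Fit S (list A) (βs γ) ys → _
      mapTailsF-sound S γ ρ fits q qs = f .sound S (_ , _ , γ) (_ , _ , ρ) (q , qs , fits)

  -- Defined field by field, so that the name stays folded until a field is projected. The
  -- combinators below repeat this pattern.
  mapTailsF : Fn Γ (list B)
  mapTailsF .code  = mapTails° .code
  mapTailsF .fun   = mapTails° .fun
  mapTailsF .time  = mapTails° .time
  mapTailsF .run   = mapTails° .run
  mapTailsF .abs   = mapTails° .abs
  mapTailsF .sound = mapTails° .sound

  -- For an `f` whose time is not governed by the bounds of its arguments: `stageDataF` enumerates
  -- labellings, and their number is small only because the list is a suffix of the given ordering.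
  -- The hypothesis is therefore confined to splittings of the actual list.
  mapTails-time : ∀ S ρ {l ox} (o : Ord) → _≼_ S (xs .time ρ) ox → _≼_ S (length (xs .fun ρ)) l →
                  (∀ us y ys → us ++ y ∷ ys ≡ xs .fun ρ → f .time (y , ys , ρ) ≤ Bound.val S o) →
                  _≼_ S (mapTailsF .time ρ)
                      (recShape (length Γ) ox l ⌜ 1 ⌝ ⌜ 1 ⌝ ⌜ 1 ⌝
                                (⌜ 2 * (length (A ∷ list A ∷ list A ∷ bool ∷ Γ) * 2 + 1 + length (A ∷ list A ∷ list A ∷ bool ∷ Γ) * 2) + 10 ⌝ ⊕ just o))
  mapTails-time S ρ {l} {ox} o tx len h =
    ≼-⊕ (≼-⊕ tx (≼-⊕ (≼-const 1) (≼-const _))) (≼-+ (≼-const _) (≼-mono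
      (Rec.loop-≤ base pre post ρ (xs .fun ρ) false (λ ys _ → ∃[ us ] us ++ ys ≡ xs .fun ρ)
        (λ _ → ≤-refl)
        (λ { {y} {ys} (us , eq) → (us List.∷ʳ y , trans (++-assoc us (y ∷ []) ys) eq) , ≤-refl ,
             ≤-trans (post-time (length Γ) (f .time (y , ys , ρ))) (+-monoʳ-≤ (overhead (length Γ)) (h us y ys eq)) })
        ([] , refl))
      (≼-* (≼-⊕ (≼-const 0) len) (≼-+ (≼-const (12 + (length Γ * 2 + length Γ * 2))) (≼-+ (≼-const 1) (≼-+ (≼-const 1) (≼-+ (≼-const (overhead (length Γ))) (≼-val o))))))))
    where
    overhead : ℕ → ℕ
    overhead n = 2 * ((4 + n) * 2 + 1 + (4 + n) * 2) + 10
    post-time : ∀ n t → 1 + (1 + ((4 + n) * 2 + 1) + ((4 + n) * 2 + (1 + ((2 + n) * 2 + 1) + ((2 + n) * 2 + t)))) + 1 ≤ overhead n + t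
    post-time n t = ≤-trans (m≤m+n _ 14) (≤-reflexive (lemma n t))
      where
      lemma : ∀ n t → 1 + (1 + ((4 + n) * 2 + 1) + ((4 + n) * 2 + (1 + ((2 + n) * 2 + 1) + ((2 + n) * 2 + t)))) + 1 + 14 ≡ 2 * ((4 + n) * 2 + 1 + (4 + n) * 2) + 10 + t
      lemma = solve-∀

private
  map° : ∀ {Γ A B} → Fn (A ∷ Γ) B → Fn Γ (list A) → Fn Γ (list B)
  map° {Γ} {A} f xs = withFun (mapTailsF (thinF (A ∷ []) (list A ∷ []) f) xs)
    (λ ρ → List.map (λ y → f .fun (y , ρ)) (xs .fun ρ)) (λ ρ → mapTails-map _ (xs .fun ρ))

mapF : ∀ {Γ A B} → Fn (A ∷ Γ) B → Fn Γ (list A) → Fn Γ (list B)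
mapF f xs .code  = (map° f xs) .code
mapF f xs .fun   = (map° f xs) .fun
mapF f xs .time  = (map° f xs) .time
mapF f xs .run   = (map° f xs) .run
mapF f xs .abs   = (map° f xs) .abs
mapF f xs .sound = (map° f xs) .sound

-- An inductive bound for a loop with step `F`: a guess after two applications of `F`, verified by
-- `check` and replaced by the trivial bound if it fails. Soundness thus does not depend on the
-- quality of the guess.
stable : ∀ A → (Bd A → Bd A) → Bd A → Bd A
stable A F β = once (joinᵇ A β (F β))
  where
  check : Bd A → Bd A
  check β′ = if ⊑ᵇ A β β′ ∧ ⊑ᵇ A (F β′) β′ then β′ else ⊤ᵇ A
  once : Bd A → Bd A
  once β₁ = check (widen A β₁ (joinᵇ A β₁ (F β₁)))

module _ (S : Scale) A (F : Bd A → Bd A) (β : Bd A) where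
  private
    β₁ = joinᵇ A β (F β)
    β′ = widen A β₁ (joinᵇ A β₁ (F β₁))

  fit-stable : ∀ x → Fit S A β x → Fit S A (stable A F β) x
  fit-stable x p with ⊑ᵇ A β β′ in eq₁ | ⊑ᵇ A (F β′) β′
  ... | true  | true  = fit-⊑ S A _ _ eq₁ x p
  ... | true  | false = fit-⊤ S A x
  ... | false | _     = fit-⊤ S A x

  stable-fit : ∀ x → Fit S A (F (stable A F β)) x → Fit S A (stable A F β) x
  stable-fit x p with ⊑ᵇ A β β′ | ⊑ᵇ A (F β′) β′ in eq₂
  ... | true  | true  = fit-⊑ S A _ _ eq₂ x p
  ... | true  | false = fit-⊤ S A x
  ... | false | _     = fit-⊤ S A x

module _ {Γ A P} (f : Fn (A ∷ P ∷ Γ) P) (p : Fn Γ P) (xs : Fn Γ (list A)) where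
  private
    base : Fn (list A ∷ P ∷ Γ) P
    base = v1
    pre : Fn (A ∷ list A ∷ list A ∷ P ∷ Γ) P
    pre = thinF (A ∷ []) (list A ∷ list A ∷ []) f
    post : Fn (P ∷ A ∷ list A ∷ list A ∷ P ∷ Γ) P
    post = v0
    raw = recF base pre post xs p
    module _ (γ : BEnv Γ) where
      βA = proj₂ (proj₁ (xs .abs γ))
      F : Bd P → Bd P
      F β = proj₁ (f .abs (βA , β , γ))
      βP = stable P F (proj₁ (p .abs γ))
    eq : ∀ ρ ys q → Rec.rec base pre post ρ ys q ≡ List.foldl (λ q y → f .fun (y , q , ρ)) q ys
    eq ρ []       q = refl
    eq ρ (y ∷ ys) q = eq ρ ys _

    abs′ : BEnv Γ → Bd (list A) × Ext → Bd P × Ext → Bd P × Ext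
    abs′ γ x q = once (stable P (λ β → proj₁ (f .abs (proj₂ (proj₁ x) , β , γ))) (proj₁ q))
      where
      n = length Γ
      once : Bd P → Bd P × Ext
      once β = β , recShape n (proj₂ x) (proj₁ (proj₁ x)) (proj₂ q) ⌜ 1 ⌝
                            (proj₂ (thinᵇ (2 + n) (f .abs (proj₂ (proj₁ x) , β , γ)))) ⌜ 1 ⌝

  private
    foldl° : Fn Γ P
    foldl° = withFun (withAbs raw
      (λ γ → abs′ γ (xs .abs γ) (p .abs γ))
      (λ S γ ρ fits → recSound base pre post xs p S γ ρ fits record
        { J     = λ _ q → Fit S P (βP γ) q
        ; Q     = λ _ _ r → Fit S P (βP γ) r
        ; J⇒fit = λ _ j → j
        ; Q⇒fit = λ _ _ q → q
        ; step  = λ { (_ , q ∷ _) j → stable-fit S P (F γ) _ _ (proj₁ (f .sound S (_ , _ , γ) (_ , _ , ρ) (q , j , fits))) }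
        ; nil   = λ j → j
        ; cons  = λ _ _ q → q
        } (fit-stable S P (F γ) _ _ (proj₁ (p .sound S γ ρ fits)))))
      (λ ρ → List.foldl (λ q y → f .fun (y , q , ρ)) (p .fun ρ) (xs .fun ρ))
      (λ ρ → eq ρ (xs .fun ρ) (p .fun ρ))

  foldlF : Fn Γ P
  foldlF .code  = foldl° .code
  foldlF .fun   = foldl° .fun
  foldlF .time  = foldl° .time
  foldlF .run   = foldl° .run
  foldlF .abs   = foldl° .abs
  foldlF .sound = foldl° .sound

module _ {Γ A B P} (f : Fn (A ∷ P ∷ Γ) (B ⊗ P)) (p : Fn Γ P) (xs : Fn Γ (list A)) where
  private
    base : Fn (list A ∷ P ∷ Γ) (list B)
    base = nilF
    f′ : Fn (A ∷ list A ∷ list A ∷ P ∷ Γ) (B ⊗ P)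
    f′ = thinF (A ∷ []) (list A ∷ list A ∷ []) f
    pre : Fn (A ∷ list A ∷ list A ∷ P ∷ Γ) P
    pre = splitF f′ v1
    post : Fn (list B ∷ A ∷ list A ∷ list A ∷ P ∷ Γ) (list B)
    post = splitF (thinF [] (list B ∷ []) f′) v0 ∷ᶠ v0
    raw = recF base pre post xs p
    module _ (γ : BEnv Γ) where
      βs = proj₁ (xs .abs γ)
      F : Bd P → Bd P
      F β = proj₂ (proj₁ (f .abs (proj₂ βs , β , γ)))
      βP = stable P F (proj₁ (p .abs γ))
      βB = proj₁ (proj₁ (f .abs (proj₂ βs , βP , γ)))
    eq : ∀ ρ ys q → Rec.rec base pre post ρ ys q ≡ mapAcc (λ y q → f .fun (y , q , ρ)) q ys
    eq ρ []       q = refl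
    eq ρ (y ∷ ys) q = cong (_ ∷_) (eq ρ ys _)

    abs′ : BEnv Γ → Bd (list A) × Ext → Bd P × Ext → Bd (list B) × Ext
    abs′ γ x q = once (f .abs (proj₂ (proj₁ x) , stable P (λ β → proj₂ (proj₁ (f .abs (proj₂ (proj₁ x) , β , γ)))) (proj₁ q) , γ))
      where
      n = length Γ
      once : Bd (B ⊗ P) × Ext → Bd (list B) × Ext
      once r = (proj₁ (proj₁ x) , proj₁ (proj₁ r)) ,
               recShape n (proj₂ x) (proj₁ (proj₁ x)) (proj₂ q) ⌜ 1 ⌝ (proj₂ (thinᵇ (2 + n) r) ⊕ ⌜ 1 ⌝)
                        ((proj₂ (thinᵇ (4 + n) (thinᵇ (2 + n) r)) ⊕ ⌜ 1 ⌝) ⊕ ⌜ 1 ⌝)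

  private
    mapAcc° : Fn Γ (list B)
    mapAcc° = withFun (withAbs raw
      (λ γ → abs′ γ (xs .abs γ) (p .abs γ))
      (λ S γ ρ fits →
        let fit : ∀ {y q} → Fit S A (proj₂ (βs γ)) y → Fit S P (βP γ) q → _
            fit q j = proj₁ (f .sound S (proj₂ (βs γ) , βP γ , γ) (_ , _ , ρ) (q , j , fits))
            (len , all) , t = recSound base pre post xs p S γ ρ fits record
              { J     = λ _ q → Fit S P (βP γ) q
              ; Q     = λ ys _ r → length r ≤ length ys × All (Fit S B (βB γ)) r
              ; J⇒fit = λ _ j → j
              ; Q⇒fit = λ (m , _) _ (l , qs) → ≼-mono l m , qs
              ; step  = λ { (_ , q ∷ _) j → stable-fit S P (F γ) _ _ (proj₂ (fit q j)) }
              ; nil   = λ _ → z≤n , []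
              ; cons  = λ { (_ , q ∷ _) j (l , qs) → s≤s l , proj₁ (fit q j) ∷ qs }
              } (fit-stable S P (F γ) _ _ (proj₁ (p .sound S γ ρ fits)))
        in (≼-mono len (proj₁ (proj₁ (xs .sound S γ ρ fits))) , all) , t))
      (λ ρ → mapAcc (λ y q → f .fun (y , q , ρ)) (p .fun ρ) (xs .fun ρ))
      (λ ρ → eq ρ (xs .fun ρ) (p .fun ρ))

  mapAccF : Fn Γ (list B)
  mapAccF .code  = mapAcc° .code
  mapAccF .fun   = mapAcc° .fun
  mapAccF .time  = mapAcc° .time
  mapAccF .run   = mapAcc° .run
  mapAccF .abs   = mapAcc° .abs
  mapAccF .sound = mapAcc° .sound

appendᵇ : ∀ A → ℕ → Bd (list A) × Ext → Bd (list A) × Ext → Bd (list A) × Ext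
appendᵇ A n x y =
  (proj₁ (proj₁ x) ⊕ proj₁ (proj₁ y) , joinᵇ A (proj₂ (proj₁ x)) (proj₂ (proj₁ y))) ,
  recShape n (proj₂ x) (proj₁ (proj₁ x)) (proj₂ y) ⌜ 1 ⌝ ⌜ 1 ⌝ (⌜ 1 ⌝ ⊕ ⌜ 1 ⌝)

module _ {Γ A} (xs ys : Fn Γ (list A)) where
  private
    base : Fn (list A ∷ list A ∷ Γ) (list A)
    base = v1
    pre : Fn (A ∷ list A ∷ list A ∷ list A ∷ Γ) (list A)
    pre = v3
    post : Fn (list A ∷ A ∷ list A ∷ list A ∷ list A ∷ Γ) (list A)
    post = v1 ∷ᶠ v0
    raw = recF base pre post xs ys
    eq : ∀ ρ ys q → Rec.rec base pre post ρ ys q ≡ ys ++ q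
    eq ρ []       q = refl
    eq ρ (y ∷ ys) q = cong (y ∷_) (eq ρ ys q)

  private
    append° : Fn Γ (list A)
    append° = withFun (withAbs raw
      (λ γ → appendᵇ A (length Γ) (xs .abs γ) (ys .abs γ))
      (λ S γ ρ fits →
        let (l , fx) = proj₁ (xs .sound S γ ρ fits)
            (m , fy) = proj₁ (ys .sound S γ ρ fits)
            _ , t = recSound base pre post xs ys S γ ρ fits record
              { J     = λ _ _ → ⊤
              ; Q     = λ _ _ _ → ⊤
              ; J⇒fit = λ _ _ → fit-⊤ S (list A) _
              ; Q⇒fit = λ _ _ _ → fit-⊤ S (list A) _
              ; step  = λ _ _ → tt
              ; nil   = λ _ → tt
              ; cons  = λ _ _ _ → tt
              } tt
        in subst (Fit S (list A) _) (sym (eq ρ (xs .fun ρ) (ys .fun ρ)))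
                 (subst (λ n → _≼_ S n _) (sym (length-++ (xs .fun ρ))) (≼-+ l m) ,
                  All++.++⁺ (mapL (fit-joinˡ S A _ _) fx) (mapL (fit-joinʳ S A _ _) fy)) , t))
      (λ ρ → xs .fun ρ ++ ys .fun ρ)
      (λ ρ → eq ρ (xs .fun ρ) (ys .fun ρ))

  appendF : Fn Γ (list A)
  appendF .code  = append° .code
  appendF .fun   = append° .fun
  appendF .time  = append° .time
  appendF .run   = append° .run
  appendF .abs   = append° .abs
  appendF .sound = append° .sound

module _ {Γ A B} (f : Fn (A ∷ Γ) (list B)) (xs : Fn Γ (list A)) where
  private
    base : Fn (list A ∷ bool ∷ Γ) (list B)
    base = nilF
    pre : Fn (A ∷ list A ∷ list A ∷ bool ∷ Γ) bool
    pre = v3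
    post : Fn (list B ∷ A ∷ list A ∷ list A ∷ bool ∷ Γ) (list B)
    post = appendF (thinF [] (list B ∷ []) (thinF (A ∷ []) (list A ∷ list A ∷ bool ∷ []) f)) v0
    raw = recF base pre post xs (boolF false)
    module _ (γ : BEnv Γ) where
      βs = proj₁ (xs .abs γ)
      β′ = proj₁ (f .abs (proj₂ βs , γ))
    eq : ∀ ρ ys p → Rec.rec base pre post ρ ys p ≡ List.concatMap (λ y → f .fun (y , ρ)) ys
    eq ρ []       p = refl
    eq ρ (y ∷ ys) p = cong (f .fun (y , ρ) ++_) (eq ρ ys p)

    -- The bound `e` for the pieces is quantified because the bound from `abs` may be infinite; then
    -- no such `e` exists and the condition is void. Otherwise `≼-∑` instantiates it with the value
    -- of the bound.
    Fits : ∀ S → BEnv Γ → List ⟦ A ⟧ → List ⟦ B ⟧ → Set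
    Fits S γ ys r = (∀ e → (∀ {x} → _≼_ S x (proj₁ (β′ γ)) → x ≤ e) → length r ≤ length ys * e) ×
                    All (Fit S B (proj₂ (β′ γ))) r

    ≼-∑ : ∀ {S l m n} {e : Ext} → _≼_ S l e →
              (∀ d → (∀ {x} → _≼_ S x m → x ≤ d) → n ≤ l * d) → _≼_ S n (e ⊗ᵉ m)
    ≼-∑ {m = nothing} {e = just _}  p h = ≤∞
    ≼-∑ {m = nothing} {e = nothing} p h = ≤∞
    ≼-∑ {S} {m = just m} p h = ≼-mono (h _ (λ { (≤v q) → q })) (≼-* p (≤v ≤-refl))

  concatMapᵇ : BEnv Γ → Bd (list A) × Ext → Bd (list B) × Ext
  concatMapᵇ γ x = once (f .abs (proj₂ (proj₁ x) , γ))
    where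
    n = length Γ
    once : Bd (list B) × Ext → Bd (list B) × Ext
    once r = (proj₁ (proj₁ x) ⊗ᵉ proj₁ (proj₁ r) , proj₂ (proj₁ r)) ,
             recShape n (proj₂ x) (proj₁ (proj₁ x)) ⌜ 1 ⌝ ⌜ 1 ⌝ ⌜ 1 ⌝
                      (proj₂ (appendᵇ B (5 + n) (thinᵇ (4 + n) (thinᵇ (1 + n) r)) (⊤ᵇ (list B) , ⌜ 1 ⌝)))

  private
    concatMap° : Fn Γ (list B)
    concatMap° = withFun (withAbs raw
      (λ γ → concatMapᵇ γ (xs .abs γ))
      (λ S γ ρ fits →
        let (h , all) , t = recSound base pre post xs (boolF false) S γ ρ fits record
              { J     = λ _ _ → ⊤
              ; Q     = λ ys _ r → Fits S γ ys r
              ; J⇒fit = λ _ _ → tt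
              ; Q⇒fit = λ _ _ _ → fit-⊤ S (list B) _
              ; step  = λ _ _ → tt
              ; nil   = λ _ → (λ _ _ → z≤n) , []
              ; cons  = λ { {r = r} (_ , q ∷ _) _ (h , qs) →
                  let (l , fs) = proj₁ (f .sound S (_ , γ) (_ , ρ) (q , fits))
                  in (λ e b → subst (_≤ _) (sym (length-++ (f .fun _) {r})) (+-mono-≤ (b l) (h e b))) , All++.++⁺ fs qs }
              } tt
        in (≼-∑ (proj₁ (proj₁ (xs .sound S γ ρ fits))) h , all) , t))
      (λ ρ → List.concatMap (λ y → f .fun (y , ρ)) (xs .fun ρ))
      (λ ρ → eq ρ (xs .fun ρ) false)

  concatMapF : Fn Γ (list B)
  concatMapF .code  = concatMap° .code
  concatMapF .fun   = concatMap° .fun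
  concatMapF .time  = concatMap° .time
  concatMapF .run   = concatMap° .run
  concatMapF .abs   = concatMap° .abs
  concatMapF .sound = concatMap° .sound

private
  not° : ∀ {Γ} → Fn Γ bool → Fn Γ bool
  not° f = withFun (ifF f (boolF false) (boolF true)) (λ ρ → not (f .fun ρ)) (λ ρ → lemma (f .fun ρ))
    where
    lemma : ∀ b → (if b then false else true) ≡ not b
    lemma true  = refl
    lemma false = refl

notF : ∀ {Γ} → Fn Γ bool → Fn Γ bool
notF f .code  = (not° f) .code
notF f .fun   = (not° f) .fun
notF f .time  = (not° f) .time
notF f .run   = (not° f) .run
notF f .abs   = (not° f) .abs
notF f .sound = (not° f) .sound

infixr 6 _∧ᶠ_
private
  and° : ∀ {Γ} → Fn Γ bool → Fn Γ bool → Fn Γ bool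
  and° f g = withFun (ifF f g (boolF false)) (λ ρ → f .fun ρ ∧ g .fun ρ) (λ ρ → lemma (f .fun ρ))
    where
    lemma : ∀ b {c} → (if b then c else false) ≡ b ∧ c
    lemma true  = refl
    lemma false = refl

_∧ᶠ_ : ∀ {Γ} → Fn Γ bool → Fn Γ bool → Fn Γ bool
(f ∧ᶠ g) .code  = (and° f g) .code
(f ∧ᶠ g) .fun   = (and° f g) .fun
(f ∧ᶠ g) .time  = (and° f g) .time
(f ∧ᶠ g) .run   = (and° f g) .run
(f ∧ᶠ g) .abs   = (and° f g) .abs
(f ∧ᶠ g) .sound = (and° f g) .sound

private
  null° : ∀ {Γ A} → Fn Γ (list A) → Fn Γ bool
  null° xs = withFun (caseL xs (boolF true) (boolF false)) (λ ρ → List.null (xs .fun ρ)) (λ ρ → lemma (xs .fun ρ))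
    where
    lemma : ∀ {A : Set} (xs : List A) → elimL xs true (λ _ _ → false) ≡ List.null xs
    lemma []       = refl
    lemma (_ ∷ _)  = refl

nullF : ∀ {Γ A} → Fn Γ (list A) → Fn Γ bool
nullF xs .code  = (null° xs) .code
nullF xs .fun   = (null° xs) .fun
nullF xs .time  = (null° xs) .time
nullF xs .run   = (null° xs) .run
nullF xs .abs   = (null° xs) .abs
nullF xs .sound = (null° xs) .sound

module _ {Γ A} (f : Fn (A ∷ Γ) bool) (xs : Fn Γ (list A)) where
  private
    f′ : Fn (A ∷ Γ) (list A)
    f′ = ifF f (v0 ∷ᶠ nilF) nilF
    raw : Fn Γ (list A)
    raw = concatMapF f′ xs
    eq : ∀ ρ ys → List.concatMap (λ y → f′ .fun (y , ρ)) ys ≡ List.filterᵇ (λ y → f .fun (y , ρ)) ys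
    eq ρ []       = refl
    eq ρ (y ∷ ys) with f .fun (y , ρ)
    ... | true  = cong (y ∷_) (eq ρ ys)
    ... | false = eq ρ ys

    all-filterᵇ : ∀ {P : ⟦ A ⟧ → Set} g {ys} → All P ys → All P (List.filterᵇ g ys)
    all-filterᵇ g []                 = []
    all-filterᵇ g {y ∷ _} (p ∷ ps) with g y
    ... | true  = p ∷ all-filterᵇ g ps
    ... | false = all-filterᵇ g ps

    length-filterᵇ : ∀ (g : ⟦ A ⟧ → Bool) ys → length (List.filterᵇ g ys) ≤ length ys
    length-filterᵇ g []       = z≤n
    length-filterᵇ g (y ∷ ys) with g y
    ... | true  = s≤s (length-filterᵇ g ys)
    ... | false = m≤n⇒m≤1+n (length-filterᵇ g ys)

    abs′ : BEnv Γ → Bd (list A) × Ext → Bd (list A) × Ext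
    abs′ γ x = proj₁ x , proj₂ (concatMapᵇ f′ xs γ x)

  private
    filter° : Fn Γ (list A)
    filter° = withAbs (withFun raw (λ ρ → List.filterᵇ (λ y → f .fun (y , ρ)) (xs .fun ρ)) (λ ρ → eq ρ (xs .fun ρ)))
      (λ γ → abs′ γ (xs .abs γ))
      (λ S γ ρ fits →
        let l , qs = proj₁ (xs .sound S γ ρ fits)
        in (≼-mono (length-filterᵇ _ (xs .fun ρ)) l , all-filterᵇ _ qs) , proj₂ (raw .sound S γ ρ fits))

  filterF : Fn Γ (list A)
  filterF .code  = filter° .code
  filterF .fun   = filter° .fun
  filterF .time  = filter° .time
  filterF .run   = filter° .run
  filterF .abs   = filter° .abs
  filterF .sound = filter° .sound

  private
    any° : Fn Γ bool
    any° = withFun (notF (nullF filterF)) (λ ρ → any (λ y → f .fun (y , ρ)) (xs .fun ρ)) (λ ρ → lemma ρ (xs .fun ρ))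
      where
      lemma : ∀ ρ ys → not (List.null (List.filterᵇ (λ y → f .fun (y , ρ)) ys)) ≡ any (λ y → f .fun (y , ρ)) ys
      lemma ρ []       = refl
      lemma ρ (y ∷ ys) with f .fun (y , ρ)
      ... | true  = refl
      ... | false = lemma ρ ys

  anyF : Fn Γ bool
  anyF .code  = any° .code
  anyF .fun   = any° .fun
  anyF .time  = any° .time
  anyF .run   = any° .run
  anyF .abs   = any° .abs
  anyF .sound = any° .sound

private
  all° : ∀ {Γ A} → Fn (A ∷ Γ) bool → Fn Γ (list A) → Fn Γ bool
  all° f xs = withFun (nullF (filterF (notF f) xs)) (λ ρ → all (λ y → f .fun (y , ρ)) (xs .fun ρ)) (λ ρ → lemma ρ (xs .fun ρ))
    where
    lemma : ∀ ρ ys → List.null (List.filterᵇ (λ y → not (f .fun (y , ρ))) ys) ≡ all (λ y → f .fun (y , ρ)) ys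
    lemma ρ []       = refl
    lemma ρ (y ∷ ys) with f .fun (y , ρ)
    ... | true  = lemma ρ ys
    ... | false = refl

allF : ∀ {Γ A} → Fn (A ∷ Γ) bool → Fn Γ (list A) → Fn Γ bool
allF f xs .code  = (all° f xs) .code
allF f xs .fun   = (all° f xs) .fun
allF f xs .time  = (all° f xs) .time
allF f xs .run   = (all° f xs) .run
allF f xs .abs   = (all° f xs) .abs
allF f xs .sound = (all° f xs) .sound

module _ {Γ A B C} (f : Fn (A ∷ B ∷ Γ) C) (xs : Fn Γ (list A)) (ys : Fn Γ (list B)) where
  private
    base : Fn (list A ∷ list B ∷ Γ) (list C)
    base = nilF
    pre : Fn (A ∷ list A ∷ list A ∷ list B ∷ Γ) (list B)
    pre = caseL v3 nilF v1
    f′ : Fn (A ∷ B ∷ list B ∷ list C ∷ A ∷ list A ∷ list A ∷ list B ∷ Γ) C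
    f′ = thinF (A ∷ B ∷ []) (list B ∷ list C ∷ A ∷ list A ∷ list A ∷ list B ∷ []) f
    post : Fn (list C ∷ A ∷ list A ∷ list A ∷ list B ∷ Γ) (list C)
    post = caseL v4 nilF (letF v3 f′ ∷ᶠ v2)
    raw = recF base pre post xs ys
    module _ (γ : BEnv Γ) where
      βx = proj₁ (xs .abs γ)
      βy = proj₁ (ys .abs γ)
      βC = proj₁ (f .abs (proj₂ βx , proj₂ βy , γ))
    eq : ∀ ρ us ws → Rec.rec base pre post ρ us ws ≡ List.zipWith (λ u w → f .fun (u , w , ρ)) us ws
    eq ρ []       ws       = refl
    eq ρ (u ∷ us) []       = refl
    eq ρ (u ∷ us) (w ∷ ws) = cong (_ ∷_) (eq ρ us ws)

    abs′ : BEnv Γ → Bd (list A) × Ext → Bd (list B) × Ext → Bd (list C) × Ext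
    abs′ γ x y = once (f .abs (proj₂ (proj₁ x) , proj₂ (proj₁ y) , γ))
      where
      n = length Γ
      once : Bd C × Ext → Bd (list C) × Ext
      once r = (proj₁ (proj₁ x) , proj₁ r) ,
               recShape n (proj₂ x) (proj₁ (proj₁ x)) (proj₂ y) ⌜ 1 ⌝ (⌜ 1 ⌝ ⊕ join ⌜ 1 ⌝ ⌜ 1 ⌝)
                        (⌜ 1 ⌝ ⊕ join ((⌜ 1 ⌝ ⊕ proj₂ (thinᵇ (2 + n) r)) ⊕ ⌜ 1 ⌝) ⌜ 1 ⌝)

  private
    zipWith° : Fn Γ (list C)
    zipWith° = withFun (withAbs raw
      (λ γ → abs′ γ (xs .abs γ) (ys .abs γ))
      (λ S γ ρ fits →
        let (len , all) , t = recSound base pre post xs ys S γ ρ fits record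
              { J     = λ _ q → Fit S (list B) (βy γ) q
              ; Q     = λ us _ r → length r ≤ length us × All (Fit S C (βC γ)) r
              ; J⇒fit = λ _ j → j
              ; Q⇒fit = λ (m , _) _ (l , qs) → ≼-mono l m , qs
              ; step  = λ { {p = []} _ j → ≼-mono z≤n (proj₁ j) , [] ; {p = _ ∷ _} _ j → fit-tail j }
              ; nil   = λ _ → z≤n , []
              ; cons  = λ { {p = []}    _ _ _ → z≤n , []
                          ; {p = _ ∷ _} (_ , u ∷ _) (_ , w ∷ _) (l , qs) →
                            s≤s l , proj₁ (f .sound S (_ , _ , γ) (_ , _ , ρ) (u , w , fits)) ∷ qs }
              } (proj₁ (ys .sound S γ ρ fits))
        in (≼-mono len (proj₁ (proj₁ (xs .sound S γ ρ fits))) , all) , t))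
      (λ ρ → List.zipWith (λ u w → f .fun (u , w , ρ)) (xs .fun ρ) (ys .fun ρ))
      (λ ρ → eq ρ (xs .fun ρ) (ys .fun ρ))

  zipWithF : Fn Γ (list C)
  zipWithF .code  = zipWith° .code
  zipWithF .fun   = zipWith° .fun
  zipWithF .time  = zipWith° .time
  zipWithF .run   = zipWith° .run
  zipWithF .abs   = zipWith° .abs
  zipWithF .sound = zipWith° .sound

-- Tries with lists of bits as keys

valueT : {A : Set} → Trie A → Maybe A
valueT empty        = nothing
valueT (node v _ _) = v

childT : {A : Set} → Bool → Trie A → Trie A
childT b     empty        = empty
childT true  (node _ _ r) = r
childT false (node _ l _) = l

lookupT : {A : Set} → List Bool → Trie A → Maybe A
lookupT []       t = valueT t
lookupT (b ∷ bs) t = lookupT bs (childT b t)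

insertT : {A : Set} → List Bool → A → Trie A → Trie A
insertT []           x t = node (just x) (childT false t) (childT true t)
insertT (true  ∷ bs) x t = node (valueT t) (childT false t) (insertT bs x (childT true t))
insertT (false ∷ bs) x t = node (valueT t) (insertT bs x (childT false t)) (childT true t)

lookup-insert : ∀ {A : Set} bs {x : A} t → lookupT bs (insertT bs x t) ≡ just x
lookup-insert []           t = refl
lookup-insert (true  ∷ bs) t = lookup-insert bs _
lookup-insert (false ∷ bs) t = lookup-insert bs _

lookup-insert-≢ : ∀ {A : Set} bs cs {x : A} t → bs ≢ cs → lookupT cs (insertT bs x t) ≡ lookupT cs t
lookup-insert-≢ []           []           t ne = ⊥-elim (ne refl)
lookup-insert-≢ []           (true  ∷ cs) t ne = refl
lookup-insert-≢ []           (false ∷ cs) t ne = refl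
lookup-insert-≢ (true  ∷ bs) []           t ne = refl
lookup-insert-≢ (true  ∷ bs) (true  ∷ cs) t ne = lookup-insert-≢ bs cs _ (ne ∘ cong (true ∷_))
lookup-insert-≢ (true  ∷ bs) (false ∷ cs) t ne = refl
lookup-insert-≢ (false ∷ bs) []           t ne = refl
lookup-insert-≢ (false ∷ bs) (true  ∷ cs) t ne = refl
lookup-insert-≢ (false ∷ bs) (false ∷ cs) t ne = lookup-insert-≢ bs cs _ (ne ∘ cong (false ∷_))

lookup-empty : ∀ {A : Set} bs → lookupT {A} bs empty ≡ nothing
lookup-empty []       = refl
lookup-empty (b ∷ bs) = lookup-empty bs

all-valueT : ∀ {A : Set} {P : A → Set} {t} → AllT P t → All? P (valueT t)
all-valueT empty        = nothing
all-valueT (node v _ _) = v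

all-childT : ∀ {A : Set} {P : A → Set} b {t} → AllT P t → AllT P (childT b t)
all-childT b     empty        = empty
all-childT true  (node _ _ r) = r
all-childT false (node _ l _) = l

module _ {A : Ty} where
  private
    value° : Fn (trie A ∷ []) (maybe A)
    value° = withFun (caseT v0 nothingF v0) (λ (t , _) → valueT t) λ { (empty , _) → refl ; (node _ _ _ , _) → refl }

  valueF : Fn (trie A ∷ []) (maybe A)
  valueF .code  = value° .code
  valueF .fun   = value° .fun
  valueF .time  = value° .time
  valueF .run   = value° .run
  valueF .abs   = value° .abs
  valueF .sound = value° .sound

  private
    child° : Fn (bool ∷ trie A ∷ []) (trie A)
    child° = withFun (caseT v1 emptyF (splitF v1 (ifF v4 v1 v0))) (λ (b , t , _) → childT b t)
      λ { (b , empty , _) → refl ; (true , node _ _ _ , _) → refl ; (false , node _ _ _ , _) → refl }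

  childF : Fn (bool ∷ trie A ∷ []) (trie A)
  childF .code  = child° .code
  childF .fun   = child° .fun
  childF .time  = child° .time
  childF .run   = child° .run
  childF .abs   = child° .abs
  childF .sound = child° .sound

  private
    base : Fn (list bool ∷ trie A ∷ list bool ∷ trie A ∷ []) (maybe A)
    base = callF valueF (v1 ∷ [])
    pre : Fn (bool ∷ list bool ∷ list bool ∷ trie A ∷ list bool ∷ trie A ∷ []) (trie A)
    pre = callF childF (v0 ∷ v3 ∷ [])
    post : Fn (maybe A ∷ bool ∷ list bool ∷ list bool ∷ trie A ∷ list bool ∷ trie A ∷ []) (maybe A)
    post = v0
    eq : ∀ ρ bs t → Rec.rec base pre post ρ bs t ≡ lookupT bs t
    eq ρ []       t = refl
    eq ρ (b ∷ bs) t = eq ρ bs _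

  private
    lookup° : Fn (list bool ∷ trie A ∷ []) (maybe A)
    lookup° = withFun (withAbs (recF base pre post v0 v1)
      (λ γ → proj₁ (proj₂ γ) , recExt base pre post v0 v1 γ (proj₁ (proj₂ γ)) (proj₁ (proj₂ γ)))
      (λ S γ ρ fits → recSound base pre post v0 v1 S γ ρ fits record
        { J     = λ _ t → Fit S (trie A) (proj₁ (proj₂ γ)) t
        ; Q     = λ _ _ r → Fit S (maybe A) (proj₁ (proj₂ γ)) r
        ; J⇒fit = λ _ j → j
        ; Q⇒fit = λ _ _ q → q
        ; step  = λ {x} _ j → all-childT x j
        ; nil   = λ j → all-valueT j
        ; cons  = λ _ _ q → q
        } (proj₁ (proj₂ fits))))
      (λ (bs , t , _) → lookupT bs t) (λ ρ@(bs , t , _) → eq ρ bs t)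

  lookupF : Fn (list bool ∷ trie A ∷ []) (maybe A)
  lookupF .code  = lookup° .code
  lookupF .fun   = lookup° .fun
  lookupF .time  = lookup° .time
  lookupF .run   = lookup° .run
  lookupF .abs   = lookup° .abs
  lookupF .sound = lookup° .sound

  private
    Γ′ : Ctx
    Γ′ = list bool ∷ A ∷ trie A ∷ []
    base′ : Fn (list bool ∷ trie A ∷ Γ′) (trie A)
    base′ = nodeF (justF v3) (callF childF (boolF false ∷ v1 ∷ [])) (callF childF (boolF true ∷ v1 ∷ []))
    pre′ : Fn (bool ∷ list bool ∷ list bool ∷ trie A ∷ Γ′) (trie A)
    pre′ = callF childF (v0 ∷ v3 ∷ [])
    post′ : Fn (trie A ∷ bool ∷ list bool ∷ list bool ∷ trie A ∷ Γ′) (trie A)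
    post′ = ifF v1 (nodeF (callF valueF (v4 ∷ [])) (callF childF (boolF false ∷ v4 ∷ [])) v0)
                   (nodeF (callF valueF (v4 ∷ [])) v0 (callF childF (boolF true ∷ v4 ∷ [])))
    eq′ : ∀ ρ bs t → Rec.rec base′ pre′ post′ ρ bs t ≡ insertT bs (proj₁ (proj₂ ρ)) t
    eq′ ρ []           t = refl
    eq′ ρ (true  ∷ bs) t = cong (node (valueT t) (childT false t)) (eq′ ρ bs (childT true t))
    eq′ ρ (false ∷ bs) t = cong (λ l → node (valueT t) l (childT true t)) (eq′ ρ bs (childT false t))

    β : BEnv Γ′ → Bd A
    β (_ , βx , βt , _) = joinᵇ A βx βt

  private
    insert° : Fn (list bool ∷ A ∷ trie A ∷ []) (trie A)
    insert° = withFun (withAbs (recF base′ pre′ post′ v0 v2)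
      (λ γ → β γ , recExt base′ pre′ post′ v0 v2 γ (β γ) (β γ))
      (λ S γ ρ fits@(_ , fx , ft , _) → recSound base′ pre′ post′ v0 v2 S γ ρ fits record
        { J     = λ _ t → Fit S (trie A) (β γ) t
        ; Q     = λ _ _ r → Fit S (trie A) (β γ) r
        ; J⇒fit = λ _ j → j
        ; Q⇒fit = λ _ _ q → q
        ; step  = λ {x} _ j → all-childT x j
        ; nil   = λ j → node (just (fit-joinˡ S A _ _ _ fx)) (all-childT false j) (all-childT true j)
        ; cons  = λ { {true}  _ j q → node (all-valueT j) (all-childT false j) q
                    ; {false} _ j q → node (all-valueT j) q (all-childT true j) }
        } (mapT (fit-joinʳ S A _ _) ft)))
      (λ (bs , x , t , _) → insertT bs x t) (λ ρ@(bs , x , t , _) → eq′ ρ bs t)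

  insertF : Fn (list bool ∷ A ∷ trie A ∷ []) (trie A)
  insertF .code  = insert° .code
  insertF .fun   = insert° .fun
  insertF .time  = insert° .time
  insertF .run   = insert° .run
  insertF .abs   = insert° .abs
  insertF .sound = insert° .sound

-- Arithmetic and comparison in binary notation with digits 1 and 2

sucL : List Bool → List Bool
sucL []           = true ∷ []
sucL (true  ∷ ds) = false ∷ ds
sucL (false ∷ ds) = true ∷ sucL ds

undigits-sucL : ∀ ds → undigits (sucL ds) ≡ suc (undigits ds)
undigits-sucL []           = refl
undigits-sucL (true  ∷ ds) = *-suc 2 (undigits ds)
undigits-sucL (false ∷ ds) = cong (λ n → suc (2 * n)) (undigits-sucL ds)

length-sucL : ∀ ds → length (sucL ds) ≤ suc (length ds)
length-sucL []           = ≤-refl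
length-sucL (true  ∷ ds) = n≤1+n _
length-sucL (false ∷ ds) = s≤s (length-sucL ds)

module _ where
  private
    base : Fn (list bool ∷ bool ∷ list bool ∷ []) (list bool)
    base = boolF true ∷ᶠ nilF
    pre : Fn (bool ∷ list bool ∷ list bool ∷ bool ∷ list bool ∷ []) bool
    pre = v3
    post : Fn (list bool ∷ bool ∷ list bool ∷ list bool ∷ bool ∷ list bool ∷ []) (list bool)
    post = ifF v1 (boolF false ∷ᶠ v2) (boolF true ∷ᶠ v0)
    eq : ∀ ρ ds p → Rec.rec base pre post ρ ds p ≡ sucL ds
    eq ρ []           p = refl
    eq ρ (true  ∷ ds) p = refl
    eq ρ (false ∷ ds) p = cong (true ∷_) (eq ρ ds p)

  private
    sucL° : Fn (list bool ∷ []) (list bool)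
    sucL° = withFun (withAbs (recF base pre post v0 (boolF false))
      (λ γ → (⌜ 0 ⌝ ⊕ proj₁ (proj₁ γ) , tt) , recExt base pre post v0 (boolF false) γ tt (⊤ᵇ (list bool)))
      (λ S γ ρ fits →
        let _ , t = recSound base pre post v0 (boolF false) S γ ρ fits record
              { J     = λ _ _ → ⊤
              ; Q     = λ _ _ _ → ⊤
              ; J⇒fit = λ _ _ → tt
              ; Q⇒fit = λ _ _ _ → fit-⊤ S (list bool) _
              ; step  = λ _ _ → tt
              ; nil   = λ _ → tt
              ; cons  = λ _ _ _ → tt
              } tt
        in subst (Fit S (list bool) _) (sym (eq ρ (proj₁ ρ) false))
             (≼-mono (length-sucL (proj₁ ρ)) (≼-⊕ (≼-const 0) (proj₁ (proj₁ fits))) , fit-⊤s S bool _) , t))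
      (λ (ds , _) → sucL ds) (λ ρ@(ds , _) → eq ρ ds false)

  sucLF : Fn (list bool ∷ []) (list bool)
  sucLF .code  = sucL° .code
  sucLF .fun   = sucL° .fun
  sucLF .time  = sucL° .time
  sucLF .run   = sucL° .run
  sucLF .abs   = sucL° .abs
  sucLF .sound = sucL° .sound

-- Two digits sum to 2, 3 or 4, that is to a digit 2 without carry, or to 1 or 2 with carry 1. The
-- carry is added afterwards by `sucL`, which takes quadratic time in all but is simple to verify.
addL : List Bool → List Bool → List Bool
addL []           ys           = ys
addL (x ∷ xs)     []           = x ∷ xs
addL (true  ∷ xs) (true  ∷ ys) = false ∷ addL xs ys
addL (true  ∷ xs) (false ∷ ys) = true ∷ sucL (addL xs ys)
addL (false ∷ xs) (true  ∷ ys) = true ∷ sucL (addL xs ys)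
addL (false ∷ xs) (false ∷ ys) = false ∷ sucL (addL xs ys)

undigits-addL : ∀ xs ys → undigits (addL xs ys) ≡ undigits xs + undigits ys
undigits-addL []           ys           = refl
undigits-addL (x ∷ xs)     []           = sym (+-identityʳ _)
undigits-addL (true  ∷ xs) (true  ∷ ys) rewrite undigits-addL xs ys = lemma (undigits xs) (undigits ys)
  where
  lemma : ∀ x y → 2 * suc (x + y) ≡ suc (2 * x) + suc (2 * y)
  lemma = solve-∀
undigits-addL (true  ∷ xs) (false ∷ ys) rewrite undigits-sucL (addL xs ys) | undigits-addL xs ys = lemma (undigits xs) (undigits ys)
  where
  lemma : ∀ x y → suc (2 * suc (x + y)) ≡ suc (2 * x) + 2 * suc y
  lemma = solve-∀
undigits-addL (false ∷ xs) (true  ∷ ys) rewrite undigits-sucL (addL xs ys) | undigits-addL xs ys = lemma (undigits xs) (undigits ys)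
  where
  lemma : ∀ x y → suc (2 * suc (x + y)) ≡ 2 * suc x + suc (2 * y)
  lemma = solve-∀
undigits-addL (false ∷ xs) (false ∷ ys) rewrite undigits-sucL (addL xs ys) | undigits-addL xs ys = lemma (undigits xs) (undigits ys)
  where
  lemma : ∀ x y → 2 * suc (suc (x + y)) ≡ 2 * suc x + 2 * suc y
  lemma = solve-∀

-- Each digit of `xs` may lengthen the result twice, by its own digit and by a carry.
length-addL : ∀ xs ys → length (addL xs ys) ≤ 2 * length xs + length ys
length-addL []           ys           = ≤-refl
length-addL (x ∷ xs)     []           = s≤s (≤-trans (≤-trans (m≤m+n _ _) (+-monoʳ-≤ (length xs) (n≤1+n _))) (m≤m+n _ _))
length-addL (x ∷ xs)     (y ∷ ys)     = ≤-trans (lemma x y) (≤-reflexive (lemma′ (length xs) (length ys)))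
  where
  r = addL xs ys
  lemma′ : ∀ a b → suc (suc (2 * a + suc b)) ≡ 2 * suc a + suc b
  lemma′ = solve-∀
  r≤ : length r ≤ 2 * length xs + suc (length ys)
  r≤ = ≤-trans (length-addL xs ys) (+-monoʳ-≤ (2 * length xs) (n≤1+n _))
  lemma : ∀ x y → length (addL (x ∷ xs) (y ∷ ys)) ≤ suc (suc (2 * length xs + suc (length ys)))
  lemma true  true  = s≤s (m≤n⇒m≤1+n r≤)
  lemma true  false = s≤s (≤-trans (length-sucL r) (s≤s r≤))
  lemma false true  = s≤s (≤-trans (length-sucL r) (s≤s r≤))
  lemma false false = s≤s (≤-trans (length-sucL r) (s≤s r≤))

module _ where
  private
    Γ : Ctx
    Γ = list bool ∷ list bool ∷ []
    base : Fn (list bool ∷ list bool ∷ Γ) (list bool)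
    base = v1
    pre : Fn (bool ∷ list bool ∷ list bool ∷ list bool ∷ Γ) (list bool)
    pre = caseL v3 nilF v1
    sucR : Fn (bool ∷ list bool ∷ list bool ∷ bool ∷ list bool ∷ list bool ∷ list bool ∷ Γ) (list bool)
    sucR = callF sucLF (v2 ∷ [])
    post : Fn (list bool ∷ bool ∷ list bool ∷ list bool ∷ list bool ∷ Γ) (list bool)
    post = caseL v4 v3 (ifF v3 (ifF v0 (boolF false ∷ᶠ v2) (boolF true ∷ᶠ sucR))
                               (ifF v0 (boolF true ∷ᶠ sucR) (boolF false ∷ᶠ sucR)))
    eq : ∀ ρ xs ys → Rec.rec base pre post ρ xs ys ≡ addL xs ys
    eq ρ []           ys           = refl
    eq ρ (x ∷ xs)     []           = refl
    eq ρ (true  ∷ xs) (true  ∷ ys) = cong (false ∷_) (eq ρ xs ys)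
    eq ρ (true  ∷ xs) (false ∷ ys) = cong (λ r → true ∷ sucL r) (eq ρ xs ys)
    eq ρ (false ∷ xs) (true  ∷ ys) = cong (λ r → true ∷ sucL r) (eq ρ xs ys)
    eq ρ (false ∷ xs) (false ∷ ys) = cong (λ r → false ∷ sucL r) (eq ρ xs ys)

    ext : BEnv Γ → Ext
    ext ((l , _) , (m , _) , _) = ⌜ 2 ⌝ ⊗ᵉ l ⊕ m

    step-≤ : ∀ (x : Bool) (xs ys : List Bool) → 2 * length xs + length (elimL {Bool} {List Bool} ys [] (λ _ ys → ys)) ≤ 2 * suc (length xs) + length ys
    step-≤ x xs []       = +-monoˡ-≤ 0 (*-monoʳ-≤ 2 (n≤1+n (length xs)))
    step-≤ x xs (y ∷ ys) = +-mono-≤ (*-monoʳ-≤ 2 (n≤1+n (length xs))) (n≤1+n (length ys))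

  private
    addL° : Fn Γ (list bool)
    addL° = withFun (withAbs (recF base pre post v0 v1)
      (λ γ → (ext γ , tt) , recExt base pre post v0 v1 γ (⊤ᵇ (list bool)) (ext γ , tt))
      (λ S γ ρ fits →
        let fit : ∀ {n} → n ≤ 2 * length (proj₁ ρ) + length (proj₁ (proj₂ ρ)) → _≼_ S n (ext γ)
            fit n≤ = ≼-mono n≤ (≼-+ (≼-* (≼-const 2) (proj₁ (proj₁ fits))) (proj₁ (proj₁ (proj₂ fits))))
            q , t = recSound base pre post v0 v1 S γ ρ fits record
              { J     = λ xs ys → 2 * length xs + length ys ≤ 2 * length (proj₁ ρ) + length (proj₁ (proj₂ ρ))
              ; Q     = λ xs ys r → r ≡ addL xs ys
              ; J⇒fit = λ _ _ → fit-⊤ S (list bool) _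
              ; Q⇒fit = λ { {xs} {ys} _ j refl → fit (≤-trans (length-addL xs ys) j) , fit-⊤s S bool _ }
              ; step  = λ { {x} {xs} {ys} _ j → ≤-trans {2 * length xs + _} {2 * suc (length xs) + length ys} (step-≤ x xs ys) j }
              ; nil   = λ _ → refl
              ; cons  = λ { {true}  {xs} {[]}        _ _ refl → refl
                          ; {false} {xs} {[]}        _ _ refl → refl
                          ; {true}  {xs} {true ∷ _}  _ _ refl → refl
                          ; {true}  {xs} {false ∷ _} _ _ refl → refl
                          ; {false} {xs} {true ∷ _}  _ _ refl → refl
                          ; {false} {xs} {false ∷ _} _ _ refl → refl }
              } ≤-refl
        in (fit (≤-trans (≤-reflexive (cong length q)) (length-addL (proj₁ ρ) (proj₁ (proj₂ ρ)))) , fit-⊤s S bool _) , t))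
      (λ (xs , ys , _) → addL xs ys) (λ ρ@(xs , ys , _) → eq ρ xs ys)

  addLF : Fn Γ (list bool)
  addLF .code  = addL° .code
  addLF .fun   = addL° .fun
  addLF .time  = addL° .time
  addLF .run   = addL° .run
  addLF .abs   = addL° .abs
  addLF .sound = addL° .sound

infixl 6 _+ᶠ_
private
  add° : ∀ {Γ} → Fn Γ nat → Fn Γ nat → Fn Γ nat
  add° f g = withFun (undigitsF (callF addLF (digitsF f ∷ digitsF g ∷ []))) (λ ρ → f .fun ρ + g .fun ρ)
    λ ρ → trans (undigits-addL (digits (f .fun ρ)) (digits (g .fun ρ))) (cong₂ _+_ (undigits-digits (f .fun ρ)) (undigits-digits (g .fun ρ)))

_+ᶠ_ : ∀ {Γ} → Fn Γ nat → Fn Γ nat → Fn Γ nat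
(f +ᶠ g) .code  = (add° f g) .code
(f +ᶠ g) .fun   = (add° f g) .fun
(f +ᶠ g) .time  = (add° f g) .time
(f +ᶠ g) .run   = (add° f g) .run
(f +ᶠ g) .abs   = (add° f g) .abs
(f +ᶠ g) .sound = (add° f g) .sound

-- The extremes among lists of a given length are all ones, with value 2^l - 1, and all twos, with
-- value 2^(l+1) - 2.
undigits-bounds : ∀ ds → 2 ^ length ds ≤ suc (undigits ds) × 2 + undigits ds ≤ 2 ^ suc (length ds)
undigits-bounds []           = s≤s z≤n , ≤-refl
undigits-bounds (true ∷ ds)  = let lo , hi = undigits-bounds ds in
  ≤-trans (*-monoʳ-≤ 2 lo) (≤-reflexive (*-suc 2 (undigits ds))) ,
  ≤-trans (≤-trans (n≤1+n _) (≤-reflexive (lemma (undigits ds)))) (*-monoʳ-≤ 2 hi)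
  where
  lemma : ∀ n → 4 + 2 * n ≡ 2 * (2 + n)
  lemma = solve-∀
undigits-bounds (false ∷ ds) = let lo , hi = undigits-bounds ds in
  ≤-trans (*-monoʳ-≤ 2 lo) (n≤1+n _) ,
  ≤-trans (≤-reflexive (lemma (undigits ds))) (*-monoʳ-≤ 2 hi)
  where
  lemma : ∀ n → 2 + 2 * suc n ≡ 2 * (2 + n)
  lemma = solve-∀

bits-≤ : ∀ n d → suc n ≤ 2 ^ d → bits n ≤ d
bits-≤ n d n< = ≮⇒≥ λ d< → <-irrefl refl (<-≤-trans (^-monoʳ-< 2 (s≤s (s≤s z≤n)) d<)
  (≤-trans (proj₁ (undigits-bounds (digits n))) (≤-trans (s≤s (≤-reflexive (undigits-digits n))) n<)))

2^bits : ∀ n → suc n ≤ 2 ^ suc (bits n)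
2^bits n = subst (λ m → suc m ≤ 2 ^ suc (bits n)) (undigits-digits n) (≤-trans (n≤1+n _) (proj₂ (undigits-bounds (digits n))))

bits-mono : ∀ {m n} → m ≤ n → bits m ≤ suc (bits n)
bits-mono {m} {n} m≤n = bits-≤ m (suc (bits n)) (≤-trans (s≤s m≤n) (2^bits n))

suc-*-≤ : ∀ m n → suc (m * n) ≤ suc m * suc n
suc-*-≤ m n = s≤s (≤-trans (*-monoʳ-≤ m (n≤1+n n)) (m≤n+m _ n))

suc-+-≤ : ∀ m n → suc (m + n) ≤ suc m * suc n
suc-+-≤ m n = s≤s (≤-trans (≤-reflexive (+-comm m n)) (+-monoʳ-≤ n (≤-trans (≤-reflexive (sym (*-identityʳ m))) (*-monoʳ-≤ m (s≤s z≤n)))))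

bits-* : ∀ m n d → suc m ≤ 2 ^ d → bits (m * n) ≤ d + suc (bits n)
bits-* m n d m< = bits-≤ (m * n) (d + suc (bits n))
  (≤-trans (suc-*-≤ m n) (≤-trans (*-mono-≤ m< (2^bits n)) (≤-reflexive (sym (^-distribˡ-+-* 2 d (suc (bits n)))))))

module _ where
  private
    Γ : Ctx
    Γ = nat ∷ nat ∷ []
    base : Fn (list bool ∷ bool ∷ Γ) nat
    base = natF 0
    pre : Fn (bool ∷ list bool ∷ list bool ∷ bool ∷ Γ) bool
    pre = v3
    post : Fn (nat ∷ bool ∷ list bool ∷ list bool ∷ bool ∷ Γ) nat
    post = ifF v1 (v6 +ᶠ (v0 +ᶠ v0)) ((v6 +ᶠ v6) +ᶠ (v0 +ᶠ v0))
    xs : Fn Γ (list bool)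
    xs = digitsF v0
    lemma-true : ∀ m y → y + (m * y + m * y) ≡ suc (2 * m) * y
    lemma-true = solve-∀
    lemma-false : ∀ m y → (y + y) + (m * y + m * y) ≡ (2 * suc m) * y
    lemma-false = solve-∀
    eq : ∀ ρ ds p → Rec.rec base pre post ρ ds p ≡ undigits ds * proj₁ (proj₂ ρ)
    eq ρ []           p = refl
    eq ρ (true  ∷ ds) p = trans (cong₂ (λ a b → proj₁ (proj₂ ρ) + (a + b)) (eq ρ ds p) (eq ρ ds p)) (lemma-true (undigits ds) _)
    eq ρ (false ∷ ds) p = trans (cong₂ (λ a b → (proj₁ (proj₂ ρ) + proj₁ (proj₂ ρ)) + (a + b)) (eq ρ ds p) (eq ρ ds p)) (lemma-false (undigits ds) _)
    ext : BEnv Γ → Ext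
    ext (l , m , _) = (⌜ 0 ⌝ ⊕ l) ⊕ (⌜ 0 ⌝ ⊕ m)

    fit : ∀ S γ (ρ : Env Γ) → FitEnv S Γ γ ρ → ∀ ds → _≼_ S (length ds) (proj₁ γ) →
          _≼_ S (bits (undigits ds * proj₁ (proj₂ ρ))) (ext γ)
    fit S γ ρ fits ds l = ≼-mono (bits-* (undigits ds) (proj₁ (proj₂ ρ)) (suc (length ds)) (≤-trans (n≤1+n _) (proj₂ (undigits-bounds ds))))
                                 (≼-+ (≼-⊕ (≼-const 0) l) (≼-⊕ (≼-const 0) (proj₁ (proj₂ fits))))

  private
    mul° : Fn Γ nat
    mul° = withFun (withAbs (recF base pre post xs (boolF false))
      (λ γ → ext γ , recExt base pre post xs (boolF false) γ tt (ext γ))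
      (λ S γ ρ fits →
        let q , t = recSound base pre post xs (boolF false) S γ ρ fits record
              { J     = λ _ _ → ⊤
              ; Q     = λ ds _ r → r ≡ undigits ds * proj₁ (proj₂ ρ)
              ; J⇒fit = λ _ _ → tt
              ; Q⇒fit = λ { {ds} (l , _) _ refl → fit S γ ρ fits ds l }
              ; step  = λ _ _ → tt
              ; nil   = λ _ → refl
              ; cons  = λ { {true}  {ds} _ _ refl → lemma-true (undigits ds) _
                          ; {false} {ds} _ _ refl → lemma-false (undigits ds) _ }
              } tt
        in subst (λ n → _≼_ S (bits n) (ext γ)) (sym q) (fit S γ ρ fits (digits (proj₁ ρ)) (proj₁ fits)) , t))
      (λ (x , y , _) → x * y)
      (λ ρ@(x , y , _) → trans (eq ρ (digits x) false) (cong (_* y) (undigits-digits x)))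

  mulF : Fn Γ nat
  mulF .code  = mul° .code
  mulF .fun   = mul° .fun
  mulF .time  = mul° .time
  mulF .run   = mul° .run
  mulF .abs   = mul° .abs
  mulF .sound = mul° .sound

infixl 7 _*ᶠ_
_*ᶠ_ : ∀ {Γ} → Fn Γ nat → Fn Γ nat → Fn Γ nat
f *ᶠ g = callF mulF (f ∷ g ∷ [])

module _ {Γ} (xs : Fn Γ (list nat)) where
  private
    base : Fn (list nat ∷ bool ∷ Γ) nat
    base = natF 0
    pre : Fn (nat ∷ list nat ∷ list nat ∷ bool ∷ Γ) bool
    pre = v3
    post : Fn (nat ∷ nat ∷ list nat ∷ list nat ∷ bool ∷ Γ) nat
    post = v1 +ᶠ v0
    eq : ∀ ρ ys p → Rec.rec base pre post ρ ys p ≡ sum ys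
    eq ρ []       p = refl
    eq ρ (y ∷ ys) p = cong (y +_) (eq ρ ys p)
    ext : BEnv Γ → Ext
    ext γ = let l , m = proj₁ (xs .abs γ) in l ⊗ᵉ (⌜ 0 ⌝ ⊕ m)

    sum-< : ∀ d ys → All (λ y → bits y ≤ d) ys → suc (sum ys) ≤ 2 ^ (length ys * suc d)
    sum-< d []       []       = ≤-refl
    sum-< d (y ∷ ys) (b ∷ bs) = ≤-trans (suc-+-≤ y (sum ys))
      (≤-trans (*-mono-≤ (≤-trans (2^bits y) (^-monoʳ-≤ 2 (s≤s b))) (sum-< d ys bs))
               (≤-reflexive (sym (^-distribˡ-+-* 2 (suc d) (length ys * suc d)))))

    fit : ∀ {S l m} ys → _≼_ S (length ys) l → All (λ y → _≼_ S (bits y) m) ys → _≼_ S (bits (sum ys)) (l ⊗ᵉ (⌜ 0 ⌝ ⊕ m))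
    fit {l = just _}  {nothing} ys p q = ≤∞
    fit {l = nothing} {nothing} ys p q = ≤∞
    fit {S} {l} {just m} ys p q =
      ≼-mono (bits-≤ (sum ys) _ (sum-< (Bound.val S m) ys (mapL (λ { _ (≤v b) → b }) q))) (≼-* p (≼-⊕ (≼-const 0) (≤v ≤-refl)))

    abs′ : BEnv Γ → Bd (list nat) × Ext → Ext × Ext
    abs′ γ x = once (proj₁ (proj₁ x) ⊗ᵉ (⌜ 0 ⌝ ⊕ proj₂ (proj₁ x)))
      where
      once : Ext → Ext × Ext
      once e = e , recShape (length Γ) (proj₂ x) (proj₁ (proj₁ x)) ⌜ 1 ⌝ ⌜ 1 ⌝ ⌜ 1 ⌝
                            (proj₂ (post .abs (e , proj₂ (proj₁ x) , proj₁ x , proj₁ x , tt , γ)))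

  private
    sum° : Fn Γ nat
    sum° = withFun (withAbs (recF base pre post xs (boolF false))
      (λ γ → abs′ γ (xs .abs γ))
      (λ S γ ρ fits →
        let q , t = recSound base pre post xs (boolF false) S γ ρ fits record
              { J     = λ _ _ → ⊤
              ; Q     = λ ys _ r → r ≡ sum ys
              ; J⇒fit = λ _ _ → tt
              ; Q⇒fit = λ { {ys} (l , bs) _ refl → fit ys l bs }
              ; step  = λ _ _ → tt
              ; nil   = λ _ → refl
              ; cons  = λ { {x} _ _ refl → refl }
              } tt
            l , bs = proj₁ (xs .sound S γ ρ fits)
        in subst (λ n → _≼_ S (bits n) (ext γ)) (sym q) (fit (xs .fun ρ) l bs) , t))
      (λ ρ → sum (xs .fun ρ)) (λ ρ → eq ρ (xs .fun ρ) false)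

  sumF : Fn Γ nat
  sumF .code  = sum° .code
  sumF .fun   = sum° .fun
  sumF .time  = sum° .time
  sumF .run   = sum° .run
  sumF .abs   = sum° .abs
  sumF .sound = sum° .sound

carry : Bool → Bool → Bool → Bool
carry true  x y = if x then y else true
carry false x y = if x then false else y

-- Decides `s + xs ≤ ys` from the least significant end, with `s` counted as 1 or 0: a pair of
-- digits influences the rest only through the question whether the comparison of the higher digits
-- has to be strict.
leL : List Bool → Bool → List Bool → Bool
leL []       s ys       = if s then not (List.null ys) else true
leL (x ∷ xs) s []       = false
leL (x ∷ xs) s (y ∷ ys) = leL xs (carry s x y) ys

module _ where
  private
    -- In contrast to `2 *`, this exposes two constructors at once, so that `_<ᵇ_` computes through
    -- it.
    double : ℕ → ℕ
    double zero    = 0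
    double (suc n) = suc (suc (double n))

    2*≡double : ∀ n → 2 * n ≡ double n
    2*≡double zero    = refl
    2*≡double (suc n) = trans (*-suc 2 n) (cong (λ m → suc (suc m)) (2*≡double n))

    value : List Bool → ℕ
    value []           = 0
    value (true ∷ ds)  = suc (double (value ds))
    value (false ∷ ds) = suc (suc (double (value ds)))

    undigits≡value : ∀ ds → undigits ds ≡ value ds
    undigits≡value []           = refl
    undigits≡value (true ∷ ds)  = cong suc (trans (2*≡double _) (cong double (undigits≡value ds)))
    undigits≡value (false ∷ ds) = trans (2*≡double _) (cong (λ n → suc (suc (double n))) (undigits≡value ds))

    even-even : ∀ m n → (double m <ᵇ suc (double n)) ≡ (m <ᵇ suc n)
    even-even zero    n       = refl
    even-even (suc m) zero    = refl
    even-even (suc m) (suc n) = even-even m n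

    even-odd : ∀ m n → (double m <ᵇ suc (suc (double n))) ≡ (m <ᵇ suc n)
    even-odd zero    n       = refl
    even-odd (suc m) zero    = refl
    even-odd (suc m) (suc n) = even-odd m n

    odd-even : ∀ m n → (double m <ᵇ double n) ≡ (m <ᵇ n)
    odd-even zero    zero    = refl
    odd-even zero    (suc n) = refl
    odd-even (suc m) zero    = refl
    odd-even (suc m) (suc n) = odd-even m n

    suc-even : ∀ m n → (suc (double m) <ᵇ double n) ≡ (m <ᵇ n)
    suc-even zero    zero    = refl
    suc-even zero    (suc n) = refl
    suc-even (suc m) zero    = refl
    suc-even (suc m) (suc n) = suc-even m n

    leL-value : ∀ xs s ys → leL xs s ys ≡ ((if s then 1 else 0) + value xs <ᵇ suc (value ys))
    leL-value []           true  []           = refl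
    leL-value []           true  (true ∷ ys)  = refl
    leL-value []           true  (false ∷ ys) = refl
    leL-value []           false ys           = refl
    leL-value (true ∷ xs)  true  []           = refl
    leL-value (false ∷ xs) true  []           = refl
    leL-value (true ∷ xs)  false []           = refl
    leL-value (false ∷ xs) false []           = refl
    leL-value (true ∷ xs)  false (true ∷ ys)  = trans (leL-value xs false ys) (sym (even-even (value xs) (value ys)))
    leL-value (true ∷ xs)  false (false ∷ ys) = trans (leL-value xs false ys) (sym (even-odd (value xs) (value ys)))
    leL-value (false ∷ xs) false (true ∷ ys)  = trans (leL-value xs true ys) (sym (odd-even (value xs) (value ys)))
    leL-value (false ∷ xs) false (false ∷ ys) = trans (leL-value xs false ys) (sym (even-even (value xs) (value ys)))
    leL-value (true ∷ xs)  true  (true ∷ ys)  = trans (leL-value xs true ys) (sym (odd-even (value xs) (value ys)))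
    leL-value (true ∷ xs)  true  (false ∷ ys) = trans (leL-value xs false ys) (sym (even-even (value xs) (value ys)))
    leL-value (false ∷ xs) true  (true ∷ ys)  = trans (leL-value xs true ys) (sym (suc-even (value xs) (value ys)))
    leL-value (false ∷ xs) true  (false ∷ ys) = trans (leL-value xs true ys) (sym (odd-even (value xs) (value ys)))

  leL-correct : ∀ xs s ys → leL xs s ys ≡ ((if s then 1 else 0) + undigits xs <ᵇ suc (undigits ys))
  leL-correct xs s ys rewrite undigits≡value xs | undigits≡value ys = leL-value xs s ys

module _ where
  private
    Γ : Ctx
    Γ = list bool ∷ list bool ∷ []
    P : Ty
    P = bool ⊗ list bool
    base : Fn (list bool ∷ P ∷ Γ) bool
    base = splitF v1 (ifF v0 (notF (nullF v1)) (boolF true))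
    pre : Fn (bool ∷ list bool ∷ list bool ∷ P ∷ Γ) P
    pre = splitF v3 (caseL v1 (v0 ,ᶠ nilF) (ifF v2 (ifF v4 v0 (boolF true)) (ifF v4 (boolF false) v0) ,ᶠ v1))
    post : Fn (bool ∷ bool ∷ list bool ∷ list bool ∷ P ∷ Γ) bool
    post = splitF v4 (caseL v1 (boolF false) v4)
    p : Fn Γ P
    p = boolF false ,ᶠ v1
    eq : ∀ ρ xs s ys → Rec.rec base pre post ρ xs (s , ys) ≡ leL xs s ys
    eq ρ []       s     ys       = refl
    eq ρ (x ∷ xs) s     []       = refl
    eq ρ (x ∷ xs) true  (y ∷ ys) = eq ρ xs (carry true x y) ys
    eq ρ (x ∷ xs) false (y ∷ ys) = eq ρ xs (carry false x y) ys

    private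
      leL° : Fn Γ bool
      leL° = withAbs (recF base pre post v0 p)
        (λ γ → tt , recExt base pre post v0 p γ (⊤ᵇ P) tt)
        (λ S γ ρ fits → recSound base pre post v0 p S γ ρ fits record
          { J     = λ _ _ → ⊤
          ; Q     = λ _ _ _ → ⊤
          ; J⇒fit = λ {_} {q} _ _ → fit-⊤ S P q
          ; Q⇒fit = λ _ _ _ → tt
          ; step  = λ _ _ → tt
          ; nil   = λ _ → tt
          ; cons  = λ _ _ _ → tt
          } tt)

    leLF : Fn Γ bool
    leLF .code  = leL° .code
    leLF .fun   = leL° .fun
    leLF .time  = leL° .time
    leLF .run   = leL° .run
    leLF .abs   = leL° .abs
    leLF .sound = leL° .sound

    <ᵇ-suc : ∀ m n → (m <ᵇ suc n) ≡ (m ≤ᵇ n)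
    <ᵇ-suc zero    n = refl
    <ᵇ-suc (suc m) n = refl

    antisym : ∀ m n → (m ≤ᵇ n) ∧ (n ≤ᵇ m) ≡ (m ≡ᵇ n)
    antisym zero    zero    = refl
    antisym zero    (suc n) = refl
    antisym (suc m) zero    = refl
    antisym (suc m) (suc n) rewrite <ᵇ-suc m n | <ᵇ-suc n m = antisym m n

  infix 5 _≤ᶠ_ _≡ᶠ_
  private
    le° : ∀ {Δ} → Fn Δ nat → Fn Δ nat → Fn Δ bool
    le° f g = withFun (callF leLF (digitsF f ∷ digitsF g ∷ [])) (λ ρ → f .fun ρ ≤ᵇ g .fun ρ)
      λ ρ → let x = f .fun ρ ; y = g .fun ρ in
        trans (eq (digits x , digits y , tt) (digits x) false (digits y))
        (trans (leL-correct (digits x) false (digits y))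
        (trans (cong₂ (λ m n → m <ᵇ suc n) (undigits-digits x) (undigits-digits y)) (<ᵇ-suc x y)))

  _≤ᶠ_ : ∀ {Δ} → Fn Δ nat → Fn Δ nat → Fn Δ bool
  (f ≤ᶠ g) .code  = (le° f g) .code
  (f ≤ᶠ g) .fun   = (le° f g) .fun
  (f ≤ᶠ g) .time  = (le° f g) .time
  (f ≤ᶠ g) .run   = (le° f g) .run
  (f ≤ᶠ g) .abs   = (le° f g) .abs
  (f ≤ᶠ g) .sound = (le° f g) .sound

  leqF : Fn (nat ∷ nat ∷ []) bool
  leqF = v0 ≤ᶠ v1

  private
    eq° : Fn (nat ∷ nat ∷ []) bool
    eq° = withFun (callF leqF (v0 ∷ v1 ∷ []) ∧ᶠ callF leqF (v1 ∷ v0 ∷ [])) (λ (x , y , _) → x ≡ᵇ y) λ (x , y , _) → antisym x y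

  eqF : Fn (nat ∷ nat ∷ []) bool
  eqF .code  = eq° .code
  eqF .fun   = eq° .fun
  eqF .time  = eq° .time
  eqF .run   = eq° .run
  eqF .abs   = eq° .abs
  eqF .sound = eq° .sound

  _≡ᶠ_ : ∀ {Δ} → Fn Δ nat → Fn Δ nat → Fn Δ bool
  f ≡ᶠ g = callF eqF (f ∷ g ∷ [])

module _ where
  private
    -- Recursion is available on lists only. To count up to a number, a list of that length is
    -- needed first, which is obtained by doubling along the digits.
    units : List Bool → List Bool
    units []           = []
    units (true  ∷ ds) = true ∷ (units ds ++ units ds)
    units (false ∷ ds) = true ∷ true ∷ (units ds ++ units ds)

    double-odd : ∀ n → 1 + (n + n) ≡ 1 + 2 * n
    double-odd n = cong (λ m → 1 + (n + m)) (sym (+-identityʳ n))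

    double-even : ∀ n → 2 + (n + n) ≡ 2 * (1 + n)
    double-even n = cong (1 +_) (trans (sym (+-suc n n)) (cong (λ m → n + (1 + m)) (sym (+-identityʳ n))))

    length-units : ∀ ds → length (units ds) ≡ undigits ds
    length-units []           = refl
    length-units (true  ∷ ds) rewrite length-++ (units ds) {units ds} | length-units ds = double-odd (undigits ds)
    length-units (false ∷ ds) rewrite length-++ (units ds) {units ds} | length-units ds = double-even (undigits ds)

    count : ℕ → List Bool → List ℕ
    count i []       = []
    count i (_ ∷ us) = i ∷ count (i + 1) us

    count-upTo : ∀ i us {f} → (∀ j → f j ≡ i + j) → count i us ≡ List.applyUpTo f (length us)
    count-upTo i []       eq = refl
    count-upTo i (_ ∷ us) eq = cong₂ _∷_ (trans (sym (+-identityʳ i)) (sym (eq 0)))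
      (count-upTo (i + 1) us (λ j → trans (eq (suc j)) (sym (+-assoc i 1 j))))

    module Units where
      base : Fn (list bool ∷ bool ∷ nat ∷ []) (list bool)
      base = nilF
      pre : Fn (bool ∷ list bool ∷ list bool ∷ bool ∷ nat ∷ []) bool
      pre = v3
      post : Fn (list bool ∷ bool ∷ list bool ∷ list bool ∷ bool ∷ nat ∷ []) (list bool)
      post = letF (appendF v0 v0) (ifF v2 (boolF true ∷ᶠ v0) (boolF true ∷ᶠ boolF true ∷ᶠ v0))
      xs : Fn (nat ∷ []) (list bool)
      xs = digitsF v0
      eq : ∀ ρ ds p → Rec.rec base pre post ρ ds p ≡ units ds
      eq ρ []           p = refl
      eq ρ (true  ∷ ds) p = cong (λ r → true ∷ (r ++ r)) (eq ρ ds p)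
      eq ρ (false ∷ ds) p = cong (λ r → true ∷ true ∷ (r ++ r)) (eq ρ ds p)
      F : Fn (nat ∷ []) (list bool)
      F = recF base pre post xs (boolF false)
      bound : Ext → Ext → Ext
      bound b e = recExt base pre post xs (boolF false) (b , tt) tt (e , tt)
      len : ∀ ρ → length (F .fun ρ) ≡ proj₁ ρ
      len ρ = trans (cong length (eq ρ (digits (proj₁ ρ)) false)) (trans (length-units (digits (proj₁ ρ))) (undigits-digits (proj₁ ρ)))
      sound′ : ∀ S n {b e} → _≼_ S (bits n) b → _≼_ S n e → _≼_ S (F .time (n , tt)) (bound b e)
      sound′ S n {b} {e} nb ne = proj₂ (recSound base pre post xs (boolF false) S (b , tt) (n , tt) (nb , tt) record
        { J     = λ ds _ → undigits ds ≤ n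
        ; Q     = λ ds _ r → length r ≡ undigits ds
        ; J⇒fit = λ _ _ → tt
        ; Q⇒fit = λ { _ j q → ≼-mono (≤-trans (≤-reflexive q) j) ne , fit-⊤s S bool _ }
        ; step  = λ { {true}  {ds} _ j → ≤-trans (≤-trans (m≤m+n _ _) (n≤1+n _)) j
                    ; {false} {ds} _ j → ≤-trans (≤-trans (n≤1+n _) (m≤m+n _ _)) j }
        ; nil   = λ _ → refl
        ; cons  = λ { {true}  {ds} {_} {r} _ _ q → trans (cong (1 +_) (length-++ r)) (trans (cong (λ n → 1 + (n + n)) q) (double-odd (undigits ds)))
                    ; {false} {ds} {_} {r} _ _ q → trans (cong (2 +_) (length-++ r)) (trans (cong (λ n → 2 + (n + n)) q) (double-even (undigits ds))) }
        } (≤-reflexive (undigits-digits n)))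

    module Count where
      Γ : Ctx
      Γ = list bool ∷ nat ∷ []
      base : Fn (list bool ∷ nat ∷ Γ) (list nat)
      base = nilF
      pre : Fn (bool ∷ list bool ∷ list bool ∷ nat ∷ Γ) nat
      pre = v3 +ᶠ natF 1
      post : Fn (list nat ∷ bool ∷ list bool ∷ list bool ∷ nat ∷ Γ) (list nat)
      post = v4 ∷ᶠ v0
      xs : Fn Γ (list bool)
      xs = v0
      eq : ∀ ρ us i → Rec.rec base pre post ρ us i ≡ count i us
      eq ρ []       i = refl
      eq ρ (_ ∷ us) i = cong (i ∷_) (eq ρ us (i + 1))
      F : Fn Γ (list nat)
      F = recF base pre post xs (natF 0)
      bound : Ext → Ext → Ext
      bound b e = recExt base pre post xs (natF 0) ((e , tt) , b , tt) (⌜ 0 ⌝ ⊕ b) (e , ⌜ 0 ⌝ ⊕ b)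
      sound′ : ∀ S us n {b e} → length us ≡ n → _≼_ S (bits n) b → _≼_ S n e →
               Fit S (list nat) (e , ⌜ 0 ⌝ ⊕ b) (F .fun (us , n , tt)) × _≼_ S (F .time (us , n , tt)) (bound b e)
      sound′ S us n {b} {e} len nb ne =
        let fe , t = recSound base pre post xs (natF 0) S ((e , tt) , b , tt) (us , n , tt)
              ((≼-mono (≤-reflexive len) ne , fit-⊤s S bool _) , nb , tt) record
                { J     = λ us i → i + length us ≤ n
                ; Q     = λ us _ r → length r ≡ length us × All (λ x → _≼_ S (bits x) (⌜ 0 ⌝ ⊕ b)) r
                ; J⇒fit = λ {us} {i} _ j → small (≤-trans (m≤m+n i _) j)
                ; Q⇒fit = λ { (l , _) _ (q , qs) → ≼-mono (≤-reflexive q) l , qs }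
                ; step  = λ { {_} {us} {i} _ j → ≤-trans (≤-reflexive (+-assoc i 1 (length us))) j }
                ; nil   = λ _ → refl , []
                ; cons  = λ { {_} {us} {i} _ j (q , qs) → cong suc q , small (≤-trans (m≤m+n i _) j) ∷ qs }
                } (≤-reflexive len)
        in (≼-mono (≤-reflexive (trans (proj₁ fe) len)) ne , proj₂ fe) , t
        where
        small : ∀ {i} → i ≤ n → _≼_ S (bits i) (⌜ 0 ⌝ ⊕ b)
        small i≤n = ≼-mono (bits-mono i≤n) (≼-⊕ (≼-const 0) nb)

  private
    range° : Fn (nat ∷ []) (list nat)
    range° = withFun (letF Units.F Count.F) (λ (n , _) → List.upTo n) λ ρ@(n , _) →
      trans (Count.eq _ (Units.F .fun ρ) 0) (trans (count-upTo 0 (Units.F .fun ρ) (λ _ → refl)) (cong List.upTo (Units.len ρ)))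

  rangeF : Fn (nat ∷ []) (list nat)
  rangeF .code  = range° .code
  rangeF .fun   = range° .fun
  rangeF .time  = range° .time
  rangeF .run   = range° .run
  rangeF .abs   = range° .abs
  rangeF .sound = range° .sound

  rangeExt : Ext → Ext → Ext
  rangeExt b e = Units.bound b e ⊕ Count.bound b e

  -- The bound e for n itself rather than its number of digits is what abs cannot express.
  rangeF-sound : ∀ S n {b e} → _≼_ S (bits n) b → _≼_ S n e →
                 Fit S (list nat) (e , ⌜ 0 ⌝ ⊕ b) (List.upTo n) × _≼_ S (rangeF .time (n , tt)) (rangeExt b e)
  rangeF-sound S n {b} {e} nb ne =
    let x , t = Count.sound′ S (Units.F .fun (n , tt)) n (Units.len (n , tt)) nb ne
    in subst (Fit S (list nat) (e , ⌜ 0 ⌝ ⊕ b))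
         (trans (Count.eq _ (Units.F .fun (n , tt)) 0) (trans (count-upTo 0 (Units.F .fun (n , tt)) (λ _ → refl)) (cong List.upTo (Units.len (n , tt))))) x ,
       ≼-⊕ (Units.sound′ S n nb ne) t

-- Enumeration of all choices from a sequence of lists

seqs : {A : Set} → List (List A) → List (List A)
seqs []         = [] ∷ []
seqs (xs ∷ xss) = List.concatMap (λ ys → List.map (_∷ ys) xs) (seqs xss)

length-concatMap : ∀ {A B : Set} (f : A → List B) {n} → (∀ x → length (f x) ≡ n) → ∀ xs → length (List.concatMap f xs) ≡ length xs * n
length-concatMap f eq []       = refl
length-concatMap f eq (x ∷ xs) = trans (length-++ (f x)) (cong₂ _+_ (eq x) (length-concatMap f eq xs))

length-seqs : ∀ {A : Set} (xss : List (List A)) → length (seqs xss) ≡ product (List.map length xss)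
length-seqs []         = refl
length-seqs (xs ∷ xss) = trans (length-concatMap _ (λ ys → length-map (_∷ ys) xs) (seqs xss))
  (trans (cong (_* length xs) (length-seqs xss)) (*-comm _ (length xs)))

module _ where
  private
    Γ : Ctx
    Γ = list (list nat) ∷ []
    base : Fn (list (list nat) ∷ bool ∷ Γ) (list (list nat))
    base = nilF ∷ᶠ nilF
    pre : Fn (list nat ∷ list (list nat) ∷ list (list nat) ∷ bool ∷ Γ) bool
    pre = v3
    post : Fn (list (list nat) ∷ list nat ∷ list (list nat) ∷ list (list nat) ∷ bool ∷ Γ) (list (list nat))
    post = concatMapF (mapF (v0 ∷ᶠ v1) v2) v0
    eq : ∀ ρ xss p → Rec.rec base pre post ρ xss p ≡ seqs xss
    eq ρ []         p = refl
    eq ρ (xs ∷ xss) p = cong (List.concatMap (λ ys → List.map (_∷ ys) xs)) (eq ρ xss p)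

    raw : Fn Γ (list (list nat))
    raw = recF base pre post v0 (boolF false)

    γ : BEnv (list (list nat) ∷ list nat ∷ list (list nat) ∷ list (list nat) ∷ bool ∷ Γ)
    γ = (fin 0 1 0 , ⊤ᵇ (list nat)) , (fin 0 0 1 , nothing) , ⊤ᵇ (list (list nat)) , ⊤ᵇ (list (list nat)) , tt , ⊤ᵇ (list (list nat)) , tt

    a : ℕ
    a = exponent (proj₂ (post .abs γ))

    -- Linearity in both lengths makes the time of one step proportional to the number of sequences
    -- it produces. Even a square would spoil the bound for the whole enumeration.
    linear-post : linear (proj₂ (post .abs γ)) ≡ true
    linear-post = refl

    1≤product : ∀ {xss : List (List ℕ)} → All (λ xs → 1 ≤ length xs) xss → 1 ≤ product (List.map length xss)
    1≤product []       = ≤-refl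
    1≤product (p ∷ ps) = *-mono-≤ p (1≤product ps)

    -- The bound for this step uses the two lists at hand as the scale.
    post-≤ : ∀ (S : Scale) xs xss p ρ → All (λ ys → 1 ≤ length ys) (xs ∷ xss) →
             post .time (Rec.rec base pre post ρ xss p , xs , xss , xs ∷ xss , p , ρ) ≤
             Scale.M S ^ a * product (List.map length (xs ∷ xss))
    post-≤ S xs xss p ρ (q ∷ qs) = begin
      post .time ρ′                           ≤⟨ Bound.≼-linear S′ _ linear-post (proj₂ (post .sound S′ γ ρ′ fits)) ⟩
      Bound.val S′ (a , 1 , 1)                ≡⟨ Bound.val-linear S′ a ⟩
      Scale.M S ^ a * (length r * length xs)  ≡⟨ cong (Scale.M S ^ a *_) (trans (*-comm (length r) _) (cong (length xs *_) r≡)) ⟩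
      Scale.M S ^ a * product (List.map length (xs ∷ xss)) ∎
      where
      open ≤-Reasoning
      r = Rec.rec base pre post ρ xss p
      ρ′ = r , xs , xss , xs ∷ xss , p , ρ
      r≡ : length r ≡ product (List.map length xss)
      r≡ = trans (cong length (eq ρ xss p)) (length-seqs xss)
      S′ : Scale
      S′ = record { M = Scale.M S ; B = length r ; F = length xs ; 2≤M = Scale.2≤M S
                  ; 1≤B = ≤-trans (1≤product qs) (≤-reflexive (sym r≡)) ; 1≤F = q }
      fits : FitEnv S′ _ γ ρ′
      fits = (≤v (≤-reflexive (sym (trans (+-identityʳ _) (trans (*-identityʳ _) (*-identityʳ (length r)))))) , fit-⊤s S′ (list nat) r) ,
             (≤v (≤-reflexive (sym (trans (+-identityʳ _) (trans (+-identityʳ _) (*-identityʳ (length xs)))))) , fit-⊤s S′ nat xs) ,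
             fit-⊤ S′ (list (list nat)) xss , fit-⊤ S′ (list (list nat)) (xs ∷ xss) , tt , fit-⊤ S′ (list (list nat)) (proj₁ ρ) , tt

    seqs° : Fn Γ (list (list nat))
    seqs° = withFun raw (λ (xss , _) → seqs xss) (λ ρ@(xss , _) → eq ρ xss false)

    all-seqs : ∀ {P : ℕ → Set} {xss} → All (All P) xss → All (λ ys → length ys ≡ length xss × All P ys) (seqs xss)
    all-seqs []         = (refl , []) ∷ []
    all-seqs (ps ∷ pss) = All++.concat⁺ (All++.map⁺ (mapL (λ ys (len , qs) → All++.map⁺ (mapL (λ x p → cong suc len , p ∷ qs) ps)) (all-seqs pss)))

  seqsF : Fn Γ (list (list nat))
  seqsF .code  = seqs° .code
  seqsF .fun   = seqs° .fun
  seqsF .time  = seqs° .time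
  seqsF .run   = seqs° .run
  seqsF .abs   = seqs° .abs
  seqsF .sound = seqs° .sound

  seqsExt : Ext → Ext → Ext
  -- The instance of `recShape` for one variable: 7 for the arguments, 6 for unpacking, 16 for the
  -- overhead, 3 and 1 for `base` and `pre`. The last summand is the bound from `post-≤`.
  seqsExt l e = ⌜ 7 ⌝ ⊕ ⌜ 6 ⌝ ⊕ (⌜ 0 ⌝ ⊕ l) ⊗ᵉ (⌜ 16 ⌝ ⊕ ⌜ 3 ⌝ ⊕ ⌜ 1 ⌝ ⊕ fin a 0 0 ⊗ᵉ e)

  seqsF-sound : ∀ S xss {l m e} → All (λ xs → 1 ≤ length xs) xss → _≼_ S (length xss) l →
                _≼_ S (product (List.map length xss)) e → All (All (λ x → _≼_ S (bits x) m)) xss →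
                Fit S (list (list nat)) (e , l , m) (seqs xss) × _≼_ S (seqsF .time (xss , tt)) (seqsExt l e)
  seqsF-sound S xss {l} {m} {e} ne len prod bs =
    (≼-mono (≤-reflexive (length-seqs xss)) prod , mapL (λ ys (eq , q) → ≼-mono (≤-reflexive eq) len , q) (all-seqs bs)) ,
    ≼-⊕ (≼-const 7) (≼-+ (≼-const 6) (≼-mono
      (Rec.loop-≤ base pre post (xss , tt) xss false
        (λ yss _ → All (λ xs → 1 ≤ length xs) yss × product (List.map length yss) ≤ product (List.map length xss))
        (λ _ → ≤-refl)
        (λ { {ys} {yss} {p} (q ∷ qs , le) →
          (qs , ≤-trans (≤-trans (≤-reflexive (sym (+-identityʳ _))) (*-monoˡ-≤ _ q)) le) , ≤-refl ,
          ≤-trans (post-≤ S ys yss p (xss , tt) (q ∷ qs)) (*-monoʳ-≤ (Scale.M S ^ a) le) })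
        (ne , ≤-refl))
      (≼-* (≼-⊕ (≼-const 0) len) (≼-+ (≼-const 16) (≼-+ (≼-const 3) (≼-+ (≼-const 1)
        (≼-* {t = Scale.M S ^ a} (≼-power a) prod)))))))

-- The algorithm

-- An item is an arc with the number of a walk, and labels are listed in the order of the items.
-- `RestT` holds multiplicities in unary: each arc, given by its ends, has a list with one entry per
-- copy left, so that using a copy means taking the tail.
PairT ArcT ItemT LabelsT RestT : Ty
PairT   = nat ⊗ nat
ArcT    = PairT ⊗ nat
ItemT   = ArcT ⊗ nat
LabelsT = list nat
RestT   = list (PairT ⊗ list nat)

v8 : ∀ {A B C D E F G H I Γ} → Fn (A ∷ B ∷ C ∷ D ∷ E ∷ F ∷ G ∷ H ∷ I ∷ Γ) I
v8 = varF (N (N (N (N (N (N (N (N Z))))))))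
v9 : ∀ {A B C D E F G H I J Γ} → Fn (A ∷ B ∷ C ∷ D ∷ E ∷ F ∷ G ∷ H ∷ I ∷ J ∷ Γ) J
v9 = varF (N (N (N (N (N (N (N (N (N Z)))))))))
v10 : ∀ {A B C D E F G H I J K Γ} → Fn (A ∷ B ∷ C ∷ D ∷ E ∷ F ∷ G ∷ H ∷ I ∷ J ∷ K ∷ Γ) K
v10 = varF (N (N (N (N (N (N (N (N (N (N Z))))))))))
v11 : ∀ {A B C D E F G H I J K L Γ} → Fn (A ∷ B ∷ C ∷ D ∷ E ∷ F ∷ G ∷ H ∷ I ∷ J ∷ K ∷ L ∷ Γ) L
v11 = varF (N (N (N (N (N (N (N (N (N (N (N Z)))))))))))

fstF : ∀ {Γ A B} → Fn Γ (A ⊗ B) → Fn Γ A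
fstF f = splitF f v0

sndF : ∀ {Γ A B} → Fn Γ (A ⊗ B) → Fn Γ B
sndF f = splitF f v1

memF : Fn (nat ∷ list nat ∷ []) bool
memF = anyF (v0 ≡ᶠ v1) v1

-- A cut is represented by the list of the vertices behind it; the arc crosses if exactly one end is
-- in that list.
crossF : Fn (ArcT ∷ list nat ∷ []) bool
crossF = letF (callF memF (sndF (fstF v0) ∷ v1 ∷ []))
              (ifF (callF memF (fstF (fstF v1) ∷ v2 ∷ [])) (notF v0) v0)

sameArcF : Fn (PairT ∷ PairT ∷ []) bool
sameArcF = (fstF v0 ≡ᶠ fstF v1) ∧ᶠ (sndF v0 ≡ᶠ sndF v1)

maskF : ∀ {Γ} → Fn (ItemT ∷ Γ) bool → Fn Γ (list ItemT) → Fn Γ LabelsT → Fn Γ LabelsT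
maskF p = zipWithF (ifF (thinF (ItemT ∷ []) (nat ∷ []) p) v1 (natF 0))

sumIfF : ∀ {Γ} → Fn (ItemT ∷ Γ) bool → Fn Γ (list ItemT) → Fn Γ LabelsT → Fn Γ nat
sumIfF p is ys = sumF (maskF p is ys)

suppF : Fn (list ItemT ∷ list nat ∷ LabelsT ∷ []) (list nat)
suppF = mapF (ifF (sumIfF (sndF v0 ≡ᶠ v1) v1 v3 ≡ᶠ natF 0) (natF 0) (natF 1)) v1

-- Self-delimiting: `true` announces a further digit and `false` the end, so that concatenated
-- numbers can be told apart.
codeF : Fn (nat ∷ []) (list bool)
codeF = appendF (concatMapF (boolF true ∷ᶠ v0 ∷ᶠ nilF) (digitsF v0)) (boolF false ∷ᶠ nilF)

keyF : Fn (list nat ∷ list nat ∷ []) (list bool)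
keyF = appendF (concatMapF (callF codeF (v0 ∷ [])) v0) (concatMapF (callF codeF (v0 ∷ [])) v1)

-- whether an arc crosses the cuts before and after the vertex v
commonF : Fn (ItemT ∷ nat ∷ list nat ∷ []) bool
commonF = callF crossF (fstF v0 ∷ (v1 ∷ᶠ v2) ∷ []) ∧ᶠ callF crossF (fstF v0 ∷ v2 ∷ [])

restrictF : Fn (list ItemT ∷ nat ∷ list nat ∷ LabelsT ∷ []) LabelsT
restrictF = maskF (callF commonF (v0 ∷ v2 ∷ v3 ∷ [])) v0 v3

weightF : Fn (list ItemT ∷ LabelsT ∷ []) nat
weightF = sumF (zipWithF (sndF (fstF v0) *ᶠ v1) v0 v1)

insertMinF : Fn (list bool ∷ LabelsT ∷ trie LabelsT ∷ list ItemT ∷ []) (trie LabelsT)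
insertMinF = caseM (callF lookupF (v0 ∷ v2 ∷ []))
  (callF insertF (v0 ∷ v1 ∷ v2 ∷ []))
  (ifF (callF weightF (v5 ∷ v1 ∷ []) ≤ᶠ callF weightF (v5 ∷ v3 ∷ [])) v4 (callF insertF (v2 ∷ v3 ∷ v4 ∷ [])))

-- The key retains only what the transition at the vertex needs: the flags and the labels of the
-- arcs that cross both the cut before it and the cut after it. Labels of arcs that end at the
-- vertex are forgotten, because balance is tested at the cuts and not at the vertex.
buildF : Fn (list LabelsT ∷ list ItemT ∷ list nat ∷ nat ∷ list nat ∷ []) (trie LabelsT)
buildF = foldlF
  (callF insertMinF (callF keyF (callF suppF (v3 ∷ v4 ∷ v0 ∷ []) ∷ callF restrictF (v3 ∷ v5 ∷ v6 ∷ v0 ∷ []) ∷ []) ∷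
                     v0 ∷ v1 ∷ v3 ∷ []))
  emptyF v0

-- Testing crossing arcs suffices: an arc has two different ends, hence it crosses the cut right
-- after the earlier one, and its labels do not change later.
totalsF : Fn (nat ∷ nat ∷ list ArcT ∷ list ItemT ∷ list nat ∷ LabelsT ∷ []) bool
totalsF = allF (ifF (callF crossF (v0 ∷ v5 ∷ []))
                    (letF (sumIfF (callF sameArcF (fstF (fstF v0) ∷ fstF v1 ∷ [])) v4 v6) ((v2 ≤ᶠ v0) ∧ᶠ (v0 ≤ᶠ v3)))
                    (boolF true)) v2

balancedF : Fn (list ItemT ∷ list nat ∷ list nat ∷ LabelsT ∷ []) bool
balancedF = allF (sumIfF ((sndF v0 ≡ᶠ v1) ∧ᶠ callF memF (sndF (fstF (fstF v0)) ∷ v4 ∷ [])) v1 v4 ≡ᶠ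
                  sumIfF ((sndF v0 ≡ᶠ v1) ∧ᶠ callF memF (fstF (fstF (fstF v0)) ∷ v4 ∷ [])) v1 v4) v1

overlayF : Fn (list ItemT ∷ list nat ∷ LabelsT ∷ LabelsT ∷ []) LabelsT
overlayF = zipWithF (ifF (callF crossF (fstF v0 ∷ v3 ∷ [])) (sndF v1) (fstF v1)) v0 (zipWithF (v0 ,ᶠ v1) v2 v3)

-- arguments: labels τ of the arcs in the new cut, flags f, trie, vertex, suffix, b, c, arcs, items, walks
extendF : Fn (LabelsT ∷ list nat ∷ trie LabelsT ∷ nat ∷ list nat ∷ nat ∷ nat ∷ list ArcT ∷ list ItemT ∷ list nat ∷ [])
             (list LabelsT)
extendF = ifF (callF totalsF (v5 ∷ v6 ∷ v7 ∷ v8 ∷ v4 ∷ v0 ∷ []) ∧ᶠ callF balancedF (v8 ∷ v9 ∷ v4 ∷ v0 ∷ []))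
  (caseM (callF lookupF (callF keyF (v1 ∷ callF restrictF (v8 ∷ v3 ∷ v4 ∷ v0 ∷ []) ∷ []) ∷ v2 ∷ []))
         nilF
         (callF overlayF (v10 ∷ v6 ∷ v1 ∷ v2 ∷ []) ∷ᶠ nilF))
  nilF

-- For each pair of flags and new state, one predecessor is looked up. Pairing the old labellings
-- with the new states instead would cost a factor `B` squared.
stageF : Fn (nat ∷ list nat ∷ list LabelsT ∷ list LabelsT ∷ nat ∷ nat ∷ list ArcT ∷ list ItemT ∷ list nat ∷ list (list nat) ∷ [])
            (list LabelsT)
stageF = letF (callF buildF (v3 ∷ v7 ∷ v8 ∷ v0 ∷ v1 ∷ []))
  (concatMapF (concatMapF (callF extendF (v0 ∷ v1 ∷ v2 ∷ v3 ∷ v4 ∷ v7 ∷ v8 ∷ v9 ∷ v10 ∷ v11 ∷ [])) v4) v10)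

StageT : Ty
StageT = nat ⊗ list nat ⊗ list LabelsT

-- Ranges, flags and states are inputs here. Their lengths are beyond what `abs` can infer and are
-- bounded by hand in `SetupTime`; given these lengths, the time of everything else follows from
-- `abs`.
CoreΓ : Ctx
CoreΓ = nat ∷ nat ∷ list ArcT ∷ list ItemT ∷ list nat ∷ list (list nat) ∷ list StageT ∷ list nat ∷ []

tablesF : Fn CoreΓ (list LabelsT)
tablesF = foldlF
  (callF stageF (fstF v0 ∷ fstF (sndF v0) ∷ sndF (sndF v0) ∷ v1 ∷ v2 ∷ v3 ∷ v4 ∷ v5 ∷ v6 ∷ v7 ∷ []))
  (mapF (natF 0) v3 ∷ᶠ nilF) v6

-- Behind the last vertex no arc crosses, so that keys differ in the flags only; the key looked up
-- says that all rows are nonzero. The vertex `0` is a dummy, since an empty suffix masks all labels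
-- anyway.
solveF : Fn CoreΓ (maybe LabelsT)
solveF = letF tablesF
  (callF lookupF (callF keyF (mapF (natF 1) v5 ∷ mapF (natF 0) v4 ∷ []) ∷
                  callF buildF (v0 ∷ v4 ∷ v5 ∷ natF 0 ∷ nilF ∷ []) ∷ []))

pickF : Fn (nat ∷ RestT ∷ []) RestT
pickF = filterF ((fstF (fstF v0) ≡ᶠ v1) ∧ᶠ notF (nullF (sndF v0))) v1

removeF : Fn (PairT ∷ RestT ∷ []) RestT
removeF = mapF (ifF (callF sameArcF (fstF v0 ∷ v1 ∷ [])) (fstF v0 ,ᶠ caseL (sndF v0) nilF v1) v0) v1

-- current vertex, traversed arcs in reverse order, remaining arcs
TrailT : Ty
TrailT = nat ⊗ list PairT ⊗ RestT

greedyF : Fn (TrailT ∷ []) TrailT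
greedyF = splitF v0 (splitF v1 (caseL (callF pickF (v2 ∷ v1 ∷ [])) v4
  (sndF (fstF v0) ,ᶠ (fstF v0 ∷ᶠ v2) ,ᶠ callF removeF (fstF v0 ∷ v3 ∷ []))))

-- current vertex, stack, finished part of the walk, remaining arcs
TourT : Ty
TourT = nat ⊗ list PairT ⊗ list PairT ⊗ RestT

tourF : Fn (TourT ∷ []) TourT
tourF = splitF v0 (splitF v1 (splitF v1 (caseL (callF pickF (v4 ∷ v1 ∷ []))
  (caseL v2 v6 (fstF v0 ,ᶠ v1 ,ᶠ (v0 ∷ᶠ v2) ,ᶠ v3))
  (sndF (fstF v0) ,ᶠ (fstF v0 ∷ᶠ v4) ,ᶠ v2 ,ᶠ callF removeF (fstF v0 ∷ v3 ∷ [])))))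

-- A label `y` becomes the list of all `i` in `rs` that are smaller than `y`. Only the length of
-- this list matters.
rowF : Fn (nat ∷ list ArcT ∷ list ItemT ∷ list nat ∷ LabelsT ∷ []) RestT
rowF = mapF (letF (sumIfF (callF sameArcF (fstF (fstF v0) ∷ fstF v1 ∷ []) ∧ᶠ (sndF v0 ≡ᶠ v2)) v3 v5)
                  (fstF v1 ,ᶠ filterF (notF (v1 ≤ᶠ v0)) v5)) v1

startF : Fn (nat ∷ list nat ∷ list ArcT ∷ list ItemT ∷ list nat ∷ LabelsT ∷ []) TrailT
startF = letF (callF rowF (v0 ∷ v2 ∷ v3 ∷ v4 ∷ v5 ∷ []))
  (foldlF (callF greedyF (v1 ∷ []))
          (caseL (filterF (notF (nullF (sndF v0))) v0) (natF 0) (fstF (fstF v0)) ,ᶠ nilF ,ᶠ v0) v2)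

leftoverF : Fn (list TrailT ∷ list ArcT ∷ []) RestT
leftoverF = mapF (fstF v0 ,ᶠ concatMapF (concatMapF (ifF (callF sameArcF (fstF v0 ∷ fstF v2 ∷ [])) (sndF v0) nilF)
                                                    (sndF (sndF v0))) v1) v1

walkF : Fn (TrailT ∷ RestT ∷ list nat ∷ []) (list PairT ⊗ RestT)
walkF = letF (foldlF (callF tourF (v1 ∷ [])) (fstF v0 ,ᶠ fstF (sndF v0) ,ᶠ nilF ,ᶠ v1) v2) (sndF (sndF v0))

-- The first list is fuel with 2 (c + 1) entries per arc: the tour needs at most one push and one
-- pop for each copy of an arc. Its length may be exponential in the encoding of `c`, but `c` is at
-- most `B`.
extractF : Fn (list ArcT ∷ list nat ∷ list ItemT ∷ list nat ∷ LabelsT ∷ []) (list (list PairT))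
extractF = letF (concatMapF (appendF v4 v4) v0)
  (letF (mapF (callF startF (v0 ∷ v1 ∷ v2 ∷ v4 ∷ v5 ∷ v6 ∷ [])) v2)
        (mapAccF (callF walkF (v0 ∷ v1 ∷ v3 ∷ [])) (callF leftoverF (v0 ∷ v2 ∷ [])) v0))

opaque
  coreF : Fn CoreΓ (maybe (list (list PairT)))
  coreF = caseM solveF nothingF (justF (callF extractF (v4 ∷ v6 ∷ v5 ∷ v9 ∷ v1 ∷ [])))

  -- An elimination principle for the opaque `coreF`: the search and the extraction enter as
  -- variables with equations, which keeps the type checker from unfolding them in the proof of
  -- correctness.
  core-fun : ∀ (ρ@(b , c , arcs , is , ks , flags , stages , rs , tt) : Env CoreΓ) (P : Maybe (List (List (ℕ × ℕ))) → Set) →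
             (∀ r (ex : List ℕ → List (List (ℕ × ℕ))) → r ≡ solveF .fun ρ → (∀ Y → ex Y ≡ extractF .fun (arcs , ks , is , rs , Y , tt)) →
              P (elimM r nothing (just ∘ ex))) →
             P (coreF .fun ρ)
  core-fun ρ P f = f _ _ refl (λ _ → refl)

InputT : Ty
InputT = nat ⊗ nat ⊗ (nat ⊗ list ArcT) ⊗ nat ⊗ list nat

SetupΓ : Ctx
SetupΓ = nat ∷ nat ∷ list ArcT ∷ nat ∷ list nat ∷ []

itemsF : Fn (list nat ∷ list ArcT ∷ []) (list ItemT)
itemsF = concatMapF (mapF (v1 ,ᶠ v0) v1) v1

-- Walk 0 takes the surplus of all walks, so the others need no label above 1.
choicesF : Fn (list nat ∷ list ItemT ∷ list nat ∷ []) (list (list nat))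
choicesF = mapF (ifF (callF crossF (fstF v0 ∷ v1 ∷ []))
                     (ifF (sndF v0 ≡ᶠ natF 0) v3 (natF 0 ∷ᶠ natF 1 ∷ᶠ nilF))
                     (natF 0 ∷ᶠ nilF)) v1

flagsF : Fn (list nat ∷ []) (list (list nat))
flagsF = mapF (natF 0 ∷ᶠ natF 1 ∷ᶠ nilF) v0

stageDataF : Fn (nat ∷ list nat ∷ list (list nat) ∷ list ItemT ∷ list nat ∷ list nat ∷ SetupΓ) StageT
stageDataF = v0 ,ᶠ v1 ,ᶠ callF seqsF (callF choicesF (v1 ∷ v3 ∷ v5 ∷ []) ∷ [])

c+1F : Fn SetupΓ nat
c+1F = v1 +ᶠ natF 1

opaque
  c≡0F : Fn SetupΓ bool
  c≡0F = v1 ≡ᶠ natF 0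

  c≡0-fun : ∀ b c arcs k ord → c≡0F .fun (b , c , arcs , k , ord , tt) ≡ (c ≡ᵇ 0)
  c≡0-fun b c arcs k ord = refl

OutputT : Ty
OutputT = maybe (list (list PairT))

setup₅F : Fn (list StageT ∷ list (list nat) ∷ list ItemT ∷ list nat ∷ list nat ∷ SetupΓ) OutputT
setup₅F = callF coreF (v5 ∷ v6 ∷ v7 ∷ v2 ∷ v3 ∷ v1 ∷ v0 ∷ v4 ∷ [])

setup₄F : Fn (list (list nat) ∷ list ItemT ∷ list nat ∷ list nat ∷ SetupΓ) OutputT
setup₄F = letF (mapTailsF stageDataF v8) setup₅F

setup₃F : Fn (list ItemT ∷ list nat ∷ list nat ∷ SetupΓ) OutputT
setup₃F = letF (callF seqsF (callF flagsF (v1 ∷ []) ∷ [])) setup₄F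

setup₂F : Fn (list nat ∷ list nat ∷ SetupΓ) OutputT
setup₂F = letF (callF itemsF (v0 ∷ v4 ∷ [])) setup₃F

setup₁F : Fn (list nat ∷ SetupΓ) OutputT
setup₁F = letF (callF rangeF (v4 ∷ [])) setup₂F

opaque
  setupF : Fn SetupΓ OutputT
  setupF = letF (callF rangeF (c+1F ∷ [])) setup₁F

-- In the two guarded cases there is no covering by nonempty walks. They are also the cases in which
-- the scale breaks down: for `c` = 0 the power (c 2^k)^p may vanish, and without arcs p may be 0,
-- so that `c` need not be at most `B`.
guardedF : Fn SetupΓ (maybe (list (list PairT)))
guardedF = ifF c≡0F nothingF (caseL v2 nothingF (thinF [] (ArcT ∷ list ArcT ∷ []) setupF))

mainF : Fn (InputT ∷ []) (maybe (list (list PairT)))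
mainF = callF guardedF (fstF v0 ∷ fstF (sndF v0) ∷ sndF (fstF (sndF (sndF v0))) ∷ fstF (sndF (sndF (sndF v0))) ∷
                        sndF (sndF (sndF (sndF v0))) ∷ [])

itemsOf : List ℕ → List ⟦ ArcT ⟧ → List ⟦ ItemT ⟧
itemsOf ks = List.concatMap (λ a → List.map (a ,_) ks)

choicesOf : List ℕ → List ⟦ ItemT ⟧ → List ℕ → List (List ℕ)
choicesOf suf is rs = choicesF .fun (suf , is , rs , tt)

-- Running time of the algorithm on a suitable scale

lenB digitB : Ext
lenB   = fin 1 0 0
digitB = fin 1 0 0

arcsB : Bd (list ArcT)
arcsB = lenB , (digitB , digitB) , digitB

-- `rs` has c + 1 ≤ M * B entries. The exponents 4 and 3 are what `rangeF-sound` yields from the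
-- digit bounds `fin 2 0 0` for c + 1 and `fin 1 0 0` for k.
rsB ksB ordB : Bd (list nat)
rsB  = fin 1 1 0 , fin 4 0 0
ksB  = lenB , fin 3 0 0
ordB = lenB , digitB

itemsB : Bd (list ItemT)
itemsB = proj₁ (itemsF .abs (ksB , arcsB , tt))

choicesB : Bd (list (list nat))
choicesB = proj₁ (choicesF .abs (ordB , itemsB , rsB , tt))

flagsB statesB : Bd (list (list nat))
flagsB  = fin 0 0 1 , proj₁ (proj₁ (flagsF .abs (ksB , tt))) , ⌜ 1 ⌝
statesB = fin 0 1 0 , proj₁ choicesB , proj₂ (proj₂ choicesB)

coreB : BEnv CoreΓ
coreB = digitB , digitB , arcsB , itemsB , ksB , flagsB , (lenB , digitB , ordB , statesB) , rsB , tt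

stageExt : Ext
stageExt = ⌜ 1 ⌝ ⊕ ⌜ 1 ⌝ ⊕ (((⌜ 1 ⌝ ⊕ ⌜ 1 ⌝ ⊕ ⌜ 1 ⌝ ⊕ ⌜ 1 ⌝) ⊕ ⌜ 6 ⌝ ⊕ proj₂ (choicesF .abs (ordB , itemsB , rsB , tt))) ⊕ ⌜ 1 ⌝) ⊕
           ⌜ 2 ⌝ ⊕ seqsExt (proj₁ choicesB) (fin 0 1 0)

setupB : BEnv SetupΓ
setupB = digitB , digitB , arcsB , digitB , ordB , tt

-- Follows the nesting of `setupF`. Having the components as parameters allows `parts-time` to be
-- checked for variables instead of large concrete bounds.
setupShape : (add rangeC rangeK items flags seqs stages core : Ext) → Ext
setupShape add rangeC rangeK items flags seqs stages core =
  ((add ⊕ ⌜ 1 ⌝) ⊕ ⌜ 2 ⌝ ⊕ rangeC) ⊕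
  ((⌜ 1 ⌝ ⊕ ⌜ 1 ⌝) ⊕ ⌜ 2 ⌝ ⊕ rangeK) ⊕
  ((⌜ 1 ⌝ ⊕ ⌜ 1 ⌝ ⊕ ⌜ 1 ⌝) ⊕ ⌜ 4 ⌝ ⊕ items) ⊕
  ((((⌜ 1 ⌝ ⊕ ⌜ 1 ⌝) ⊕ ⌜ 2 ⌝ ⊕ flags) ⊕ ⌜ 1 ⌝) ⊕ ⌜ 2 ⌝ ⊕ seqs) ⊕
  stages ⊕ ⌜ 17 ⌝ ⊕ ⌜ 16 ⌝ ⊕ core

stagesExt setupExt : Ext
-- There are 9 variables where `stageDataF` is mapped, and 116 is the overhead that `mapTails-time`
-- then gives.
stagesExt = recShape 9 ⌜ 1 ⌝ lenB ⌜ 1 ⌝ ⌜ 1 ⌝ ⌜ 1 ⌝ (⌜ 116 ⌝ ⊕ just (exponent stageExt , 1 , 1))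
setupExt = setupShape (proj₂ (c+1F .abs setupB)) (rangeExt (fin 2 0 0) (fin 1 1 0)) (rangeExt (fin 1 0 0) (fin 1 0 0))
  (proj₂ (itemsF .abs (ksB , arcsB , tt))) (proj₂ (flagsF .abs (ksB , tt)))
  (seqsExt (proj₁ (proj₁ (flagsF .abs (ksB , tt)))) (fin 0 0 1)) stagesExt (proj₂ (coreF .abs coreB))

testB : BEnv SetupΓ
testB = nothing , digitB , ⊤ᵇ (list ArcT) , nothing , ⊤ᵇ (list nat) , tt

-- `⌜ 100 ⌝` generously covers the passing of the arguments and the case distinctions, as verified
-- in `main-≤` and `trivial-≤`.
testExt trivialExt mainExt : Ext
testExt    = proj₂ (c≡0F .abs testB)
trivialExt = ⌜ 100 ⌝ ⊕ testExt
mainExt    = ⌜ 100 ⌝ ⊕ testExt ⊕ setupExt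

opaque
  unfolding c≡0F
  trivial-linear : linear trivialExt ≡ true
  trivial-linear = refl

stage-linear : linear stageExt ≡ true
stage-linear = refl

opaque
  unfolding coreF c≡0F
  -- Here the type checker evaluates the abstract interpretation of the whole program. That `refl`
  -- is accepted means that the running time is at most `M ^ a * B * F` for some constant a.
  main-linear : linear mainExt ≡ true
  main-linear = refl

all-mapTails : ∀ {A B : Set} {P : B → Set} (f : A → List A → B) xs us →
               (∀ ws y ys → ws ++ y ∷ ys ≡ us ++ xs → P (f y ys)) → All P (mapTails f xs)
all-mapTails f []       us h = []
all-mapTails f (x ∷ xs) us h =
  h us x xs refl ∷ all-mapTails f xs (us List.∷ʳ x) (λ ws y ys eq → h ws y ys (trans eq (++-assoc us (x ∷ []) xs)))

length-mapTails : ∀ {A B : Set} (f : A → List A → B) xs → length (mapTails f xs) ≡ length xs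
length-mapTails f []       = refl
length-mapTails f (x ∷ xs) = cong suc (length-mapTails f xs)

-- The cutwidth enters through `cut≤B`: at each cut of the ordering there are at most `B` labellings
-- of the crossing arcs.
record Small (S : Scale) (b c : ℕ) (arcs : List ⟦ ArcT ⟧) (k : ℕ) (ord : List ℕ) : Set where
  open Scale S
  field
    bits-b : bits b ≤ M
    bits-c : bits c ≤ M
    bits-k : bits k ≤ M
    k≤M    : k ≤ M
    c≤B    : c ≤ B
    arcs≤M : length arcs ≤ M
    bits-a : All (λ a → (bits (proj₁ (proj₁ a)) ≤ M × bits (proj₂ (proj₁ a)) ≤ M) × bits (proj₂ a) ≤ M) arcs
    ord≤M  : length ord ≤ M
    bits-o : All (λ v → bits v ≤ M) ord
    2^k≤F  : 2 ^ k ≤ F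
    cut≤B  : ∀ us v suf → us ++ v ∷ suf ≡ ord →
             product (List.map length (choicesOf suf (itemsOf (List.upTo k) arcs) (List.upTo (c + 1)))) ≤ B

product-flags : ∀ (ks : List ℕ) → product (List.map length (List.map (λ _ → 0 ∷ 1 ∷ []) ks)) ≡ 2 ^ length ks
product-flags []       = refl
product-flags (_ ∷ ks) = cong (2 *_) (product-flags ks)

module _ {S : Scale} {Γ : Ctx} where
  -- The value bound by the let comes with an equation, so that subsequent bounds speak of `rs`,
  -- `ks` or `is` rather than of programs.
  let-≼ : ∀ {A B e e′} (f : Fn Γ A) (g : Fn (A ∷ Γ) B) ρ {x} → f .fun ρ ≡ x →
          _≼_ S (f .time ρ) e → _≼_ S (g .time (x , ρ)) e′ → _≼_ S (letF f g .time ρ) (e ⊕ e′)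
  let-≼ f g ρ refl = ≼-⊕

  call-≼ : ∀ {Δ A e e′} (f : Fn Δ A) (fs : Args Γ Δ) ρ {δ} → argsFun fs ρ ≡ δ →
           _≼_ S (argsTime fs ρ) e → _≼_ S (f .time δ) e′ → _≼_ S (callF f fs .time ρ) (e ⊕ ⌜ length Δ * 2 ⌝ ⊕ e′)
  call-≼ f fs ρ refl t u = ≼-⊕ t (≼-+ (≼-const _) u)

module SetupTime (S : Scale) (b c : ℕ) (arcs : List ⟦ ArcT ⟧) (k : ℕ) (ord : List ℕ) (sm : Small S b c arcs k ord) where
  open Scale S
  open Small sm

  small : ∀ {n} → n ≤ M → _≼_ S n (fin 1 0 0)
  small n≤M = ≼-mono n≤M (≤v (≤-reflexive (sym (trans (*-identityʳ _) (*-identityʳ M)))))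

  rs ks : List ℕ
  rs = List.upTo (c + 1)
  ks = List.upTo k
  is : List ⟦ ItemT ⟧
  is = itemsOf ks arcs

  suc-c : _≼_ S (c + 1) (fin 1 1 0)
  suc-c = ≤v (begin
    c + 1          ≤⟨ +-mono-≤ c≤B 1≤B ⟩
    B + B          ≡⟨ cong (B +_) (sym (+-identityʳ B)) ⟩
    2 * B          ≤⟨ *-monoˡ-≤ B 2≤M ⟩
    M * B          ≡⟨ cong₂ _*_ (sym (*-identityʳ M)) (trans (sym (*-identityʳ B)) (sym (*-identityʳ _))) ⟩
    M ^ 1 * (B ^ 1 * 1) ∎)
    where open ≤-Reasoning

  inB : ∀ {n} → n ≤ B → _≼_ S n (fin 0 1 0)
  inB n≤B = ≤v (≤-trans n≤B (≤-reflexive (sym (trans (+-identityʳ _) (trans (*-identityʳ _) (*-identityʳ B))))))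

  inF : ∀ {n} → n ≤ F → _≼_ S n (fin 0 0 1)
  inF n≤F = ≤v (≤-trans n≤F (≤-reflexive (sym (trans (+-identityʳ _) (trans (+-identityʳ _) (*-identityʳ F))))))

  bits-suc-c : _≼_ S (bits (c + 1)) (fin 2 0 0)
  bits-suc-c = ≼-mono (bits-≤ (c + 1) (suc (suc (bits c))) lemma) (≤v (begin
    2 + bits c     ≤⟨ +-mono-≤ 2≤M bits-c ⟩
    M + M          ≡⟨ cong (M +_) (sym (+-identityʳ M)) ⟩
    2 * M          ≤⟨ *-mono-≤ 2≤M (≤-reflexive (sym (*-identityʳ M))) ⟩
    M ^ 2          ≡⟨ sym (*-identityʳ _) ⟩
    M ^ 2 * 1      ∎))
    where
    open ≤-Reasoning
    lemma : suc (c + 1) ≤ 2 ^ suc (suc (bits c))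
    lemma = begin
      suc (c + 1)                       ≡⟨ cong suc (+-comm c 1) ⟩
      1 + suc c                         ≤⟨ +-mono-≤ (m^n>0 2 (suc (bits c))) (2^bits c) ⟩
      2 ^ suc (bits c) + 2 ^ suc (bits c) ≡⟨ cong (2 ^ suc (bits c) +_) (sym (+-identityʳ _)) ⟩
      2 ^ suc (suc (bits c)) ∎

  rs-fit : Fit S (list nat) (fin 1 1 0 , fin 4 0 0) rs × _≼_ S (rangeF .time (c + 1 , tt)) (rangeExt (fin 2 0 0) (fin 1 1 0))
  rs-fit = rangeF-sound S (c + 1) bits-suc-c suc-c

  ks-fit : Fit S (list nat) (fin 1 0 0 , fin 3 0 0) ks × _≼_ S (rangeF .time (k , tt)) (rangeExt (fin 1 0 0) (fin 1 0 0))
  ks-fit = rangeF-sound S k (small bits-k) (small k≤M)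

  arcs-fit : Fit S (list ArcT) arcsB arcs
  arcs-fit = small arcs≤M , mapL (λ _ ((p , q) , r) → (small p , small q) , small r) bits-a

  items-sound : Fit S (list ItemT) itemsB is × _≼_ S (itemsF .time (ks , arcs , tt)) (proj₂ (itemsF .abs (ksB , arcsB , tt)))
  items-sound = itemsF .sound S (ksB , arcsB , tt) (ks , arcs , tt) (proj₁ ks-fit , arcs-fit , tt)

  flags-sound : Fit S (list (list nat)) flagsB (seqs (List.map (λ _ → 0 ∷ 1 ∷ []) ks)) ×
                _≼_ S (seqsF .time (List.map (λ _ → 0 ∷ 1 ∷ []) ks , tt)) (seqsExt (proj₁ (proj₁ (flagsF .abs (ksB , tt)))) (fin 0 0 1))
  flags-sound = seqsF-sound S _ (All++.map⁺ (All.universal (λ _ → s≤s z≤n) ks))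
    (proj₁ (proj₁ (flagsF .sound S (ksB , tt) (ks , tt) (proj₁ ks-fit , tt))))
    (inF (≤-trans (≤-reflexive (trans (product-flags ks) (cong (2 ^_) (length-upTo k)))) 2^k≤F))
    (All++.map⁺ (All.universal (λ _ → ≼-mono z≤n (≼-const 1) ∷ ≼-const 1 ∷ []) ks))

  module _ (us : List ℕ) (v : ℕ) (suf : List ℕ) (eq : us ++ v ∷ suf ≡ ord) where

    v-fit : Fit S nat digitB v × Fit S (list nat) ordB suf
    v-fit = small (All.head ps) , small (≤-trans (≤-trans (m≤n+m (length suf) (length us)) (≤-trans (+-monoʳ-≤ (length us) (n≤1+n _))
              (≤-reflexive (sym (length-++ us))))) (≤-trans (≤-reflexive (cong length eq)) ord≤M)) , mapL (λ _ → small) (All.tail ps)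
      where
      ps : All (λ v → bits v ≤ M) (v ∷ suf)
      ps = All++.++⁻ʳ us (subst (All _) (sym eq) bits-o)

    choices-sound : Fit S (list (list nat)) choicesB (choicesOf suf is rs) ×
                    _≼_ S (choicesF .time (suf , is , rs , tt)) (proj₂ (choicesF .abs (ordB , itemsB , rsB , tt)))
    choices-sound = choicesF .sound S (ordB , itemsB , rsB , tt) (suf , is , rs , tt) (proj₂ v-fit , proj₁ items-sound , proj₁ rs-fit , tt)

    nonempty : ∀ is → All (λ xs → 1 ≤ length xs) (choicesOf suf is rs)
    nonempty []       = []
    nonempty (i ∷ is) = lemma (crossF .fun (proj₁ i , suf , tt)) (eqF .fun (proj₂ i , 0 , tt)) ∷ nonempty is
      where
      lemma : ∀ x y → 1 ≤ length (if x then (if y then rs else 0 ∷ 1 ∷ []) else 0 ∷ [])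
      lemma true  true  = ≤-trans (m≤n+m 1 c) (≤-reflexive (sym (length-upTo (c + 1))))
      lemma true  false = s≤s z≤n
      lemma false y     = s≤s z≤n

    states-sound : Fit S (list (list nat)) statesB (seqs (choicesOf suf is rs)) ×
                   _≼_ S (seqsF .time (choicesOf suf is rs , tt)) (seqsExt (proj₁ choicesB) (fin 0 1 0))
    states-sound = seqsF-sound S _ (nonempty is) (proj₁ (proj₁ choices-sound)) (inB (cut≤B us v suf eq))
                               (mapL (λ _ → proj₂) (proj₂ (proj₁ choices-sound)))

    stage-time : ∀ fs {ρ : Env SetupΓ} → _≼_ S (stageDataF .time (v , suf , fs , is , ks , rs , ρ)) stageExt
    stage-time fs =
      ≼-⊕ (≼-const 1) (≼-⊕ (≼-const 1) (≼-⊕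
        (≼-⊕ (≼-⊕ (≼-⊕ (≼-const 1) (≼-⊕ (≼-const 1) (≼-⊕ (≼-const 1) (≼-const 1)))) (≼-+ (≼-const 6) (proj₂ choices-sound))) (≼-const 1))
        (≼-+ (≼-const 2) (proj₂ states-sound))))

  fs : List (List ℕ)
  fs = seqs (List.map (λ _ → 0 ∷ 1 ∷ []) ks)

  stages : List ⟦ StageT ⟧
  stages = mapTails (λ v suf → v , suf , seqs (choicesOf suf is rs)) ord

  stages-fit : Fit S (list StageT) (lenB , digitB , ordB , statesB) stages
  stages-fit = small (≤-trans (≤-reflexive (length-mapTails _ ord)) ord≤M) ,
    all-mapTails _ ord [] (λ us v suf eq →
      proj₁ (v-fit us v suf eq) , proj₂ (v-fit us v suf eq) , proj₁ (states-sound us v suf eq))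

  ρ : Env SetupΓ
  ρ = b , c , arcs , k , ord , tt

  ρ-fit : FitEnv S SetupΓ setupB ρ
  ρ-fit = small bits-b , small bits-c , arcs-fit , small bits-k , (small ord≤M , mapL (λ _ → small) bits-o) , tt

  core-time : _≼_ S (coreF .time (b , c , arcs , is , ks , fs , stages , rs , tt)) (proj₂ (coreF .abs coreB))
  core-time = proj₂ (coreF .sound S coreB (b , c , arcs , is , ks , fs , stages , rs , tt)
    (small bits-b , small bits-c , arcs-fit , proj₁ items-sound , proj₁ ks-fit , proj₁ flags-sound , stages-fit , proj₁ rs-fit , tt))

  stages-time : _≼_ S (mapTailsF stageDataF v8 .time (fs , is , ks , rs , ρ)) stagesExt
  stages-time = mapTails-time stageDataF v8 S (fs , is , ks , rs , ρ) (exponent stageExt , 1 , 1) (≼-const 1) (small ord≤M)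
    (λ us v suf eq → Bound.≼-linear S stageExt stage-linear (stage-time us v suf eq fs {ρ}))

  -- Arbitrary bounds for the components: the composition below is checked without evaluating the
  -- concrete ones, which are supplied only in `setup-time`.
  module _ {add rangeC rangeK items flags seqs stagesE core : Ext}
           (t-add : _≼_ S (c+1F .time ρ) add) (t-rangeC : _≼_ S (rangeF .time (c + 1 , tt)) rangeC)
           (t-rangeK : _≼_ S (rangeF .time (k , tt)) rangeK) (t-items : _≼_ S (itemsF .time (ks , arcs , tt)) items)
           (t-flags : _≼_ S (flagsF .time (ks , tt)) flags)
           (t-seqs : _≼_ S (seqsF .time (List.map (λ _ → 0 ∷ 1 ∷ []) ks , tt)) seqs)
           (t-stages : _≼_ S (mapTailsF stageDataF v8 .time (fs , is , ks , rs , ρ)) stagesE)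
           (t-core : _≼_ S (coreF .time (b , c , arcs , is , ks , fs , stages , rs , tt)) core) where

    time₅ : _≼_ S (setup₅F .time (stages , fs , is , ks , rs , ρ)) (⌜ 17 ⌝ ⊕ ⌜ 16 ⌝ ⊕ core)
    time₅ = call-≼ {e = ⌜ 17 ⌝} {core} coreF (v5 ∷ v6 ∷ v7 ∷ v2 ∷ v3 ∷ v1 ∷ v0 ∷ v4 ∷ []) (stages , fs , is , ks , rs , ρ) refl (≼-const 17) t-core

    eq₄ : mapTailsF stageDataF v8 .fun (fs , is , ks , rs , ρ) ≡ stages
    eq₄ = refl

    time₄ : _≼_ S (setup₄F .time (fs , is , ks , rs , ρ)) (stagesE ⊕ ⌜ 17 ⌝ ⊕ ⌜ 16 ⌝ ⊕ core)
    time₄ = let-≼ {e = stagesE} {⌜ 17 ⌝ ⊕ ⌜ 16 ⌝ ⊕ core} (mapTailsF stageDataF v8) setup₅F (fs , is , ks , rs , ρ) {stages} eq₄ t-stages time₅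

    fs-time : _≼_ S (callF seqsF (callF flagsF (v1 ∷ []) ∷ []) .time (is , ks , rs , ρ))
                    ((((⌜ 1 ⌝ ⊕ ⌜ 1 ⌝) ⊕ ⌜ 2 ⌝ ⊕ flags) ⊕ ⌜ 1 ⌝) ⊕ ⌜ 2 ⌝ ⊕ seqs)
    fs-time = call-≼ seqsF (callF flagsF (v1 ∷ []) ∷ []) (is , ks , rs , ρ) refl
      (≼-⊕ (call-≼ flagsF (v1 ∷ []) (is , ks , rs , ρ) refl (≼-⊕ (≼-const 1) (≼-const 1)) t-flags) (≼-const 1)) t-seqs

    time₃ : _≼_ S (setup₃F .time (is , ks , rs , ρ))
                  (((((⌜ 1 ⌝ ⊕ ⌜ 1 ⌝) ⊕ ⌜ 2 ⌝ ⊕ flags) ⊕ ⌜ 1 ⌝) ⊕ ⌜ 2 ⌝ ⊕ seqs) ⊕ stagesE ⊕ ⌜ 17 ⌝ ⊕ ⌜ 16 ⌝ ⊕ core)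
    time₃ = let-≼ (callF seqsF (callF flagsF (v1 ∷ []) ∷ [])) setup₄F (is , ks , rs , ρ) {fs} refl fs-time time₄

    time₂ : _≼_ S (setup₂F .time (ks , rs , ρ))
                  (((⌜ 1 ⌝ ⊕ ⌜ 1 ⌝ ⊕ ⌜ 1 ⌝) ⊕ ⌜ 4 ⌝ ⊕ items) ⊕
                   ((((⌜ 1 ⌝ ⊕ ⌜ 1 ⌝) ⊕ ⌜ 2 ⌝ ⊕ flags) ⊕ ⌜ 1 ⌝) ⊕ ⌜ 2 ⌝ ⊕ seqs) ⊕ stagesE ⊕ ⌜ 17 ⌝ ⊕ ⌜ 16 ⌝ ⊕ core)
    time₂ = let-≼ (callF itemsF (v0 ∷ v4 ∷ [])) setup₃F (ks , rs , ρ) {is} refl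
      (call-≼ itemsF (v0 ∷ v4 ∷ []) (ks , rs , ρ) refl (≼-⊕ (≼-const 1) (≼-⊕ (≼-const 1) (≼-const 1))) t-items) time₃

    time₁ : _≼_ S (setup₁F .time (rs , ρ))
                  (((⌜ 1 ⌝ ⊕ ⌜ 1 ⌝) ⊕ ⌜ 2 ⌝ ⊕ rangeK) ⊕ ((⌜ 1 ⌝ ⊕ ⌜ 1 ⌝ ⊕ ⌜ 1 ⌝) ⊕ ⌜ 4 ⌝ ⊕ items) ⊕
                   ((((⌜ 1 ⌝ ⊕ ⌜ 1 ⌝) ⊕ ⌜ 2 ⌝ ⊕ flags) ⊕ ⌜ 1 ⌝) ⊕ ⌜ 2 ⌝ ⊕ seqs) ⊕ stagesE ⊕ ⌜ 17 ⌝ ⊕ ⌜ 16 ⌝ ⊕ core)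
    time₁ = let-≼ (callF rangeF (v4 ∷ [])) setup₂F (rs , ρ) {ks} refl
      (call-≼ rangeF (v4 ∷ []) (rs , ρ) refl (≼-⊕ (≼-const 1) (≼-const 1)) t-rangeK) time₂

    opaque
      unfolding setupF
      parts-time : _≼_ S (setupF .time ρ) (setupShape add rangeC rangeK items flags seqs stagesE core)
      parts-time = let-≼ (callF rangeF (c+1F ∷ [])) setup₁F ρ {rs} refl
        (call-≼ rangeF (c+1F ∷ []) ρ refl (≼-⊕ t-add (≼-const 1)) t-rangeC) time₁

  setup-time : _≼_ S (setupF .time ρ) setupExt
  setup-time = parts-time (proj₂ (c+1F .sound S setupB ρ ρ-fit)) (proj₂ rs-fit) (proj₂ ks-fit) (proj₂ items-sound)
    (proj₂ (flagsF .sound S (ksB , tt) (ks , tt) (proj₁ ks-fit , tt))) (proj₂ flags-sound) stages-time core-time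

input : (b c n : ℕ) (arcs : List ⟦ ArcT ⟧) (k : ℕ) (ord : List ℕ) → ⟦ InputT ⟧
input b c n arcs k ord = b , c , (n , arcs) , k , ord

test-time : ∀ S b c arcs k ord → bits c ≤ Scale.M S → _≼_ S (c≡0F .time (b , c , arcs , k , ord , tt)) testExt
test-time S b c arcs k ord bits-c = proj₂ (c≡0F .sound S testB (b , c , arcs , k , ord , tt)
  (≤∞ , ≼-mono bits-c (≤v (≤-reflexive (sym (trans (*-identityʳ _) (*-identityʳ M))))) ,
   fit-⊤ S (list ArcT) arcs , ≤∞ , fit-⊤ S (list nat) ord , tt))
  where open Scale S

module _ (b n k : ℕ) (ord : List ℕ) where
  private
    test : ℕ → List ⟦ ArcT ⟧ → ℕ
    test c arcs = c≡0F .time (b , c , arcs , k , ord , tt)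

  -- Once the guard is decided, the time of `mainF` computes to numerals plus two unknown times; the
  -- summand 25 in `eq` is the slack up to 100.
  main-≤ : ∀ c a arcs → mainF .time (input b (suc c) n (a ∷ arcs) k ord , tt) ≤
                        suc (100 + suc (test (suc c) (a ∷ arcs) + setupF .time (b , suc c , a ∷ arcs , k , ord , tt)))
  main-≤ c a arcs rewrite c≡0-fun b (suc c) (a ∷ arcs) k ord = lemma (test (suc c) (a ∷ arcs)) (setupF .time (b , suc c , a ∷ arcs , k , ord , tt))
    where
    eq : ∀ x y → 1 + 41 + (10 + (1 + x + (2 + (12 + (10 + y))))) + 25 ≡ suc (100 + suc (x + y))
    eq = solve-∀
    lemma : ∀ x y → 1 + 41 + (10 + (1 + x + (2 + (12 + (10 + y))))) ≤ suc (100 + suc (x + y))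
    lemma x y = ≤-trans (m≤m+n _ 25) (≤-reflexive (eq x y))

  trivial-≤ : ∀ c arcs → c ≡ 0 ⊎ arcs ≡ [] → mainF .time (input b c n arcs k ord , tt) ≤ suc (100 + test c arcs)
  trivial-≤ zero    arcs     _ rewrite c≡0-fun b 0 arcs k ord = lemma (test 0 arcs)
    where
    eq : ∀ x → 1 + 41 + (10 + (1 + x + 23)) + 25 ≡ suc (100 + x)
    eq = solve-∀
    lemma : ∀ x → 1 + 41 + (10 + (1 + x + 23)) ≤ suc (100 + x)
    lemma x = ≤-trans (m≤m+n _ 25) (≤-reflexive (eq x))
  trivial-≤ (suc c) []       _ rewrite c≡0-fun b (suc c) [] k ord = lemma (test (suc c) [])
    where
    eq : ∀ x → 1 + 41 + (10 + (1 + x + 3)) + 45 ≡ suc (100 + x)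
    eq = solve-∀
    lemma : ∀ x → 1 + 41 + (10 + (1 + x + 3)) ≤ suc (100 + x)
    lemma x = ≤-trans (m≤m+n _ 45) (≤-reflexive (eq x))
  trivial-≤ (suc c) (_ ∷ _) (inj₁ ())
  trivial-≤ (suc c) (_ ∷ _) (inj₂ ())

  main-trivial : ∀ c arcs → c ≡ 0 ⊎ arcs ≡ [] → mainF .fun (input b c n arcs k ord , tt) ≡ nothing
  main-trivial zero    arcs _ rewrite c≡0-fun b 0 arcs k ord = refl
  main-trivial (suc c) []   _ rewrite c≡0-fun b (suc c) [] k ord = refl
  main-trivial (suc c) (_ ∷ _) (inj₁ ())
  main-trivial (suc c) (_ ∷ _) (inj₂ ())

  main-setup : ∀ c arcs → c ≢ 0 → arcs ≢ [] →
               mainF .fun (input b c n arcs k ord , tt) ≡ setupF .fun (b , c , arcs , k , ord , tt)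
  main-setup zero    arcs       c≢0 _    = ⊥-elim (c≢0 refl)
  main-setup (suc c) []         _   a≢[] = ⊥-elim (a≢[] refl)
  main-setup (suc c) (a ∷ arcs) _   _ rewrite c≡0-fun b (suc c) (a ∷ arcs) k ord = refl

  main-time : ∀ S c arcs → c ≢ 0 → arcs ≢ [] → Small S b c arcs k ord →
              mainF .time (input b c n arcs k ord , tt) ≤ Bound.val S (exponent mainExt , 1 , 1)
  main-time S zero    arcs       c≢0 _    sm = ⊥-elim (c≢0 refl)
  main-time S (suc c) []         _   a≢[] sm = ⊥-elim (a≢[] refl)
  main-time S (suc c) (a ∷ arcs) _   _    sm = Bound.≼-linear S mainExt main-linear (≼-mono (main-≤ c a arcs)
    (≼-⊕ (≼-const 100) (≼-⊕ (test-time S b (suc c) (a ∷ arcs) k ord (Small.bits-c sm)) (SetupTime.setup-time S b (suc c) (a ∷ arcs) k ord sm))))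

  trivial-time : ∀ S c arcs → bits c ≤ Scale.M S → c ≡ 0 ⊎ arcs ≡ [] →
                 mainF .time (input b c n arcs k ord , tt) ≤ Bound.val S (exponent trivialExt , 1 , 1)
  trivial-time S c arcs bits-c triv = Bound.≼-linear S trivialExt trivial-linear
    (≼-mono (trivial-≤ c arcs triv) (≼-⊕ (≼-const 100) (test-time S b c arcs k ord bits-c)))

opaque
  unfolding setupF
  setup-core : ∀ b c arcs k ord → let rs = List.upTo (c + 1) ; ks = List.upTo k ; is = itemsOf ks arcs in
               setupF .fun (b , c , arcs , k , ord , tt) ≡
               coreF .fun (b , c , arcs , is , ks , seqs (List.map (λ _ → 0 ∷ 1 ∷ []) ks) ,
                           mapTails (λ v suf → v , suf , seqs (choicesOf suf is rs)) ord , rs , tt)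
  setup-core b c arcs k ord = refl

-- Sequences of choices, injectivity of keys, and tries of lightest entries

zipWith-map₂ : ∀ {A B C D : Set} (f : B → C → D) (g : A → B) (h : A → C) xs →
              List.zipWith f (List.map g xs) (List.map h xs) ≡ List.map (λ x → f (g x) (h x)) xs
zipWith-map₂ f g h []       = refl
zipWith-map₂ f g h (x ∷ xs) = cong (_ ∷_) (zipWith-map₂ f g h xs)

map-≡⇒≗ : ∀ {A B : Set} {f g : A → B} xs → List.map f xs ≡ List.map g xs → ∀ {x} → x ∈ xs → f x ≡ g x
map-≡⇒≗ (x ∷ xs) eq (here refl) = ∷-injectiveˡ eq
map-≡⇒≗ (x ∷ xs) eq (there i)   = map-≡⇒≗ xs (∷-injectiveʳ eq) i

map-cong-∈ : ∀ {A B : Set} {f g : A → B} xs → (∀ {x} → x ∈ xs → f x ≡ g x) → List.map f xs ≡ List.map g xs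
map-cong-∈ []       h = refl
map-cong-∈ (x ∷ xs) h = cong₂ _∷_ (h (here refl)) (map-cong-∈ xs (h ∘ there))

≡ᵇ-refl : ∀ n → (n ≡ᵇ n) ≡ true
≡ᵇ-refl zero    = refl
≡ᵇ-refl (suc n) = ≡ᵇ-refl n

≡ᵇ-true : ∀ m n → (m ≡ᵇ n) ≡ true → m ≡ n
≡ᵇ-true m n eq = ≡ᵇ⇒≡ m n (subst T (sym eq) tt)

≡ᵇ-false : ∀ {m n} → m ≢ n → (m ≡ᵇ n) ≡ false
≡ᵇ-false {m} {n} ne with m ≡ᵇ n in eq
... | true  = ⊥-elim (ne (≡ᵇ-true m n eq))
... | false = refl

≤⇒≤ᵇ-true : ∀ {m n} → m ≤ n → (m ≤ᵇ n) ≡ true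
≤⇒≤ᵇ-true {m} {n} m≤n with m ≤ᵇ n in eq
... | true  = refl
... | false = ⊥-elim (subst T eq (≤⇒≤ᵇ m≤n))

∈-seqs⁺ : ∀ {A B : Set} (t : A → B) (ch : A → List B) xs → (∀ x → t x ∈ ch x) →
          List.map t xs ∈ seqs (List.map ch xs)
∈-seqs⁺ t ch []       h = here refl
∈-seqs⁺ t ch (x ∷ xs) h = ∈-concatMap⁺ _ (Any.map (λ { refl → ∈-map⁺ (_∷ List.map t xs) (h x) }) (∈-seqs⁺ t ch xs h))

module _ {A B : Set} (_≟_ : DecidableEquality A) (ch : A → List B) (default : ∀ x → ∃[ y ] y ∈ ch x) where

  -- The function is redefined at `x`, which leaves the tail alone because `x` does not recur in it.
  -- Outside the list its values come from `default`.
  ∈-seqs⁻ : ∀ xs {ys} → Unique xs → ys ∈ seqs (List.map ch xs) → ∃[ t ] ys ≡ List.map t xs × (∀ x → t x ∈ ch x)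
  ∈-seqs⁻ []       []        (here refl) = (λ x → proj₁ (default x)) , refl , λ x → proj₂ (default x)
  ∈-seqs⁻ (x ∷ xs) (x∉ ∷ u) i with find (∈-concatMap⁻ (λ ys → List.map (_∷ ys) (ch x)) {xs = seqs (List.map ch xs)} i)
  ... | zs , j , p with ∈-map⁻ (_∷ zs) p | ∈-seqs⁻ xs u j
  ...   | y , y∈ , refl | t , refl , t∈ = t′ , cong₂ _∷_ (sym t′-x) (map-cong-∈ xs (λ {z} z∈ → sym (t′-≢ (λ eq → All.lookup x∉ z∈ (sym eq))))) , t′∈
    where
    t′ : A → B
    t′ z with z ≟ x
    ... | yes _ = y
    ... | no  _ = t z
    t′-x : t′ x ≡ y
    t′-x with x ≟ x
    ... | yes _ = refl
    ... | no ne = ⊥-elim (ne refl)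
    t′-≢ : ∀ {z} → z ≢ x → t′ z ≡ t z
    t′-≢ {z} ne with z ≟ x
    ... | yes eq = ⊥-elim (ne eq)
    ... | no _   = refl
    t′∈ : ∀ z → t′ z ∈ ch z
    t′∈ z with z ≟ x
    ... | yes refl = y∈
    ... | no _     = t∈ z

codeL : ℕ → List Bool
codeL n = codeF .fun (n , tt)

keyL : List ℕ → List ℕ → List Bool
keyL f ys = keyF .fun (f , ys , tt)

module _ where
  private
    marked : List Bool → List Bool
    marked ds = List.concatMap (λ d → true ∷ d ∷ []) ds ++ false ∷ []

    marked-injective : ∀ ds es {r s} → marked ds ++ r ≡ marked es ++ s → ds ≡ es × r ≡ s
    marked-injective []       []       eq = refl , ∷-injectiveʳ eq
    marked-injective (d ∷ ds) (e ∷ es) eq =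
      let eq₁ , eq₂ = marked-injective ds es (∷-injectiveʳ (∷-injectiveʳ eq))
      in cong₂ _∷_ (∷-injectiveˡ (∷-injectiveʳ eq)) eq₁ , eq₂
    marked-injective []       (e ∷ es) ()
    marked-injective (d ∷ ds) []       ()

    digits-injective : ∀ {m n} → digits m ≡ digits n → m ≡ n
    digits-injective {m} {n} eq = trans (sym (undigits-digits m)) (trans (cong undigits eq) (undigits-digits n))

    codes-injective : ∀ xs ys {r s} → length xs ≡ length ys → List.concatMap codeL xs ++ r ≡ List.concatMap codeL ys ++ s → xs ≡ ys × r ≡ s
    codes-injective []       []       len eq = refl , eq
    codes-injective (x ∷ xs) (y ∷ ys) {r} {s} len eq =
      let eq₁ , eq₂ = marked-injective (digits x) (digits y)
                        (trans (sym (++-assoc (codeL x) (List.concatMap codeL xs) r)) (trans eq (++-assoc (codeL y) (List.concatMap codeL ys) s)))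
          eq₃ , eq₄ = codes-injective xs ys (suc-injective len) eq₂
      in cong₂ _∷_ (digits-injective eq₁) eq₃ , eq₄

  -- The codes of numbers delimit themselves, but the end of a list is not marked; equal lengths fix
  -- where the flags stop and the labels begin.
  keyL-injective : ∀ f g ys zs → length f ≡ length g → length ys ≡ length zs → keyL f ys ≡ keyL g zs → f ≡ g × ys ≡ zs
  keyL-injective f g ys zs lf ly eq =
    let eq₁ , eq₂ = codes-injective f g lf eq
    in eq₁ , proj₁ (codes-injective ys zs {[]} {[]} ly (trans (++-identityʳ _) (trans eq₂ (sym (++-identityʳ _)))))

module Best {A : Set} (key : A → List Bool) (weight : A → ℕ) where

  -- Written so that `buildF .fun` is `build` by computation, with the key and the weight as the
  -- program computes them.
  add : Trie A → A → Trie A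
  add t y = elimM (lookupT (key y) t) (insertT (key y) y t)
                  (λ y′ → if weight y′ ≤ᵇ weight y then t else insertT (key y) y t)

  build : List A → Trie A
  build = List.foldl add empty

  private
    -- The possible outcomes of a lookup after adding `y`. Either it yields `y`, which is no heavier
    -- than the former entry, or nothing changed, and then under the key of `y` there already was an
    -- entry no heavier than `y`. Both `sound-add` and `complete-add` follow from this alone.
    data Added (t : Trie A) (y : A) (bs : List Bool) : Maybe A → Set where
      new  : bs ≡ key y → (∀ y′ → lookupT bs t ≡ just y′ → weight y ≤ weight y′) → Added t y bs (just y)
      keep : (bs ≡ key y → ∃[ y′ ] lookupT bs t ≡ just y′ × weight y′ ≤ weight y) → Added t y bs (lookupT bs t)

    inserted : ∀ t y bs → (∀ y′ → lookupT (key y) t ≡ just y′ → weight y ≤ weight y′) → Added t y bs (lookupT bs (insertT (key y) y t))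
    inserted t y bs h with ≡-dec _≟ᵇ_ (key y) bs
    ... | yes refl = subst (Added t y bs) (sym (lookup-insert (key y) t)) (new refl h)
    ... | no ne    = subst (Added t y bs) (sym (lookup-insert-≢ (key y) bs t ne)) (keep λ eq → ⊥-elim (ne (sym eq)))

    added : ∀ t y bs → Added t y bs (lookupT bs (add t y))
    added t y bs with lookupT (key y) t in eq
    ... | nothing = inserted t y bs λ y′ eq′ → case-⊥ (trans (sym eq) eq′)
      where
      case-⊥ : ∀ {y′ : A} {B : Set} → _≡_ {A = Maybe A} nothing (just y′) → B
      case-⊥ ()
    ... | just y′ with weight y′ ≤ᵇ weight y in le
    ...   | true  = keep λ { refl → y′ , eq , ≤ᵇ-true _ _ le }
    ...   | false = inserted t y bs λ { y″ eq′ → lemma (trans (sym eq) eq′) }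
      where
      lemma : ∀ {y″} → just y′ ≡ just y″ → weight y ≤ weight y″
      lemma refl = ≰⇒≥ λ w → subst T le (≤⇒≤ᵇ w)

    Sound : (A → Set) → Trie A → Set
    Sound P t = ∀ bs y → lookupT bs t ≡ just y → P y × key y ≡ bs

    Complete : A → Trie A → Set
    Complete y t = ∃[ y′ ] lookupT (key y) t ≡ just y′ × weight y′ ≤ weight y

    sound-add : ∀ {P t y} → P y → Sound P t → Sound P (add t y)
    sound-add {P} {t} {y} p s bs z eq with lookupT bs (add t y) | added t y bs | eq
    ... | _ | new refl _ | refl = p , refl
    ... | _ | keep _     | eq   = s bs z eq

    complete-add : ∀ {y z t} → Complete z t → Complete z (add t y)
    complete-add {y} {z} {t} (z′ , eq , le) with lookupT (key z) (add t y) | added t y (key z)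
    ... | _ | new _ h = y , refl , ≤-trans (h z′ eq) le
    ... | _ | keep _  = z′ , eq , le

    complete-new : ∀ t y → Complete y (add t y)
    complete-new t y with lookupT (key y) (add t y) | added t y (key y)
    ... | _ | new _ _ = y , refl , ≤-refl
    ... | _ | keep h  = h refl

    foldl-sound : ∀ {P} ys t → All P ys → Sound P t → Sound P (List.foldl add t ys)
    foldl-sound []       t []       s = s
    foldl-sound (y ∷ ys) t (p ∷ ps) s = foldl-sound ys (add t y) ps (sound-add p s)

    foldl-complete : ∀ ys t {z} → Complete z t → Complete z (List.foldl add t ys)
    foldl-complete []       t c = c
    foldl-complete (y ∷ ys) t c = foldl-complete ys (add t y) (complete-add c)

    foldl-complete-∈ : ∀ ys t {z} → z ∈ ys → Complete z (List.foldl add t ys)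
    foldl-complete-∈ (y ∷ ys) t (here refl) = foldl-complete ys (add t y) (complete-new t y)
    foldl-complete-∈ (y ∷ ys) t (there i)   = foldl-complete-∈ ys (add t y) i

  build-sound : ∀ {P : A → Set} ys → All P ys → ∀ {bs y} → lookupT bs (build ys) ≡ just y → P y × key y ≡ bs
  build-sound ys ps = foldl-sound ys empty ps (λ bs y eq → ⊥-elim (nothing≢ (trans (sym (lookup-empty bs)) eq))) _ _
    where
    nothing≢ : ∀ {y : A} → _≡_ {A = Maybe A} nothing (just y) → ⊥
    nothing≢ ()

  build-complete : ∀ ys {y} → y ∈ ys → ∃[ y′ ] lookupT (key y) (build ys) ≡ just y′ × weight y′ ≤ weight y
  build-complete ys = foldl-complete-∈ ys empty

upTo≡map-toℕ : ∀ k → List.upTo k ≡ List.map toℕ (List.allFin k)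
upTo≡map-toℕ k = trans (lemma k id) (sym (map-tabulate id toℕ))
  where
  lemma : ∀ n (f : ℕ → ℕ) → List.applyUpTo f n ≡ List.tabulate (λ (i : Fin n) → f (toℕ i))
  lemma zero    f = refl
  lemma (suc n) f = cong (f 0 ∷_) (lemma n (f ∘ suc))

all⁻ : ∀ {A : Set} (p : A → Bool) xs → all p xs ≡ true → ∀ {x} → x ∈ xs → p x ≡ true
all⁻ p (x ∷ xs) eq (here refl) = proj₁ (∧-true eq)
all⁻ p (x ∷ xs) eq (there i)   = all⁻ p xs (proj₂ (∧-true {p x} eq)) i

all⁺ : ∀ {A : Set} (p : A → Bool) xs → (∀ {x} → x ∈ xs → p x ≡ true) → all p xs ≡ true
all⁺ p []       h = refl
all⁺ p (x ∷ xs) h rewrite h (here refl) = all⁺ p xs (h ∘ there)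

all-map : ∀ {A B : Set} (p : B → Bool) (f : A → B) xs → all p (List.map f xs) ≡ all (p ∘ f) xs
all-map p f []       = refl
all-map p f (x ∷ xs) = cong (p (f x) ∧_) (all-map p f xs)

∧-true⁺ : ∀ {a b} → a ≡ true → b ≡ true → a ∧ b ≡ true
∧-true⁺ refl refl = refl

-- Correctness of the dynamic program

module Labels (m k : ℕ) where

  Ix : Set
  Ix = Fin m × Fin k

  ixs : List Ix
  ixs = List.cartesianProduct (List.allFin m) (List.allFin k)

  Labelling : Set
  Labelling = Ix → ℕ

  ∈-ixs : ∀ ix → ix ∈ ixs
  ∈-ixs (a , j) = ∈-cartesianProduct⁺ (∈-allFin a) (∈-allFin j)

  ixs-unique : Unique ixs
  ixs-unique = cartesianProduct⁺ (allFin⁺ m) (allFin⁺ k)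

  L : Labelling → List ℕ
  L y = List.map y ixs

  L-cong : ∀ {y z : Labelling} → (∀ ix → y ix ≡ z ix) → L y ≡ L z
  L-cong eq = map-cong eq ixs

  L-injective : ∀ {y z : Labelling} → L y ≡ L z → ∀ ix → y ix ≡ z ix
  L-injective eq ix = map-≡⇒≗ ixs eq (∈-ixs ix)

  S : Labelling → ℕ
  S y = sum (L y)

  S-cong : ∀ {y z : Labelling} → (∀ ix → y ix ≡ z ix) → S y ≡ S z
  S-cong eq = cong sum (L-cong eq)

  S-+ : ∀ (y z : Labelling) → S (λ ix → y ix + z ix) ≡ S y + S z
  S-+ y z = lemma ixs
    where
    interchange : ∀ a b c d → (a + b) + (c + d) ≡ (a + c) + (b + d)
    interchange = solve-∀
    lemma : ∀ xs → sum (List.map (λ ix → y ix + z ix) xs) ≡ sum (List.map y xs) + sum (List.map z xs)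
    lemma []       = refl
    lemma (x ∷ xs) = trans (cong (y x + z x +_) (lemma xs)) (interchange (y x) (z x) _ _)

infix 8 _when_
_when_ : ℕ → Bool → ℕ
n when p = if p then n else 0

when-+ : ∀ x y p → (x + y) when p ≡ x when p + y when p
when-+ x y true  = refl
when-+ x y false = refl

when-0 : ∀ p → 0 when p ≡ 0
when-0 true  = refl
when-0 false = refl

sign : ℕ → ℕ
sign n = if n ≡ᵇ 0 then 0 else 1

sign-+ : ∀ m m′ n → sign m ≡ sign m′ → sign (m + n) ≡ sign (m′ + n)
sign-+ zero    zero     n eq = refl
sign-+ (suc m) (suc m′) n eq = refl
sign-+ zero    (suc m′) n ()
sign-+ (suc m) zero     n ()

module DP (m k : ℕ) (tl hd w : Fin m → ℕ) (tl≢hd : ∀ a → tl a ≢ hd a)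
          (distinct : ∀ {a a′} → tl a ≡ tl a′ → hd a ≡ hd a′ → a ≡ a′) (b c : ℕ) where
  open Labels m k

  arc : Fin m → ⟦ ArcT ⟧
  arc a = (tl a , hd a) , w a

  item : Ix → ⟦ ItemT ⟧
  item (a , j) = arc a , toℕ j

  arcs : List ⟦ ArcT ⟧
  arcs = List.map arc (List.allFin m)

  ks rs : List ℕ
  ks = List.upTo k
  rs = List.upTo (c + 1)

  is : List ⟦ ItemT ⟧
  is = itemsOf ks arcs

  is≡ : is ≡ List.map item ixs
  is≡ = trans (cong (λ ks → itemsOf ks arcs) (upTo≡map-toℕ k)) (lemma (List.allFin m))
    where
    lemma : ∀ as → itemsOf (List.map toℕ (List.allFin k)) (List.map arc as) ≡ List.map item (List.cartesianProduct as (List.allFin k))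
    lemma []       = refl
    lemma (a ∷ as) = trans (cong₂ _++_ (trans (sym (map-∘ (List.allFin k))) (map-∘ (List.allFin k))) (lemma as))
                           (sym (map-++ item (List.map (a ,_) (List.allFin k)) _))

  χ : List ℕ → ℕ → Bool
  χ suf v = memF .fun (v , suf , tt)

  cross both : List ℕ → Fin m → Bool
  cross suf a = crossF .fun (arc a , suf , tt)
  both suf a = χ suf (tl a) ∧ χ suf (hd a)

  same : Fin m → Fin m → Bool
  same a a′ = sameArcF .fun ((tl a , hd a) , (tl a′ , hd a′) , tt)

  same-refl : ∀ a → same a a ≡ true
  same-refl a rewrite ≡ᵇ-refl (tl a) | ≡ᵇ-refl (hd a) = refl

  same⇒≡ : ∀ a a′ → same a a′ ≡ true → a ≡ a′
  same⇒≡ a a′ eq = let p , q = ∧-true {tl a ≡ᵇ tl a′} eq in distinct (≡ᵇ-true _ _ p) (≡ᵇ-true _ _ q)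

  row : ℕ → Labelling → ℕ
  row j y = S (λ (a , i) → y (a , i) when (toℕ i ≡ᵇ j))

  arcTotal : Fin m → Labelling → ℕ
  arcTotal a y = S (λ (a′ , i) → y (a′ , i) when same a′ a)

  into outof : List ℕ → ℕ → Labelling → ℕ
  into  suf j y = S (λ (a , i) → y (a , i) when ((toℕ i ≡ᵇ j) ∧ χ suf (hd a)))
  outof suf j y = S (λ (a , i) → y (a , i) when ((toℕ i ≡ᵇ j) ∧ χ suf (tl a)))

  W : Labelling → ℕ
  W y = S (λ (a , i) → w a * y (a , i))

  restrict : ℕ → List ℕ → Labelling → Labelling
  restrict v suf y (a , i) = y (a , i) when (cross (v ∷ suf) a ∧ cross suf a)

  overlay : List ℕ → Labelling → Labelling → Labelling
  overlay suf y t (a , i) = if cross suf a then t (a , i) else y (a , i)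

  -- Passes from the lists of the program to functions on pairs of an arc and a walk. All the lemmas
  -- `supp-L` to `balanced-L` that translate a test rest on `is≡` in this way.
  masked : ∀ (p : ⟦ ItemT ⟧ → Bool) y → List.zipWith (λ i n → n when p i) is (L y) ≡ L (λ ix → y ix when p (item ix))
  masked p y = trans (cong (λ is → List.zipWith (λ i n → n when p i) is (L y)) is≡) (zipWith-map₂ (λ i n → n when p i) item y ixs)

  suppP : List ℕ → List ℕ
  suppP Y = suppF .fun (is , ks , Y , tt)

  restrictP : ℕ → List ℕ → List ℕ → List ℕ
  restrictP v suf Y = restrictF .fun (is , v , suf , Y , tt)

  keyP : ℕ → List ℕ → List ℕ → List Bool
  keyP v suf Y = keyL (suppP Y) (restrictP v suf Y)

  weightP : List ℕ → ℕ
  weightP Y = weightF .fun (is , Y , tt)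

  supp-L : ∀ y → suppP (L y) ≡ List.map (λ j → sign (row j y)) ks
  supp-L y = map-cong (λ j → cong (λ n → sign (sum n)) (masked (λ i → proj₂ i ≡ᵇ j) y)) ks

  restrict-L : ∀ v suf y → restrictP v suf (L y) ≡ L (restrict v suf y)
  restrict-L v suf y = masked (λ i → crossF .fun (proj₁ i , v ∷ suf , tt) ∧ crossF .fun (proj₁ i , suf , tt)) y

  weight-L : ∀ y → weightP (L y) ≡ W y
  weight-L y = cong sum (trans (cong (λ is → List.zipWith (λ i n → proj₂ (proj₁ i) * n) is (L y)) is≡)
                               (zipWith-map₂ (λ i n → proj₂ (proj₁ i) * n) item y ixs))

  overlay-L : ∀ suf y t → overlayF .fun (is , suf , L y , L t , tt) ≡ L (overlay suf y t)
  overlay-L suf y t =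
    trans (cong₂ (List.zipWith g) is≡ (zipWith-map₂ _,_ y t ixs)) (zipWith-map₂ g item (λ ix → y ix , t ix) ixs)
    where
    g : ⟦ ItemT ⟧ → ℕ × ℕ → ℕ
    g i n = if crossF .fun (proj₁ i , suf , tt) then proj₂ n else proj₁ n

  totals-L : ∀ suf y → totalsF .fun (b , c , arcs , is , suf , L y , tt) ≡
             all (λ a → if cross suf a then (b ≤ᵇ arcTotal a y) ∧ (arcTotal a y ≤ᵇ c) else true) (List.allFin m)
  totals-L suf y = trans (all-map _ arc (List.allFin m)) (cong and (map-cong lemma (List.allFin m)))
    where
    lemma : ∀ a → _ ≡ (if cross suf a then (b ≤ᵇ arcTotal a y) ∧ (arcTotal a y ≤ᵇ c) else true)
    lemma a = cong (λ Y → if cross suf a then (b ≤ᵇ sum Y) ∧ (sum Y ≤ᵇ c) else true)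
                   (masked (λ i → sameArcF .fun (proj₁ (proj₁ i) , (tl a , hd a) , tt)) y)

  balanced-L : ∀ suf y → balancedF .fun (is , ks , suf , L y , tt) ≡ all (λ j → into suf j y ≡ᵇ outof suf j y) ks
  balanced-L suf y = cong and (map-cong lemma ks)
    where
    lemma : ∀ j → _ ≡ (into suf j y ≡ᵇ outof suf j y)
    lemma j = cong₂ (λ X Y → sum X ≡ᵇ sum Y) (masked (λ i → (proj₂ i ≡ᵇ j) ∧ χ suf (proj₂ (proj₁ (proj₁ i)))) y)
                                             (masked (λ i → (proj₂ i ≡ᵇ j) ∧ χ suf (proj₁ (proj₁ (proj₁ i)))) y)

  table : ℕ → List ℕ → List (List ℕ) → Trie (List ℕ)
  table v suf T = buildF .fun (T , is , ks , v , suf , tt)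

  table-sound : ∀ v suf {P : List ℕ → Set} T → All P T → ∀ {bs Y} → lookupT bs (table v suf T) ≡ just Y → P Y × keyP v suf Y ≡ bs
  table-sound v suf = Best.build-sound (keyP v suf) weightP

  table-complete : ∀ v suf T {Y} → Y ∈ T → ∃[ Y′ ] lookupT (keyP v suf Y) (table v suf T) ≡ just Y′ × weightP Y′ ≤ weightP Y
  table-complete v suf = Best.build-complete (keyP v suf) weightP

  flags : List (List ℕ)
  flags = seqs (List.map (λ _ → 0 ∷ 1 ∷ []) ks)

  choices : List ℕ → Ix → List ℕ
  choices suf (a , j) = if cross suf a then (if toℕ j ≡ᵇ 0 then rs else 0 ∷ 1 ∷ []) else 0 ∷ []

  states : List ℕ → List (List ℕ)
  states suf = seqs (choicesOf suf is rs)

  states≡ : ∀ suf → states suf ≡ seqs (List.map (choices suf) ixs)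
  states≡ suf = cong seqs (trans (cong (λ is → choicesOf suf is rs) is≡) (sym (map-∘ ixs)))

  valid : List ℕ → List ℕ → Bool
  valid suf τ = totalsF .fun (b , c , arcs , is , suf , τ , tt) ∧ balancedF .fun (is , ks , suf , τ , tt)

  extend : ℕ → List ℕ → Trie (List ℕ) → List ℕ → List ℕ → List (List ℕ)
  extend v suf t f τ = if valid suf τ
    then elimM (lookupT (keyL f (restrictP v suf τ)) t) [] (λ Y → overlayF .fun (is , suf , Y , τ , tt) ∷ [])
    else []

  stage : ℕ → List ℕ → List (List ℕ) → List (List ℕ)
  stage v suf T = stageF .fun (v , suf , states suf , T , b , c , arcs , is , ks , flags , tt)

  extend⁻ : ∀ v suf t f τ {Z} → Z ∈ extend v suf t f τ →
            valid suf τ ≡ true × ∃[ Y ] lookupT (keyL f (restrictP v suf τ)) t ≡ just Y × Z ≡ overlayF .fun (is , suf , Y , τ , tt)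
  extend⁻ v suf t f τ i with valid suf τ | lookupT (keyL f (restrictP v suf τ)) t | i
  ... | true  | just Y  | here refl = refl , Y , refl , refl
  ... | true  | nothing | ()
  ... | false | _       | ()

  extend⁺ : ∀ v suf t f τ {Y} → valid suf τ ≡ true → lookupT (keyL f (restrictP v suf τ)) t ≡ just Y →
            overlayF .fun (is , suf , Y , τ , tt) ∈ extend v suf t f τ
  extend⁺ v suf t f τ eq eq′ rewrite eq | eq′ = here refl

  ∈-concatMap⁻′ : ∀ {A B : Set} (f : A → List B) xs {y} → y ∈ List.concatMap f xs → ∃[ x ] x ∈ xs × y ∈ f x
  ∈-concatMap⁻′ f xs i = find (∈-concatMap⁻ f {xs = xs} i)

  ∈-concatMap⁺′ : ∀ {A B : Set} (f : A → List B) {xs x y} → x ∈ xs → y ∈ f x → y ∈ List.concatMap f xs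
  ∈-concatMap⁺′ f i j = ∈-concatMap⁺ f (lose i j)

  _≟ix_ : DecidableEquality Ix
  _≟ix_ = ≡-dec× Fin._≟_ Fin._≟_

  states⁻ : ∀ suf {τ} → τ ∈ states suf → Σ[ t ∈ Labelling ] τ ≡ L t × (∀ ix → t ix ∈ choices suf ix)
  states⁻ suf i = ∈-seqs⁻ _≟ix_ (choices suf) default ixs ixs-unique (subst (_ ∈_) (states≡ suf) i)
    where
    default : ∀ ix → ∃[ y ] y ∈ choices suf ix
    default (a , j) with cross suf a | toℕ j ≡ᵇ 0
    ... | true  | true  = 0 , subst (λ n → 0 ∈ List.upTo n) (+-comm 1 c) (here refl)
    ... | true  | false = 0 , here refl
    ... | false | _     = 0 , here refl

  off : ∀ suf {t : Labelling} → (∀ ix → t ix ∈ choices suf ix) → ∀ a j → cross suf a ≡ false → t (a , j) ≡ 0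
  off suf t∈ a j eq with cross suf a | t∈ (a , j)
  off suf t∈ a j refl | false | here eq = eq

  Balanced : List ℕ → Labelling → Set
  Balanced suf y = ∀ (j : Fin k) → into suf (toℕ j) y ≡ outof suf (toℕ j) y

  InRange : Labelling → Fin m → Set
  InRange y a = b ≤ arcTotal a y × arcTotal a y ≤ c

  balanced⁻ : ∀ suf y → all (λ j → into suf j y ≡ᵇ outof suf j y) ks ≡ true → Balanced suf y
  balanced⁻ suf y eq j = ≡ᵇ-true _ _ (all⁻ _ ks eq (subst (toℕ j ∈_) (sym (upTo≡map-toℕ k)) (∈-map⁺ toℕ (∈-allFin j))))

  balanced⁺ : ∀ suf y → Balanced suf y → all (λ j → into suf j y ≡ᵇ outof suf j y) ks ≡ true
  balanced⁺ suf y bal = all⁺ _ ks λ {j} j∈ → lemma (∈-map⁻ toℕ (subst (j ∈_) (upTo≡map-toℕ k) j∈))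
    where
    lemma : ∀ {j} → ∃[ i ] i ∈ List.allFin k × j ≡ toℕ i → (into suf j y ≡ᵇ outof suf j y) ≡ true
    lemma (i , _ , refl) rewrite bal i = ≡ᵇ-refl (outof suf (toℕ i) y)

  valid⁻ : ∀ suf t → valid suf (L t) ≡ true → (∀ a → cross suf a ≡ true → InRange t a) × Balanced suf t
  valid⁻ suf t eq =
    let eq₁ , eq₂ = ∧-true {totalsF .fun (b , c , arcs , is , suf , L t , tt)} eq
    in (λ a cr → range a cr (all⁻ _ (List.allFin m) (trans (sym (totals-L suf t)) eq₁) (∈-allFin a))) ,
       balanced⁻ suf t (trans (sym (balanced-L suf t)) eq₂)
    where
    range : ∀ a → cross suf a ≡ true → (if cross suf a then (b ≤ᵇ arcTotal a t) ∧ (arcTotal a t ≤ᵇ c) else true) ≡ true → InRange t a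
    range a cr eq rewrite cr = let p , q = ∧-true {b ≤ᵇ arcTotal a t} eq in ≤ᵇ-true _ _ p , ≤ᵇ-true _ _ q

  valid⁺ : ∀ suf t → (∀ a → cross suf a ≡ true → InRange t a) → Balanced suf t → valid suf (L t) ≡ true
  valid⁺ suf t range bal = ∧-true⁺ (trans (totals-L suf t) (all⁺ _ (List.allFin m) (λ {a} _ → lemma a (range a))))
                                   (trans (balanced-L suf t) (balanced⁺ suf t bal))
    where
    lemma : ∀ a → (cross suf a ≡ true → InRange t a) → (if cross suf a then (b ≤ᵇ arcTotal a t) ∧ (arcTotal a t ≤ᵇ c) else true) ≡ true
    lemma a h with cross suf a
    ... | true  = let p , q = h refl in ∧-true⁺ (≤⇒≤ᵇ-true p) (≤⇒≤ᵇ-true q)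
    ... | false = refl

  -- In an ordering these are the arcs whose earlier end is `v`, that is the arcs that receive their
  -- labels at this stage.
  new : ℕ → List ℕ → Fin m → Bool
  new v suf a = both (v ∷ suf) a ∧ not (both suf a)

  -- The part of a labelling that is decided once all vertices outside `suf` have been treated.
  cut : List ℕ → Labelling → Labelling
  cut suf y (a , j) = y (a , j) when not (both suf a)

  fresh : ℕ → List ℕ → Labelling → Labelling
  fresh v suf y (a , j) = y (a , j) when new v suf a

  -- For an arc with vt, vh saying whether v is its tail or head, and t, h
  -- whether its tail and head are in the suffix: the cases of both and cross.
  private
    not-loop : ∀ v a → ((v ≡ᵇ tl a) ∧ (v ≡ᵇ hd a)) ≡ false
    not-loop v a with v ≡ᵇ tl a in p | v ≡ᵇ hd a in q
    ... | true  | true  = ⊥-elim (tl≢hd a (trans (sym (≡ᵇ-true v _ p)) (≡ᵇ-true v _ q)))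
    ... | true  | false = refl
    ... | false | _     = refl

    overlay-case : ∀ vt vh t h (y τ : ℕ) → vt ∧ vh ≡ false → let t₁ = vt ∨ t ; h₁ = vh ∨ h ; cr = if t then not h else h ; cr₁ = if t₁ then not h₁ else h₁ in
      (t₁ ∧ h₁ ≡ true → y ≡ 0) → (cr₁ ∧ cr ≡ true → y ≡ τ) →
      (if cr then τ else y) ≡ y + τ when (t₁ ∧ h₁ ∧ not (t ∧ h))
    overlay-case vt    vh    true  true  y τ _ z e = sym (trans (cong (λ b → y + τ when b) (lemma (vt ∨ true) (vh ∨ true))) (+-identityʳ y))
      where
      lemma : ∀ a b → (a ∧ b ∧ false) ≡ false
      lemma true  true  = refl
      lemma true  false = refl
      lemma false _     = refl
    overlay-case true  true  _ _ y τ () z e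
    overlay-case true  false true  false y τ _ z e = trans (sym (e refl)) (sym (+-identityʳ y))
    overlay-case true  false false true  y τ _ z e = sym (cong (_+ τ) (z refl))
    overlay-case true  false false false y τ _ z e = sym (+-identityʳ y)
    overlay-case false true  true  false y τ _ z e = sym (cong (_+ τ) (z refl))
    overlay-case false true  false true  y τ _ z e = trans (sym (e refl)) (sym (+-identityʳ y))
    overlay-case false true  false false y τ _ z e = sym (+-identityʳ y)
    overlay-case false false true  false y τ _ z e = trans (sym (e refl)) (sym (+-identityʳ y))
    overlay-case false false false true  y τ _ z e = trans (sym (e refl)) (sym (+-identityʳ y))
    overlay-case false false false false y τ _ z e = sym (+-identityʳ y)

    cut-case : ∀ vt vh t h (y : ℕ) → vt ∧ vh ≡ false →
      y when not (t ∧ h) ≡ y when not ((vt ∨ t) ∧ (vh ∨ h)) + y when ((vt ∨ t) ∧ (vh ∨ h) ∧ not (t ∧ h))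
    cut-case true  true  t     h     y ()
    cut-case true  false true  true  y _ = refl
    cut-case true  false true  false y _ = sym (+-identityʳ y)
    cut-case true  false false true  y _ = refl
    cut-case true  false false false y _ = sym (+-identityʳ y)
    cut-case false true  true  true  y _ = refl
    cut-case false true  true  false y _ = refl
    cut-case false true  false true  y _ = sym (+-identityʳ y)
    cut-case false true  false false y _ = sym (+-identityʳ y)
    cut-case false false true  true  y _ = refl
    cut-case false false true  false y _ = sym (+-identityʳ y)
    cut-case false false false true  y _ = sym (+-identityʳ y)
    cut-case false false false false y _ = sym (+-identityʳ y)

    new-case : ∀ vt vh t h → vt ∧ vh ≡ false → ((vt ∨ t) ∧ (vh ∨ h) ∧ not (t ∧ h)) ≡ true → (if t then not h else h) ≡ true
    new-case true  true  t     h     () _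
    new-case true  false true  true  _ ()
    new-case true  false true  false _ ()
    new-case true  false false true  _ _ = refl
    new-case true  false false false _ ()
    new-case false true  true  true  _ ()
    new-case false true  true  false _ _ = refl
    new-case false true  false true  _ ()
    new-case false true  false false _ ()
    new-case false false true  true  _ ()
    new-case false false true  false _ ()
    new-case false false false true  _ ()
    new-case false false false false _ ()

  -- Turns the overlay into a sum, for which rows, flows and weights are additive. On arcs crossing
  -- both cuts old and new labels agree; on new arcs the old label is zero; all other arcs keep the
  -- old label. `cut-new` decomposes the labelling to compete with in the same way.
  overlay-new : ∀ v suf y t → (∀ a j → both (v ∷ suf) a ≡ true → y (a , j) ≡ 0) →
                (∀ a j → cross (v ∷ suf) a ∧ cross suf a ≡ true → y (a , j) ≡ t (a , j)) →
                ∀ ix → overlay suf y t ix ≡ y ix + fresh v suf t ix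
  overlay-new v suf y t z e (a , j) = trans (overlay-case (v ≡ᵇ tl a) (v ≡ᵇ hd a) (χ suf (tl a)) (χ suf (hd a)) (y (a , j)) (t (a , j)) (not-loop v a) (z a j) (e a j))
    (cong (λ b → y (a , j) + t (a , j) when b) (sym (∧-assoc (χ (v ∷ suf) (tl a)) (χ (v ∷ suf) (hd a)) _)))

  cut-new : ∀ v suf y ix → cut suf y ix ≡ cut (v ∷ suf) y ix + fresh v suf y ix
  cut-new v suf y (a , j) = trans (cut-case (v ≡ᵇ tl a) (v ≡ᵇ hd a) (χ suf (tl a)) (χ suf (hd a)) (y (a , j)) (not-loop v a))
    (cong (λ b → cut (v ∷ suf) y (a , j) + y (a , j) when b) (sym (∧-assoc (χ (v ∷ suf) (tl a)) (χ (v ∷ suf) (hd a)) _)))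

  new⇒cross : ∀ v suf a → new v suf a ≡ true → cross suf a ≡ true
  new⇒cross v suf a eq = new-case (v ≡ᵇ tl a) (v ≡ᵇ hd a) (χ suf (tl a)) (χ suf (hd a)) (not-loop v a)
    (trans (sym (∧-assoc (χ (v ∷ suf) (tl a)) (χ (v ∷ suf) (hd a)) _)) eq)

  -- `past` collects the suffixes of all cuts passed so far. Undecided arcs carry zero, so that the
  -- balance at these cuts is meaningful for a partial labelling.
  record Sound (past : List (List ℕ)) (suf : List ℕ) (y : Labelling) : Set where
    field
      zero-ahead : ∀ a j → both suf a ≡ true → y (a , j) ≡ 0
      balanced   : All (λ s → Balanced s y) past
      inRange    : ∀ a → both suf a ≡ false → InRange y a

  Represents : (Labelling → Set) → List ℕ → Set
  Represents P Y = ∃[ y ] Y ≡ L y × P y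

  Above : List (List ℕ) → List ℕ → Set
  Above past suf = All (λ s → ∀ u → χ suf u ≡ true → χ s u ≡ true) past

  into-+ : ∀ s j y z → into s j (λ ix → y ix + z ix) ≡ into s j y + into s j z
  into-+ s j y z = trans (S-cong (λ (a , i) → when-+ (y (a , i)) (z (a , i)) ((toℕ i ≡ᵇ j) ∧ χ s (hd a)))) (S-+ _ _)

  outof-+ : ∀ s j y z → outof s j (λ ix → y ix + z ix) ≡ outof s j y + outof s j z
  outof-+ s j y z = trans (S-cong (λ (a , i) → when-+ (y (a , i)) (z (a , i)) ((toℕ i ≡ᵇ j) ∧ χ s (tl a)))) (S-+ _ _)

  row-+ : ∀ j y z → row j (λ ix → y ix + z ix) ≡ row j y + row j z
  row-+ j y z = trans (S-cong (λ (a , i) → when-+ (y (a , i)) (z (a , i)) (toℕ i ≡ᵇ j))) (S-+ _ _)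

  W-+ : ∀ y z → W (λ ix → y ix + z ix) ≡ W y + W z
  W-+ y z = trans (S-cong (λ (a , i) → *-distribˡ-+ (w a) (y (a , i)) (z (a , i)))) (S-+ _ _)

  into-cong : ∀ s j {y z} → (∀ ix → y ix ≡ z ix) → into s j y ≡ into s j z
  into-cong s j eq = S-cong (λ (a , i) → cong (_when ((toℕ i ≡ᵇ j) ∧ χ s (hd a))) (eq (a , i)))

  outof-cong : ∀ s j {y z} → (∀ ix → y ix ≡ z ix) → outof s j y ≡ outof s j z
  outof-cong s j eq = S-cong (λ (a , i) → cong (_when ((toℕ i ≡ᵇ j) ∧ χ s (tl a))) (eq (a , i)))

  row-cong : ∀ j {y z} → (∀ ix → y ix ≡ z ix) → row j y ≡ row j z
  row-cong j eq = S-cong (λ (a , i) → cong (_when (toℕ i ≡ᵇ j)) (eq (a , i)))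

  W-cong : ∀ {y z} → (∀ ix → y ix ≡ z ix) → W y ≡ W z
  W-cong eq = S-cong (λ (a , i) → cong (w a *_) (eq (a , i)))

  balanced-cong : ∀ s {y z} → (∀ ix → y ix ≡ z ix) → Balanced s y → Balanced s z
  balanced-cong s eq bal j = trans (sym (into-cong s (toℕ j) eq)) (trans (bal j) (outof-cong s (toℕ j) eq))

  inside-balanced : ∀ s z → (∀ a j → z (a , j) ≢ 0 → both s a ≡ true) → Balanced s z
  inside-balanced s z inside j = S-cong λ (a , i) → lemma a i (toℕ i ≡ᵇ toℕ j) (z (a , i)) (inside a i)
    where
    lemma : ∀ a i p n → (n ≢ 0 → both s a ≡ true) → n when (p ∧ χ s (hd a)) ≡ n when (p ∧ χ s (tl a))
    lemma a i p zero    h = trans (when-0 (p ∧ χ s (hd a))) (sym (when-0 (p ∧ χ s (tl a))))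
    lemma a i p (suc n) h with ∧-true {χ s (tl a)} (h λ ())
    ... | eq₁ , eq₂ rewrite eq₁ | eq₂ = refl

  balanced-+ : ∀ s y z → Balanced s y → Balanced s z → Balanced s (λ ix → y ix + z ix)
  balanced-+ s y z bal bal′ j =
    trans (into-+ s (toℕ j) y z) (trans (cong₂ _+_ (bal j) (bal′ j)) (sym (outof-+ s (toℕ j) y z)))

  balanced-cancel : ∀ s y z → Balanced s (λ ix → y ix + z ix) → Balanced s z → Balanced s y
  balanced-cancel s y z bal bal′ j = +-cancelʳ-≡ (into s (toℕ j) z) _ _
    (trans (sym (into-+ s (toℕ j) y z)) (trans (bal j) (trans (outof-+ s (toℕ j) y z) (cong (outof s (toℕ j) y +_) (sym (bal′ j))))))

  arcTotal-cong : ∀ a {y z} → (∀ i → y (a , i) ≡ z (a , i)) → arcTotal a y ≡ arcTotal a z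
  arcTotal-cong a {y} {z} eq = S-cong λ (a′ , i) → lemma a′ i
    where
    lemma : ∀ a′ i → y (a′ , i) when same a′ a ≡ z (a′ , i) when same a′ a
    lemma a′ i with same a′ a in s
    ... | false = refl
    ... | true with same⇒≡ a′ a s
    ...   | refl = eq i

  inRange-cong : ∀ a {y z} → (∀ i → y (a , i) ≡ z (a , i)) → InRange y a → InRange z a
  inRange-cong a eq (p , q) = subst (b ≤_) (arcTotal-cong a eq) p , subst (_≤ c) (arcTotal-cong a eq) q

  crossing : List ℕ → Labelling → Labelling
  crossing suf y (a , j) = y (a , j) when cross suf a

  private
    both⇒off : ∀ suf a → both suf a ≡ true → cross suf a ≡ false
    both⇒off suf a eq with ∧-true {χ suf (tl a)} eq
    ... | p , q rewrite p | q = refl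

    when-true : ∀ n {p} → p ≡ true → n when p ≡ n
    when-true n refl = refl

    when-false : ∀ n {p} → p ≡ false → n when p ≡ 0
    when-false n refl = refl

    when-≢0 : ∀ n p → n when p ≢ 0 → p ≡ true
    when-≢0 n true  ne = refl
    when-≢0 n false ne = ⊥-elim (ne refl)

    not-false : ∀ {p} → p ≡ false → not p ≡ true
    not-false refl = refl

    ∨-true : ∀ p {q} → q ≡ true → p ∨ q ≡ true
    ∨-true true  _    = refl
    ∨-true false refl = refl

    false≢true : ∀ {p} {A : Set} → p ≡ false → p ≡ true → A
    false≢true refl ()

  -- Only crossing arcs count. A noncrossing arc with an end in `suf` has both ends there, where `y`
  -- vanishes, and `t` vanishes on all noncrossing arcs.
  balanced-crossing : ∀ suf y t → (∀ a j → both suf a ≡ true → y (a , j) ≡ 0) →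
                      (∀ a j → cross suf a ≡ true → y (a , j) ≡ t (a , j)) → (∀ a j → cross suf a ≡ false → t (a , j) ≡ 0) →
                      Balanced suf t → Balanced suf y
  balanced-crossing suf y t z e o bal j =
    trans (S-cong λ (a , i) → lemma (a , i) (hd a) (λ q → λ p → hd-case a p q))
          (trans (bal j) (sym (S-cong λ (a , i) → lemma (a , i) (tl a) (λ q p → tl-case a p q))))
    where
    hd-case : ∀ a → cross suf a ≡ false → χ suf (hd a) ≡ true → both suf a ≡ true
    hd-case a cr h with χ suf (tl a) | χ suf (hd a)
    ... | true  | true  = refl
    hd-case a () h    | false | true
    hd-case a cr ()   | _     | false
    tl-case : ∀ a → cross suf a ≡ false → χ suf (tl a) ≡ true → both suf a ≡ true
    tl-case a cr h with χ suf (tl a) | χ suf (hd a)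
    ... | true  | true  = refl
    tl-case a () h    | true  | false
    tl-case a cr ()   | false | _
    lemma : ∀ ix u → (χ suf u ≡ true → cross suf (proj₁ ix) ≡ false → both suf (proj₁ ix) ≡ true) →
            y ix when ((toℕ (proj₂ ix) ≡ᵇ toℕ j) ∧ χ suf u) ≡ t ix when ((toℕ (proj₂ ix) ≡ᵇ toℕ j) ∧ χ suf u)
    lemma (a , i) u h with toℕ i ≡ᵇ toℕ j | χ suf u
    ... | false | _     = refl
    ... | true  | false = refl
    ... | true  | true with cross suf a in cr
    ...   | true  = e a i cr
    ...   | false = trans (z a i (h refl refl)) (sym (o a i cr))

  sound-step : ∀ past v suf y t → Above past (v ∷ suf) → Sound past (v ∷ suf) y →
               (∀ a j → cross (v ∷ suf) a ∧ cross suf a ≡ true → y (a , j) ≡ t (a , j)) →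
               (∀ a j → cross suf a ≡ false → t (a , j) ≡ 0) →
               (∀ a → cross suf a ≡ true → InRange t a) → Balanced suf t →
               Sound (suf ∷ past) suf (overlay suf y t)
  sound-step past v suf y t above s e o range bal = record
    { zero-ahead = zero′
    ; balanced   = balanced-crossing suf y″ t zero′ (λ a j cr → cong (λ b → if b then t (a , j) else y (a , j)) cr) o bal ∷
                   -- The added arcs have both ends inside each earlier suffix, so they contribute
                   -- equally to the two sides of its balance.
                   All.map (λ {s} (ab , bl) → balanced-cong s (λ ix → sym (y″≡ ix))
                     (balanced-+ s y (fresh v suf t) bl (inside-balanced s (fresh v suf t) (λ a j ne →
                        let p , q = ∧-true {χ (v ∷ suf) (tl a)} (proj₁ (∧-true {both (v ∷ suf) a} (when-≢0 _ (new v suf a) ne)))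
                        in ∧-true⁺ (ab _ p) (ab _ q)))))
                   (All.zip (above , Sound.balanced s))
    ; inRange    = range′ }
    where
    y″ = overlay suf y t
    y″≡ : ∀ ix → y″ ix ≡ y ix + fresh v suf t ix
    y″≡ = overlay-new v suf y t (Sound.zero-ahead s) e
    ahead : ∀ a → both suf a ≡ true → both (v ∷ suf) a ≡ true
    ahead a eq = let p , q = ∧-true {χ suf (tl a)} eq in ∧-true⁺ (∨-true (v ≡ᵇ tl a) p) (∨-true (v ≡ᵇ hd a) q)
    zero′ : ∀ a j → both suf a ≡ true → y″ (a , j) ≡ 0
    zero′ a j eq = trans (cong (λ b → if b then t (a , j) else y (a , j)) (both⇒off suf a eq)) (Sound.zero-ahead s a j (ahead a eq))
    range′ : ∀ a → both suf a ≡ false → InRange y″ a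
    range′ a eq with both (v ∷ suf) a in eq₁
    ... | false = inRange-cong a (λ i → sym (trans (y″≡ (a , i)) (trans (cong (y (a , i) +_) (when-false (t (a , i)) (cong (_∧ not (both suf a)) eq₁))) (+-identityʳ _))))
                               (Sound.inRange s a eq₁)
    ... | true  = inRange-cong a (λ i → sym (cong (λ b → if b then t (a , i) else y (a , i)) cr)) (range a cr)
      where
      cr = new⇒cross v suf a (∧-true⁺ eq₁ (not-false eq))

  choice : Ix → List ℕ
  choice (a , j) = if toℕ j ≡ᵇ 0 then rs else 0 ∷ 1 ∷ []

  record Valid (ord : List ℕ) (y : Labelling) : Set where
    field
      chosen   : ∀ ix → y ix ∈ choice ix
      balanced : ∀ us v suf → ord ≡ us ++ v ∷ suf → Balanced suf y
      inRange  : ∀ a → InRange y a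

  -- An exchange argument: an entry of the table may differ from `y*` on finished arcs, but it has
  -- the same crossing labels and flags and is no heavier than the decided part of `y*`, so it can
  -- be continued just as `y*` is.
  record Approximates (suf : List ℕ) (y* y : Labelling) : Set where
    field
      agree : ∀ a j → cross suf a ≡ true → y (a , j) ≡ y* (a , j)
      signs : ∀ j → sign (row j y) ≡ sign (row j (cut suf y*))
      light : W y ≤ W (cut suf y*)

  Complete : List ℕ → Labelling → List (List ℕ) → Set
  Complete suf y* T = ∃[ y ] L y ∈ T × Approximates suf y* y

  private
    signs-L : ∀ {y z} → suppP (L y) ≡ suppP (L z) → ∀ j → j ∈ ks → sign (row j y) ≡ sign (row j z)
    signs-L {y} {z} eq j j∈ = map-≡⇒≗ ks (trans (sym (supp-L y)) (trans eq (supp-L z))) j∈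

    restrict-≡ : ∀ v suf {y z} → restrictP v suf (L y) ≡ restrictP v suf (L z) →
                 ∀ a j → cross (v ∷ suf) a ∧ cross suf a ≡ true → y (a , j) ≡ z (a , j)
    restrict-≡ v suf {y} {z} eq a j cr =
      trans (sym (when-true (y (a , j)) cr)) (trans (L-injective {restrict v suf y} {restrict v suf z}
        (trans (sym (restrict-L v suf y)) (trans eq (restrict-L v suf z))) (a , j)) (when-true (z (a , j)) cr))

    length-supp : ∀ y z → length (suppP (L y)) ≡ length (suppP (L z))
    length-supp y z = trans (cong length (supp-L y)) (trans (length-map (λ j → sign (row j y)) ks)
                        (trans (sym (length-map (λ j → sign (row j z)) ks)) (cong length (sym (supp-L z)))))

    length-restrict : ∀ v suf y z → length (restrictP v suf (L y)) ≡ length (restrictP v suf (L z))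
    length-restrict v suf y z = trans (cong length (restrict-L v suf y)) (trans (length-map (restrict v suf y) ixs)
                        (trans (sym (length-map (restrict v suf z) ixs)) (cong length (sym (restrict-L v suf z)))))

  flags⁻ : ∀ {f} → f ∈ flags → length f ≡ length ks
  flags⁻ {f} f∈ = let t , eq , _ = ∈-seqs⁻ _≟ℕ_ (λ _ → 0 ∷ 1 ∷ []) (λ _ → 0 , here refl) ks (upTo⁺ k) f∈
                  in trans (cong length eq) (length-map t ks)

  stage-sound : ∀ past v suf T → Above past (v ∷ suf) → All (Represents (Sound past (v ∷ suf))) T →
                All (Represents (Sound (suf ∷ past) suf)) (stage v suf T)
  stage-sound past v suf T above sT = All.tabulate λ {Z} Z∈ →
    let f , f∈ , Z∈₁ = ∈-concatMap⁻′ (λ f → List.concatMap (extend v suf (table v suf T) f) (states suf)) flags Z∈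
        τ , τ∈ , Z∈₂ = ∈-concatMap⁻′ (extend v suf (table v suf T) f) (states suf) Z∈₁
        t , τ≡ , t∈ = states⁻ suf τ∈
        ok , Y , found , Z≡ = extend⁻ v suf (table v suf T) f τ Z∈₂
        (y , Y≡ , s) , key≡ = table-sound v suf T sT found
        range , bal = valid⁻ suf t (trans (cong (valid suf) (sym τ≡)) ok)
        off′ = off suf {t} t∈
        key≡′ : keyL (suppP (L y)) (restrictP v suf (L y)) ≡ keyL f (restrictP v suf (L t))
        key≡′ = trans (cong (keyP v suf) (sym Y≡)) (trans key≡ (cong (λ τ → keyL f (restrictP v suf τ)) τ≡))
        _ , eq = keyL-injective (suppP (L y)) f (restrictP v suf (L y)) (restrictP v suf (L t))
                   (trans (trans (cong length (supp-L y)) (length-map _ ks)) (sym (flags⁻ f∈))) (length-restrict v suf y t) key≡′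
    in overlay suf y t , trans Z≡ (trans (cong₂ (λ Y τ → overlayF .fun (is , suf , Y , τ , tt)) Y≡ τ≡) (overlay-L suf y t)) ,
       sound-step past v suf y t above s (restrict-≡ v suf eq) off′ range bal

  -- The crossing part `t` of `y*` is one of the states. Looking up its restriction with the flags
  -- of `y` succeeds, since `y` was itself added under this key. The entry `y′` found is at most as
  -- heavy as `y`, and the overlay adds to it exactly the arcs that `y*` gains.
  stage-complete : ∀ past v suf T y* → All (Represents (Sound past (v ∷ suf))) T →
                   (∀ ix → y* ix ∈ choice ix) → Balanced suf y* → (∀ a → InRange y* a) →
                   Complete (v ∷ suf) y* T → Complete suf y* (stage v suf T)
  stage-complete past v suf T y* sT ch bal range (y , y∈ , ap) =
    overlay suf y′ t ,
    subst (_∈ stage v suf T) (trans (cong (λ Y → overlayF .fun (is , suf , Y , L t , tt)) Y′≡) (overlay-L suf y′ t))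
      (∈-concatMap⁺′ (λ f → List.concatMap (extend v suf (table v suf T) f) (states suf)) f∈
        (∈-concatMap⁺′ (extend v suf (table v suf T) f) t∈ (extend⁺ v suf (table v suf T) f (L t) t-valid found′))) ,
    record
      { agree = λ a j cr → trans (cong (λ b → if b then t (a , j) else y′ (a , j)) cr) (when-true (y* (a , j)) cr)
      ; signs = λ j → trans (cong sign (trans (row-cong j y″≡) (row-+ j y′ (fresh v suf y*))))
                      (trans (sign-+ (row j y′) (row j (cut (v ∷ suf) y*)) _ (row-signs j))
                             (cong sign (sym (trans (row-cong j (cut-new v suf y*)) (row-+ j (cut (v ∷ suf) y*) (fresh v suf y*))))))
      ; light = begin
          W (overlay suf y′ t)                            ≡⟨ trans (W-cong y″≡) (W-+ y′ (fresh v suf y*)) ⟩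
          W y′ + W (fresh v suf y*)                       ≤⟨ +-monoˡ-≤ _ W-≤ ⟩
          W (cut (v ∷ suf) y*) + W (fresh v suf y*)       ≡⟨ sym (trans (W-cong (cut-new v suf y*)) (W-+ (cut (v ∷ suf) y*) (fresh v suf y*))) ⟩
          W (cut suf y*)                                  ∎ }
    where
    open ≤-Reasoning
    open Approximates ap
    t = crossing suf y*
    f = suppP (L y)
    best = table-complete v suf T y∈
    Y′ = proj₁ best
    found : lookupT (keyP v suf (L y)) (table v suf T) ≡ just Y′
    found = proj₁ (proj₂ best)
    rep = table-sound v suf T sT found
    y′ = proj₁ (proj₁ rep)
    Y′≡ : Y′ ≡ L y′
    Y′≡ = proj₁ (proj₂ (proj₁ rep))
    s′ = proj₂ (proj₂ (proj₁ rep))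
    keys = keyL-injective (suppP (L y′)) (suppP (L y)) (restrictP v suf (L y′)) (restrictP v suf (L y))
             (length-supp y′ y) (length-restrict v suf y′ y) (trans (cong (keyP v suf) (sym Y′≡)) (proj₂ rep))
    -- `y` and `y*` agree on the arcs crossing the old cut, hence on those crossing both cuts.
    restrict-t : restrictP v suf (L t) ≡ restrictP v suf (L y)
    restrict-t = trans (restrict-L v suf t) (trans (L-cong λ (a , j) → lemma a j) (sym (restrict-L v suf y)))
      where
      lemma : ∀ a j → (y* (a , j) when cross suf a) when (cross (v ∷ suf) a ∧ cross suf a) ≡ y (a , j) when (cross (v ∷ suf) a ∧ cross suf a)
      lemma a j with cross (v ∷ suf) a in p | cross suf a
      ... | true  | true  = sym (agree a j p)
      ... | true  | false = refl
      ... | false | _     = refl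
    found′ : lookupT (keyL f (restrictP v suf (L t))) (table v suf T) ≡ just Y′
    found′ = trans (cong (λ r → lookupT (keyL f r) (table v suf T)) restrict-t) found
    f∈ : f ∈ flags
    f∈ = subst (_∈ flags) (sym (supp-L y)) (∈-seqs⁺ (λ j → sign (row j y)) (λ _ → 0 ∷ 1 ∷ []) ks (λ j → sign∈ (row j y)))
      where
      sign∈ : ∀ n → sign n ∈ 0 ∷ 1 ∷ []
      sign∈ zero    = here refl
      sign∈ (suc n) = there (here refl)
    t∈ : L t ∈ states suf
    t∈ = subst (L t ∈_) (sym (states≡ suf)) (∈-seqs⁺ t (choices suf) ixs λ (a , j) → lemma a j)
      where
      lemma : ∀ a j → t (a , j) ∈ choices suf (a , j)
      lemma a j with cross suf a
      ... | true  = ch (a , j)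
      ... | false = here refl
    t-valid : valid suf (L t) ≡ true
    -- From the balance of `y*` the arcs inside `suf` are cancelled, and those with no end in `suf`
    -- contribute to neither side; the crossing arcs remain.
    t-valid = valid⁺ suf t (λ a cr → inRange-cong a (λ i → sym (when-true (y* (a , i)) cr)) (range a))
      (balanced-crossing′ (balanced-cancel suf (λ ix → y* ix when not (both suf (proj₁ ix))) (λ ix → y* ix when both suf (proj₁ ix))
        (balanced-cong suf (λ (a , i) → split (y* (a , i)) (both suf a)) bal)
        (inside-balanced suf _ (λ a j ne → when-≢0 _ (both suf a) ne))))
      where
      split : ∀ n p → n ≡ n when not p + n when p
      split n true  = refl
      split n false = sym (+-identityʳ n)
      balanced-crossing′ : Balanced suf (λ ix → y* ix when not (both suf (proj₁ ix))) → Balanced suf t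
      balanced-crossing′ = balanced-crossing″
        where
        term : ∀ n T H p → (p ≡ T ⊎ p ≡ H) → (n when not (T ∧ H)) when p ≡ (n when (if T then not H else H)) when p
        term n true  true  p     _ = refl
        term n true  false p     _ = refl
        term n false true  p     _ = refl
        term n false false true  (inj₁ ())
        term n false false true  (inj₂ ())
        term n false false false _ = refl
        term′ : ∀ n T H q p → (p ≡ T ⊎ p ≡ H) → (n when not (T ∧ H)) when (q ∧ p) ≡ (n when (if T then not H else H)) when (q ∧ p)
        term′ n T H true  p h = term n T H p h
        term′ n T H false p h = refl
        balanced-crossing″ : Balanced suf (λ ix → y* ix when not (both suf (proj₁ ix))) → Balanced suf t
        balanced-crossing″ bal j =
          trans (S-cong λ (a , i) → sym (term′ (y* (a , i)) (χ suf (tl a)) (χ suf (hd a)) (toℕ i ≡ᵇ toℕ j) _ (inj₂ refl)))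
          (trans (bal j) (S-cong λ (a , i) → term′ (y* (a , i)) (χ suf (tl a)) (χ suf (hd a)) (toℕ i ≡ᵇ toℕ j) _ (inj₁ refl)))
    fresh-≡ : ∀ ix → fresh v suf t ix ≡ fresh v suf y* ix
    fresh-≡ (a , j) with new v suf a in eq
    ... | true  = when-true (y* (a , j)) (new⇒cross v suf a eq)
    ... | false = refl
    y″≡ : ∀ ix → overlay suf y′ t ix ≡ y′ ix + fresh v suf y* ix
    y″≡ ix = trans (overlay-new v suf y′ t (Sound.zero-ahead s′) (restrict-≡ v suf (trans (proj₂ keys) (sym restrict-t))) ix)
                   (cong (y′ ix +_) (fresh-≡ ix))
    row-signs : ∀ j → sign (row j y′) ≡ sign (row j (cut (v ∷ suf) y*))
    row-signs j = trans (lemma (j <? k)) (signs j)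
      where
      lemma : Dec (j < k) → sign (row j y′) ≡ sign (row j y)
      lemma (yes j<k) = signs-L {y′} {y} (proj₁ keys) j (∈-upTo⁺ j<k)
      -- No walk has such a number, so both rows are empty.
      lemma (no j≮k)  = cong sign (S-cong λ (a , i) → trans (none y′ a i) (sym (none y a i)))
        where
        none : ∀ z a i → z (a , i) when (toℕ i ≡ᵇ j) ≡ 0
        none z a i = when-false (z (a , i)) (≡ᵇ-false λ eq → j≮k (subst (_< k) eq (toℕ<n i)))
    W-≤ : W y′ ≤ W (cut (v ∷ suf) y*)
    W-≤ = begin
      W y′            ≡⟨ trans (sym (weight-L y′)) (cong weightP (sym Y′≡)) ⟩
      weightP Y′      ≤⟨ proj₂ (proj₂ best) ⟩
      weightP (L y)   ≡⟨ weight-L y ⟩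
      W y             ≤⟨ light ⟩
      W (cut (v ∷ suf) y*) ∎

  tables : List ℕ → List (List ℕ) → List (List ℕ)
  tables []        T = T
  tables (v ∷ suf) T = tables suf (stage v suf T)

  suffixes : List ℕ → List (List ℕ) → List (List ℕ)
  suffixes []        past = past
  suffixes (v ∷ suf) past = suffixes suf (suf ∷ past)

  ∈-suffixes : ∀ us v suf past → suf ∈ suffixes (us ++ v ∷ suf) past
  ∈-suffixes []       v suf past = later suf (here refl)
    where
    later : ∀ suf {s past} → s ∈ past → s ∈ suffixes suf past
    later []        i = i
    later (v ∷ suf) i = later suf (there i)
  ∈-suffixes (u ∷ us) v suf past = ∈-suffixes us v suf _

  tables-sound : ∀ past ord T → Above past ord → All (Represents (Sound past ord)) T →
                 All (Represents (Sound (suffixes ord past) [])) (tables ord T)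
  tables-sound past []        T above sT = sT
  tables-sound past (v ∷ suf) T above sT = tables-sound (suf ∷ past) suf (stage v suf T)
    ((λ _ eq → eq) ∷ All.map (λ ab u eq → ab u (∨-true (v ≡ᵇ u) eq)) above) (stage-sound past v suf T above sT)

  tables-complete : ∀ past ord T y* → Above past ord → All (Represents (Sound past ord)) T →
                    Valid ord y* → Complete ord y* T → Complete [] y* (tables ord T)
  tables-complete past []        T y* above sT val cp = cp
  tables-complete past (v ∷ suf) T y* above sT val cp = tables-complete (suf ∷ past) suf (stage v suf T) y*
    ((λ _ eq → eq) ∷ All.map (λ ab u eq → ab u (∨-true (v ≡ᵇ u) eq)) above) (stage-sound past v suf T above sT)
    (record { chosen = Valid.chosen val ; inRange = Valid.inRange val
            ; balanced = λ us u s eq → Valid.balanced val (v ∷ us) u s (cong (v ∷_) eq) })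
    (stage-complete past v suf T y* sT (Valid.chosen val) (Valid.balanced val [] v suf refl) (Valid.inRange val) cp)

  NonZeroRows : Labelling → Set
  NonZeroRows y = ∀ (j : Fin k) → row (toℕ j) y ≢ 0

  module _ (ord : List ℕ) (covers : ∀ a → both ord a ≡ true) where

    stages : List ⟦ StageT ⟧
    stages = mapTails (λ v suf → v , suf , states suf) ord

    solution : Maybe (List ℕ)
    solution = solveF .fun (b , c , arcs , is , ks , flags , stages , rs , tt)

    private
      start : List (List ℕ)
      start = List.map (λ _ → 0) is ∷ []

      zeros≡ : List.map (λ _ → 0) is ≡ L (λ _ → 0)
      zeros≡ = trans (cong (List.map (λ _ → 0)) is≡) (sym (map-∘ ixs))

      final : List (List ℕ)
      final = tables ord start

      tables≡ : ∀ ord T → tablesF .fun (b , c , arcs , is , ks , flags , [] , rs , tt) ≡ start →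
                List.foldl (λ T st → stageF .fun (proj₁ st , proj₁ (proj₂ st) , proj₂ (proj₂ st) , T , b , c , arcs , is , ks , flags , tt)) T
                           (mapTails (λ v suf → v , suf , states suf) ord) ≡ tables ord T
      tables≡ []        T _ = refl
      tables≡ (v ∷ suf) T h = tables≡ suf (stage v suf T) h

      query : List Bool
      query = keyL (List.map (λ _ → 1) ks) (List.map (λ _ → 0) is)

      solution≡ : solution ≡ lookupT query (table 0 [] final)
      solution≡ = cong (λ T → lookupT query (table 0 [] T)) (tables≡ ord start refl)

      start-sound : All (Represents (Sound [] ord)) start
      start-sound = ((λ _ → 0) , zeros≡ , record
        { zero-ahead = λ _ _ _ → refl ; balanced = [] ; inRange = λ a eq → false≢true eq (covers a) }) ∷ []

      cut-ord : ∀ y ix → cut ord y ix ≡ 0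
      cut-ord y (a , j) rewrite covers a = refl

      start-complete : ∀ y* → Complete ord y* start
      start-complete y* = (λ _ → 0) , here (sym zeros≡) , record
        { agree = λ a j cr → false≢true (both⇒off ord a (covers a)) cr
        ; signs = λ j → cong sign (row-cong j (λ ix → sym (cut-ord y* ix)))
        ; light = ≤-reflexive (W-cong (λ ix → sym (cut-ord y* ix))) }

      final-sound : All (Represents (Sound (suffixes ord []) [])) final
      final-sound = tables-sound [] ord start [] start-sound

      restrict-[] : ∀ y → restrictP 0 [] (L y) ≡ List.map (λ _ → 0) is
      restrict-[] y = trans (restrict-L 0 [] y) (trans (L-cong (λ (a , j) → when-false (y (a , j)) (lemma (cross (0 ∷ []) a)))) (sym zeros≡))
        where
        lemma : ∀ p → p ∧ false ≡ false
        lemma true  = refl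
        lemma false = refl

      sign≡1 : ∀ n → sign n ≡ 1 → n ≢ 0
      sign≡1 zero () _
      sign≡1 (suc n) _ ()

      ≢0⇒sign≡1 : ∀ n → n ≢ 0 → sign n ≡ 1
      ≢0⇒sign≡1 zero    ne = ⊥-elim (ne refl)
      ≢0⇒sign≡1 (suc n) ne = refl

      best : ∀ y* → Valid ord y* → NonZeroRows y* → ∃[ Y ] lookupT query (table 0 [] final) ≡ just Y × weightP Y ≤ W y*
      best y* val ne =
        let y , y∈ , ap = tables-complete [] ord start y* [] start-sound val (start-complete y*)
            Y , found , le = table-complete 0 [] final y∈
            supp≡ : suppP (L y) ≡ List.map (λ _ → 1) ks
            supp≡ = trans (supp-L y) (map-cong-∈ ks λ {j} j∈ → trans (Approximates.signs ap j)
                      (trans (cong sign (row-cong j (λ _ → refl))) (lemma (subst (j ∈_) (upTo≡map-toℕ k) j∈))))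
        in Y , trans (cong₂ (λ f r → lookupT (keyL f r) (table 0 [] final)) (sym supp≡) (sym (restrict-[] y))) found ,
           ≤-trans le (≤-trans (≤-reflexive (weight-L y)) (Approximates.light ap))
        where
        lemma : ∀ {j} → j ∈ List.map toℕ (List.allFin k) → sign (row j y*) ≡ 1
        lemma j∈ with ∈-map⁻ toℕ j∈
        ... | i , _ , refl = ≢0⇒sign≡1 _ (ne i)

    -- Comparison with the valid labellings is the right notion of minimality: every covering yields
    -- a valid labelling of the same weight, and from the labelling returned a covering of at most
    -- its weight is extracted.
    Optimal : Maybe (List ℕ) → Set
    Optimal nothing  = ∀ y → Valid ord y → ¬ NonZeroRows y
    Optimal (just Y) = ∃[ y ] Y ≡ L y × (∀ us v suf → ord ≡ us ++ v ∷ suf → Balanced suf y) × (∀ a → InRange y a) × NonZeroRows y ×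
                       (∀ y* → Valid ord y* → NonZeroRows y* → W y ≤ W y*)

    solution-optimal : Optimal solution
    solution-optimal = subst Optimal (sym solution≡) (optimal _ refl)
      where
      optimal : ∀ r → lookupT query (table 0 [] final) ≡ r → Optimal r
      optimal nothing eq y val ne with best y val ne
      ... | Y , found , _ with trans (sym eq) found
      ...   | ()
      optimal (just Y) eq =
        let (y , Y≡ , s) , key≡ = table-sound 0 [] final final-sound eq
            supp≡ , _ = keyL-injective (suppP (L y)) (List.map (λ _ → 1) ks) (restrictP 0 [] (L y)) (List.map (λ _ → 0) is)
                          (trans (trans (cong length (supp-L y)) (length-map _ ks)) (sym (length-map _ ks)))
                          (cong length (restrict-[] y)) (trans (cong (keyP 0 []) (sym Y≡)) key≡)
        in y , Y≡ , (λ us v suf eq → All.lookup (Sound.balanced s) (subst (λ o → suf ∈ suffixes o []) (sym eq) (∈-suffixes us v suf []))) ,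
           (λ a → Sound.inRange s a refl) ,
           (λ j → sign≡1 _ (map-≡⇒≗ ks (trans (sym (supp-L y)) supp≡) (subst (toℕ j ∈_) (sym (upTo≡map-toℕ k)) (∈-map⁺ toℕ (∈-allFin j))))) ,
           λ y* val ne → let Y′ , found , le = best y* val ne in
             ≤-trans (≤-reflexive (trans (sym (weight-L y)) (cong weightP (sym Y≡)))) (subst (λ Y → weightP Y ≤ W y*) (just-injective (trans (sym found) eq)) le)

sum-single : ∀ {A : Set} (f : A → ℕ) (p : A → Bool) {x₀} → p x₀ ≡ true → (∀ x → p x ≡ true → x ≡ x₀) →
             ∀ xs → Unique xs → x₀ ∈ xs → sum (List.map (λ x → f x when p x) xs) ≡ f x₀
sum-single f p {x₀} p₀ only (x ∷ xs) (x∉ ∷ u) (here refl) =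
  trans (cong₂ _+_ (cong (λ b → f x when b) p₀) (none xs x∉)) (+-identityʳ (f x))
  where
  none : ∀ xs → All (x ≢_) xs → sum (List.map (λ x → f x when p x) xs) ≡ 0
  none []       []        = refl
  none (y ∷ ys) (ne ∷ nes) with p y in eq
  ... | true  = ⊥-elim (ne (sym (only y eq)))
  ... | false = none ys nes
sum-single f p {x₀} p₀ only (x ∷ xs) (x∉ ∷ u) (there i) with p x in eq
... | true  = ⊥-elim (All.lookup x∉ i (only x eq))
... | false = sum-single f p p₀ only xs u i

concatMap-single : ∀ {A B : Set} (f : A → List B) (p : A → Bool) {x₀} → p x₀ ≡ true → (∀ x → p x ≡ true → x ≡ x₀) →
                   ∀ xs → Unique xs → x₀ ∈ xs → List.concatMap (λ x → if p x then f x else []) xs ≡ f x₀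
concatMap-single f p {x₀} p₀ only (x ∷ xs) (x∉ ∷ u) (here refl) =
  trans (cong₂ _++_ (cong (λ b → if b then f x else []) p₀) (none xs x∉)) (++-identityʳ (f x))
  where
  none : ∀ xs → All (x ≢_) xs → List.concatMap (λ x → if p x then f x else []) xs ≡ []
  none []       []        = refl
  none (y ∷ ys) (ne ∷ nes) with p y in eq
  ... | true  = ⊥-elim (ne (sym (only y eq)))
  ... | false = none ys nes
concatMap-single f p {x₀} p₀ only (x ∷ xs) (x∉ ∷ u) (there i) with p x in eq
... | true  = ⊥-elim (All.lookup x∉ i (only x eq))
... | false = concatMap-single f p p₀ only xs u i

filterᵇ-map : ∀ {A B : Set} (p : B → Bool) (f : A → B) xs → List.filterᵇ p (List.map f xs) ≡ List.map f (List.filterᵇ (p ∘ f) xs)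
filterᵇ-map p f []       = refl
filterᵇ-map p f (x ∷ xs) with p (f x)
... | true  = cong (f x ∷_) (filterᵇ-map p f xs)
... | false = filterᵇ-map p f xs

∈-filterᵇ⁻ : ∀ {A : Set} (p : A → Bool) xs {x} → x ∈ List.filterᵇ p xs → p x ≡ true
∈-filterᵇ⁻ p (x ∷ xs) i with p x in eq | i
... | true  | here refl = eq
... | true  | there i   = ∈-filterᵇ⁻ p xs i
... | false | i         = ∈-filterᵇ⁻ p xs i

∈-filterᵇ⁺ : ∀ {A : Set} (p : A → Bool) xs {x} → x ∈ xs → p x ≡ true → x ∈ List.filterᵇ p xs
∈-filterᵇ⁺ p (x ∷ xs) (here refl) eq rewrite eq = here refl
∈-filterᵇ⁺ p (x ∷ xs) (there i)   eq with p x
... | true  = there (∈-filterᵇ⁺ p xs i eq)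
... | false = ∈-filterᵇ⁺ p xs i eq

≡ᵇ-sym : ∀ x y → (x ≡ᵇ y) ≡ (y ≡ᵇ x)
≡ᵇ-sym zero    zero    = refl
≡ᵇ-sym zero    (suc y) = refl
≡ᵇ-sym (suc x) zero    = refl
≡ᵇ-sym (suc x) (suc y) = ≡ᵇ-sym x y

-- Closed trails and tours

module Walks (m : ℕ) (tl hd : Fin m → ℕ) (distinct : ∀ {a a′} → tl a ≡ tl a′ → hd a ≡ hd a′ → a ≡ a′) where

  Arc : Set
  Arc = Fin m

  same : Arc → Arc → Bool
  same a a′ = sameArcF .fun ((tl a , hd a) , (tl a′ , hd a′) , tt)

  same-refl : ∀ a → same a a ≡ true
  same-refl a rewrite ≡ᵇ-refl (tl a) | ≡ᵇ-refl (hd a) = refl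

  same⇒≡ : ∀ a a′ → same a a′ ≡ true → a ≡ a′
  same⇒≡ a a′ eq = let p , q = ∧-true {tl a ≡ᵇ tl a′} eq in distinct (≡ᵇ-true _ _ p) (≡ᵇ-true _ _ q)

  SA : (Arc → ℕ) → ℕ
  SA f = sum (List.map f (List.allFin m))

  SA-cong : ∀ {f g : Arc → ℕ} → (∀ a → f a ≡ g a) → SA f ≡ SA g
  SA-cong eq = cong sum (map-cong eq (List.allFin m))

  SA-+ : ∀ (f g : Arc → ℕ) → SA (λ a → f a + g a) ≡ SA f + SA g
  SA-+ f g = lemma (List.allFin m)
    where
    interchange : ∀ a b c d → (a + b) + (c + d) ≡ (a + c) + (b + d)
    interchange = solve-∀
    lemma : ∀ xs → sum (List.map (λ a → f a + g a) xs) ≡ sum (List.map f xs) + sum (List.map g xs)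
    lemma []       = refl
    lemma (x ∷ xs) = trans (cong (f x + g x +_) (lemma xs)) (interchange (f x) (g x) _ _)

  SA-mono : ∀ {f g : Arc → ℕ} → (∀ a → f a ≤ g a) → SA f ≤ SA g
  SA-mono {f} {g} le = lemma (List.allFin m)
    where
    lemma : ∀ xs → sum (List.map f xs) ≤ sum (List.map g xs)
    lemma []       = z≤n
    lemma (x ∷ xs) = +-mono-≤ (le x) (lemma xs)

  SA-const : ∀ n → SA (λ _ → n) ≡ m * n
  SA-const n = trans (lemma (List.allFin m)) (cong (_* n) (length-tabulate {n = m} id))
    where
    lemma : ∀ (xs : List Arc) → sum (List.map (λ _ → n) xs) ≡ length xs * n
    lemma []       = refl
    lemma (x ∷ xs) = cong (n +_) (lemma xs)

  SA-≥ : ∀ (f : Arc → ℕ) a → f a ≤ SA f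
  SA-≥ f a = lemma (List.allFin m) (∈-allFin a)
    where
    lemma : ∀ xs → a ∈ xs → f a ≤ sum (List.map f xs)
    lemma (x ∷ xs) (here refl) = m≤m+n (f x) _
    lemma (x ∷ xs) (there i)   = ≤-trans (lemma xs i) (m≤n+m _ (f x))

  SA-single : ∀ (f : Arc → ℕ) a → SA (λ x → f x when same x a) ≡ f a
  SA-single f a = sum-single f (λ x → same x a) (same-refl a) (λ x → same⇒≡ x a) (List.allFin m) (allFin⁺ m) (∈-allFin a)

  count : Arc → List Arc → ℕ
  count a []       = 0
  count a (b ∷ as) = 1 when same a b + count a as

  count-++ : ∀ a as bs → count a (as ++ bs) ≡ count a as + count a bs
  count-++ a []       bs = refl
  count-++ a (x ∷ as) bs = trans (cong (1 when same a x +_) (count-++ a as bs)) (sym (+-assoc (1 when same a x) _ _))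

  SA-count : ∀ (f : Arc → ℕ) as → SA (λ a → f a * count a as) ≡ sum (List.map f as)
  SA-count f []       = trans (SA-cong (λ a → *-zeroʳ (f a))) (trans (SA-const 0) (*-zeroʳ m))
  SA-count f (b ∷ as) = trans (SA-cong (λ a → trans (*-distribˡ-+ (f a) (1 when same a b) (count a as)) (cong (_+ f a * count a as) (lemma a (same a b)))))
    (trans (SA-+ _ _) (cong₂ _+_ (SA-single f b) (SA-count f as)))
    where
    lemma : ∀ a p → f a * (1 when p) ≡ f a when p
    lemma a true  = *-identityʳ (f a)
    lemma a false = *-zeroʳ (f a)

  SA-length : ∀ as → SA (λ a → count a as) ≡ length as
  SA-length as = trans (SA-cong (λ a → sym (+-identityʳ (count a as)))) (trans (SA-count (λ _ → 1) as) (lemma as))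
    where
    lemma : ∀ (as : List Arc) → sum (List.map (λ _ → 1) as) ≡ length as
    lemma []       = refl
    lemma (a ∷ as) = cong suc (lemma as)

  ∈-count : ∀ {a as} → a ∈ as → 1 ≤ count a as
  ∈-count {a} (here refl) rewrite same-refl a = s≤s z≤n
  ∈-count {a} {b ∷ as} (there i) = ≤-trans (∈-count i) (m≤n+m _ (1 when same a b))

  count-∈ : ∀ a as → 1 ≤ count a as → a ∈ as
  count-∈ a (b ∷ as) le with same a b in eq
  ... | true  = here (same⇒≡ a b eq)
  ... | false = there (count-∈ a as le)

  data Walk : ℕ → List Arc → ℕ → Set where
    []  : ∀ {u} → Walk u [] u
    _∷_ : ∀ {u v a as} → tl a ≡ u → Walk (hd a) as v → Walk u (a ∷ as) v

  -- A walk kept as a stack, with its last arc on top.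
  data RWalk (u : ℕ) : List Arc → ℕ → Set where
    []  : RWalk u [] u
    _∷_ : ∀ {v w a as} → tl a ≡ v × hd a ≡ w → RWalk u as v → RWalk u (a ∷ as) w

  -- The lists mirror the unary multiplicities of `RestT`; the proofs look only at their lengths
  -- `left`.
  Rest : Set
  Rest = Arc → List ℕ

  left : Rest → Arc → ℕ
  left ns a = length (ns a)

  pair : Arc → ℕ × ℕ
  pair a = tl a , hd a

  conc : Rest → ⟦ RestT ⟧
  conc ns = List.map (λ a → pair a , ns a) (List.allFin m)

  available : Rest → ℕ → List Arc
  available ns v = List.filterᵇ (λ a → (tl a ≡ᵇ v) ∧ not (List.null (ns a))) (List.allFin m)

  tailL : List ℕ → List ℕ
  tailL ns = elimL ns [] (λ _ ns → ns)

  remove : Arc → Rest → Rest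
  remove a ns x = if same x a then tailL (ns x) else ns x

  pick-conc : ∀ ns v → pickF .fun (v , conc ns , tt) ≡ List.map (λ a → pair a , ns a) (available ns v)
  pick-conc ns v = filterᵇ-map _ (λ a → pair a , ns a) (List.allFin m)

  remove-conc : ∀ a ns → removeF .fun (pair a , conc ns , tt) ≡ conc (remove a ns)
  remove-conc a ns = trans (sym (map-∘ (List.allFin m))) (map-cong (λ x → lemma x (same x a)) (List.allFin m))
    where
    lemma : ∀ x p → (if p then (pair x , tailL (ns x)) else (pair x , ns x)) ≡ (pair x , (if p then tailL (ns x) else ns x))
    lemma x true  = refl
    lemma x false = refl

  Dead : Rest → ℕ → Set
  Dead ns v = ∀ a → tl a ≡ v → left ns a ≡ 0

  private
    null-left : ∀ (xs : List ℕ) → not (List.null xs) ≡ true → 1 ≤ length xs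
    null-left (x ∷ xs) _ = s≤s z≤n

    left-null : ∀ (xs : List ℕ) → 1 ≤ length xs → not (List.null xs) ≡ true
    left-null (x ∷ xs) _ = refl

  available⁻ : ∀ ns v {a as} → available ns v ≡ a ∷ as → tl a ≡ v × 1 ≤ left ns a
  available⁻ ns v {a} eq =
    let p , q = ∧-true {tl a ≡ᵇ v} (∈-filterᵇ⁻ _ (List.allFin m) (subst (a ∈_) (sym eq) (here refl)))
    in ≡ᵇ-true _ _ p , null-left (ns a) q

  available-[] : ∀ ns v → available ns v ≡ [] → Dead ns v
  available-[] ns v eq a tl≡ with left ns a in le
  ... | zero  = refl
  ... | suc n with subst (a ∈_) eq (∈-filterᵇ⁺ _ (List.allFin m) (∈-allFin a)
                     (∧-true⁺ (trans (cong (_≡ᵇ v) tl≡) (≡ᵇ-refl v)) (left-null (ns a) (≤-trans (s≤s z≤n) (≤-reflexive (sym le))))))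
  ...   | ()

  left-remove : ∀ a ns → 1 ≤ left ns a → ∀ x → left (remove a ns) x + 1 when same x a ≡ left ns x
  left-remove a ns le x with same x a in eq
  ... | false = +-identityʳ _
  ... | true with same⇒≡ x a eq
  ...   | refl = lemma (ns a) le
    where
    lemma : ∀ (xs : List ℕ) → 1 ≤ length xs → length (tailL xs) + 1 ≡ length xs
    lemma (x ∷ xs) _ = +-comm (length xs) 1

  remove-≤ : ∀ a ns x → left (remove a ns) x ≤ left ns x
  remove-≤ a ns x with same x a
  ... | false = ≤-refl
  ... | true  = lemma (ns x)
    where
    lemma : ∀ (xs : List ℕ) → length (tailL xs) ≤ length xs
    lemma []       = z≤n
    lemma (x ∷ xs) = n≤1+n _

  outs ins : Rest → ℕ → ℕ
  outs ns v = SA (λ a → left ns a when (tl a ≡ᵇ v))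
  ins  ns v = SA (λ a → left ns a when (hd a ≡ᵇ v))

  private
    removed : ∀ (p : Arc → Bool) a ns → 1 ≤ left ns a →
              SA (λ x → left (remove a ns) x when p x) + 1 when p a ≡ SA (λ x → left ns x when p x)
    removed p a ns le = trans (cong (SA (λ x → left (remove a ns) x when p x) +_) (sym (SA-single (λ x → 1 when p x) a)))
      (trans (sym (SA-+ _ _)) (SA-cong λ x → lemma x (p x) (same x a) (left-remove a ns le x)))
      where
      lemma : ∀ x q s → left (remove a ns) x + 1 when s ≡ left ns x →
              left (remove a ns) x when q + (1 when q) when s ≡ left ns x when q
      lemma x true  s     eq = eq
      lemma x false true  eq = refl
      lemma x false false eq = refl

  size-remove : ∀ a ns → 1 ≤ left ns a → SA (left (remove a ns)) + 1 ≡ SA (left ns)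
  size-remove a ns = removed (λ _ → true) a ns

  Flow : Rest → ℕ → ℕ → Set
  Flow ns cur w = ∀ v → outs ns v + 1 when (v ≡ᵇ w) ≡ ins ns v + 1 when (v ≡ᵇ cur)

  flow-push : ∀ {a} ns {w} → 1 ≤ left ns a → Flow ns (tl a) w → Flow (remove a ns) (hd a) w
  flow-push {a} ns {w} le fl v = +-cancelʳ-≡ (1 when (v ≡ᵇ tl a)) _ _ (begin
    outs ns′ v + 1 when (v ≡ᵇ w) + 1 when (v ≡ᵇ tl a)   ≡⟨ swap (outs ns′ v) _ _ ⟩
    outs ns′ v + 1 when (v ≡ᵇ tl a) + 1 when (v ≡ᵇ w)   ≡⟨ cong (λ p → outs ns′ v + 1 when p + 1 when (v ≡ᵇ w)) (≡ᵇ-sym v (tl a)) ⟩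
    outs ns′ v + 1 when (tl a ≡ᵇ v) + 1 when (v ≡ᵇ w)   ≡⟨ cong (_+ 1 when (v ≡ᵇ w)) (removed (λ x → tl x ≡ᵇ v) a ns le) ⟩
    outs ns v + 1 when (v ≡ᵇ w)                         ≡⟨ fl v ⟩
    ins ns v + 1 when (v ≡ᵇ tl a)                       ≡⟨ cong (_+ 1 when (v ≡ᵇ tl a)) (sym (removed (λ x → hd x ≡ᵇ v) a ns le)) ⟩
    ins ns′ v + 1 when (hd a ≡ᵇ v) + 1 when (v ≡ᵇ tl a) ≡⟨ cong (λ p → ins ns′ v + 1 when p + 1 when (v ≡ᵇ tl a)) (≡ᵇ-sym (hd a) v) ⟩
    ins ns′ v + 1 when (v ≡ᵇ hd a) + 1 when (v ≡ᵇ tl a) ∎)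
    where
    open ≡-Reasoning
    ns′ = remove a ns
    swap : ∀ x y z → x + y + z ≡ x + z + y
    swap = solve-∀

  dead-outs : ∀ {ns v} → Dead ns v → outs ns v ≡ 0
  dead-outs {ns} {v} dead = trans (SA-cong lemma) (trans (SA-const 0) (*-zeroʳ m))
    where
    lemma : ∀ a → left ns a when (tl a ≡ᵇ v) ≡ 0
    lemma a with tl a ≡ᵇ v in eq
    ... | true  = dead a (≡ᵇ-true _ _ eq)
    ... | false = refl

  flow-stuck : ∀ ns {cur w} → Flow ns cur w → Dead ns cur → cur ≡ w
  flow-stuck ns {cur} {w} fl dead = ≡ᵇ-true cur w (lemma (cur ≡ᵇ w) (trans (sym (cong (_+ 1 when (cur ≡ᵇ w)) (dead-outs {ns} dead))) (trans (fl cur) (cong (λ p → ins ns cur + 1 when p) (≡ᵇ-refl cur)))))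
    where
    lemma : ∀ p → 1 when p ≡ ins ns cur + 1 → p ≡ true
    lemma true  _  = refl
    lemma false eq with trans eq (+-comm (ins ns cur) 1)
    ... | ()

  flow-shift : ∀ ns {v w} → Flow ns v v → Flow ns w w
  flow-shift ns {v} {w} fl x = cong (_+ 1 when (x ≡ᵇ w)) (+-cancelʳ-≡ (1 when (x ≡ᵇ v)) _ _ (fl x))

  dead-remove : ∀ {a ns v} → Dead ns v → Dead (remove a ns) v
  dead-remove {a} {ns} dead x tl≡ = n≤0⇒n≡0 (≤-trans (remove-≤ a ns x) (≤-reflexive (dead x tl≡)))

  iterate : {A : Set} → (A → A) → ℕ → A → A
  iterate f zero    x = x
  iterate f (suc n) x = iterate f n (f x)

  foldl-iterate : ∀ {A B C : Set} (f : A → A) (g : C → C) (h : A → C) → (∀ x → g (h x) ≡ h (f x)) →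
                  ∀ (xs : List B) x → List.foldl (λ q _ → g q) (h x) xs ≡ h (iterate f (length xs) x)
  foldl-iterate f g h eq []       x = refl
  foldl-iterate f g h eq (_ ∷ xs) x = trans (cong (λ q → List.foldl (λ q _ → _) q xs) (eq x)) (foldl-iterate f g h eq xs (f x))

  Trail : Set
  Trail = ℕ × List Arc × Rest

  concTrail : Trail → ⟦ TrailT ⟧
  concTrail (cur , st , ns) = cur , List.map pair st , conc ns

  greedy : Trail → Trail
  greedy (cur , st , ns) = elimL (available ns cur) (cur , st , ns) (λ a _ → hd a , a ∷ st , remove a ns)

  greedy-conc : ∀ s → greedyF .fun (concTrail s , tt) ≡ concTrail (greedy s)
  greedy-conc (cur , st , ns) = trans
    (cong (λ r → elimL r (concTrail (cur , st , ns))
                         (λ x _ → proj₂ (proj₁ x) , proj₁ x ∷ List.map pair st , removeF .fun (proj₁ x , conc ns , tt))) (pick-conc ns cur))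
    (lemma (available ns cur))
    where
    lemma : ∀ as → elimL (List.map (λ a → pair a , ns a) as) (concTrail (cur , st , ns))
                     (λ x _ → proj₂ (proj₁ x) , proj₁ x ∷ List.map pair st , removeF .fun (proj₁ x , conc ns , tt)) ≡
                   concTrail (elimL as (cur , st , ns) (λ a _ → hd a , a ∷ st , remove a ns))
    lemma []       = refl
    lemma (a ∷ as) = cong (λ r → hd a , pair a ∷ List.map pair st , r) (remove-conc a ns)

  module Greedy (u : ℕ) (ns₀ : Rest) where

    record Inv (s : Trail) : Set where
      field
        walk  : RWalk u (proj₁ (proj₂ s)) (proj₁ s)
        flow  : Flow (proj₂ (proj₂ s)) (proj₁ s) u
        total : ∀ a → left (proj₂ (proj₂ s)) a + count a (proj₁ (proj₂ s)) ≡ left ns₀ a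

    greedy-inv : ∀ {s} → Inv s → Inv (greedy s)
    greedy-inv {cur , st , ns} i with available ns cur in eq
    ... | []     = i
    ... | a ∷ as = let tl≡ , le = available⁻ ns cur eq in record
      { walk  = (tl≡ , refl) ∷ Inv.walk i
      ; flow  = flow-push ns le (subst (λ v → Flow ns v u) (sym tl≡) (Inv.flow i))
      ; total = λ x → trans (sym (+-assoc (left (remove a ns) x) (1 when same x a) (count x st)))
                            (trans (cong (_+ count x st) (left-remove a ns le x)) (Inv.total i x)) }

    Stuck : Trail → Set
    Stuck (cur , st , ns) = Dead ns cur

    -- Each effective step uses up an arc, and a stuck trail is a fixed point of `greedy`, so that
    -- surplus fuel does no harm.
    greedy-stuck : ∀ n s → SA (left (proj₂ (proj₂ s))) ≤ n → Inv s →
                   Inv (iterate greedy n s) × Stuck (iterate greedy n s)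
    greedy-stuck zero (cur , st , ns) le i =
      i , λ a _ → n≤0⇒n≡0 (≤-trans (SA-≥ (left ns) a) le)
    greedy-stuck (suc n) s@(cur , st , ns) le i with available ns cur in eq | greedy-inv i
    ... | []     | i′ = fixed n (available-[] ns cur eq)
      where
      fixed : ∀ n → Dead ns cur → Inv (iterate greedy n s) × Stuck (iterate greedy n s)
      fixed zero    dead = i , dead
      fixed (suc n) dead rewrite eq = fixed n dead
    ... | a ∷ as | i′ = greedy-stuck n (hd a , a ∷ st , remove a ns)
      (≤-pred (≤-trans (≤-reflexive (trans (+-comm 1 _) (size-remove a ns (proj₂ (available⁻ ns cur eq))))) le)) i′

    closed : ∀ {s} → Inv s → Stuck s → RWalk u (proj₁ (proj₂ s)) u × Flow (proj₂ (proj₂ s)) u u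
    closed {cur , st , ns} i dead with flow-stuck ns (Inv.flow i) dead
    ... | refl = Inv.walk i , Inv.flow i

  Tour : Set
  Tour = ℕ × List Arc × List Arc × Rest

  concTour : Tour → ⟦ TourT ⟧
  concTour (cur , st , out , ns) = cur , List.map pair st , List.map pair out , conc ns

  tour : Tour → Tour
  tour (cur , st , out , ns) = elimL (available ns cur)
    (elimL st (cur , st , out , ns) (λ a st → tl a , st , a ∷ out , ns))
    (λ a _ → hd a , a ∷ st , out , remove a ns)

  tour-conc : ∀ s → tourF .fun (concTour s , tt) ≡ concTour (tour s)
  tour-conc (cur , st , out , ns) = trans
    (cong (λ r → elimL r pop push) (pick-conc ns cur)) (lemma (available ns cur) st)
    where
    pop : ⟦ TourT ⟧
    pop = elimL (List.map pair st) (concTour (cur , st , out , ns)) (λ x xs → proj₁ x , xs , x ∷ List.map pair out , conc ns)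
    push : (ℕ × ℕ) × List ℕ → ⟦ RestT ⟧ → ⟦ TourT ⟧
    push x _ = proj₂ (proj₁ x) , proj₁ x ∷ List.map pair st , List.map pair out , removeF .fun (proj₁ x , conc ns , tt)
    lemma : ∀ as st′ → elimL (List.map (λ a → pair a , ns a) as)
                         (elimL (List.map pair st′) (concTour (cur , st , out , ns)) (λ x xs → proj₁ x , xs , x ∷ List.map pair out , conc ns)) push ≡
                       concTour (elimL as (elimL st′ (cur , st , out , ns) (λ a st → tl a , st , a ∷ out , ns)) (λ a _ → hd a , a ∷ st , out , remove a ns))
    lemma []       []      = refl
    lemma []       (_ ∷ _) = refl
    lemma (a ∷ as) _       = cong (λ r → hd a , pair a ∷ List.map pair st , List.map pair out , r) (remove-conc a ns)

  module Touring (u : ℕ) (st₀ : List Arc) (ns₀ : Rest) where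

    record Inv (s : Tour) : Set where
      field
        w     : ℕ
        walk  : RWalk u (proj₁ (proj₂ s)) (proj₁ s)
        done  : Walk w (proj₁ (proj₂ (proj₂ s))) u
        flow  : Flow (proj₂ (proj₂ (proj₂ s))) (proj₁ s) w
        dead  : ∀ {a} → a ∈ proj₁ (proj₂ (proj₂ s)) → Dead (proj₂ (proj₂ (proj₂ s))) (hd a)
        total : ∀ a → left (proj₂ (proj₂ (proj₂ s))) a + count a (proj₁ (proj₂ s)) + count a (proj₁ (proj₂ (proj₂ s))) ≡ left ns₀ a + count a st₀
        fewer : ∀ a → left (proj₂ (proj₂ (proj₂ s))) a ≤ left ns₀ a

    Done : Tour → Set
    Done (cur , st , out , ns) = st ≡ [] × Dead ns cur

    potential : Tour → ℕ
    potential (cur , st , out , ns) = SA (left ns) + SA (left ns) + length st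

    tour-done : ∀ n s → potential s ≤ n → Inv s → Inv (iterate tour n s) × Done (iterate tour n s)
    tour-done zero (cur , st , out , ns) le i =
      i , length-0 st (n≤0⇒n≡0 (≤-trans (m≤n+m _ (SA (left ns) + SA (left ns))) le)) ,
      λ a _ → n≤0⇒n≡0 (≤-trans (SA-≥ (left ns) a) (≤-trans (m≤m+n _ _) (≤-trans (m≤m+n _ _) le)))
      where
      length-0 : ∀ (xs : List Arc) → length xs ≡ 0 → xs ≡ []
      length-0 [] _ = refl
    tour-done (suc n) s@(cur , st , out , ns) le i with available ns cur in eq
    ... | a ∷ as = let tl≡ , 1≤ = available⁻ ns cur eq in
      tour-done n (hd a , a ∷ st , out , remove a ns)
        (≤-pred (≤-trans (≤-reflexive (lemma (SA (left (remove a ns))) (SA (left ns)) (length st) (size-remove a ns 1≤))) le)) record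
        { w = Inv.w i ; walk = (tl≡ , refl) ∷ Inv.walk i ; done = Inv.done i
        ; flow  = flow-push ns 1≤ (subst (λ v → Flow ns v (Inv.w i)) (sym tl≡) (Inv.flow i))
        ; dead  = λ b∈ → dead-remove {a} {ns} (Inv.dead i b∈)
        ; total = λ x → trans (cong (_+ count x out) (trans (sym (+-assoc (left (remove a ns) x) (1 when same x a) (count x st)))
                                                            (cong (_+ count x st) (left-remove a ns 1≤ x)))) (Inv.total i x)
        ; fewer = λ x → ≤-trans (remove-≤ a ns x) (Inv.fewer i x) }
      where
      lemma : ∀ x y l → x + 1 ≡ y → suc (x + x + suc l) ≡ y + y + l
      lemma x _ l refl = arith x l
        where
        arith : ∀ x l → 1 + (x + x + (1 + l)) ≡ x + 1 + (x + 1) + l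
        arith = solve-∀
    tour-done (suc n) s@(cur , [] , out , ns) le i | [] = fixed n
      where
      fixed : ∀ n → Inv (iterate tour n s) × Done (iterate tour n s)
      fixed zero    = i , refl , available-[] ns cur eq
      fixed (suc n) rewrite eq = fixed n
    tour-done (suc n) s@(cur , a ∷ st , out , ns) le i | [] =
      tour-done n (tl a , st , a ∷ out , ns) (≤-pred (≤-trans (≤-reflexive (sym (+-suc _ (length st)))) le)) (pop (Inv.walk i))
      where
      cur-dead : Dead ns cur
      cur-dead = available-[] ns cur eq
      pop : RWalk u (a ∷ st) cur → Inv (tl a , st , a ∷ out , ns)
      pop ((refl , refl) ∷ r) = record
        { w = tl a ; walk = r
        ; done  = refl ∷ subst (λ v → Walk v out u) (sym cur≡w) (Inv.done i)
        ; flow  = flow-shift ns (subst (Flow ns (hd a)) (sym cur≡w) (Inv.flow i))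
        ; dead  = λ { (here refl) → cur-dead ; (there b∈) → Inv.dead i b∈ }
        ; total = λ x → trans (shuffle (left ns x) (count x st) (1 when same x a) (count x out)) (Inv.total i x)
        ; fewer = Inv.fewer i }
        where
        cur≡w : hd a ≡ Inv.w i
        cur≡w = flow-stuck ns (Inv.flow i) cur-dead
        shuffle : ∀ p q r t → p + q + (r + t) ≡ p + (r + q) + t
        shuffle = solve-∀

    record Result (out : List Arc) (ns : Rest) : Set where
      field
        walk  : Walk u out u
        flow  : Flow ns u u
        deadᵤ : Dead ns u
        dead  : ∀ {a} → a ∈ out → Dead ns (hd a)
        total : ∀ a → left ns a + count a out ≡ left ns₀ a + count a st₀
        fewer : ∀ a → left ns a ≤ left ns₀ a

    result : ∀ {s} → Inv s → Done s → Result (proj₁ (proj₂ (proj₂ s))) (proj₂ (proj₂ (proj₂ s)))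
    result {cur , .[] , out , ns} i (refl , dead) with Inv.walk i
    ... | [] with flow-stuck ns (Inv.flow i) dead
    ...   | eq = record
      { walk = subst (λ v → Walk v out u) (sym eq) (Inv.done i) ; flow = subst (Flow ns u) (sym eq) (Inv.flow i)
      ; deadᵤ = dead ; dead = Inv.dead i
      ; total = λ a → trans (cong (_+ count a out) (sym (+-identityʳ (left ns a)))) (Inv.total i a) ; fewer = Inv.fewer i }

    touring : ∀ n → RWalk u st₀ u → Flow ns₀ u u → SA (left ns₀) + SA (left ns₀) + length st₀ ≤ n →
          let s = iterate tour n (u , st₀ , [] , ns₀) in Result (proj₁ (proj₂ (proj₂ s))) (proj₂ (proj₂ (proj₂ s)))
    touring n r fl le = result (proj₁ end) (proj₂ end)
      where
      start : Inv (u , st₀ , [] , ns₀)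
      start = record { w = u ; walk = r ; done = [] ; flow = fl ; dead = λ () ; total = λ a → +-identityʳ _ ; fewer = λ _ → ≤-refl }
      end = tour-done n (u , st₀ , [] , ns₀) le start

elimL-map : ∀ {A B C : Set} (f : A → B) xs {c : C} {g : B → C} → elimL (List.map f xs) c (λ x _ → g x) ≡ elimL xs c (λ x _ → g (f x))
elimL-map f []       = refl
elimL-map f (x ∷ xs) = refl

concatMap-map′ : ∀ {A B C : Set} (f : B → List C) (g : A → B) xs → List.concatMap f (List.map g xs) ≡ List.concatMap (f ∘ g) xs
concatMap-map′ f g []       = refl
concatMap-map′ f g (x ∷ xs) = cong (f (g x) ++_) (concatMap-map′ f g xs)

length-below : ∀ y s n → y ≤ s + n → s ≤ y → length (List.filterᵇ (λ i → not (y ≤ᵇ i)) (List.applyUpTo (s +_) n)) + s ≡ y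
length-below y s zero    y≤ s≤ = ≤-antisym s≤ (≤-trans y≤ (≤-reflexive (+-identityʳ s)))
length-below y s (suc n) y≤ s≤ with y ≤ᵇ s + 0 in eq
... | true  = trans (cong (_+ s) (none n 1)) (≤-antisym s≤ y≤s)
  where
  y≤s : y ≤ s
  y≤s = ≤-trans (≤ᵇ-true y (s + 0) eq) (≤-reflexive (+-identityʳ s))
  none : ∀ n d → length (List.filterᵇ (λ i → not (y ≤ᵇ i)) (List.applyUpTo (λ x → s + (d + x)) n)) ≡ 0
  none zero    d = refl
  none (suc n) d rewrite ≤⇒≤ᵇ-true (≤-trans y≤s (m≤m+n s (d + 0))) =
    trans (cong (λ xs → length (List.filterᵇ (λ i → not (y ≤ᵇ i)) xs)) (applyUpTo-cong n (λ x → cong (s +_) (+-suc d x)))) (none n (suc d))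
    where
    applyUpTo-cong : ∀ {f g : ℕ → ℕ} n → (∀ x → f x ≡ g x) → List.applyUpTo f n ≡ List.applyUpTo g n
    applyUpTo-cong zero    h = refl
    applyUpTo-cong (suc n) h = cong₂ _∷_ (h 0) (applyUpTo-cong n (h ∘ suc))
... | false = trans (sym (+-suc _ s)) (trans (cong (λ xs → length (List.filterᵇ (λ i → not (y ≤ᵇ i)) xs) + suc s) (applyUpTo-cong n (+-suc s)))
                (length-below y (suc s) n (≤-trans y≤ (≤-reflexive (+-suc s n))) s<))
  where
  s< : suc s ≤ y
  s< = ≰⇒> λ y≤s → subst T eq (≤⇒≤ᵇ (≤-trans y≤s (m≤m+n s 0)))
  applyUpTo-cong : ∀ {f g : ℕ → ℕ} n → (∀ x → f x ≡ g x) → List.applyUpTo f n ≡ List.applyUpTo g n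
  applyUpTo-cong zero    h = refl
  applyUpTo-cong (suc n) h = cong₂ _∷_ (h 0) (applyUpTo-cong n (h ∘ suc))

-- Extraction of closed walks from a labelling

module Extraction (m k : ℕ) (tl hd w : Fin m → ℕ) (tl≢hd : ∀ a → tl a ≢ hd a)
                  (distinct : ∀ {a a′} → tl a ≡ tl a′ → hd a ≡ hd a′ → a ≡ a′) (b c : ℕ) where
  open Walks m tl hd distinct
  private module D = DP m k tl hd w tl≢hd distinct b c
  open Labels m k

  SK : (Fin k → ℕ) → ℕ
  SK f = sum (List.map f (List.allFin k))

  Even : Rest → Set
  Even ns = ∀ v → outs ns v ≡ ins ns v

  even⇒flow : ∀ ns {u} → Even ns → Flow ns u u
  even⇒flow ns even v = cong (_+ _) (even v)

  flow⇒even : ∀ ns {u} → Flow ns u u → Even ns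
  flow⇒even ns {u} fl v = +-cancelʳ-≡ (1 when (v ≡ᵇ u)) _ _ (fl v)

  fuel : List ℕ
  fuel = List.concatMap (λ _ → D.rs ++ D.rs) D.arcs

  length-fuel : length fuel ≡ m * (c + 1 + (c + 1))
  length-fuel = trans (length-concatMap (λ _ → D.rs ++ D.rs) (λ _ → trans (length-++ D.rs) (cong₂ _+_ (length-upTo (c + 1)) (length-upTo (c + 1)))) D.arcs)
                      (cong (_* (c + 1 + (c + 1))) (trans (length-map D.arc (List.allFin m)) (length-tabulate {n = m} id)))

  tours : List Trail → Rest → List (List Arc) × Rest
  tours []                 ns = [] , ns
  tours ((u , st , _) ∷ ts) ns =
    let s = iterate tour (length fuel) (u , st , [] , ns) ; outs , ns′ = tours ts (proj₂ (proj₂ (proj₂ s)))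
    in proj₁ (proj₂ (proj₂ s)) ∷ outs , ns′

  tours-conc : ∀ ts ns → mapAcc (λ t R → walkF .fun (t , R , fuel , tt)) (conc ns) (List.map concTrail ts) ≡
                         List.map (List.map pair) (proj₁ (tours ts ns))
  tours-conc []                   ns = refl
  tours-conc ((u , st , ns′) ∷ ts) ns =
    cong₂ _∷_ (cong (λ s → proj₁ (proj₂ (proj₂ s))) end)
              (trans (cong (λ R → mapAcc (λ t R → walkF .fun (t , R , fuel , tt)) R (List.map concTrail ts)) (cong (λ s → proj₂ (proj₂ (proj₂ s))) end))
                     (tours-conc ts _))
    where
    end : List.foldl (λ q _ → tourF .fun (q , tt)) (concTour (u , st , [] , ns)) fuel ≡ concTour (iterate tour (length fuel) (u , st , [] , ns))
    end = foldl-iterate tour (λ q → tourF .fun (q , tt)) concTour tour-conc fuel (u , st , [] , ns)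

  stacks : Arc → List Trail → ℕ
  stacks a ts = sum (List.map (λ t → count a (proj₁ (proj₂ t))) ts)

  Closed : List Arc → Set
  Closed as = as ≢ [] × ∃[ u ] Walk u as u

  Ready : Trail → Set
  Ready (u , st , _) = RWalk u st u × st ≢ []

  record ToursResult (ts : List Trail) (ns : Rest) (os : List (List Arc)) (ns′ : Rest) : Set where
    field
      closed : All Closed os
      number : length os ≡ length ts
      dead   : ∀ {a} → a ∈ List.concat os → Dead ns′ (hd a)
      even   : Even ns′
      total  : ∀ a → left ns′ a + count a (List.concat os) ≡ left ns a + stacks a ts
      fewer  : ∀ a → left ns′ a ≤ left ns a

  record Extracted (y : Labelling) : Set where
    field
      {walks}  : List (List Arc)
      unused   : Rest
      extract≡ : extractF .fun (D.arcs , D.ks , D.is , D.rs , L y , tt) ≡ List.map (List.map pair) walks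
      closed   : All Closed walks
      number   : length walks ≡ k
      dead     : ∀ {a} → a ∈ List.concat walks → Dead unused (hd a)
      even     : Even unused
      total    : ∀ a → left unused a + count a (List.concat walks) ≡ SK (λ j → y (a , j))

  tours-result : ∀ ts ns → All Ready ts → Even ns → (∀ a → left ns a + stacks a ts ≤ c) →
                 ToursResult ts ns (proj₁ (tours ts ns)) (proj₂ (tours ts ns))
  tours-result [] ns [] even le = record
    { closed = [] ; number = refl ; dead = λ () ; even = even ; total = λ a → refl ; fewer = λ a → ≤-refl }
  tours-result ((u , st , _) ∷ ts) ns ((r , st≢) ∷ rs) even le = record
    { closed = (nonempty , u , R.walk) ∷ T.closed
    ; number = cong suc T.number
    ; dead   = λ {a} i → dead a (∈-++⁻ out i)
    ; even   = T.even
    ; total  = λ a → trans (cong (left (proj₂ rest) a +_) (count-++ a out _)) (trans (shuffle (left (proj₂ rest) a) (count a out) _)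
                 (trans (cong (_+ count a out) (T.total a)) (trans (shuffle′ (left ns′ a) _ (count a out)) (trans (cong (_+ stacks a ts) (R.total a)) (+-assoc (left ns a) _ _)))))
    ; fewer  = λ a → ≤-trans (T.fewer a) (R.fewer a) }
    where
    s = iterate tour (length fuel) (u , st , [] , ns)
    out = proj₁ (proj₂ (proj₂ s))
    ns′ = proj₂ (proj₂ (proj₂ s))
    rest = tours ts ns′
    enough : SA (left ns) + SA (left ns) + length st ≤ length fuel
    enough = begin
      SA (left ns) + SA (left ns) + length st                 ≡⟨ cong (SA (left ns) + SA (left ns) +_) (sym (SA-length st)) ⟩
      SA (left ns) + SA (left ns) + SA (λ a → count a st)     ≡⟨ trans (cong (_+ SA (λ a → count a st)) (sym (SA-+ _ _))) (sym (SA-+ _ _)) ⟩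
      SA (λ a → left ns a + left ns a + count a st)           ≤⟨ SA-mono bound ⟩
      SA (λ _ → c + 1 + (c + 1))                              ≡⟨ SA-const (c + 1 + (c + 1)) ⟩
      m * (c + 1 + (c + 1))                                   ≡⟨ sym length-fuel ⟩
      length fuel                                             ∎
      where
      open ≤-Reasoning
      bound : ∀ a → left ns a + left ns a + count a st ≤ c + 1 + (c + 1)
      bound a = ≤-trans (≤-reflexive (+-assoc (left ns a) _ _)) (+-mono-≤
        (≤-trans (m≤m+n (left ns a) _) (≤-trans (le a) (m≤m+n c 1)))
        (≤-trans (+-monoʳ-≤ (left ns a) (m≤m+n (count a st) _)) (≤-trans (le a) (m≤m+n c 1))))
    module R = Touring.Result (Touring.touring u st ns (length fuel) r (even⇒flow ns even) enough)
    module T = ToursResult (tours-result ts ns′ rs (flow⇒even ns′ R.flow) (λ a → ≤-trans (+-monoˡ-≤ (stacks a ts) (≤-trans (m≤m+n (left ns′ a) (count a out))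
                  (≤-reflexive (R.total a)))) (≤-trans (≤-reflexive (+-assoc (left ns a) _ _)) (le a))))
    shuffle : ∀ x y z → x + (y + z) ≡ x + z + y
    shuffle = solve-∀
    shuffle′ : ∀ x y z → x + y + z ≡ x + z + y
    shuffle′ = solve-∀
    nonempty : out ≢ []
    nonempty out≡ = absurd st st≢ λ a a∈ → n≮n (left ns a) (begin-strict
      left ns a                    <⟨ m<m+n (left ns a) (∈-count a∈) ⟩
      left ns a + count a st       ≡⟨ sym (R.total a) ⟩
      left ns′ a + count a out     ≡⟨ trans (cong (λ o → left ns′ a + count a o) out≡) (+-identityʳ _) ⟩
      left ns′ a                   ≤⟨ R.fewer a ⟩
      left ns a                    ∎)
      where
      open ≤-Reasoning
      absurd : ∀ (st : List Arc) → st ≢ [] → (∀ a → a ∈ st → ⊥) → ⊥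
      absurd []      ne h = ne refl
      absurd (a ∷ _) ne h = h a (here refl)
    dead : ∀ a → a ∈ out ⊎ a ∈ List.concat (proj₁ rest) → Dead (proj₂ rest) (hd a)
    dead a (inj₁ i) x tl≡ = n≤0⇒n≡0 (≤-trans (T.fewer x) (≤-reflexive (R.dead i x tl≡)))
    dead a (inj₂ i) = T.dead i

  module _ (y : Labelling)
           (circulation : ∀ j v → SA (λ a → y (a , j) when (tl a ≡ᵇ v)) ≡ SA (λ a → y (a , j) when (hd a ≡ᵇ v)))
           (bounded : ∀ a → SK (λ j → y (a , j)) ≤ c) (nonzero : ∀ j → ∃[ a ] 1 ≤ y (a , j)) where

    initial : Fin k → Rest
    initial j a = List.filterᵇ (λ i → not (y (a , j) ≤ᵇ i)) D.rs

    y≤c : ∀ a j → y (a , j) ≤ c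
    y≤c a j = ≤-trans (lemma (List.allFin k) (∈-allFin j)) (bounded a)
      where
      lemma : ∀ js → j ∈ js → y (a , j) ≤ sum (List.map (λ j → y (a , j)) js)
      lemma (j ∷ js) (here refl) = m≤m+n _ _
      lemma (i ∷ js) (there i∈)  = ≤-trans (lemma js i∈) (m≤n+m _ (y (a , i)))

    left-initial : ∀ j a → left (initial j) a ≡ y (a , j)
    left-initial j a = trans (sym (+-identityʳ _)) (length-below (y (a , j)) 0 (c + 1) (≤-trans (y≤c a j) (m≤m+n c 1)) z≤n)

    even-initial : ∀ j → Even (initial j)
    even-initial j v = trans (SA-cong (λ a → cong (_when (tl a ≡ᵇ v)) (left-initial j a)))
      (trans (circulation j v) (sym (SA-cong (λ a → cong (_when (hd a ≡ᵇ v)) (left-initial j a)))))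

    row-conc : ∀ j → rowF .fun (toℕ j , D.arcs , D.is , D.rs , L y , tt) ≡ conc (initial j)
    row-conc j = trans (sym (map-∘ (List.allFin m))) (map-cong (λ a → cong (λ n → pair a , List.filterᵇ (λ i → not (n ≤ᵇ i)) D.rs) (entry a)) (List.allFin m))
      where
      entry : ∀ a → sum (List.zipWith (λ i n → n when (sameArcF .fun (proj₁ (proj₁ i) , pair a , tt) ∧ (proj₂ i ≡ᵇ toℕ j))) D.is (L y)) ≡ y (a , j)
      entry a = trans (cong sum (D.masked (λ i → sameArcF .fun (proj₁ (proj₁ i) , pair a , tt) ∧ (proj₂ i ≡ᵇ toℕ j)) y))
        (sum-single y (λ (a′ , i) → same a′ a ∧ (toℕ i ≡ᵇ toℕ j)) (∧-true⁺ (same-refl a) (≡ᵇ-refl (toℕ j)))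
          (λ (a′ , i) eq → let p , q = ∧-true {same a′ a} eq in cong₂ _,_ (same⇒≡ a′ a p) (toℕ-injective (≡ᵇ-true _ _ q)))
          ixs ixs-unique (∈-ixs (a , j)))

    -- Some arc of a nonzero row has a copy, so the default `0` does not occur. Beginning at the
    -- tail of such an arc guarantees a nonempty trail.
    origin : Fin k → ℕ
    origin j = elimL (List.filterᵇ (λ a → not (List.null (initial j a))) (List.allFin m)) 0 (λ a _ → tl a)

    origin-tail : ∀ j → ∃[ a ] origin j ≡ tl a × 1 ≤ left (initial j) a
    origin-tail j with List.filterᵇ (λ a → not (List.null (initial j a))) (List.allFin m) in eq
    ... | a ∷ as = a , refl , not-null (initial j a) (∈-filterᵇ⁻ _ (List.allFin m) (subst (a ∈_) (sym eq) (here refl)))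
      where
      not-null : ∀ (xs : List ℕ) → not (List.null xs) ≡ true → 1 ≤ length xs
      not-null (x ∷ xs) _ = s≤s z≤n
    ... | [] with nonzero j
    ...   | a , 1≤y with subst (a ∈_) eq (∈-filterᵇ⁺ _ (List.allFin m) (∈-allFin a) (not-null (initial j a) (≤-trans 1≤y (≤-reflexive (sym (left-initial j a))))))
      where
      not-null : ∀ (xs : List ℕ) → 1 ≤ length xs → not (List.null xs) ≡ true
      not-null (x ∷ xs) _ = refl
    ...     | ()

    trail : Fin k → Trail
    trail j = iterate greedy (length fuel) (origin j , [] , initial j)

    start-conc : ∀ j → startF .fun (toℕ j , fuel , D.arcs , D.is , D.rs , L y , tt) ≡ concTrail (trail j)
    start-conc j = trans
      (cong (λ R → List.foldl (λ q _ → greedyF .fun (q , tt)) (elimL (List.filterᵇ (λ r → not (List.null (proj₂ r))) R) 0 (λ r _ → proj₁ (proj₁ r)) , [] , R) fuel) (row-conc j))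
      (trans (cong (λ u → List.foldl (λ q _ → greedyF .fun (q , tt)) (u , [] , conc (initial j)) fuel)
               (trans (cong (λ rs → elimL rs 0 (λ r _ → proj₁ (proj₁ r))) (filterᵇ-map _ (λ a → pair a , initial j a) (List.allFin m))) (elimL-map (λ a → pair a , initial j a) (List.filterᵇ (λ a → not (List.null (initial j a))) (List.allFin m)))))
             (foldl-iterate greedy (λ q → greedyF .fun (q , tt)) concTrail greedy-conc fuel (origin j , [] , initial j)))

    private
      SA-initial : ∀ j → SA (left (initial j)) ≤ length fuel
      SA-initial j = ≤-trans (SA-mono (λ a → ≤-trans (≤-reflexive (left-initial j a)) (≤-trans (y≤c a j) (≤-trans (m≤m+n c 1) (m≤m+n (c + 1) (c + 1))))))
        (≤-reflexive (trans (SA-const _) (sym length-fuel)))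

      ended : ∀ j → Greedy.Inv (origin j) (initial j) (trail j) × Greedy.Stuck (origin j) (initial j) (trail j)
      ended j = Greedy.greedy-stuck (origin j) (initial j) (length fuel) _ (SA-initial j)
        (record { walk = [] ; flow = even⇒flow (initial j) (even-initial j) ; total = λ a → +-identityʳ _ })

    trail-total : ∀ j a → left (proj₂ (proj₂ (trail j))) a + count a (proj₁ (proj₂ (trail j))) ≡ y (a , j)
    trail-total j a = trans (Greedy.Inv.total (proj₁ (ended j)) a) (left-initial j a)

    trail-even : ∀ j → Even (proj₂ (proj₂ (trail j)))
    trail-even j = flow⇒even (proj₂ (proj₂ (trail j))) (proj₂ (Greedy.closed (origin j) (initial j) (proj₁ (ended j)) (proj₂ (ended j))))

    trail-origin : ∀ j → proj₁ (trail j) ≡ origin j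
    trail-origin j = flow-stuck (proj₂ (proj₂ (trail j))) (Greedy.Inv.flow (proj₁ (ended j))) (proj₂ (ended j))

    trail-ready : ∀ j → Ready (trail j)
    trail-ready j = subst (λ u → RWalk u (proj₁ (proj₂ (trail j))) u) (sym (trail-origin j))
                      (proj₁ (Greedy.closed (origin j) (initial j) (proj₁ (ended j)) (proj₂ (ended j)))) , nonempty
      where
      nonempty : proj₁ (proj₂ (trail j)) ≢ []
      -- The trail is stuck at its origin, so the arc found there with a positive label has been
      -- used up and must lie on the trail.
      nonempty st≡ with origin-tail j
      ... | a , o≡ , 1≤ = n≮n 0 (begin-strict
        0                                                   <⟨ 1≤ ⟩
        left (initial j) a                                  ≡⟨ trans (left-initial j a) (sym (trail-total j a)) ⟩
        left (proj₂ (proj₂ (trail j))) a + count a (proj₁ (proj₂ (trail j)))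
          ≡⟨ cong₂ _+_ (proj₂ (ended j) a (trans (sym o≡) (sym (trail-origin j)))) (cong (count a) st≡) ⟩
        0                                                   ∎)
        where open ≤-Reasoning

    -- What the trails leave over is pooled across all rows: only the total of an arc is
    -- constrained, not which walk traverses it.
    leftover : List (Fin k) → Rest
    leftover js a = List.concatMap (λ j → proj₂ (proj₂ (trail j)) a) js

    left-leftover : ∀ j js a → left (leftover (j ∷ js)) a ≡ left (proj₂ (proj₂ (trail j))) a + left (leftover js) a
    left-leftover j js a = length-++ (proj₂ (proj₂ (trail j)) a)

    even-leftover : ∀ js → Even (leftover js)
    even-leftover []       v = trans (SA-cong (λ a → trans (when-0 (tl a ≡ᵇ v)) (sym (when-0 (hd a ≡ᵇ v))))) refl
    even-leftover (j ∷ js) v = trans (split (λ a → tl a ≡ᵇ v)) (trans (cong₂ _+_ (trail-even j v) (even-leftover js v)) (sym (split (λ a → hd a ≡ᵇ v))))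
      where
      split : ∀ (p : Arc → Bool) → SA (λ a → left (leftover (j ∷ js)) a when p a) ≡
                                   SA (λ a → left (proj₂ (proj₂ (trail j))) a when p a) + SA (λ a → left (leftover js) a when p a)
      split p = trans (SA-cong (λ a → trans (cong (_when p a) (left-leftover j js a)) (when-+ _ _ (p a)))) (SA-+ _ _)

    leftover-total : ∀ js a → left (leftover js) a + stacks a (List.map trail js) ≡ sum (List.map (λ j → y (a , j)) js)
    leftover-total []       a = refl
    leftover-total (j ∷ js) a = trans (cong (_+ stacks a (List.map trail (j ∷ js))) (left-leftover j js a))
      (trans (interchange (left (proj₂ (proj₂ (trail j))) a) _ (count a (proj₁ (proj₂ (trail j)))) _) (cong₂ _+_ (trail-total j a) (leftover-total js a)))
      where
      interchange : ∀ p q r s → p + q + (r + s) ≡ (p + r) + (q + s)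
      interchange = solve-∀

    starts : List ⟦ TrailT ⟧
    starts = List.map (λ j → startF .fun (j , fuel , D.arcs , D.is , D.rs , L y , tt)) D.ks

    starts≡ : starts ≡ List.map concTrail (List.map trail (List.allFin k))
    starts≡ = trans (cong (List.map _) (upTo≡map-toℕ k)) (trans (sym (map-∘ (List.allFin k))) (trans (map-cong start-conc (List.allFin k)) (map-∘ (List.allFin k))))

    leftover-conc : leftoverF .fun (starts , D.arcs , tt) ≡ conc (leftover (List.allFin k))
    leftover-conc = trans (sym (map-∘ (List.allFin m))) (map-cong (λ a → cong (pair a ,_) (lemma a)) (List.allFin m))
      where
      arcs-of : ∀ a ns → List.concatMap (λ r → if sameArcF .fun (proj₁ r , pair a , tt) then proj₂ r else []) (conc ns) ≡ ns a
      arcs-of a ns = trans (concatMap-map′ _ (λ x → pair x , ns x) (List.allFin m))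
        (concatMap-single ns (λ x → same x a) (same-refl a) (λ x → same⇒≡ x a) (List.allFin m) (allFin⁺ m) (∈-allFin a))
      lemma : ∀ a → List.concatMap (λ t → List.concatMap (λ r → if sameArcF .fun (proj₁ r , pair a , tt) then proj₂ r else []) (proj₂ (proj₂ t))) starts ≡ leftover (List.allFin k) a
      lemma a = trans (cong (List.concatMap _) starts≡) (trans (concatMap-map′ _ concTrail (List.map trail (List.allFin k)))
        (trans (concatMap-map′ _ trail (List.allFin k)) (concatMap-cong (λ j → arcs-of a (proj₂ (proj₂ (trail j)))) (List.allFin k))))

    extraction : Extracted y
    extraction = record
      { unused   = proj₂ (tours ts ns)
      ; extract≡ = trans (cong₂ (mapAcc (λ t R → walkF .fun (t , R , fuel , tt))) leftover-conc starts≡) (tours-conc ts ns)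
      ; closed   = R.closed
      ; number   = trans R.number (trans (length-map trail (List.allFin k)) (length-tabulate {n = k} id))
      ; dead     = R.dead
      ; even     = R.even
      ; total    = λ a → trans (R.total a) (leftover-total (List.allFin k) a) }
      where
      ts = List.map trail (List.allFin k)
      ns = leftover (List.allFin k)
      module R = ToursResult (tours-result ts ns (All++.map⁺ (All.universal trail-ready (List.allFin k)))
        (even-leftover (List.allFin k)) (λ a → ≤-trans (≤-reflexive (leftover-total (List.allFin k) a)) (bounded a)))

when-∧ : ∀ n p q → n when (p ∧ q) ≡ (n when q) when p
when-∧ n true  q = refl
when-∧ n false q = refl

when-∨ : ∀ n p q → p ∧ q ≡ false → n when (p ∨ q) ≡ n when p + n when q
when-∨ n true  false _ = sym (+-identityʳ n)
when-∨ n false q     _ = refl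

-- Labellings and coverings

module Slices (m k : ℕ) (tl hd w : Fin m → ℕ) (tl≢hd : ∀ a → tl a ≢ hd a)
              (distinct : ∀ {a a′} → tl a ≡ tl a′ → hd a ≡ hd a′ → a ≡ a′) (b c : ℕ) where
  open Walks m tl hd distinct
  open Labels m k
  open Extraction m k tl hd w tl≢hd distinct b c using (SK; Even; ToursResult; Closed)
  private module D = DP m k tl hd w tl≢hd distinct b c

  SK-when : ∀ (f : Fin k → ℕ) p → SK (λ i → f i when p) ≡ SK f when p
  SK-when f true  = refl
  SK-when f false = lemma (List.allFin k)
    where
    lemma : ∀ (js : List (Fin k)) → sum (List.map (λ _ → 0) js) ≡ 0
    lemma []       = refl
    lemma (j ∷ js) = lemma js

  S≡SA : ∀ (f : Arc → Fin k → ℕ) → S (λ (a , i) → f a i) ≡ SA (λ a → SK (f a))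
  S≡SA f = lemma (List.allFin m)
    where
    lemma : ∀ as → sum (List.map (λ (a , i) → f a i) (List.cartesianProduct as (List.allFin k))) ≡ sum (List.map (λ a → SK (f a)) as)
    lemma []       = refl
    lemma (a ∷ as) = trans (cong sum (map-++ (λ (a , i) → f a i) (List.map (a ,_) (List.allFin k)) _))
      (trans (sum-++ (List.map (λ (a , i) → f a i) (List.map (a ,_) (List.allFin k))) _)
             (cong₂ _+_ (cong sum (sym (map-∘ (List.allFin k)))) (lemma as)))

  SK-single : ∀ (f : Fin k → ℕ) j → SK (λ i → f i when (toℕ i ≡ᵇ toℕ j)) ≡ f j
  SK-single f j = sum-single f (λ i → toℕ i ≡ᵇ toℕ j) (≡ᵇ-refl (toℕ j)) (λ i eq → toℕ-injective (≡ᵇ-true _ _ eq)) (List.allFin k) (allFin⁺ k) (∈-allFin j)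

  slice : ∀ (f : Arc → Fin k → ℕ) j → S (λ (a , i) → f a i when (toℕ i ≡ᵇ toℕ j)) ≡ SA (λ a → f a j)
  slice f j = trans (S≡SA _) (SA-cong λ a → SK-single (f a) j)

  row≡ : ∀ j y → D.row (toℕ j) y ≡ SA (λ a → y (a , j))
  row≡ j y = slice (λ a i → y (a , i)) j

  into≡ : ∀ s j y → D.into s (toℕ j) y ≡ SA (λ a → y (a , j) when D.χ s (hd a))
  into≡ s j y = trans (S-cong λ (a , i) → when-∧ (y (a , i)) (toℕ i ≡ᵇ toℕ j) (D.χ s (hd a))) (slice (λ a i → y (a , i) when D.χ s (hd a)) j)

  outof≡ : ∀ s j y → D.outof s (toℕ j) y ≡ SA (λ a → y (a , j) when D.χ s (tl a))
  outof≡ s j y = trans (S-cong λ (a , i) → when-∧ (y (a , i)) (toℕ i ≡ᵇ toℕ j) (D.χ s (tl a))) (slice (λ a i → y (a , i) when D.χ s (tl a)) j)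

  arcTotal≡ : ∀ a y → D.arcTotal a y ≡ SK (λ j → y (a , j))
  arcTotal≡ a y = trans (S≡SA (λ a′ i → y (a′ , i) when same a′ a))
    (trans (SA-cong λ a′ → SK-when (λ i → y (a′ , i)) (same a′ a)) (SA-single (λ a′ → SK (λ i → y (a′ , i))) a))

  W≡ : ∀ y → D.W y ≡ SA (λ a → w a * SK (λ j → y (a , j)))
  W≡ y = trans (S≡SA (λ a i → w a * y (a , i))) (SA-cong λ a → lemma (w a) (λ i → y (a , i)) (List.allFin k))
    where
    lemma : ∀ n (f : Fin k → ℕ) js → sum (List.map (λ i → n * f i) js) ≡ n * sum (List.map f js)
    lemma n f []       = sym (*-zeroʳ n)
    lemma n f (j ∷ js) = trans (cong (n * f j +_) (lemma n f js)) (sym (*-distribˡ-+ n (f j) _))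

  -- Stated for an arbitrary set `p` of vertices instead of a single vertex, so that it applies
  -- directly to the suffix behind any cut.
  walk-balance : ∀ (p : ℕ → Bool) {u as v} → Walk u as v →
                 SA (λ a → count a as when p (hd a)) + 1 when p u ≡ SA (λ a → count a as when p (tl a)) + 1 when p v
  walk-balance p [] = cong (_+ _) (SA-cong λ a → trans (when-0 (p (hd a))) (sym (when-0 (p (tl a)))))
  walk-balance p {as = x ∷ as} {v} (refl ∷ r) = begin
    SA (λ a → count a (x ∷ as) when p (hd a)) + 1 when p (tl x)     ≡⟨ cong (_+ 1 when p (tl x)) (split (p ∘ hd)) ⟩
    1 when p (hd x) + SA (λ a → count a as when p (hd a)) + 1 when p (tl x)
      ≡⟨ cong (_+ 1 when p (tl x)) (trans (+-comm (1 when p (hd x)) _) (walk-balance p r)) ⟩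
    SA (λ a → count a as when p (tl a)) + 1 when p v + 1 when p (tl x) ≡⟨ shuffle _ (1 when p v) (1 when p (tl x)) ⟩
    1 when p (tl x) + SA (λ a → count a as when p (tl a)) + 1 when p v ≡⟨ cong (_+ 1 when p v) (sym (split (p ∘ tl))) ⟩
    SA (λ a → count a (x ∷ as) when p (tl a)) + 1 when p v ∎
    where
    open ≡-Reasoning
    shuffle : ∀ x y z → x + y + z ≡ z + x + y
    shuffle = solve-∀
    split : ∀ (q : Arc → Bool) → SA (λ a → count a (x ∷ as) when q a) ≡ 1 when q x + SA (λ a → count a as when q a)
    split q = trans (SA-cong λ a → trans (when-+ (1 when same a x) (count a as) (q a)) (cong (_+ count a as when q a) (swap (same a x) (q a))))
                    (trans (SA-+ _ _) (cong (_+ SA (λ a → count a as when q a)) (SA-single (λ a → 1 when q a) x)))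
      where
      swap : ∀ p q → (1 when p) when q ≡ (1 when q) when p
      swap true  true  = refl
      swap true  false = refl
      swap false true  = refl
      swap false false = refl

  EvenCount : List Arc → Set
  EvenCount as = ∀ (p : ℕ → Bool) → SA (λ a → count a as when p (hd a)) ≡ SA (λ a → count a as when p (tl a))

  closed⇒even : ∀ {u as} → Walk u as u → EvenCount as
  closed⇒even {u} r p = +-cancelʳ-≡ (1 when p u) _ _ (walk-balance p r)

  even-++ : ∀ as bs → EvenCount as → EvenCount bs → EvenCount (as ++ bs)
  even-++ as bs e f p = trans (split (p ∘ hd)) (trans (cong₂ _+_ (e p) (f p)) (sym (split (p ∘ tl))))
    where
    split : ∀ (q : Arc → Bool) → SA (λ a → count a (as ++ bs) when q a) ≡ SA (λ a → count a as when q a) + SA (λ a → count a bs when q a)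
    split q = trans (SA-cong λ a → trans (cong (_when q a) (count-++ a as bs)) (when-+ (count a as) (count a bs) (q a))) (SA-+ _ _)

  even-rest : ∀ as cs ds → (∀ a → count a as ≡ count a cs + count a ds) → EvenCount as → EvenCount cs → EvenCount ds
  even-rest as cs ds eq e f p = +-cancelˡ-≡ (SA (λ a → count a cs when p (hd a))) _ _
    (trans (sym (split (p ∘ hd))) (trans (e p) (trans (split (p ∘ tl)) (cong (_+ SA (λ a → count a ds when p (tl a))) (sym (f p))))))
    where
    split : ∀ (q : Arc → Bool) → SA (λ a → count a as when q a) ≡ SA (λ a → count a cs when q a) + SA (λ a → count a ds when q a)
    split q = trans (SA-cong λ a → trans (cong (_when q a) (eq a)) (when-+ (count a cs) (count a ds) (q a))) (SA-+ _ _)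

  walk-++⁻ : ∀ as {bs u v} → Walk u (as ++ bs) v → ∃[ x ] Walk u as x × Walk x bs v
  walk-++⁻ []       r        = _ , [] , r
  walk-++⁻ (a ∷ as) (eq ∷ r) = let x , r₁ , r₂ = walk-++⁻ as r in x , eq ∷ r₁ , r₂

  Simple : List Arc → Set
  Simple as = ∀ a → count a as ≤ 1

  repeat : ∀ as → Simple as ⊎ ∃[ p ] ∃[ a ] ∃[ q ] ∃[ r ] as ≡ p ++ a ∷ q ++ a ∷ r
  repeat []       = inj₁ λ a → z≤n
  repeat (x ∷ xs) with count x xs in eq
  ... | suc n = let q , r , eq′ = ∈-∃++ (count-∈ x xs (≤-trans (s≤s z≤n) (≤-reflexive (sym eq)))) in inj₂ ([] , x , q , r , cong (x ∷_) eq′)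
  ... | zero with repeat xs
  ...   | inj₂ (p , a , q , r , eq′) = inj₂ (x ∷ p , a , q , r , cong (x ∷_) eq′)
  ...   | inj₁ s = inj₁ λ a → lemma a
    where
    lemma : ∀ a → count a (x ∷ xs) ≤ 1
    lemma a with same a x in eq′
    ... | false = s a
    ... | true with same⇒≡ a x eq′
    ...   | refl = s≤s (≤-reflexive eq)

  record Split (as : List Arc) : Set where
    field
      cycle rest : List Arc
      nonempty   : cycle ≢ []
      origin     : ℕ
      walk       : Walk origin cycle origin
      simple     : Simple cycle
      counts     : ∀ a → count a as ≡ count a cycle + count a rest

  -- Between two occurrences of an arc `a` lies the shorter closed walk `a ∷ q`, to which the
  -- recursion applies. Everything else goes to `rest`, which need not be a walk: only the counts of
  -- its arcs are used, and these are balanced by `even-rest`.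
  split-cycle : ∀ n as {u} → length as ≤ n → as ≢ [] → Walk u as u → Split as
  split-cycle n [] len ne r = ⊥-elim (ne refl)
  split-cycle (suc n) as@(_ ∷ _) {u} len ne r with repeat as
  ... | inj₁ s = record { cycle = as ; rest = [] ; nonempty = ne ; origin = u ; walk = r ; simple = s ; counts = λ a → sym (+-identityʳ _) }
  ... | inj₂ (p , a , q , z , eq) with walk-++⁻ p (subst (λ as → Walk u as u) eq r)
  ...   | _ , _ , (refl ∷ r₂) with walk-++⁻ q r₂
  ...     | _ , r₃ , (refl ∷ _) = record
    { cycle = S′.cycle ; rest = S′.rest ++ (p ++ a ∷ z) ; nonempty = S′.nonempty ; origin = S′.origin ; walk = S′.walk ; simple = S′.simple
    ; counts = λ x → begin
        count x as                                                            ≡⟨ cong (count x) eq ⟩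
        count x (p ++ a ∷ q ++ a ∷ z)                                         ≡⟨ count-++ x p _ ⟩
        count x p + (1 when same x a + count x (q ++ a ∷ z))                  ≡⟨ cong (λ n → count x p + (1 when same x a + n)) (count-++ x q _) ⟩
        count x p + (1 when same x a + (count x q + count x (a ∷ z)))         ≡⟨ shuffle (count x p) (1 when same x a) (count x q) (count x (a ∷ z)) ⟩
        count x (a ∷ q) + (count x p + count x (a ∷ z))                       ≡⟨ cong₂ _+_ (S′.counts x) (sym (count-++ x p _)) ⟩
        count x S′.cycle + count x S′.rest + count x (p ++ a ∷ z)             ≡⟨ +-assoc (count x S′.cycle) _ _ ⟩
        count x S′.cycle + (count x S′.rest + count x (p ++ a ∷ z))           ≡⟨ cong (count x S′.cycle +_) (sym (count-++ x S′.rest _)) ⟩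
        count x S′.cycle + count x (S′.rest ++ (p ++ a ∷ z)) ∎ }
    where
    open ≡-Reasoning
    shuffle : ∀ p s q z → p + (s + (q + z)) ≡ s + q + (p + z)
    shuffle = solve-∀
    shorter : length (a ∷ q) ≤ n
    shorter = ≤-pred (≤-trans (s≤s (≤-trans (m≤m+n (length (a ∷ q)) (length z)) (≤-trans (≤-reflexive (arith (length q) (length z))) (m≤n+m _ (length p)))))
      (≤-trans (≤-reflexive (sym (trans (cong length eq) (trans (length-++ p) (trans (cong (λ n → length p + suc n) (length-++ q)) (arith′ (length p) (length q) (length z))))))) len))
      where
      arith : ∀ q z → 1 + q + z ≡ q + (1 + z)
      arith = solve-∀
      arith′ : ∀ p q z → p + (1 + (q + (1 + z))) ≡ 1 + (p + (q + (1 + z)))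
      arith′ = solve-∀
    module S′ = Split (split-cycle n (a ∷ q) shorter (λ ()) (refl ∷ r₃))

  -- The arcs of a covering redistributed over the rows of a labelling. Simplicity of the rows other
  -- than 0 is what gives them labels at most 1.
  record Distributed (as : List Arc) : Set where
    field
      X       : Fin k → List Arc
      counts  : ∀ a → SK (λ j → count a (X j)) ≡ count a as
      even    : ∀ j → EvenCount (X j)
      nonempty : ∀ j → X j ≢ []
      simple  : ∀ j → toℕ j ≢ 0 → Simple (X j)

  module _ {as : List Arc} (d : Distributed as) (inRange : ∀ a → b ≤ count a as × count a as ≤ c) where
    open Distributed d

    labelling : Labelling
    labelling (a , j) = count a (X j)

    labelling-valid : ∀ ord → D.Valid ord labelling
    labelling-valid ord = record
      { chosen   = λ (a , j) → chosen a j
      ; balanced = λ _ _ suf _ j → trans (into≡ suf j labelling) (trans (even j (D.χ suf)) (sym (outof≡ suf j labelling)))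
      ; inRange  = λ a → subst (λ n → b ≤ n × n ≤ c) (sym (trans (arcTotal≡ a labelling) (counts a))) (inRange a) }
      where
      chosen : ∀ a j → count a (X j) ∈ D.choice (a , j)
      chosen a j with toℕ j ≡ᵇ 0 in eq
      ... | true  = ∈-upTo⁺ (≤-trans (s≤s (≤-trans (≤-trans (lemma (List.allFin k) (∈-allFin j)) (≤-reflexive (counts a))) (proj₂ (inRange a)))) (≤-reflexive (+-comm 1 c)))
        where
        lemma : ∀ js → j ∈ js → count a (X j) ≤ sum (List.map (λ j → count a (X j)) js)
        lemma (j ∷ js) (here refl) = m≤m+n _ _
        lemma (i ∷ js) (there i∈)  = ≤-trans (lemma js i∈) (m≤n+m _ (count a (X i)))
      ... | false with count a (X j) | simple j (λ eq′ → false≢true (trans (sym eq) (cong (_≡ᵇ 0) eq′))) a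
        where
        false≢true : false ≡ true → ⊥
        false≢true ()
      ...   | zero        | _ = here refl
      ...   | suc zero    | _ = there (here refl)
      ...   | suc (suc _) | s≤s ()

    labelling-nonzero : D.NonZeroRows labelling
    labelling-nonzero j eq = lemma (X j) (nonempty j) (trans (sym (SA-length (X j))) (trans (sym (row≡ j labelling)) eq))
      where
      lemma : ∀ (as : List Arc) → as ≢ [] → length as ≡ 0 → ⊥
      lemma [] ne _ = ne refl

    labelling-weight : D.W labelling ≡ sum (List.map w as)
    labelling-weight = trans (W≡ labelling) (trans (SA-cong λ a → cong (w a *_) (counts a)) (SA-count w as))

sum-tabulate : ∀ {n} (f : Fin n → ℕ) → sum (List.map f (List.allFin n)) ≡ sum (List.tabulate f)
sum-tabulate f = cong sum (map-tabulate id f)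

any⁻ : ∀ suf v → memF .fun (v , suf , tt) ≡ true → v ∈ suf
any⁻ (x ∷ suf) v eq with x ≡ᵇ v in eq′
... | true  = here (sym (≡ᵇ-true x v eq′))
... | false = there (any⁻ suf v eq)

any⁺ : ∀ suf v → v ∈ suf → memF .fun (v , suf , tt) ≡ true
any⁺ (x ∷ suf) v (here refl) rewrite ≡ᵇ-refl x = refl
any⁺ (x ∷ suf) v (there i) with x ≡ᵇ v
... | true  = refl
... | false = any⁺ suf v i

encList-map : ∀ {A B : Set} (e : B → Tree) (f : A → B) xs → encList e (List.map f xs) ≡ encList (λ x → e (f x)) xs
encList-map e f []       = refl
encList-map e f (x ∷ xs) = cong (e (f x) ∙_) (encList-map e f xs)

encList-cong : ∀ {A : Set} {e f : A → Tree} → (∀ x → e x ≡ f x) → ∀ xs → encList e xs ≡ encList f xs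
encList-cong h []       = refl
encList-cong h (x ∷ xs) = cong₂ _∙_ (h x) (encList-cong h xs)

-- Correctness of the algorithm on a digraph with an ordering

module Instance (G : WeightedDigraph) (conn : Connected G) (ν : Ordering G) (b c k′ : ℕ) where
  open WeightedDigraph G using (n; m; tail; head; noLoop; noParallel; ω)

  k : ℕ
  k = suc k′

  tl hd : Fin m → ℕ
  tl a = toℕ (tail a)
  hd a = toℕ (head a)

  tl≢hd : ∀ a → tl a ≢ hd a
  tl≢hd a eq = noLoop a (toℕ-injective eq)

  distinct : ∀ {a a′} → tl a ≡ tl a′ → hd a ≡ hd a′ → a ≡ a′
  distinct p q = noParallel (toℕ-injective p) (toℕ-injective q)

  module D = DP m k tl hd ω tl≢hd distinct b c
  open Labels m k
  open Walks m tl hd distinct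
  open Extraction m k tl hd ω tl≢hd distinct b c using (SK; Even; Closed; Extracted; extraction)
  open Slices m k tl hd ω tl≢hd distinct b c

  vertices : List (Fin n)
  vertices = List.tabulate (ν ⟨$⟩ʳ_)

  ord : List ℕ
  ord = List.map toℕ vertices

  ord-unique : Unique ord
  ord-unique = map⁺ toℕ-injective (tabulate⁺ (λ {i} {j} eq → trans (sym (inverseˡ ν)) (trans (cong (ν ⟨$⟩ˡ_) eq) (inverseˡ ν))))

  ∈-ord : ∀ u → toℕ u ∈ ord
  ∈-ord u = ∈-map⁺ toℕ (subst (_∈ vertices) (inverseʳ ν) (∈-tabulate⁺ (ν ⟨$⟩ˡ u)))

  covers : ∀ a → D.both ord a ≡ true
  covers a = ∧-true⁺ (any⁺ ord (tl a) (∈-ord (tail a))) (any⁺ ord (hd a) (∈-ord (head a)))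

  walk⁺ : ∀ {u as v} → IsWalk G u as v → Walk (toℕ u) as (toℕ v)
  walk⁺ []         = []
  walk⁺ (refl ∷ r) = refl ∷ walk⁺ r

  walk⁻ : ∀ {u as v} → Walk (toℕ u) as (toℕ v) → IsWalk G u as v
  walk⁻ {as = as} r = lemma as r refl refl
    where
    lemma : ∀ as {u v x y} → Walk x as y → x ≡ toℕ u → y ≡ toℕ v → IsWalk G u as v
    lemma []       []         eq eq′ = subst (IsWalk G _ []) (toℕ-injective (trans (sym eq) eq′)) []
    lemma (a ∷ as) (refl ∷ r) eq eq′ = toℕ-injective eq ∷ lemma as r refl eq′

  closed⁺ : ∀ {as} → IsNonEmptyClosedWalk G as → Closed as
  closed⁺ (ne , u , r) = ne , toℕ u , walk⁺ r

  closed⁻ : ∀ {as} → Closed as → IsNonEmptyClosedWalk G as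
  closed⁻ {[]}     (ne , _)             = ⊥-elim (ne refl)
  closed⁻ {a ∷ as} (ne , _ , refl ∷ r) = ne , tail a , walk⁻ (refl ∷ r)

  filter-count : ∀ a as → length (List.filter (a Fin.≟_) as) ≡ count a as
  filter-count a []       = refl
  filter-count a (x ∷ as) with a Fin.≟ x | same a x in eq
  ... | yes _    | true  = cong suc (filter-count a as)
  ... | no _     | false = filter-count a as
  ... | yes refl | false = ⊥-elim (true≢false (trans (sym (same-refl a)) eq))
    where
    true≢false : true ≡ false → ⊥
    true≢false ()
  ... | no ne    | true  = ⊥-elim (ne (same⇒≡ a x eq))

  record Distribution {l} (ws : Vec (List Arc) l) : Set where
    field
      cycle  : Fin l → List Arc
      rest   : List Arc
      counts : ∀ a → sum (List.tabulate (λ i → count a (cycle i))) + count a rest ≡ count a (List.concat (Vec.toList ws))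
      even   : ∀ i → EvenCount (cycle i)
      nonempty : ∀ i → cycle i ≢ []
      simple : ∀ i → Simple (cycle i)
      even-r : EvenCount rest

  distribution : ∀ {l} (ws : Vec (List Arc) l) → VAll.All (IsNonEmptyClosedWalk G) ws → Distribution ws
  distribution []       [] = record
    { cycle = λ () ; rest = [] ; counts = λ a → refl ; even = λ () ; nonempty = λ () ; simple = λ ()
    ; even-r = λ p → SA-cong λ a → trans (when-0 (p (hd a))) (sym (when-0 (p (tl a)))) }
  distribution (as ∷ ws) (cl ∷ cls) = record
    { cycle    = λ { zero → S.cycle ; (suc i) → T.cycle i }
    ; rest     = S.rest ++ T.rest
    ; counts   = λ a → trans (cong (sum (List.tabulate (λ i → count a (Fin-case i))) +_) (count-++ a S.rest T.rest))
                 (trans (shuffle (count a S.cycle) (sum (List.tabulate (λ i → count a (T.cycle i)))) (count a S.rest) (count a T.rest))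
                 (trans (cong₂ _+_ (sym (S.counts a)) (T.counts a)) (sym (count-++ a as _))))
    ; even     = λ { zero → closed⇒even S.walk ; (suc i) → T.even i }
    ; nonempty = λ { zero → S.nonempty ; (suc i) → T.nonempty i }
    ; simple   = λ { zero → S.simple ; (suc i) → T.simple i }
    ; even-r   = even-++ S.rest T.rest (even-rest as S.cycle S.rest S.counts (closed⇒even (proj₂ (proj₂ (closed⁺ cl)))) (closed⇒even S.walk)) T.even-r }
    where
    module S = Split (split-cycle (length as) as ≤-refl (proj₁ cl) (proj₂ (proj₂ (closed⁺ cl))))
    module T = Distribution (distribution ws cls)
    Fin-case : Fin (suc _) → List Arc
    Fin-case zero    = S.cycle
    Fin-case (suc i) = T.cycle i
    shuffle : ∀ x y z t → x + y + (z + t) ≡ (x + z) + (y + t)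
    shuffle = solve-∀

  distributed : (ws : Walks G k) → VAll.All (IsNonEmptyClosedWalk G) ws → Distributed (traversed G ws)
  distributed (as ∷ ws) (cl ∷ cls) = record
    { X = X
    ; counts = λ a → trans (sum-tabulate (λ j → count a (X j))) (trans (cong (_+ sum (List.tabulate (λ i → count a (T.cycle i)))) (count-++ a as T.rest))
                 (trans (shuffle (count a as) (count a T.rest) _) (trans (cong (count a as +_) (T.counts a)) (sym (count-++ a as _)))))
    ; even = λ { zero → even-++ as T.rest (closed⇒even (proj₂ (proj₂ (closed⁺ cl)))) T.even-r ; (suc i) → T.even i }
    ; nonempty = λ { zero → nonempty as (proj₁ cl) ; (suc i) → T.nonempty i }
    ; simple = λ { zero ne → ⊥-elim (ne refl) ; (suc i) _ → T.simple i } }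
    where
    module T = Distribution (distribution ws cls)
    -- The first walk keeps all its arcs, so that row 0 is nonempty, and absorbs what the simple
    -- cycles leave over of the others.
    X : Fin k → List Arc
    X zero    = as ++ T.rest
    X (suc i) = T.cycle i
    shuffle : ∀ x y z → x + y + z ≡ x + (z + y)
    shuffle = solve-∀
    nonempty : ∀ (as : List Arc) {bs} → as ≢ [] → as ++ bs ≢ []
    nonempty []      ne _ = ne refl
    nonempty (_ ∷ _) ne ()

  traversed-range : ∀ (ws : Walks G k) → IsCovering G b c ws → ∀ a → b ≤ count a (traversed G ws) × count a (traversed G ws) ≤ c
  traversed-range ws (_ , range) a = subst (λ x → b ≤ x × x ≤ c) (filter-count a (traversed G ws)) (range a)

  Solves : Maybe (List ℕ) → Set
  Solves = D.Optimal ord covers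

  no-covering : Solves nothing → ∀ (ws : Walks G k) → ¬ IsCovering G b c ws
  no-covering none ws cov@(cls , _) =
    none (labelling d r) (labelling-valid d r ord) (labelling-nonzero d r)
    where
    d = distributed ws cls
    r = traversed-range ws cov

  module _ (y : Labelling) (bal : ∀ us v suf → ord ≡ us ++ v ∷ suf → D.Balanced suf y) where

    private
      In Out : (ℕ → Bool) → Fin k → ℕ
      In  p j = SA (λ a → y (a , j) when p (hd a))
      Out p j = SA (λ a → y (a , j) when p (tl a))

      -- The hypothesis covers the proper suffixes. The whole ordering contains both ends of every
      -- arc, so both sides are then the full row.
      suffix-balance : ∀ us s → ord ≡ us ++ s → ∀ j → In (D.χ s) j ≡ Out (D.χ s) j
      suffix-balance us s eq j with initLast us
      ... | []       = SA-cong λ a → let p , q = ∧-true {D.χ ord (tl a)} (covers a) in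
                         cong (y (a , j) when_) (trans (subst (λ o → D.χ o (hd a) ≡ true) eq q) (sym (subst (λ o → D.χ o (tl a) ≡ true) eq p)))
      ... | us′ ∷ʳ′ u = trans (sym (into≡ s j y)) (trans (bal us′ u s (trans eq (++-assoc us′ (u ∷ []) s)) j) (outof≡ s j y))

    -- Two consecutive cuts differ by one vertex `v`, so subtracting their balances leaves the
    -- balance at `v`; this needs that `v` does not recur in the rest of the ordering. A number
    -- outside the ordering is the end of no arc.
    circulation : ∀ j v → SA (λ a → y (a , j) when (tl a ≡ᵇ v)) ≡ SA (λ a → y (a , j) when (hd a ≡ᵇ v))
    circulation j v with D.χ ord v in eq
    ... | false = trans (none tl (λ a eq′ → ∉ a (tl a) (proj₁ (∧-true (covers a))) eq′)) (sym (none hd (λ a eq′ → ∉ a (hd a) (proj₂ (∧-true {D.χ ord (tl a)} (covers a))) eq′)))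
      where
      ∉ : ∀ a u → D.χ ord u ≡ true → u ≡ v → ⊥
      ∉ a u eq′ refl with trans (sym eq′) eq
      ... | ()
      none : ∀ (f : Arc → ℕ) → (∀ a → f a ≢ v) → SA (λ a → y (a , j) when (f a ≡ᵇ v)) ≡ 0
      none f ne = trans (SA-cong λ a → cong (y (a , j) when_) (≡ᵇ-false (ne a))) (trans (SA-const 0) (*-zeroʳ m))
    ... | true with ∈-∃++ (any⁻ ord v eq)
    ...   | us , suf , ord≡ = trans (SA-cong λ a → cong (y (a , j) when_) (≡ᵇ-sym (tl a) v)) (trans (sym in≡out) (SA-cong λ a → cong (y (a , j) when_) (≡ᵇ-sym v (hd a))))
      where
      v∉ : D.χ suf v ≡ false
      v∉ with D.χ suf v in eq′
      ... | false = refl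
      ... | true  = ⊥-elim (All.lookup (head-unique (++⁻ʳ-unique us (subst Unique ord≡ ord-unique))) (any⁻ suf v eq′) refl)
        where
        ++⁻ʳ-unique : ∀ us {xs : List ℕ} → Unique (us ++ xs) → Unique xs
        ++⁻ʳ-unique []       u       = u
        ++⁻ʳ-unique (_ ∷ us) (_ ∷ u) = ++⁻ʳ-unique us u
        head-unique : ∀ {x : ℕ} {xs} → Unique (x ∷ xs) → All (x ≢_) xs
        head-unique (h ∷ _) = h
      disjoint : ∀ x → (v ≡ᵇ x) ∧ D.χ suf x ≡ false
      disjoint x with v ≡ᵇ x in eq′
      ... | false = refl
      ... | true with ≡ᵇ-true v x eq′
      ...   | refl = v∉
      split : ∀ (f : Arc → ℕ) → SA (λ a → y (a , j) when D.χ (v ∷ suf) (f a)) ≡ SA (λ a → y (a , j) when (v ≡ᵇ f a)) + SA (λ a → y (a , j) when D.χ suf (f a))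
      split f = trans (SA-cong λ a → when-∨ (y (a , j)) (v ≡ᵇ f a) (D.χ suf (f a)) (disjoint (f a))) (SA-+ _ _)
      in≡out : SA (λ a → y (a , j) when (v ≡ᵇ hd a)) ≡ SA (λ a → y (a , j) when (v ≡ᵇ tl a))
      in≡out = +-cancelʳ-≡ (In (D.χ suf) j) _ _ (trans (sym (split hd)) (trans (suffix-balance us (v ∷ suf) ord≡ j)
        (trans (split tl) (cong (SA (λ a → y (a , j) when (v ≡ᵇ tl a)) +_) (sym (suffix-balance (us List.∷ʳ v) suf (trans ord≡ (sym (++-assoc us (v ∷ []) suf))) j))))))

  module Extractable (y : Labelling) (bal : ∀ us v suf → ord ≡ us ++ v ∷ suf → D.Balanced suf y)
                     (range : ∀ a → D.InRange y a) (nz : D.NonZeroRows y) where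

    sums : ∀ a → b ≤ SK (λ j → y (a , j)) × SK (λ j → y (a , j)) ≤ c
    sums a = subst (λ x → b ≤ x × x ≤ c) (arcTotal≡ a y) (range a)

    nonzero : ∀ j → ∃[ a ] 1 ≤ y (a , j)
    nonzero j = lemma (List.allFin m) (λ eq → nz j (trans (row≡ j y) eq))
      where
      lemma : ∀ as → sum (List.map (λ a → y (a , j)) as) ≢ 0 → ∃[ a ] 1 ≤ y (a , j)
      lemma []       ne = ⊥-elim (ne refl)
      lemma (a ∷ as) ne with y (a , j) in eq
      ... | zero  = lemma as ne
      ... | suc _ = a , ≤-trans (s≤s z≤n) (≤-reflexive (sym eq))

    extracted : Extracted y
    extracted = extraction y (circulation y bal) (proj₂ ∘ sums) nonzero

  module Answer {y : Labelling} (sums : ∀ a → b ≤ SK (λ j → y (a , j)) × SK (λ j → y (a , j)) ≤ c) (R : Extracted y) where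

    private
      module R = Extracted R

    os : List (List Arc)
    os = R.walks

    ns : Rest
    ns = R.unused

    total : ∀ a → left ns a + count a (List.concat os) ≡ SK (λ j → y (a , j))
    total = R.total

    ws : Walks G k
    ws = Vec.cast (R.number) (Vec.fromList os)

    toList-ws : Vec.toList ws ≡ os
    toList-ws = trans (toList-cast _ (Vec.fromList os)) (toList∘fromList os)

    Visited : ℕ → Set
    Visited v = ∃[ a ] a ∈ List.concat os × hd a ≡ v

    visited⇒dead : ∀ {v} → Visited v → Dead ns v
    visited⇒dead (a , a∈ , refl) = R.dead a∈

    -- In a closed walk each arc is entered through its tail: by the arc before it, or by the last
    -- arc of the walk if it is the first.
    tail-visited : ∀ {a} → a ∈ List.concat os → Visited (tl a)
    tail-visited {a} a∈ with ∈-concat⁻′ os a∈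
    ... | o , a∈o , o∈ with All.lookup R.closed o∈
    ...   | ne , u , r = let a′ , a′∈ , eq = entered r a∈o in a′ , ∈-concat⁺′ a′∈ o∈ , eq
      where
      last-head : ∀ {a as u v} → Walk u (a ∷ as) v → ∃[ x ] x ∈ a ∷ as × hd x ≡ v
      last-head {a} {[]}     (_ ∷ [])  = a , here refl , refl
      last-head {a} {_ ∷ _}  (_ ∷ r)   = let x , x∈ , eq = last-head r in x , there x∈ , eq
      before : ∀ {as u v} → Walk u as v → a ∈ as → u ≡ tl a ⊎ ∃[ x ] x ∈ as × hd x ≡ tl a
      before (refl ∷ r) (here refl) = inj₁ refl
      before (eq ∷ r)   (there i) with before r i
      ... | inj₁ eq′            = inj₂ (_ , here refl , eq′)
      ... | inj₂ (x , x∈ , eq′) = inj₂ (x , there x∈ , eq′)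
      entered : ∀ {as u} → Walk u as u → a ∈ as → ∃[ x ] x ∈ as × hd x ≡ tl a
      entered {_ ∷ _} r i with before r i
      ... | inj₂ found = found
      ... | inj₁ refl  = last-head r

    all-used : 1 ≤ b → ∀ a → left ns a ≡ 0
    all-used 1≤b a = visited⇒dead (everywhere (tail a)) a refl
      where
      used : ∀ x → left ns x ≡ 0 → x ∈ List.concat os
      used x eq = count-∈ x (List.concat os) (≤-trans (≤-trans 1≤b (proj₁ (sums x))) (≤-reflexive (trans (sym (total x)) (cong (_+ count x (List.concat os)) eq))))
      forward : ∀ x → Visited (tl x) → Visited (hd x)
      forward x vis = x , used x (visited⇒dead vis x refl) , refl
      backward : ∀ x → Visited (hd x) → Visited (tl x)
      backward x vis = tail-visited (used x (n≤0⇒n≡0 (begin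
        left ns x                           ≡⟨ cong (left ns x when_) (sym (≡ᵇ-refl (hd x))) ⟩
        left ns x when (hd x ≡ᵇ hd x)       ≤⟨ SA-≥ (λ z → left ns z when (hd z ≡ᵇ hd x)) x ⟩
        ins ns (hd x)                       ≡⟨ sym (R.even (hd x)) ⟩
        outs ns (hd x)                      ≡⟨ dead-outs {ns} (visited⇒dead vis) ⟩
        0                                   ∎)))
        where open ≤-Reasoning
      spread : ∀ {u v} → EqClosure (λ x y → ∃[ a ] tail a ≡ x × head a ≡ y) u v → Visited (toℕ u) → Visited (toℕ v)
      spread ε vis = vis
      spread (fwd (x , refl , refl) ◅ r) vis = spread r (forward x vis)
      spread (bwd (x , refl , refl) ◅ r) vis = spread r (backward x vis)
      someone : ∃[ u ] Visited (toℕ u)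
      someone = lemma os refl R.closed
        where
        lemma : ∀ os′ → os ≡ os′ → All Closed os′ → ∃[ u ] Visited (toℕ u)
        lemma [] eq _ = ⊥-elim (0≢suc (trans (cong length (sym eq)) (R.number)))
          where
          0≢suc : 0 ≡ suc k′ → ⊥
          0≢suc ()
        lemma ([] ∷ _)      eq ((ne , _) ∷ _) = ⊥-elim (ne refl)
        lemma ((x ∷ o) ∷ _) eq _ = head x , x , subst (λ os → x ∈ List.concat os) (sym eq) (here refl) , refl
      everywhere : ∀ u → Visited (toℕ u)
      everywhere u = spread (conn (proj₁ someone) u) (proj₂ someone)

    count-ws : ∀ a → occurrences G a ws ≡ count a (List.concat os)
    count-ws a = trans (filter-count a (traversed G ws)) (cong (λ o → count a (List.concat o)) toList-ws)

    covering : IsCovering G b c ws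
    covering = toAll ws (subst (All Closed) (sym toList-ws) R.closed) , λ a → subst (λ x → b ≤ x × x ≤ c) (sym (count-ws a)) (lower a , ≤-trans (≤-trans (m≤n+m _ (left ns a)) (≤-reflexive (total a))) (proj₂ (sums a)))
      where
      toAll : ∀ {l} (ws : Vec (List Arc) l) → All Closed (Vec.toList ws) → VAll.All (IsNonEmptyClosedWalk G) ws
      toAll []       []       = []
      toAll (w ∷ ws) (p ∷ ps) = closed⁻ p ∷ toAll ws ps
      lower : ∀ a → b ≤ count a (List.concat os)
      lower a with 1 ≤? b
      ... | no b≱1 = ≤-trans (≤-reflexive (n<1⇒n≡0 (≰⇒> b≱1))) z≤n
      ... | yes 1≤b = ≤-trans (proj₁ (sums a)) (≤-reflexive (trans (sym (total a)) (cong (_+ count a (List.concat os)) (all-used 1≤b a))))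

    weight-≤ : weight G ws ≤ D.W y
    weight-≤ = begin
      sum (List.map ω (List.concat (Vec.toList ws)))   ≡⟨ cong (λ o → sum (List.map ω (List.concat o))) toList-ws ⟩
      sum (List.map ω (List.concat os))                ≡⟨ sym (SA-count ω (List.concat os)) ⟩
      SA (λ a → ω a * count a (List.concat os))        ≤⟨ SA-mono (λ a → *-monoʳ-≤ (ω a) (≤-trans (m≤n+m _ (left ns a)) (≤-reflexive (total a)))) ⟩
      SA (λ a → ω a * SK (λ j → y (a , j)))            ≡⟨ sym (W≡ y) ⟩
      D.W y                                            ∎
      where open ≤-Reasoning

    optimal : (∀ y* → D.Valid ord y* → D.NonZeroRows y* → D.W y ≤ D.W y*) →
              ∀ (ws′ : Walks G k) → IsCovering G b c ws′ → weight G ws ≤ weight G ws′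
    optimal opt ws′ cov@(cls , _) = ≤-trans weight-≤ (≤-trans
      (opt (labelling d r) (labelling-valid d r ord) (labelling-nonzero d r)) (≤-reflexive (labelling-weight d r)))
      where
      d = distributed ws′ cls
      r = traversed-range ws′ cov

    encoded : ∀ {out} → out ≡ List.map (List.map pair) os → enc OutputT (just out) ≡ encAnswer G (just ws)
    encoded refl = cong (leaf ∙_) (begin
      encList (encList (enc PairT)) (List.map (List.map pair) os)      ≡⟨ encList-map (encList (enc PairT)) (List.map pair) os ⟩
      encList (λ o → encList (enc PairT) (List.map pair o)) os         ≡⟨ encList-cong (encList-map (enc PairT) pair) os ⟩
      encList (encList (encArc G)) os                                  ≡⟨ cong (encList (encList (encArc G))) (sym toList-ws) ⟩
      encList (encList (encArc G)) (Vec.toList ws)                     ∎)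
      where open ≡-Reasoning

  core-correct : EncodesSolution G b c k (enc OutputT (coreF .fun (b , c , D.arcs , D.is , D.ks , D.flags , D.stages ord covers , D.rs , tt)))
  core-correct = core-fun _ (λ o → EncodesSolution G b c k (enc OutputT o)) λ r ex r≡ ex≡ →
    correct r ex (subst Solves (sym r≡) (D.solution-optimal ord covers)) ex≡
    where
    correct : ∀ r ex → Solves r → (∀ Y → ex Y ≡ extractF .fun (D.arcs , D.ks , D.is , D.rs , Y , tt)) →
              EncodesSolution G b c k (enc OutputT (elimM r nothing (just ∘ ex)))
    correct nothing  ex none _ = nothing , refl , no-covering none
    correct (just _) ex (y , refl , bal , range , nz , opt) ex≡ =
      let open Extractable y bal range nz ; open Answer sums extracted in
      just ws , encoded (trans (ex≡ (L y)) (Extracted.extract≡ extracted)) , covering , optimal opt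

-- Time in terms of the input size

≤-∙ˡ : ∀ {x} l r → x ≤ size l → x ≤ size (l ∙ r)
≤-∙ˡ l r x≤ = ≤-trans x≤ (≤-trans (m≤m+n _ (size r)) (n≤1+n _))

≤-∙ʳ : ∀ {x} l r → x ≤ size r → x ≤ size (l ∙ r)
≤-∙ʳ l r x≤ = ≤-trans x≤ (≤-trans (m≤n+m _ (size l)) (n≤1+n _))

bits-≤-size : ∀ x → bits x ≤ size (encℕ x)
bits-≤-size x = lemma (ℕᵇ.fromℕ x)
  where
  lemma : ∀ x → length (digitsᵇ x) ≤ size (encℕᵇ x)
  lemma ℕᵇ.zero  = z≤n
  lemma 2[1+ x ] = s≤s (≤-trans (lemma x) (n≤1+n _))
  lemma 1+[2 x ] = s≤s (≤-trans (lemma x) (m≤n+m _ 3))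

length-≤-size : ∀ {A : Set} (e : A → Tree) xs → length xs ≤ size (encList e xs)
length-≤-size e []       = z≤n
length-≤-size e (x ∷ xs) = s≤s (≤-trans (length-≤-size e xs) (m≤n+m _ (size (e x))))

elements-≤-size : ∀ {A : Set} (e : A → Tree) xs → All (λ x → size (e x) ≤ size (encList e xs)) xs
elements-≤-size e []       = []
elements-≤-size e (x ∷ xs) = ≤-∙ˡ (e x) (encList e xs) ≤-refl ∷ All.map (≤-∙ʳ (e x) (encList e xs)) (elements-≤-size e xs)

^-distribʳ-* : ∀ a m n → (m * n) ^ a ≡ m ^ a * n ^ a
^-distribʳ-* zero    m n = refl
^-distribʳ-* (suc a) m n = trans (cong (m * n *_) (^-distribʳ-* a m n)) (shuffle m n (m ^ a) (n ^ a))
  where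
  shuffle : ∀ x y z u → x * y * (z * u) ≡ x * z * (y * u)
  shuffle = solve-∀

-- With h the half of k rounded down, k + 1 ≤ 2 (h + 1). Of the a + 1 factors h + 1, one is at most
-- 2^h and the others together are at most C 2^h by induction, and 2^h 2^h ≤ 2^k. The constant grows
-- by the factor 2^(a+1).
polynomial≤exponential : ∀ a → ∃[ C ] 1 ≤ C × (∀ k → suc k ^ a ≤ C * 2 ^ k)
polynomial≤exponential zero    = 1 , ≤-refl , λ k → ≤-trans (m^n>0 2 k) (≤-reflexive (sym (+-identityʳ _)))
polynomial≤exponential (suc a) with polynomial≤exponential a
... | C , 1≤C , bound = 2 ^ suc a * C , *-mono-≤ (m^n>0 2 (suc a)) 1≤C , λ k → let h = ⌊ k /2⌋ in begin
  suc k ^ suc a                           ≤⟨ ^-monoˡ-≤ (suc a) (halved k) ⟩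
  (2 * suc h) ^ suc a                     ≡⟨ ^-distribʳ-* (suc a) 2 (suc h) ⟩
  2 ^ suc a * (suc h * suc h ^ a)         ≤⟨ *-monoʳ-≤ (2 ^ suc a) (*-mono-≤ (n<2^n h) (bound h)) ⟩
  2 ^ suc a * (2 ^ h * (C * 2 ^ h))       ≡⟨ shuffle (2 ^ suc a) (2 ^ h) C ⟩
  2 ^ suc a * C * (2 ^ h * 2 ^ h)         ≡⟨ cong (2 ^ suc a * C *_) (sym (^-distribˡ-+-* 2 h h)) ⟩
  2 ^ suc a * C * 2 ^ (h + h)             ≤⟨ *-monoʳ-≤ (2 ^ suc a * C) (^-monoʳ-≤ 2 (≤-trans (+-monoʳ-≤ h (⌊n/2⌋≤⌈n/2⌉ k)) (≤-reflexive (⌊n/2⌋+⌈n/2⌉≡n k)))) ⟩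
  2 ^ suc a * C * 2 ^ k                   ∎
  where
  open ≤-Reasoning
  shuffle : ∀ x y z → x * (y * (z * y)) ≡ x * z * (y * y)
  shuffle = solve-∀
  double : ∀ h → suc (h + suc h) ≡ 2 * suc h
  double = solve-∀
  halved : ∀ k → suc k ≤ 2 * suc ⌊ k /2⌋
  halved k = ≤-trans (s≤s (≤-trans (≤-reflexive (sym (⌊n/2⌋+⌈n/2⌉≡n k))) (+-monoʳ-≤ ⌊ k /2⌋ (⌈n/2⌉≤1+⌊n/2⌋ k)))) (≤-reflexive (double ⌊ k /2⌋))
    where
    ⌈n/2⌉≤1+⌊n/2⌋ : ∀ n → ⌈ n /2⌉ ≤ suc ⌊ n /2⌋
    ⌈n/2⌉≤1+⌊n/2⌋ zero          = z≤n
    ⌈n/2⌉≤1+⌊n/2⌋ (suc zero)    = ≤-refl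
    ⌈n/2⌉≤1+⌊n/2⌋ (suc (suc n)) = s≤s (⌈n/2⌉≤1+⌊n/2⌋ n)
  n<2^n : ∀ n → suc n ≤ 2 ^ n
  n<2^n zero    = ≤-refl
  n<2^n (suc n) = ≤-trans (+-mono-≤ (m^n>0 2 n) (n<2^n n)) (≤-reflexive (cong (2 ^ n +_) (sym (+-identityʳ _))))

module _ (N k B : ℕ) (2≤N : 2 ≤ N) (1≤B : 1 ≤ B) where

  scale : Scale
  scale = record { M = N * suc k ; B = B ; F = 2 ^ k
                 ; 2≤M = *-mono-≤ 2≤N (s≤s z≤n) ; 1≤B = 1≤B ; 1≤F = m^n>0 2 k }

  -- The power of k + 1 contained in `M ^ a` is absorbed by the second factor 2^k. The summand `a′`
  -- of the degree is slack, which lets the main case and the trivial one share a single degree.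
  scale-O* : ∀ a a′ {t} → t ≤ Bound.val scale (a , 1 , 1) → t ≤ O* (proj₁ (polynomial≤exponential a)) (a + a′) N (B * 4 ^ k)
  scale-O* a a′ {t} t≤ with polynomial≤exponential a
  ... | C , _ , bound = begin
    t                                          ≤⟨ t≤ ⟩
    Bound.val scale (a , 1 , 1)                ≡⟨ Bound.val-linear scale a ⟩
    (N * suc k) ^ a * (B * 2 ^ k)              ≡⟨ cong (_* (B * 2 ^ k)) (^-distribʳ-* a N (suc k)) ⟩
    N ^ a * suc k ^ a * (B * 2 ^ k)            ≤⟨ *-monoˡ-≤ (B * 2 ^ k) (*-mono-≤ (^-monoʳ-≤ N (m≤m+n a a′)) (bound k)) ⟩
    N ^ (a + a′) * (C * 2 ^ k) * (B * 2 ^ k)   ≡⟨ shuffle (N ^ (a + a′)) C (2 ^ k) B ⟩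
    C * N ^ (a + a′) * (B * (2 ^ k * 2 ^ k))   ≡⟨ cong (λ x → C * N ^ (a + a′) * (B * x)) (sym (^-distribʳ-* k 2 2)) ⟩
    C * N ^ (a + a′) * (B * 4 ^ k)             ≤⟨ *-monoʳ-≤ (C * N ^ (a + a′)) (n≤1+n _) ⟩
    C * N ^ (a + a′) * (1 + B * 4 ^ k)         ∎
    where
    open ≤-Reasoning
    instance
      N≢0 = >-nonZero (≤-trans (s≤s z≤n) 2≤N)
    shuffle : ∀ x y z u → x * (y * z) * (u * z) ≡ y * x * (u * (z * z))
    shuffle = solve-∀

module _ (N : ℕ) (2≤N : 2 ≤ N) where

  -- In the trivial cases (c 2^k)^p may be 0 and is unsuitable as a scale. The time is then
  -- polynomial in the input size alone and is covered by the summand 1 of `O*`.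
  trivialScale : Scale
  trivialScale = record { M = N ; B = 1 ; F = 1 ; 2≤M = 2≤N ; 1≤B = ≤-refl ; 1≤F = ≤-refl }

  trivial-O* : ∀ C a a′ f {t} → 1 ≤ C → t ≤ Bound.val trivialScale (a′ , 1 , 1) → t ≤ O* C (a + a′) N f
  trivial-O* C a a′ f {t} 1≤C t≤ = begin
    t                                   ≤⟨ t≤ ⟩
    N ^ a′ * 1                          ≡⟨ cong (_* 1) (sym (*-identityˡ (N ^ a′))) ⟩
    1 * N ^ a′ * 1                      ≤⟨ *-mono-≤ (*-mono-≤ 1≤C (^-monoʳ-≤ N (m≤n+m a′ a))) (s≤s z≤n) ⟩
    C * N ^ (a + a′) * (1 + f)          ∎
    where
    open ≤-Reasoning
    instance
      N≢0 = >-nonZero (≤-trans (s≤s z≤n) 2≤N)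

-- Together with `late-or-early` this translates membership in a suffix into positions of the
-- ordering, the form in which `Crosses` is stated.
position-of : ∀ {n} (f : Fin n → ℕ) us v {suf x} → us ++ v ∷ suf ≡ List.tabulate f → x ∈ suf → ∃[ j ] f j ≡ x × length us < toℕ j
position-of {zero}  f []       v () x∈
position-of {zero}  f (u ∷ us) v () x∈
position-of {suc n} f []       v refl x∈ with ∈-tabulate⁻ x∈
... | j , refl = suc j , refl , s≤s z≤n
position-of {suc n} f (u ∷ us) v eq x∈ with position-of (f ∘ suc) us v (∷-injectiveʳ eq) x∈
... | j , eq′ , lt = suc j , eq′ , s≤s lt

late-or-early : ∀ {n} (f : Fin n → ℕ) us v {suf} → us ++ v ∷ suf ≡ List.tabulate f → ∀ j → f j ∈ suf ⊎ toℕ j ≤ length us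
late-or-early f us       v eq   zero    = inj₂ z≤n
late-or-early f []       v refl (suc j) = inj₁ (∈-tabulate⁺ j)
late-or-early f (u ∷ us) v eq   (suc j) with late-or-early (f ∘ suc) us v (∷-injectiveʳ eq) j
... | inj₁ f∈ = inj₁ f∈
... | inj₂ j≤ = inj₂ (s≤s j≤)

length-filter-∷ : ∀ {A : Set} {P : A → Set} (P? : ∀ x → Dec (P x)) x xs → length (List.filter P? xs) ≤ length (List.filter P? (x ∷ xs))
length-filter-∷ P? x xs with P? x
... | yes _ = n≤1+n _
... | no _  = ≤-refl

null? : ∀ {A : Set} c (xs : List A) → (c ≡ 0 ⊎ xs ≡ []) ⊎ (c ≢ 0 × xs ≢ [])
null? zero    _        = inj₁ (inj₁ refl)
null? (suc _) []       = inj₁ (inj₂ refl)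
null? (suc _) (_ ∷ _)  = inj₂ ((λ ()) , (λ ()))

module Running (G : WeightedDigraph) (conn : Connected G) (ν : Ordering G) (b c k′ p : ℕ) (width : cutwidth G ν ≤ p) where
  open Instance G conn ν b c k′
  open WeightedDigraph G using (n; m; tail; head; noLoop; ω)

  argument : ⟦ InputT ⟧
  argument = input b c n D.arcs k ord

  encInput≡ : enc InputT argument ≡ encInput G b c k ν
  encInput≡ = cong₂ (λ x y → encℕ b ∙ encℕ c ∙ (encℕ n ∙ x) ∙ encℕ k ∙ y)
    (encList-map (enc ArcT) D.arc (List.allFin m)) (encList-map encℕ toℕ vertices)

  no-covering-trivial : c ≡ 0 ⊎ D.arcs ≡ [] → ∀ (ws : Walks G k) → ¬ IsCovering G b c ws
  no-covering-trivial _    (([] ∷ _)) (((ne , _) ∷ _) , _) = ne refl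
  no-covering-trivial (inj₁ c≡0) ((a ∷ as) ∷ ws) (_ , range) =
    1≰0 (≤-trans (∈-length (∈-filter⁺ (a Fin.≟_) {xs = traversed G ((a ∷ as) ∷ ws)} (here refl) refl)) (subst (_ ≤_) c≡0 (proj₂ (range a))))
    where
    1≰0 : 1 ≤ 0 → ⊥
    1≰0 ()
  no-covering-trivial (inj₂ eq) ((a ∷ as) ∷ ws) _ with subst (D.arc a ∈_) eq (∈-map⁺ D.arc (∈-allFin a))
  ... | ()

  main-correct : EncodesSolution G b c k (enc OutputT (mainF .fun (argument , tt)))
  main-correct with null? c D.arcs
  ... | inj₁ triv = subst (EncodesSolution G b c k ∘ enc OutputT) (sym (main-trivial b n k ord c D.arcs triv))
                      (nothing , refl , no-covering-trivial triv)
  ... | inj₂ (c≢0 , arcs≢[]) = subst (EncodesSolution G b c k ∘ enc OutputT)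
    (sym (trans (main-setup b n k ord c D.arcs c≢0 arcs≢[]) (setup-core b c D.arcs k ord))) core-correct

  Size : ℕ
  Size = size (enc InputT argument)

  2≤Size : 2 ≤ Size
  2≤Size = s≤s (≤-trans (size>0 (encℕ b)) (m≤m+n _ _))
    where
    size>0 : ∀ t → 1 ≤ size t
    size>0 leaf    = s≤s z≤n
    size>0 (_ ∙ _) = s≤s z≤n

  cutSize-≤ : ∀ i → cutSize G ν i ≤ p
  cutSize-≤ i = ≤-trans (All++.tabulate⁻ (xs≤max 0 (List.tabulate (cutSize G ν))) i) width

  module _ (us : List ℕ) (v : ℕ) (suf : List ℕ) (eq : us ++ v ∷ suf ≡ ord) where

    private
      f : Fin n → ℕ
      f j = toℕ (ν ⟨$⟩ʳ j)

      eq′ : us ++ v ∷ suf ≡ List.tabulate f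
      eq′ = trans eq (map-tabulate (ν ⟨$⟩ʳ_) toℕ)

    -- The position of `v`, counted from 0; the vertices of `suf` are exactly those at later
    -- positions.
    cutAt : Fin n
    cutAt = Fin.fromℕ< (≤-trans (≤-trans (m≤m+n (suc (length us)) (length suf)) (≤-reflexive
      (trans (sym (+-suc (length us) (length suf))) (sym (length-++ us))))) (≤-reflexive (trans (cong length eq′) (length-tabulate f))))

    cutAt≡ : toℕ cutAt ≡ length us
    cutAt≡ = toℕ-fromℕ< _

    after : ∀ u → D.χ suf (toℕ u) ≡ true → cutAt Fin.< (ν ⟨$⟩ˡ u)
    after u χ≡ with position-of f us v eq′ (any⁻ suf (toℕ u) χ≡)
    ... | j , fj≡ , lt = subst₂ _<_ (sym cutAt≡) (cong toℕ (trans (sym (inverseˡ ν)) (cong (ν ⟨$⟩ˡ_) (toℕ-injective fj≡)))) lt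

    before : ∀ u → D.χ suf (toℕ u) ≡ false → (ν ⟨$⟩ˡ u) Fin.≤ cutAt
    before u χ≡ with late-or-early f us v eq′ (ν ⟨$⟩ˡ u)
    ... | inj₂ le = ≤-trans le (≤-reflexive (sym cutAt≡))
    ... | inj₁ f∈ with trans (sym (any⁺ suf (toℕ u) (subst (λ u → toℕ u ∈ suf) (inverseʳ ν) f∈))) χ≡
    ...   | ()

    cross⇒Crosses : ∀ a → D.cross suf a ≡ true → Crosses G ν cutAt a
    cross⇒Crosses a = lemma (D.χ suf (tl a)) (D.χ suf (hd a)) refl refl
      where
      lemma : ∀ x y → D.χ suf (tl a) ≡ x → D.χ suf (hd a) ≡ y → (if x then not y else y) ≡ true → Crosses G ν cutAt a
      lemma true  false eq₁ eq₂ _ = inj₂ (before (head a) eq₂ , after (tail a) eq₁)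
      lemma false true  eq₁ eq₂ _ = inj₁ (before (tail a) eq₁ , after (head a) eq₂)

    module _ (1≤c : 1 ≤ c) where

      private
        options : List ⟦ ItemT ⟧ → ℕ
        options is = product (List.map length (choicesOf suf is D.rs))

        instance
          c2^k≢0 = >-nonZero (*-mono-≤ 1≤c (m^n>0 2 k))

        options-++ : ∀ is is′ → options (is ++ is′) ≡ options is * options is′
        options-++ is is′ = trans (cong product (trans (cong (List.map length) (map-++ _ is is′)) (map-++ length (choicesOf suf is D.rs) (choicesOf suf is′ D.rs))))
          (product-++ (List.map length (choicesOf suf is D.rs)) (List.map length (choicesOf suf is′ D.rs)))

        -- The successor keeps the walk numbers away from 0, so each of these items on a crossing
        -- arc has the two labels 0 and 1.
        later-options : ∀ a l (g : ℕ → ℕ) → options (List.map (D.arc a ,_) (List.applyUpTo (suc ∘ g) l)) ≡ (if D.cross suf a then 2 ^ l else 1)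
        later-options a zero    g with D.cross suf a
        ... | true  = refl
        ... | false = refl
        later-options a (suc l) g with D.cross suf a | later-options a l (g ∘ suc)
        ... | true  | ih = cong (2 *_) ih
        ... | false | ih = trans (+-identityʳ _) ih

        -- A crossing arc has c + 1 labels for walk 0 and 2 for each of the other k - 1 walks. As 1
        -- ≤ c, the number (c + 1) 2^(k-1) is at most 2 c 2^(k-1), which is the base c 2^k of the
        -- theorem.
        arc-options : ∀ a → options (List.map (D.arc a ,_) D.ks) ≤ (if D.cross suf a then c * 2 ^ k else 1)
        arc-options a with D.cross suf a | later-options a k′ id
        ... | false | ih = ≤-reflexive (trans (+-identityʳ _) ih)
        ... | true  | ih = begin
          length D.rs * _        ≡⟨ cong₂ _*_ (length-upTo (c + 1)) ih ⟩
          (c + 1) * 2 ^ k′       ≤⟨ *-monoˡ-≤ (2 ^ k′) (+-monoʳ-≤ c 1≤c) ⟩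
          (c + c) * 2 ^ k′       ≡⟨ double c (2 ^ k′) ⟩
          c * (2 * 2 ^ k′)       ∎
          where
          open ≤-Reasoning
          double : ∀ x y → (x + x) * y ≡ x * (2 * y)
          double = solve-∀

      cut-options : ∀ as → options (itemsOf D.ks (List.map D.arc as)) ≤ (c * 2 ^ k) ^ length (List.filter (crosses? G ν cutAt) as)
      cut-options []       = ≤-refl
      cut-options (a ∷ as) = ≤-trans (≤-reflexive (options-++ (List.map (D.arc a ,_) D.ks) _))
        (≤-trans (*-mono-≤ (arc-options a) (cut-options as)) (lemma (D.cross suf a) refl))
        where
        crossing : List (Fin m) → List (Fin m)
        crossing = List.filter (crosses? G ν cutAt)
        lemma : ∀ x → D.cross suf a ≡ x →
                (if x then c * 2 ^ k else 1) * (c * 2 ^ k) ^ length (crossing as) ≤ (c * 2 ^ k) ^ length (crossing (a ∷ as))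
        lemma true  cr = ≤-reflexive (cong (λ xs → (c * 2 ^ k) ^ length xs) (sym (filter-accept (crosses? G ν cutAt) (cross⇒Crosses a cr))))
        lemma false _  = ≤-trans (≤-reflexive (*-identityˡ _)) (^-monoʳ-≤ (c * 2 ^ k) (length-filter-∷ (crosses? G ν cutAt) a as))

      cut-≤ : options D.is ≤ (c * 2 ^ k) ^ p
      cut-≤ = ≤-trans (cut-options (List.allFin m)) (^-monoʳ-≤ (c * 2 ^ k) (cutSize-≤ cutAt))

  -- An arc crosses the cut right after its earlier end. This is what puts `c` below `B`, and hence
  -- walks of length proportional to `c` within the time bound.
  1≤p : D.arcs ≢ [] → 1 ≤ p
  1≤p arcs≢[] = let i , cr = crossed in ≤-trans (∈-length (∈-filter⁺ (crosses? G ν i) (∈-allFin a) cr)) (cutSize-≤ i)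
    where
    first : ∀ as → List.map D.arc as ≢ [] → Fin m
    first []      ne = ⊥-elim (ne refl)
    first (a ∷ _) _  = a
    a : Fin m
    a = first (List.allFin m) arcs≢[]
    crossed : ∃[ i ] Crosses G ν i a
    crossed with Fin-<-cmp (ν ⟨$⟩ˡ tail a) (ν ⟨$⟩ˡ head a)
    ... | tri< lt _ _ = ν ⟨$⟩ˡ tail a , inj₁ (≤-refl , lt)
    ... | tri> _ _ gt = ν ⟨$⟩ˡ head a , inj₂ (≤-refl , gt)
    ... | tri≈ _ e _  = ⊥-elim (noLoop a (trans (sym (inverseʳ ν)) (trans (cong (ν ⟨$⟩ʳ_) e) (inverseʳ ν))))

  B : ℕ
  B = (c * 2 ^ k) ^ p

  1≤B : 1 ≤ c → 1 ≤ B
  1≤B 1≤c = m^n>0 (c * 2 ^ k) {{>-nonZero (*-mono-≤ 1≤c (m^n>0 2 k))}} p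

  small : (1≤c : 1 ≤ c) → D.arcs ≢ [] → Small (scale Size k B 2≤Size (1≤B 1≤c)) b c D.arcs k ord
  small 1≤c arcs≢[] = record
    { bits-b = to-M (≤-∙ˡ (encℕ b) r₁ (bits-≤-size b))
    ; bits-c = to-M (≤-∙ʳ (encℕ b) r₁ (≤-∙ˡ (encℕ c) r₂ (bits-≤-size c)))
    ; bits-k = to-M (in₃ (≤-∙ˡ (encℕ k) eo (bits-≤-size k)))
    ; k≤M    = ≤-trans (n≤1+n k) (≤-trans (≤-reflexive (sym (*-identityˡ (suc k)))) (*-monoˡ-≤ (suc k) (≤-trans (s≤s z≤n) 2≤Size)))
    ; c≤B    = ≤-trans (m≤m*n c (2 ^ k) {{>-nonZero (m^n>0 2 k)}}) (≤-trans (≤-reflexive (sym (^-identityʳ (c * 2 ^ k))))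
                 (^-monoʳ-≤ (c * 2 ^ k) {{>-nonZero (*-mono-≤ 1≤c (m^n>0 2 k))}} (1≤p arcs≢[])))
    ; arcs≤M = to-M (inA (length-≤-size (enc ArcT) D.arcs))
    ; bits-a = All.map (λ {((u , v) , w)} le →
                   let whole : ∀ {x} → x ≤ size (enc ArcT ((u , v) , w)) → x ≤ Size * suc k
                       whole x≤ = to-M (inA (≤-trans x≤ le))
                   in (whole (≤-∙ˡ (encℕ u ∙ encℕ v) (encℕ w) (≤-∙ˡ (encℕ u) (encℕ v) (bits-≤-size u))) , whole (≤-∙ˡ (encℕ u ∙ encℕ v) (encℕ w) (≤-∙ʳ (encℕ u) (encℕ v) (bits-≤-size v)))) ,
                      whole (≤-∙ʳ (encℕ u ∙ encℕ v) (encℕ w) (bits-≤-size w)))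
                 (elements-≤-size (enc ArcT) D.arcs)
    ; ord≤M  = to-M (in₃ (≤-∙ʳ (encℕ k) eo (length-≤-size encℕ ord)))
    ; bits-o = All.map (λ {v} le → to-M (in₃ (≤-∙ʳ (encℕ k) eo (≤-trans (bits-≤-size v) le)))) (elements-≤-size encℕ ord)
    ; 2^k≤F  = ≤-refl
    ; cut≤B  = λ us v suf eq → cut-≤ us v suf eq 1≤c }
    where
    ea eo eg r₃ r₂ r₁ : Tree
    ea = encList (enc ArcT) D.arcs
    eo = encList encℕ ord
    eg = encℕ n ∙ ea
    r₃ = encℕ k ∙ eo
    r₂ = eg ∙ r₃
    r₁ = encℕ c ∙ r₂
    to-M : ∀ {x} → x ≤ Size → x ≤ Size * suc k
    to-M x≤ = ≤-trans x≤ (m≤m*n Size (suc k))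
    in₃ : ∀ {x} → x ≤ size r₃ → x ≤ Size
    in₃ x≤ = ≤-∙ʳ (encℕ b) r₁ (≤-∙ʳ (encℕ c) r₂ (≤-∙ʳ eg r₃ x≤))
    inA : ∀ {x} → x ≤ size ea → x ≤ Size
    inA x≤ = ≤-∙ʳ (encℕ b) r₁ (≤-∙ʳ (encℕ c) r₂ (≤-∙ˡ eg r₃ (≤-∙ʳ (encℕ n) ea x≤)))

  main-time-≤ : mainF .time (argument , tt) ≤
    O* (proj₁ (polynomial≤exponential (exponent mainExt))) (exponent mainExt + exponent trivialExt) Size (B * 4 ^ k)
  main-time-≤ with null? c D.arcs
  ... | inj₁ triv = trivial-O* Size 2≤Size _ (exponent mainExt) (exponent trivialExt) (B * 4 ^ k)
                      (proj₁ (proj₂ (polynomial≤exponential (exponent mainExt))))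
                      (trivial-time b n k ord (trivialScale Size 2≤Size) c D.arcs (≤-∙ʳ (encℕ b) r₁ (≤-∙ˡ (encℕ c) r₂ (bits-≤-size c))) triv)
    where
    r₁ r₂ : Tree
    r₂ = enc ((nat ⊗ list ArcT) ⊗ nat ⊗ list nat) (proj₂ (proj₂ argument))
    r₁ = encℕ c ∙ r₂
  ... | inj₂ (c≢0 , arcs≢[]) = scale-O* Size k B 2≤Size (1≤B 1≤c) (exponent mainExt) (exponent trivialExt)
                                 (main-time b n k ord (scale Size k B 2≤Size (1≤B 1≤c)) c D.arcs c≢0 arcs≢[] (small 1≤c arcs≢[]))
    where
    1≤c : 1 ≤ c
    1≤c = n≢0⇒n>0 c≢0

  solved : program (mainF .code) On encInput G b c k ν Outputs EncodesSolution G b c k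
             Within O* (proj₁ (polynomial≤exponential (exponent mainExt))) (exponent mainExt + exponent trivialExt)
                       (size (encInput G b c k ν)) (B * 4 ^ k)
  solved = subst (λ i → program (mainF .code) On i Outputs EncodesSolution G b c k
                          Within O* (proj₁ (polynomial≤exponential (exponent mainExt))) (exponent mainExt + exponent trivialExt) (size i) (B * 4 ^ k))
    encInput≡ (_ , _ , program-eval (mainF .code) (mainF .run tt (argument , tt)) , main-correct , main-time-≤)

theorem3 :
  Σ[ P ∈ Program ] ∃[ C ] ∃[ d ]
    (∀ (b c : ℕ) → b ≤ c →
     ∀ (G : WeightedDigraph) → Connected G →
     ∀ (k : ℕ) .{{_ : NonZero k}} →
     ∀ (ν : Ordering G) (p : ℕ) → cutwidth G ν ≤ p →
     P On encInput G b c k ν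
       Outputs EncodesSolution G b c k
       Within O* C d (size (encInput G b c k ν)) ((c * 2 ^ k) ^ p * 4 ^ k))
theorem3 = program (mainF .code) , proj₁ (polynomial≤exponential (exponent mainExt)) , exponent mainExt + exponent trivialExt , λ { b c _ G conn (suc k′) ν p width → Running.solved G conn ν b c k′ p width }
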